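{- Let $\Gamma=\mathrm{SL}_3(\mathbb{Z})$. For a prime $q$ let $\mathbb{F}_q$ be the field with $q$ elements, $P_q=P^2(\mathbb{F}_q)$ the projective plane over $\mathbb{F}_q$, and $\Phi_q:\mathrm{SL}_3(\mathbb{Z})\to\mathrm{Sym}(P_q)$ the action obtained by reducing a matrix modulo $q$ and letting $\mathrm{SL}_3(\mathbb{F}_q)$ act naturally on $P_q$. Then for every $\epsilon>0$ there is a function $f_\epsilon$ on primes with $f_\epsilon(q)\to0$ as $q\to\infty$ such that for every prime $q$ there exists a set $Y\subset P_q$ with $|Y|\ge(1-f_\epsilon(q))|P_q|$, such that for every $x\in Y$ there exists a set $Z_x\subset P_q$ with $|Z_x|\ge(1-f_\epsilon(q))|P_q|$, such that for every $y\in Z_x$ there exists $\gamma\in\Gamma$ with $\|\gamma\|_\infty\le q^{1/3+\epsilon}$ and $\Phi_q(\gamma)x=y$.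
   Context: $\|\gamma\|_\infty$ denotes the maximum of the absolute values of the entries of the matrix $\gamma$. $P^2(\mathbb{F}_q)$ is the set of nonzero vectors in $\mathbb{F}_q^3$ modulo multiplication by $\mathbb{F}_q^\times$. -}

module Defs where

open import Data.Nat as ℕ using (ℕ; zero; suc)
open import Data.Integer as ℤ using (ℤ; +_)
open import Data.Integer.Divisibility using () renaming (_∣_ to _∣ℤ_)
open import Data.Rational as ℚ using (ℚ; ↥_; ↧ₙ_)
open import Data.Fin using (Fin; toℕ) renaming (zero to f0; suc to fs)
open import Data.Product using (Σ; ∃; _×_; _,_)
open import Relation.Nullary using (¬_)
open import Relation.Binary.PropositionalEquality using (_≡_)

Mat3 : Set
Mat3 = Fin 3 → Fin 3 → ℤ

Vec3 : Set
Vec3 = Fin 3 → ℤ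

i0 i1 i2 : Fin 3
i0 = f0
i1 = fs f0
i2 = fs (fs f0)

det3 : Mat3 → ℤ
det3 m =
  (m i0 i0 ℤ.* (m i1 i1 ℤ.* m i2 i2 ℤ.- m i1 i2 ℤ.* m i2 i1))
  ℤ.- (m i0 i1 ℤ.* (m i1 i0 ℤ.* m i2 i2 ℤ.- m i1 i2 ℤ.* m i2 i0))
  ℤ.+ (m i0 i2 ℤ.* (m i1 i0 ℤ.* m i2 i1 ℤ.- m i1 i1 ℤ.* m i2 i0))

SL3Z : Set
SL3Z = Σ Mat3 λ γ → det3 γ ≡ + 1

mulMV : Mat3 → Vec3 → Vec3
mulMV m v i = m i i0 ℤ.* v i0 ℤ.+ m i i1 ℤ.* v i1 ℤ.+ m i i2 ℤ.* v i2

infix 4 _≡[mod_]_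
_≡[mod_]_ : ℤ → ℕ → ℤ → Set
a ≡[mod q ] b = (+ q) ∣ℤ (a ℤ.- b)

-- Points of P²(F_q), F_q = ℤ/qℤ with residues 0..q-1 (Fin q), each point given
-- by its unique normalised representative (first nonzero coordinate equal to 1):
--   [1 : b : c],  [0 : 1 : c],  [0 : 0 : 1].
data PPoint (q : ℕ) : Set where
  pt1 : Fin q → Fin q → PPoint q
  pt2 : Fin q → PPoint q
  pt3 : PPoint q

rep : {q : ℕ} → PPoint q → Vec3
rep (pt1 b c) = λ { f0 → + 1 ; (fs f0) → + toℕ b ; (fs (fs f0)) → + toℕ c }
rep (pt2 c)   = λ { f0 → + 0 ; (fs f0) → + 1 ; (fs (fs f0)) → + toℕ c }
rep pt3       = λ { f0 → + 0 ; (fs f0) → + 0 ; (fs (fs f0)) → + 1 }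

cardP : ℕ → ℕ
cardP q = q ℕ.* q ℕ.+ q ℕ.+ 1

Acts : (q : ℕ) → SL3Z → PPoint q → PPoint q → Set
Acts q (γ , _) x y =
  ∃ λ (l : ℤ) → ¬ (l ≡[mod q ] (+ 0)) ×
    ((i : Fin 3) → mulMV γ (rep x) i ≡[mod q ] (l ℤ.* rep y i))

-- a ≤ q ^ r for a natural a, natural q and positive rational r = n/d
-- (n = ↥ r > 0, d = ↧ₙ r), expressed exactly as a^d ≤ q^n.
_≤pow[_,_] : ℕ → ℕ → ℚ → Set
a ≤pow[ q , r ] = a ℕ.^ (↧ₙ r) ℕ.≤ q ℕ.^ ℤ.∣ ↥ r ∣

NormBound : SL3Z → ℕ → ℚ → Set
NormBound (γ , _) q r = (i j : Fin 3) → ℤ.∣ γ i j ∣ ≤pow[ q , r ]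

ℕtoℚ : ℕ → ℚ
ℕtoℚ n = + n ℚ./ 1

-- Only the affine points x = (1 : b : c) of the plane are used; the q + 1 others are absorbed in the error term.
--
-- First, a proportion 1 / polylog q of all pairs (x , y) is joined by matrices of size at most q^(1/3).  With
-- C m³ ≤ q < C (m + 1)³, take the matrices whose first two rows u, v have leading entries (a , c), coprime and
-- of size m, and 2 × 2 minors (D , e), coprime and of size m²; reducing entries keeps the whole matrix of size
-- O(m).  There are about m⁶ ≈ q² of them, so by Cauchy–Schwarz it suffices to bound collisions γ x ~ γ′ x.  Such
-- an x lies in the kernel of γ − κ γ′ mod q, where κ is one of at most three roots of a cubic.  Two such x for
-- one κ force A₁ A₄ ≡ A₂ A₃, where the Aᵢ are the 3 × 3 determinants formed from u, v, u′, v′.  As q exceeds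
-- these determinants, three of the primitive coefficients of the linear relation between u, v, u′, v′ determine
-- the fourth, and a packing bound for lattice points on each hyperplane makes such pairs rare up to logarithms.
--
-- Next, the action on the affine plane of translations and shears by bounded amounts has a spectral gap: a
-- nearly invariant function of mean zero is split into dyadic bands by the averages (1 + τ) / 2, the shears
-- spread out the bands in one direction, and the lowest band vanishes by Poincaré's inequality.  Hence a set of
-- density 1 / polylog q grows to density 1 − 1/k in O(log log q) + O(log k) bounded steps.  Growing first the
-- sources of each well-connected y, then the targets of almost every x, costs a factor (log q)^O(1) ≤ q^δ.
module Submission where

-- Bookkeeping of the second moment: about q² matrices give q⁴ pairs. The diagonal contributes at
-- most q² collisions per matrix, a generic pair at most three and an exceptional pair at most 3q,
-- so all is of order q⁴ once the exceptional pairs number q³ up to logarithms. The three logarithms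
-- come from summing 1 / |c₁ c₂ c₃| over normals of hyperplanes; with the constants they keep this
-- argument away from density 1, and expansion does the rest.
--
-- The gap must not depend on q, since a bounded factor is paid at every step. It rests on 1/3 + 1/3
-- < 1: up to small parts the energy lies in two halves of the frequency plane, according to the
-- coordinate direction of faster oscillation, and in each half the shears by 64 and 128 exhibit
-- three almost orthogonal pieces of comparable size. Only squared norms of products of (1 ± τ) / 2
-- occur, and these are rational.
--
-- The exponent is handled exactly: 1/3 + ε = n/d > 1/3 says d + 1 ≤ 3n, so a distortion N with
-- N^(3d) ≤ q is absorbed.

-- Finite sums and positivity certificates over the rationals.

module RationalSums where

  open import Data.Nat as ℕ using (ℕ; zero; suc)
  import Data.Nat.Properties as ℕₚ
  open import Data.Rational
  open import Data.Rational.Properties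
  open import Data.Rational.Solver
  open +-*-Solver using (solve; _:=_; _:+_; _:*_; _:-_; con)
  open import Relation.Binary.PropositionalEquality
  open import Data.Product
  open import Data.Sum using (inj₁; inj₂)

  Nn : ℚ → Set
  Nn a = 0ℚ ≤ a

  _⊞_ : ∀ {a b} → Nn a → Nn b → Nn (a + b)
  _⊞_ {a} {b} p r = subst (_≤ a + b) (+-identityˡ 0ℚ) (+-mono-≤ p r)
  infixl 5 _⊞_

  _⊡_ : ∀ {a b} → Nn a → Nn b → Nn (a * b)
  _⊡_ {a} {b} p r = subst (_≤ a * b) (*-zeroʳ a) (*-monoˡ-≤-nonNeg a {{nonNegative p}} r)
  infixl 6 _⊡_

  diff : ∀ {a b} → a ≤ b → Nn (b - a)
  diff {a} {b} p = subst (_≤ b - a) (+-inverseʳ a) (+-monoˡ-≤ (- a) p)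

  -- Inequalities are proved by certificates: the ring solver rewrites `y - x` as an expression `e`
  -- assembled from squares, products and known differences by means of `sq-Nn`, `⊡`, `⊞` and
  -- `diff`.
  concl : ∀ {x y e} → Nn e → y - x ≡ e → x ≤ y
  concl {x} {y} {e} p r = subst₂ _≤_ (+-identityˡ x) eq (+-monoˡ-≤ x (subst Nn (sym r) p))
    where
    eq : y - x + x ≡ y
    eq = solve 2 (λ y x → y :- x :+ x := y) refl y x

  sq-Nn : ∀ a → Nn (a * a)
  sq-Nn a with ≤-total 0ℚ a
  ... | inj₁ p = p ⊡ p
  ... | inj₂ p = subst Nn (solve 1 (λ a → (con 0ℚ :- a) :* (con 0ℚ :- a) := a :* a) refl a) (diff p ⊡ diff p)

  sum : ℕ → (ℕ → ℚ) → ℚ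
  sum zero f = 0ℚ
  sum (suc n) f = sum n f + f n

  sum-cong : ∀ n {f g : ℕ → ℚ} → (∀ i → f i ≡ g i) → sum n f ≡ sum n g
  sum-cong zero h = refl
  sum-cong (suc n) h = cong₂ _+_ (sum-cong n h) (h n)

  sum-mono : ∀ n {f g : ℕ → ℚ} → (∀ i → f i ≤ g i) → sum n f ≤ sum n g
  sum-mono zero h = ≤-refl
  sum-mono (suc n) h = +-mono-≤ (sum-mono n h) (h n)

  sum-Nn : ∀ n {f : ℕ → ℚ} → (∀ i → Nn (f i)) → Nn (sum n f)
  sum-Nn zero h = ≤-refl
  sum-Nn (suc n) h = sum-Nn n h ⊞ h n

  sum-+ : ∀ n (f g : ℕ → ℚ) → sum n (λ i → f i + g i) ≡ sum n f + sum n g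
  sum-+ zero f g = refl
  sum-+ (suc n) f g = trans (cong (_+ (f n + g n)) (sum-+ n f g))
    (solve 4 (λ a b c d → a :+ b :+ (c :+ d) := a :+ c :+ (b :+ d)) refl (sum n f) (sum n g) (f n) (g n))

  sum-* : ∀ n c (f : ℕ → ℚ) → sum n (λ i → c * f i) ≡ c * sum n f
  sum-* zero c f = sym (*-zeroʳ c)
  sum-* (suc n) c f = trans (cong (_+ c * f n) (sum-* n c f)) (sym (*-distribˡ-+ c (sum n f) (f n)))

  sum-swap : ∀ m n (f : ℕ → ℕ → ℚ) → sum m (λ i → sum n (f i)) ≡ sum n (λ j → sum m (λ i → f i j))
  sum-swap zero n f = sym (zeros n)
    where
    zeros : ∀ n → sum n (λ _ → 0ℚ) ≡ 0ℚ
    zeros zero = refl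
    zeros (suc n) = trans (+-identityʳ _) (zeros n)
  sum-swap (suc m) n f = trans (cong (_+ sum n (f m)) (sum-swap m n f)) (sym (sum-+ n _ (f m)))

  sum-split : ∀ i n (f : ℕ → ℚ) → sum (n ℕ.+ i) f ≡ sum i f + sum n (λ j → f (j ℕ.+ i))
  sum-split i zero f = sym (+-identityʳ _)
  sum-split i (suc n) f = trans (cong (_+ f (n ℕ.+ i)) (sum-split i n f)) (+-assoc (sum i f) (sum n (λ j → f (j ℕ.+ i))) (f (n ℕ.+ i)))

  sum-tail : ∀ i n {f : ℕ → ℚ} → (∀ j → Nn (f j)) → sum n (λ j → f (j ℕ.+ i)) ≤ sum (n ℕ.+ i) f
  sum-tail i n {f} h = subst₂ _≤_ (+-identityˡ _) (sym (sum-split i n f)) (+-monoˡ-≤ _ (sum-Nn i h))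

  sum-mono< : ∀ n {f g : ℕ → ℚ} → (∀ i → i ℕ.< n → f i ≤ g i) → sum n f ≤ sum n g
  sum-mono< zero h = ≤-refl
  sum-mono< (suc n) h = +-mono-≤ (sum-mono< n (λ i p → h i (ℕₚ.m<n⇒m<1+n p))) (h n ℕₚ.≤-refl)

-- Dyadic averaging filters and their energies.

module ShiftEnergies where

  open import Data.Nat as ℕ using (ℕ; zero; suc)
  import Data.Nat.Properties as ℕₚ
  open import Data.Integer as ℤ using (ℤ)
  import Data.Integer.Properties as ℤₚ
  open import Data.Rational
  open import Data.Rational.Properties
  open import Data.Rational.Solver
  open +-*-Solver using (solve; _:=_; _:+_; _:*_; _:-_; con)
  open import Data.List using (List; []; _∷_; _++_)
  open import Data.List.Properties using (++-assoc)
  open import Data.List.Relation.Binary.Permutation.Propositional using (_↭_; prep; swap; ↭-refl; ↭-sym; ↭-trans; ↭-reflexive)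
  open import Data.List.Relation.Binary.Permutation.Propositional.Properties using (shift; ++-comm; ++⁺ˡ; ++⁺ʳ)
  open import Relation.Binary.PropositionalEquality
  open import Data.Product using (_×_; _,_)
  open RationalSums

  W : Set
  W = ℤ × ℤ

  infixl 6 _⊕_
  _⊕_ : W → W → W
  (a , b) ⊕ (c , d) = (a ℤ.+ c) , (b ℤ.+ d)

  -- A w and B w stand for the commuting operators (1 + τ) / 2 and (1 − τ) / 2 with τ the translation by w.
  data Op : Set where
    A B : W → Op

  pw : ℕ → W → W
  pw zero w = w
  pw (suc i) w = pw i w ⊕ pw i w

  pw-+ : ∀ i j w → pw i (pw j w) ≡ pw (i ℕ.+ j) w
  pw-+ zero j w = refl
  pw-+ (suc i) j w = cong (λ z → z ⊕ z) (pw-+ i j w)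

  ⊕-interchange : ∀ a b → (a ⊕ b) ⊕ (a ⊕ b) ≡ (a ⊕ a) ⊕ (b ⊕ b)
  ⊕-interchange (a , b) (c , d) = cong₂ _,_ (inter a c) (inter b d)
    where
    inter : ∀ a c → (a ℤ.+ c) ℤ.+ (a ℤ.+ c) ≡ (a ℤ.+ a) ℤ.+ (c ℤ.+ c)
    inter a c = trans (ℤₚ.+-assoc a c _) (trans (cong (λ z → a ℤ.+ z) (trans (ℤₚ.+-comm c (a ℤ.+ c)) (ℤₚ.+-assoc a c c))) (sym (ℤₚ.+-assoc a a (c ℤ.+ c))))

  pw-⊕ : ∀ i a b → pw i (a ⊕ b) ≡ pw i a ⊕ pw i b
  pw-⊕ zero a b = refl
  pw-⊕ (suc i) a b = trans (cong (λ z → z ⊕ z) (pw-⊕ i a b)) (⊕-interchange (pw i a) (pw i b))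

  -- The average over the translations by 0, w, ..., (2^j - 1) w, factored into the operators (1 +
  -- τ^(2^i)) / 2 for i < j. It is a low-pass filter along w: what survives is smooth at scale 2^j.
  E : W → ℕ → List Op
  E w zero = []
  E w (suc j) = A (pw j w) ∷ E w j

  E-+ : ∀ w i j → E (pw j w) i ++ E w j ≡ E w (i ℕ.+ j)
  E-+ w zero j = refl
  E-+ w (suc i) j = cong₂ _∷_ (cong A (pw-+ i j w)) (E-+ w i j)

  ¼ : ℚ
  ¼ = ℤ.+ 1 / 4

  c4 : ℕ → ℚ
  c4 zero = 1ℚ
  c4 (suc k) = ¼ * c4 k

  ¼-Nn : Nn ¼
  ¼-Nn = nonNegative⁻¹ ¼

  c4-Nn : ∀ k → Nn (c4 k)
  c4-Nn zero = nonNegative⁻¹ 1ℚ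
  c4-Nn (suc k) = ¼-Nn ⊡ c4-Nn k

  -- N l is the squared norm of the product of the operators in l applied to a fixed function.
  record Energy : Set where
    field
      N     : List Op → ℚ
      N≥0   : ∀ l → Nn (N l)
      perm  : ∀ {l m} → l ↭ m → N l ≡ N m
      split : ∀ w l → N (A w ∷ l) + N (B w ∷ l) ≡ N l
      dbl   : ∀ w l → N (A w ∷ B w ∷ l) ≡ ¼ * N (B (w ⊕ w) ∷ l)
      tri   : ∀ x y l → N (B y ∷ l) ≤ (1ℚ + 1ℚ) * N (B (x ⊕ y) ∷ l) + (1ℚ + 1ℚ) * N (B x ∷ l)

  module Props (En : Energy) where
    open Energy En

    mono : ∀ o l → N (o ∷ l) ≤ N l
    mono (A w) l = concl (N≥0 (B w ∷ l)) (trans (cong (_- N (A w ∷ l)) (sym (split w l)))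
      (solve 2 (λ a b → a :+ b :- a := b) refl (N (A w ∷ l)) (N (B w ∷ l))))
    mono (B w) l = concl (N≥0 (A w ∷ l)) (trans (cong (_- N (B w ∷ l)) (sym (split w l)))
      (solve 2 (λ a b → a :+ b :- b := a) refl (N (A w ∷ l)) (N (B w ∷ l))))

    mono++ : ∀ xs l → N (xs ++ l) ≤ N l
    mono++ [] l = ≤-refl
    mono++ (x ∷ xs) l = ≤-trans (mono x (xs ++ l)) (mono++ xs l)

    perm≤ : ∀ {l m} → l ↭ m → N l ≤ N m
    perm≤ p = ≤-reflexive (perm p)

    drop-mid : ∀ o xs l → N (o ∷ xs ++ l) ≤ N (o ∷ l)
    drop-mid o xs l = ≤-trans (perm≤ (↭-sym (shift o xs l))) (mono++ xs (o ∷ l))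

    swap++ : ∀ (xs ys l : List Op) → xs ++ ys ++ l ↭ ys ++ xs ++ l
    swap++ xs ys l = ↭-trans (↭-reflexive (sym (++-assoc xs ys l)))
      (↭-trans (++⁺ʳ l (++-comm xs ys)) (↭-reflexive (++-assoc ys xs l)))

    drop-mid2 : ∀ xs ys l → N (xs ++ ys ++ l) ≤ N (xs ++ l)
    drop-mid2 xs ys l = ≤-trans (perm≤ (swap++ xs ys l)) (mono++ ys (xs ++ l))

    -- (1 - τ)(1 + τ)(1 + τ²)(1 + τ⁴)... telescopes to 1 - τ^(2^k). Each factor brings a halving,
    -- that is 1/4 in the squared norm.
    lowpass-eq : ∀ y k m → N (B y ∷ E y k ++ m) ≡ c4 k * N (B (pw k y) ∷ m)
    lowpass-eq y zero m = sym (*-identityˡ _)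
    lowpass-eq y (suc k) m = begin
      N (B y ∷ A (pw k y) ∷ E y k ++ m)      ≡⟨ perm (prep (B y) (↭-sym (shift (A (pw k y)) (E y k) m))) ⟩
      N (B y ∷ E y k ++ A (pw k y) ∷ m)      ≡⟨ lowpass-eq y k _ ⟩
      c4 k * N (B (pw k y) ∷ A (pw k y) ∷ m) ≡⟨ cong (c4 k *_) (trans (perm (swap (B (pw k y)) (A (pw k y)) ↭-refl)) (dbl (pw k y) m)) ⟩
      c4 k * (¼ * N (B (pw (suc k) y) ∷ m))  ≡⟨ solve 3 (λ a b c → a :* (b :* c) := (b :* a) :* c) refl (c4 k) ¼ _ ⟩
      c4 (suc k) * N (B (pw (suc k) y) ∷ m)  ∎
      where open ≡-Reasoning

    -- An average over 2^(k+i) steps hardly sees a difference over 2^i steps: the filter is split at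
    -- level i, and its upper k factors telescope against the difference.
    lowpass : ∀ a i k l → N (B (pw i a) ∷ E a (k ℕ.+ i) ++ l) ≤ c4 k * N l
    lowpass a i k l = begin
      N (B (pw i a) ∷ E a (k ℕ.+ i) ++ l)        ≡⟨ cong (λ z → N (B (pw i a) ∷ z ++ l)) (sym (E-+ a k i)) ⟩
      N (B y ∷ (E y k ++ E a i) ++ l)            ≡⟨ cong (λ z → N (B y ∷ z)) (++-assoc (E y k) (E a i) l) ⟩
      N (B y ∷ E y k ++ (E a i ++ l))            ≡⟨ lowpass-eq y k _ ⟩
      c4 k * N (B (pw k y) ∷ E a i ++ l)         ≤⟨ *-monoˡ-≤-nonNeg (c4 k) {{nonNegative (c4-Nn k)}} (≤-trans (mono _ _) (mono++ (E a i) l)) ⟩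
      c4 k * N l                                 ∎
      where
      open ≤-Reasoning
      y = pw i a

    2ℚ 4ℚ : ℚ
    2ℚ = 1ℚ + 1ℚ
    4ℚ = 2ℚ + 2ℚ

    -- Smoothness along b and along b + D gives smoothness along D, by the triangle inequality `tri`
    -- with the multiple 2^i b as the intermediate shift.
    lowpass₂ : ∀ b D i k l → N (B (pw i D) ∷ E (b ⊕ D) (k ℕ.+ i) ++ E b (k ℕ.+ i) ++ l) ≤ 4ℚ * (c4 k * N l)
    lowpass₂ b D i k l = ≤-trans (tri (pw i b) (pw i D) (Ea ++ Eb ++ l))
      (concl (nonNegative⁻¹ 2ℚ ⊡ diff p ⊞ nonNegative⁻¹ 2ℚ ⊡ diff r)
        (solve 3 (λ x y z → (con 4ℚ :* z) :- (con 2ℚ :* x :+ con 2ℚ :* y) := con 2ℚ :* (z :- x) :+ con 2ℚ :* (z :- y)) refl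
          (N (B (pw i b ⊕ pw i D) ∷ Ea ++ Eb ++ l)) (N (B (pw i b) ∷ Ea ++ Eb ++ l)) (c4 k * N l)))
      where
      Ea = E (b ⊕ D) (k ℕ.+ i)
      Eb = E b (k ℕ.+ i)
      scale : ∀ {x y} → x ≤ y → c4 k * x ≤ c4 k * y
      scale = *-monoˡ-≤-nonNeg (c4 k) {{nonNegative (c4-Nn k)}}
      p : N (B (pw i b ⊕ pw i D) ∷ Ea ++ Eb ++ l) ≤ c4 k * N l
      p = subst (λ z → N (B z ∷ Ea ++ Eb ++ l) ≤ c4 k * N l) (pw-⊕ i b D)
        (≤-trans (lowpass (b ⊕ D) i k (Eb ++ l)) (scale (mono++ Eb l)))
      r : N (B (pw i b) ∷ Ea ++ Eb ++ l) ≤ c4 k * N l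
      r = ≤-trans (perm≤ (prep _ (swap++ Ea Eb l))) (≤-trans (lowpass b i k (Ea ++ l)) (scale (mono++ Ea l)))

    -- The dyadic band: smoothed along w up to scale 2^i, then differenced at that very scale.
    band : W → ℕ → List Op → List Op
    band w i l = B (pw i w) ∷ E w i ++ l

    telescope : ∀ w j l → N l ≡ sum j (λ i → N (band w i l)) + N (E w j ++ l)
    telescope w zero l = sym (+-identityˡ _)
    telescope w (suc j) l = trans (telescope w j l) (trans (cong (sum j (λ i → N (band w i l)) +_) (sym (split (pw j w) (E w j ++ l))))
      (solve 3 (λ a b c → a :+ (b :+ c) := a :+ c :+ b) refl (sum j (λ i → N (band w i l))) (N (A (pw j w) ∷ E w j ++ l)) (N (band w j l))))

    bands≤ : ∀ w j l → sum j (λ i → N (band w i l)) ≤ N l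
    bands≤ w j l = concl (N≥0 (E w j ++ l)) (trans (cong (_- sum j (λ i → N (band w i l))) (telescope w j l))
      (solve 2 (λ a b → a :+ b :- a := b) refl (sum j (λ i → N (band w i l))) (N (E w j ++ l))))

    -- Telescoping the differenced function along x, the difference over 2^r steps is an additional
    -- operator in each of the bands 0, ..., r - 1 and may be dropped there; on the smooth remainder
    -- it is exactly what turns it into band r.
    far-band : ∀ x r y → N (B (pw r x) ∷ y) ≤ sum (suc r) (λ i → N (band x i y))
    far-band x r y = begin
      N l  ≡⟨ telescope x r l ⟩
      sum r (λ i → N (band x i l)) + N (E x r ++ l)
        ≤⟨ +-mono-≤ (sum-mono r (λ i → drop-last i)) (perm≤ (shift (B (pw r x)) (E x r) y)) ⟩
      sum (suc r) (λ i → N (band x i y)) ∎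
      where
      open ≤-Reasoning
      l = B (pw r x) ∷ y
      drop-last : ∀ i → N (band x i l) ≤ N (band x i y)
      drop-last i = drop-mid2 (B (pw i x) ∷ E x i) (B (pw r x) ∷ []) y

    ℕ→ℚ : ℕ → ℚ
    ℕ→ℚ n = sum n (λ _ → 1ℚ)

    sum-const : ∀ n c → sum n (λ _ → c) ≡ ℕ→ℚ n * c
    sum-const zero c = sym (*-zeroˡ c)
    sum-const (suc n) c = trans (cong (_+ c) (sum-const n c)) (solve 2 (λ a c → a :* c :+ c := (a :+ con 1ℚ) :* c) refl (ℕ→ℚ n) c)

    -- `far-band` covers each summand by the bands j, ..., j + r. For a fixed offset these bands are
    -- distinct as j varies, so their sum is at most the whole energy, and there are r + 1 offsets.
    far-bands≤ : ∀ w r J s l → sum J (λ j → N (B (pw (r ℕ.+ (j ℕ.+ s)) w) ∷ E w (j ℕ.+ s) ++ l)) ≤ ℕ→ℚ (suc r) * N l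
    far-bands≤ w r J s l = begin
      sum J (λ j → N (B (pw (r ℕ.+ (j ℕ.+ s)) w) ∷ E w (j ℕ.+ s) ++ l))
        ≤⟨ sum-mono J (λ j → step (j ℕ.+ s)) ⟩
      sum J (λ j → sum (suc r) (λ i → G (i ℕ.+ (j ℕ.+ s))))
        ≡⟨ sum-swap J (suc r) (λ j i → G (i ℕ.+ (j ℕ.+ s))) ⟩
      sum (suc r) (λ i → sum J (λ j → G (i ℕ.+ (j ℕ.+ s))))
        ≤⟨ sum-mono (suc r) inner ⟩
      sum (suc r) (λ i → N l)
        ≡⟨ sum-const (suc r) (N l) ⟩
      ℕ→ℚ (suc r) * N l ∎
      where
      open ≤-Reasoning
      G : ℕ → ℚ
      G i = N (band w i l)
      step : ∀ j → N (B (pw (r ℕ.+ j) w) ∷ E w j ++ l) ≤ sum (suc r) (λ i → G (i ℕ.+ j))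
      step j = subst₂ _≤_ (cong (λ z → N (B z ∷ E w j ++ l)) (pw-+ r j w))
        (sum-cong (suc r) (λ i → cong N (cong₂ _∷_ (cong B (pw-+ i j w)) (trans (sym (++-assoc (E (pw j w) i) (E w j) l)) (cong (_++ l) (E-+ w i j))))))
        (far-band (pw j w) r (E w j ++ l))
      inner : ∀ i → sum J (λ j → G (i ℕ.+ (j ℕ.+ s))) ≤ N l
      inner i = ≤-trans (≤-reflexive (sum-cong J (λ j → cong G (trans (ℕₚ.+-comm i (j ℕ.+ s)) (ℕₚ.+-assoc j s i)))))
        (≤-trans (sum-tail (s ℕ.+ i) J (λ j → N≥0 _)) (bands≤ w (J ℕ.+ (s ℕ.+ i)) l))

    -- Trades one difference for a pair of equal differences plus a quarter of the difference at the
    -- doubled step. The pair is what `cross` needs: one factor is spent on a gain, the other keeps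
    -- the sum over scales bounded.
    square-step : ∀ x l → N (B x ∷ l) ≡ ¼ * N (B (x ⊕ x) ∷ l) + N (B x ∷ B x ∷ l)
    square-step x l = trans (sym (split x (B x ∷ l))) (cong (_+ N (B x ∷ B x ∷ l)) (dbl x l))

    kk : ∀ j c k s → c ℕ.+ k ≡ s → k ℕ.+ (j ℕ.+ c) ≡ j ℕ.+ s
    kk j c k s h = trans (ℕₚ.+-comm k (j ℕ.+ c)) (trans (ℕₚ.+-assoc j c k) (cong (j ℕ.+_) h))

    kk′ : ∀ j c R i s → c ℕ.+ R ≡ s ℕ.+ i → (j ℕ.+ c) ℕ.+ R ≡ i ℕ.+ (j ℕ.+ s)
    kk′ j c R i s h = trans (ℕₚ.+-assoc j c R) (trans (cong (j ℕ.+_) h) (trans (sym (ℕₚ.+-assoc j s i)) (ℕₚ.+-comm (j ℕ.+ s) i)))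

    module Cross (w b : W) (R : ℕ) where
      D : W
      D = pw R w

      P : ℕ → List Op → List Op
      P j m = E (b ⊕ D) j ++ E b j ++ m

      G X S : ℕ → ℕ → ℚ
      G i j = N (B (pw (i ℕ.+ j) w) ∷ E w j ++ [])
      X i j = N (B (pw (i ℕ.+ j) w) ∷ P j (E w j ++ []))
      S i j = N (B (pw (i ℕ.+ j) w) ∷ B (pw (i ℕ.+ j) w) ∷ P j (E w j ++ []))

      X≤G : ∀ i j → X i j ≤ G i j
      X≤G i j = ≤-trans (drop-mid _ (E (b ⊕ D) j) _) (drop-mid _ (E b j) _)

      X-step : ∀ i j → X i j ≡ ¼ * X (suc i) j + S i j
      X-step i j = square-step (pw (i ℕ.+ j) w) (P j (E w j ++ []))

      -- 2^(i+j) w is the same vector as 2^i′ D, because D = 2^R w. One of the two differences is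
      -- thus a difference along D and gains from `lowpass₂`; here k = R - i.
      S≤ : ∀ i i′ k j → k ℕ.+ i′ ≡ j → i′ ℕ.+ R ≡ i ℕ.+ j → S i j ≤ 4ℚ * (c4 k * G i j)
      S≤ i i′ k j refl h = begin
        S i j ≤⟨ perm≤ (prep y (↭-trans (↭-sym (shift y (E (b ⊕ D) j) _)) (++⁺ˡ (E (b ⊕ D) j) (↭-sym (shift y (E b j) _))))) ⟩
        N (y ∷ P j (y ∷ E w j ++ [])) ≡⟨ cong (λ z → N (B z ∷ P j (y ∷ E w j ++ []))) (trans (cong (λ z → pw z w) (sym h)) (sym (pw-+ i′ R w))) ⟩
        N (B (pw i′ D) ∷ P j (y ∷ E w j ++ [])) ≤⟨ lowpass₂ b D i′ k (y ∷ E w j ++ []) ⟩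
        4ℚ * (c4 k * G i j) ∎
        where
        open ≤-Reasoning
        y = B (pw (i ℕ.+ j) w)

    -- Smoothness at scale 2^j along b and b + D forces smoothness along D = 2^R w, which clashes
    -- with oscillation along w at scale 2^j. `square-step` is applied four times. Stage i has
    -- weight 4^(-i) and gains 4 · 4^(-(R - i)), and the difference that is left sums over j to at
    -- most i + 1 energies, whence 4 · 4^(-R) (1 + 2 + 3 + 4). What remains after the fourth stage
    -- is 4^(-4) times at most 5 energies.
    cross : ∀ w b r e J → e ℕ.+ (3 ℕ.+ r) ≡ 7 →
      sum J (λ j → N (B (pw (j ℕ.+ 7) w) ∷ E (b ⊕ pw (3 ℕ.+ r) w) (j ℕ.+ 7) ++ E b (j ℕ.+ 7) ++ E w (j ℕ.+ 7) ++ []))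
      ≤ (4ℚ * c4 (3 ℕ.+ r) * ℕ→ℚ 10 + c4 4 * ℕ→ℚ 5) * N []
    cross w b r e J h = begin
      sum J (λ j → X 0 (j ℕ.+ 7)) ≤⟨ sum-mono J pointwise ⟩
      sum J (λ j → κ * (G 0 (j ℕ.+ 7) + G 1 (j ℕ.+ 7) + G 2 (j ℕ.+ 7) + G 3 (j ℕ.+ 7)) + c4 4 * G 4 (j ℕ.+ 7))
        ≡⟨ trans (sum-+ J _ _) (cong₂ _+_ (trans (sum-* J κ _) (cong (κ *_) (trans (sum-+ J _ _) (cong (_+ sum J (g 3)) (trans (sum-+ J _ _) (cong (_+ sum J (g 2)) (sum-+ J _ _))))))) (sum-* J (c4 4) (g 4))) ⟩
      κ * (sum J (g 0) + sum J (g 1) + sum J (g 2) + sum J (g 3)) + c4 4 * sum J (g 4)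
        ≤⟨ concl ((c4R ⊡ (bd 0 ⊞ bd 1 ⊞ bd 2 ⊞ bd 3)) ⊞ (c4-Nn 4 ⊡ bd 4))
           (solve 8 (λ κ n g0 g1 g2 g3 g4 c → (κ :* con (ℕ→ℚ 10) :+ c :* con (ℕ→ℚ 5)) :* n :- (κ :* (g0 :+ g1 :+ g2 :+ g3) :+ c :* g4)
             := κ :* ((con (ℕ→ℚ 1) :* n :- g0) :+ (con (ℕ→ℚ 2) :* n :- g1) :+ (con (ℕ→ℚ 3) :* n :- g2) :+ (con (ℕ→ℚ 4) :* n :- g3)) :+ c :* (con (ℕ→ℚ 5) :* n :- g4))
             refl κ (N []) (sum J (g 0)) (sum J (g 1)) (sum J (g 2)) (sum J (g 3)) (sum J (g 4)) (c4 4)) ⟩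
      (κ * ℕ→ℚ 10 + c4 4 * ℕ→ℚ 5) * N [] ∎
      where
      open ≤-Reasoning
      R = 3 ℕ.+ r
      open Cross w b R
      κ = 4ℚ * c4 R
      c4R : Nn κ
      c4R = nonNegative⁻¹ 4ℚ ⊡ c4-Nn R
      g : ℕ → ℕ → ℚ
      g i j = G i (j ℕ.+ 7)
      bd : ∀ i → Nn (ℕ→ℚ (suc i) * N [] - sum J (g i))
      bd i = diff (far-bands≤ w i J 7 [])
      eR : ∀ i k → i ℕ.+ k ≡ R → e ℕ.+ i ℕ.+ k ≡ 7
      eR i k p = trans (ℕₚ.+-assoc e i k) (trans (cong (e ℕ.+_) p) h)
      eR′ : ∀ i → e ℕ.+ i ℕ.+ R ≡ 7 ℕ.+ i
      eR′ i = trans (ℕₚ.+-assoc e i R) (trans (cong (e ℕ.+_) (ℕₚ.+-comm i R)) (trans (sym (ℕₚ.+-assoc e R i)) (cong (ℕ._+ i) h)))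
      SS : ∀ j i k → i ℕ.+ k ≡ R → S i (j ℕ.+ 7) ≤ 4ℚ * (c4 k * g i j)
      SS j i k p = S≤ i (j ℕ.+ (e ℕ.+ i)) k (j ℕ.+ 7) (kk j (e ℕ.+ i) k 7 (eR i k p)) (kk′ j (e ℕ.+ i) R i 7 (eR′ i))
      pointwise : ∀ j → X 0 (j ℕ.+ 7) ≤ κ * (g 0 j + g 1 j + g 2 j + g 3 j) + c4 4 * g 4 j
      pointwise j = concl
        (diff (SS j 0 (3 ℕ.+ r) refl) ⊞ ¼-Nn ⊡ diff (SS j 1 (2 ℕ.+ r) refl) ⊞ ¼-Nn ⊡ (¼-Nn ⊡ diff (SS j 2 (1 ℕ.+ r) refl))
          ⊞ ¼-Nn ⊡ (¼-Nn ⊡ (¼-Nn ⊡ diff (SS j 3 r refl))) ⊞ c4-Nn 4 ⊡ diff (X≤G 4 (j ℕ.+ 7)))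
        (trans (cong (λ z → κ * (g 0 j + g 1 j + g 2 j + g 3 j) + c4 4 * g 4 j - z) x0)
          (solve 11 (λ c g0 g1 g2 g3 g4 s0 s1 s2 s3 x4 →
            con 4ℚ :* (con ¼ :* (con ¼ :* (con ¼ :* c))) :* (g0 :+ g1 :+ g2 :+ g3) :+ con (c4 4) :* g4 :- (con ¼ :* (con ¼ :* (con ¼ :* (con ¼ :* x4 :+ s3) :+ s2) :+ s1) :+ s0)
            := (con 4ℚ :* (con ¼ :* (con ¼ :* (con ¼ :* c)) :* g0) :- s0) :+ con ¼ :* (con 4ℚ :* (con ¼ :* (con ¼ :* c) :* g1) :- s1)
              :+ con ¼ :* (con ¼ :* (con 4ℚ :* ((con ¼ :* c) :* g2) :- s2)) :+ con ¼ :* (con ¼ :* (con ¼ :* (con 4ℚ :* (c :* g3) :- s3))) :+ con (c4 4) :* (g4 :- x4))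
            refl (c4 r) (g 0 j) (g 1 j) (g 2 j) (g 3 j) (g 4 j) (S 0 jj) (S 1 jj) (S 2 jj) (S 3 jj) (X 4 jj)))
        where
        jj = j ℕ.+ 7
        x0 : X 0 jj ≡ ¼ * (¼ * (¼ * (¼ * X 4 jj + S 3 jj) + S 2 jj) + S 1 jj) + S 0 jj
        x0 = trans (X-step 0 jj) (cong (λ z → ¼ * z + S 0 jj) (trans (X-step 1 jj) (cong (λ z → ¼ * z + S 1 jj)
          (trans (X-step 2 jj) (cong (λ z → ¼ * z + S 2 jj) (X-step 3 jj))))))

    -- Inclusion-exclusion for commuting averages: the energy removed by the filter along `a` is a
    -- sum of bands, and each of these bands can only shrink when the filter along `b` has been
    -- applied first.
    bonferroni₂ : ∀ a b i l → N (E a i ++ l) + N (E b i ++ l) ≤ N l + N (E a i ++ E b i ++ l)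
    bonferroni₂ a b i l = concl (diff (sum-mono i (λ k → drop-mid2 (B (pw k a) ∷ E a k) (E b i) l)))
      (trans (cong₂ (λ x y → x + n₃ - (n₁ + y)) (telescope a i l) (telescope a i (E b i ++ l)))
        (solve 4 (λ s₁ s₂ n₁ n₃ → s₁ :+ n₁ :+ n₃ :- (n₁ :+ (s₂ :+ n₃)) := s₁ :- s₂) refl
          (sum i (λ k → N (band a k l))) (sum i (λ k → N (band a k (E b i ++ l)))) n₁ n₃))
      where
      n₁ = N (E a i ++ l)
      n₃ = N (E a i ++ E b i ++ l)

    -- After telescoping along `a`, the claim is `bonferroni₂` for `b` and `c` inside every band;
    -- the triple term is nonnegative and is discarded.
    bonferroni₃ : ∀ a b c i l → N (E a i ++ l) + N (E b i ++ l) + N (E c i ++ l)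
      ≤ N l + N (E a i ++ E b i ++ l) + N (E a i ++ E c i ++ l) + N (E b i ++ E c i ++ l)
    bonferroni₃ a b c i l = concl (diff key ⊞ N≥0 (E a i ++ E b i ++ E c i ++ l))
      (trans (cong₂ (λ x y → x + nab + nac + y - (na + nb + nc)) (telescope a i l) (telescope a i (E b i ++ E c i ++ l)))
       (trans (cong₂ (λ x y → sl + na + nab + nac + (sbc + nabc) - (na + x + y)) (telescope a i (E b i ++ l)) (telescope a i (E c i ++ l)))
        (trans (solve 8 (λ sl sb sc sbc na nab nac nabc →
          sl :+ na :+ nab :+ nac :+ (sbc :+ nabc) :- (na :+ (sb :+ nab) :+ (sc :+ nac)) := sl :+ sbc :- (sb :+ sc) :+ nabc) refl
          sl sb sc sbc na nab nac nabc)
          (cong₂ (λ x y → x - y + nabc) (sym (sum-+ i _ _)) (sym (sum-+ i _ _))))))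
      where
      na = N (E a i ++ l)
      nb = N (E b i ++ l)
      nc = N (E c i ++ l)
      nab = N (E a i ++ E b i ++ l)
      nac = N (E a i ++ E c i ++ l)
      nabc = N (E a i ++ E b i ++ E c i ++ l)
      s : List Op → ℚ
      s m = sum i (λ k → N (band a k m))
      sl = s l
      sb = s (E b i ++ l)
      sc = s (E c i ++ l)
      sbc = s (E b i ++ E c i ++ l)
      into : ∀ k m → band a k (E b i ++ m) ↭ E b i ++ band a k m
      into k m = swap++ (B (pw k a) ∷ E a k) (E b i) m
      key : sum i (λ k → N (band a k (E b i ++ l)) + N (band a k (E c i ++ l))) ≤ sum i (λ k → N (band a k l) + N (band a k (E b i ++ E c i ++ l)))
      key = sum-mono i (λ k → subst₂ _≤_
        (cong₂ _+_ (perm (↭-sym (into k l))) (perm (swap++ (E c i) (B (pw k a) ∷ E a k) l)))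
        (cong (N (band a k l) +_) (perm (↭-trans (++⁺ˡ (E b i) (swap++ (E c i) (B (pw k a) ∷ E a k) l)) (↭-sym (into k (E c i ++ l))))))
        (bonferroni₂ b c i (band a k l)))

    -- The frequency plane is cut into nested square shells. Passing from level J to J + 1 in both
    -- directions loses a part oscillating along w and a part oscillating along v; in the latter the
    -- extra smoothing along w is dropped.
    ladder : ∀ v w J → N [] ≤ N (E v J ++ E w J ++ []) + sum J (λ j → N (band w j (E v j ++ [])) + N (band v j (E w j ++ [])))
    ladder v w zero = ≤-reflexive (sym (+-identityʳ (N [])))
    ladder v w (suc J) = ≤-trans (ladder v w J) (concl (diff (drop-mid2 (B pv ∷ E v J) (A pw′ ∷ []) (E w J ++ [])))
       (trans (cong (λ z → N (A pv ∷ E v J ++ A pw′ ∷ E w J ++ []) + (s + (b + a)) - (z + s)) top)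
         (solve 5 (λ n s a b r → n :+ (s :+ (b :+ a)) :- ((n :+ r) :+ b :+ s) := a :- r) refl
           (N (A pv ∷ E v J ++ A pw′ ∷ E w J ++ [])) s a b (N (B pv ∷ E v J ++ A pw′ ∷ E w J ++ [])))))
      where
      pv = pw J v
      pw′ = pw J w
      s = sum J (λ j → N (band w j (E v j ++ [])) + N (band v j (E w j ++ [])))
      a = N (band v J (E w J ++ []))
      b = N (band w J (E v J ++ []))
      top : N (E v J ++ E w J ++ []) ≡ N (A pv ∷ E v J ++ A pw′ ∷ E w J ++ []) + N (B pv ∷ E v J ++ A pw′ ∷ E w J ++ []) + b
      top = trans (sym (split pw′ _)) (cong₂ _+_ (trans (perm (↭-sym (shift (A pw′) (E v J) _))) (sym (split pv _)))
        (perm (prep _ (swap++ (E v J) (E w J) []))))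

-- Functions on the torus (ℤ/q)² and their energies.

module PeriodicFunctions where

  open import Data.Nat as ℕ using (ℕ; zero; suc)
  import Data.Nat.Properties as ℕₚ
  open import Data.Integer as ℤ using (ℤ)
  import Data.Integer.Properties as ℤₚ
  import Data.Integer.Tactic.RingSolver as ℤR
  open import Data.Rational
  open import Data.Rational.Properties
  open import Data.Rational.Solver
  open +-*-Solver using (solve; _:=_; _:+_; _:*_; _:-_; con)
  open import Data.List using (List; []; _∷_)
  open import Data.List.Relation.Binary.Permutation.Propositional using (_↭_; prep; swap; refl; trans)
  open import Relation.Binary.PropositionalEquality as ≡ using (_≡_; sym; cong; cong₂; module ≡-Reasoning)
  open import Data.Product using (_,_; proj₁; proj₂)
  open RationalSums
  open ShiftEnergies

  -- Functions on (ℤ/q)² are represented by doubly periodic functions on ℤ², so that translations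
  -- and shears are plain integer arithmetic; one period is used only for summation.
  Fn : Set
  Fn = ℤ → ℤ → ℚ

  shift-multiple⁺ : ∀ {A : Set} q {g : ℤ → A} → (∀ x → g (x ℤ.+ ℤ.+ q) ≡ g x) → ∀ n x → g (x ℤ.+ ℤ.+ n ℤ.* ℤ.+ q) ≡ g x
  shift-multiple⁺ q {g} p zero x = cong g (ℤₚ.+-identityʳ x)
  shift-multiple⁺ q {g} p (suc n) x = ≡.trans (cong g (lem x (ℤ.+ n) (ℤ.+ q))) (≡.trans (p (x ℤ.+ ℤ.+ n ℤ.* ℤ.+ q)) (shift-multiple⁺ q p n x))
    where
    lem : ∀ x n q → x ℤ.+ (ℤ.+ 1 ℤ.+ n) ℤ.* q ≡ x ℤ.+ n ℤ.* q ℤ.+ q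
    lem = ℤR.solve-∀

  shift-multiple : ∀ {A : Set} q {g : ℤ → A} → (∀ x → g (x ℤ.+ ℤ.+ q) ≡ g x) → ∀ n x → g (x ℤ.+ n ℤ.* ℤ.+ q) ≡ g x
  shift-multiple q p (ℤ.+ n) x = shift-multiple⁺ q p n x
  shift-multiple q {g} p (ℤ.-[1+ n ]) x = ≡.trans (sym (shift-multiple⁺ q p (suc n) (x ℤ.+ ℤ.-[1+ n ] ℤ.* ℤ.+ q))) (cong g (lem x (ℤ.+ suc n) (ℤ.+ q)))
    where
    lem : ∀ x n q → x ℤ.+ (ℤ.- n) ℤ.* q ℤ.+ n ℤ.* q ≡ x
    lem = ℤR.solve-∀

  module _ (q : ℕ) where

    Periodic₁ : (ℤ → ℚ) → Set
    Periodic₁ g = ∀ x → g (x ℤ.+ ℤ.+ q) ≡ g x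

    record Periodic (f : Fn) : Set where
      field
        per₁ : ∀ x y → f (x ℤ.+ ℤ.+ q) y ≡ f x y
        per₂ : ∀ x y → f x (y ℤ.+ ℤ.+ q) ≡ f x y

    S₁ : (ℤ → ℚ) → ℚ
    S₁ g = sum q (λ i → g (ℤ.+ i))

    sum-rotate : ∀ n (h : ℕ → ℚ) → sum n (λ i → h (suc i)) + h 0 ≡ sum n h + h n
    sum-rotate zero h = ≡.refl
    sum-rotate (suc n) h = begin
      sum n (λ i → h (suc i)) + h (suc n) + h 0 ≡⟨ solve 3 (λ a b c → a :+ b :+ c := a :+ c :+ b) ≡.refl (sum n (λ i → h (suc i))) (h (suc n)) (h 0) ⟩
      sum n (λ i → h (suc i)) + h 0 + h (suc n) ≡⟨ cong (_+ h (suc n)) (sum-rotate n h) ⟩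
      sum n h + h n + h (suc n) ∎
      where open ≡-Reasoning

    S₁-suc : ∀ {g} → Periodic₁ g → S₁ (λ x → g (x ℤ.+ ℤ.+ 1)) ≡ S₁ g
    S₁-suc {g} p = +-cancelʳ-≡ (g (ℤ.+ 0)) _ _ (begin
      S₁ (λ x → g (x ℤ.+ ℤ.+ 1)) + g (ℤ.+ 0)    ≡⟨ cong (_+ g (ℤ.+ 0)) (sum-cong q (λ i → cong (λ z → g (ℤ.+ z)) (ℕₚ.+-comm i 1))) ⟩
      sum q (λ i → g (ℤ.+ suc i)) + g (ℤ.+ 0) ≡⟨ sum-rotate q (λ i → g (ℤ.+ i)) ⟩
      S₁ g + g (ℤ.+ q)                         ≡⟨ cong (S₁ g +_) (p (ℤ.+ 0)) ⟩
      S₁ g + g (ℤ.+ 0)                         ∎)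
      where
      open ≡-Reasoning
      +-cancelʳ-≡ : ∀ c a b → a + c ≡ b + c → a ≡ b
      +-cancelʳ-≡ c a b h = ≡.trans (solve 2 (λ a c → a := a :+ c :- c) ≡.refl a c) (≡.trans (cong (_- c) h) (solve 2 (λ a c → a :+ c :- c := a) ≡.refl b c))

    per-shift : ∀ {g} a → Periodic₁ g → Periodic₁ (λ x → g (x ℤ.+ a))
    per-shift {g} a p x = ≡.trans (cong g (lem x (ℤ.+ q) a)) (p (x ℤ.+ a))
      where
      lem : ∀ x q a → x ℤ.+ q ℤ.+ a ≡ x ℤ.+ a ℤ.+ q
      lem = ℤR.solve-∀

    S₁-shift⁺ : ∀ n {g} → Periodic₁ g → S₁ (λ x → g (x ℤ.+ ℤ.+ n)) ≡ S₁ g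
    S₁-shift⁺ zero {g} p = sum-cong q (λ i → cong g (ℤₚ.+-identityʳ (ℤ.+ i)))
    S₁-shift⁺ (suc n) {g} p = ≡.trans (sum-cong q (λ i → cong g (lem (ℤ.+ i) (ℤ.+ n)))) (≡.trans (S₁-suc {λ x → g (x ℤ.+ ℤ.+ n)} (per-shift (ℤ.+ n) p)) (S₁-shift⁺ n p))
      where
      lem : ∀ x n → x ℤ.+ (ℤ.+ 1 ℤ.+ n) ≡ x ℤ.+ ℤ.+ 1 ℤ.+ n
      lem = ℤR.solve-∀

    S₁-shift : ∀ a {g} → Periodic₁ g → S₁ (λ x → g (x ℤ.+ a)) ≡ S₁ g
    S₁-shift (ℤ.+ n) p = S₁-shift⁺ n p
    S₁-shift a@(ℤ.-[1+ n ]) {g} p = ≡.trans (sym (S₁-shift⁺ (suc n) {λ x → g (x ℤ.+ a)} (per-shift a p)))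
      (sum-cong q (λ i → cong g (lem (ℤ.+ i) (ℤ.+ suc n))))
      where
      lem : ∀ x n → x ℤ.+ n ℤ.+ (ℤ.- n) ≡ x
      lem = ℤR.solve-∀

    S₂ : Fn → ℚ
    S₂ h = sum q (λ j → S₁ (λ x → h x (ℤ.+ j)))

    S₂-cong : ∀ {f g : Fn} → (∀ x y → f x y ≡ g x y) → S₂ f ≡ S₂ g
    S₂-cong h = sum-cong q (λ j → sum-cong q (λ i → h (ℤ.+ i) (ℤ.+ j)))

    S₂-mono : ∀ {f g : Fn} → (∀ x y → f x y ≤ g x y) → S₂ f ≤ S₂ g
    S₂-mono h = sum-mono q (λ j → sum-mono q (λ i → h (ℤ.+ i) (ℤ.+ j)))

    S₂-Nn : ∀ {f : Fn} → (∀ x y → Nn (f x y)) → Nn (S₂ f)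
    S₂-Nn h = sum-Nn q (λ j → sum-Nn q (λ i → h (ℤ.+ i) (ℤ.+ j)))

    S₂-+ : ∀ (f g : Fn) → S₂ (λ x y → f x y + g x y) ≡ S₂ f + S₂ g
    S₂-+ f g = ≡.trans (sum-cong q (λ j → sum-+ q (λ i → f (ℤ.+ i) (ℤ.+ j)) (λ i → g (ℤ.+ i) (ℤ.+ j)))) (sum-+ q _ _)

    S₂-* : ∀ c (f : Fn) → S₂ (λ x y → c * f x y) ≡ c * S₂ f
    S₂-* c f = ≡.trans (sum-cong q (λ j → sum-* q c (λ i → f (ℤ.+ i) (ℤ.+ j)))) (sum-* q c _)

    S₂-transpose : ∀ f → S₂ (λ x y → f y x) ≡ S₂ f
    S₂-transpose f = sum-swap q q (λ j i → f (ℤ.+ j) (ℤ.+ i))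

    open Periodic

    -- A shear rotates each row separately, by an amount constant on that row, so an arbitrary
    -- function `s` of the row is allowed.
    S₂-shear : ∀ {f} → Periodic f → (s : ℤ → ℤ) → S₂ (λ x y → f (x ℤ.+ s y) y) ≡ S₂ f
    S₂-shear {f} p s = sum-cong q (λ j → S₁-shift (s (ℤ.+ j)) {λ x → f x (ℤ.+ j)} (λ x → per₁ p x (ℤ.+ j)))

    transpose-per : ∀ {f} → Periodic f → Periodic (λ x y → f y x)
    transpose-per p = record { per₁ = λ x y → per₂ p y x ; per₂ = λ x y → per₁ p y x }

    S₂-shift : ∀ {f} → Periodic f → ∀ a b → S₂ (λ x y → f (x ℤ.+ a) (y ℤ.+ b)) ≡ S₂ f
    S₂-shift {f} p a b = ≡.trans (sym (S₂-transpose (λ x y → f (x ℤ.+ a) (y ℤ.+ b))))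
      (≡.trans (S₂-shear {λ x y → f (y ℤ.+ a) x} (record { per₁ = λ x y → per₂ p (y ℤ.+ a) x ; per₂ = λ x y → ≡.trans (cong (λ z → f z x) (lem y (ℤ.+ q) a)) (per₁ p (y ℤ.+ a) x) }) (λ _ → b))
        (≡.trans (S₂-transpose (λ x y → f (x ℤ.+ a) y)) (S₂-shear p (λ _ → a))))
      where
      lem : ∀ x q a → x ℤ.+ q ℤ.+ a ≡ x ℤ.+ a ℤ.+ q
      lem = ℤR.solve-∀

    sq : Fn → Fn
    sq f x y = f x y * f x y

    shifted : W → Fn → Fn
    shifted w f x y = f (x ℤ.+ proj₁ w) (y ℤ.+ proj₂ w)

    Q : Fn → ℚ
    Q f = S₂ (sq f)

    Q-Nn : ∀ f → Nn (Q f)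
    Q-Nn f = S₂-Nn (λ x y → sq-Nn (f x y))

    sgn : Op → ℚ
    sgn (A _) = 1ℚ
    sgn (B _) = - 1ℚ

    vec : Op → W
    vec (A w) = w
    vec (B w) = w

    ⟦_⟧ : List Op → Fn → Fn
    ⟦ [] ⟧ f x y = f x y
    ⟦ o ∷ l ⟧ f x y = ½ * (⟦ l ⟧ f x y + sgn o * ⟦ l ⟧ f (x ℤ.+ proj₁ (vec o)) (y ℤ.+ proj₂ (vec o)))

    ⟦⟧-per : ∀ l {f} → Periodic f → Periodic (⟦ l ⟧ f)
    ⟦⟧-per [] p = p
    ⟦⟧-per (o ∷ l) {f} p = record
      { per₁ = λ x y → cong₂ (λ a b → ½ * (a + sgn o * b)) (per₁ ih x y) (≡.trans (cong (λ z → ⟦ l ⟧ f z (y ℤ.+ b)) (lem x (ℤ.+ q) a)) (per₁ ih (x ℤ.+ a) (y ℤ.+ b)))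
      ; per₂ = λ x y → cong₂ (λ a b → ½ * (a + sgn o * b)) (per₂ ih x y) (≡.trans (cong (⟦ l ⟧ f (x ℤ.+ a)) (lem y (ℤ.+ q) b)) (per₂ ih (x ℤ.+ a) (y ℤ.+ b))) }
      where
      ih = ⟦⟧-per l p
      a = proj₁ (vec o)
      b = proj₂ (vec o)
      lem : ∀ x q a → x ℤ.+ q ℤ.+ a ≡ x ℤ.+ a ℤ.+ q
      lem = ℤR.solve-∀

    ⟦⟧-perm : ∀ {l m} → l ↭ m → ∀ f x y → ⟦ l ⟧ f x y ≡ ⟦ m ⟧ f x y
    ⟦⟧-perm refl f x y = ≡.refl
    ⟦⟧-perm (prep o p) f x y = cong₂ (λ a b → ½ * (a + sgn o * b)) (⟦⟧-perm p f x y) (⟦⟧-perm p f _ _)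
    ⟦⟧-perm (swap {xs} {ys} o o′ p) f x y = ≡.trans
      (cong (λ z → ½ * (½ * (g x y + s′ * g (x ℤ.+ a′) (y ℤ.+ b′)) + s * (½ * (g (x ℤ.+ a) (y ℤ.+ b) + s′ * z)))) (cong₂ g (lem x a a′) (lem y b b′)))
      (≡.trans (solve 6 (λ s s′ g₀ g₁ g₂ g₃ → con ½ :* (con ½ :* (g₀ :+ s′ :* g₁) :+ s :* (con ½ :* (g₂ :+ s′ :* g₃))) := con ½ :* (con ½ :* (g₀ :+ s :* g₂) :+ s′ :* (con ½ :* (g₁ :+ s :* g₃)))) ≡.refl
        s s′ (g x y) (g (x ℤ.+ a′) (y ℤ.+ b′)) (g (x ℤ.+ a) (y ℤ.+ b)) (g (x ℤ.+ a′ ℤ.+ a) (y ℤ.+ b′ ℤ.+ b)))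
       (cong₂ (λ u v → ½ * (u + s′ * v)) (cong₂ (λ u v → ½ * (u + s * v)) (⟦⟧-perm p f x y) (⟦⟧-perm p f _ _)) (cong₂ (λ u v → ½ * (u + s * v)) (⟦⟧-perm p f _ _) (⟦⟧-perm p f _ _))))
      where
      g = ⟦ xs ⟧ f
      s = sgn o
      s′ = sgn o′
      a = proj₁ (vec o)
      b = proj₂ (vec o)
      a′ = proj₁ (vec o′)
      b′ = proj₂ (vec o′)
      lem : ∀ x a c → x ℤ.+ a ℤ.+ c ≡ x ℤ.+ c ℤ.+ a
      lem = ℤR.solve-∀
    ⟦⟧-perm (trans p r) f x y = ≡.trans (⟦⟧-perm p f x y) (⟦⟧-perm r f x y)

    -- `split` is the parallelogram law, `dbl` the factorisation (1 + τ)(1 - τ) = 1 - τ², and `tri`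
    -- the identity τ_v (1 - τ_w) = (1 - τ_v τ_w) - (1 - τ_v) with |a - b|² ≤ 2|a|² + 2|b|².
    -- Invariance of the sum under translation is used throughout.
    energy : ∀ f → Periodic f → Energy
    energy f p = record
      { N = λ l → Q (⟦ l ⟧ f)
      ; N≥0 = λ l → Q-Nn (⟦ l ⟧ f)
      ; perm = λ r → S₂-cong (λ x y → cong₂ _*_ (⟦⟧-perm r f x y) (⟦⟧-perm r f x y))
      ; split = split′
      ; dbl = dbl′
      ; tri = tri′
      }
      where
      shiftQ : ∀ l w → Q (shifted w (⟦ l ⟧ f)) ≡ Q (⟦ l ⟧ f)
      shiftQ l w = S₂-shift {λ x y → ⟦ l ⟧ f x y * ⟦ l ⟧ f x y} (record { per₁ = λ x y → cong₂ _*_ (per₁ pl x y) (per₁ pl x y) ; per₂ = λ x y → cong₂ _*_ (per₂ pl x y) (per₂ pl x y) }) (proj₁ w) (proj₂ w)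
        where pl = ⟦⟧-per l p
      split′ : ∀ w l → Q (⟦ A w ∷ l ⟧ f) + Q (⟦ B w ∷ l ⟧ f) ≡ Q (⟦ l ⟧ f)
      split′ w@(a , b) l = begin
        Q (⟦ A w ∷ l ⟧ f) + Q (⟦ B w ∷ l ⟧ f) ≡⟨ sym (S₂-+ (sq (⟦ A w ∷ l ⟧ f)) (sq (⟦ B w ∷ l ⟧ f))) ⟩
        S₂ (λ x y → ⟦ A w ∷ l ⟧ f x y * ⟦ A w ∷ l ⟧ f x y + ⟦ B w ∷ l ⟧ f x y * ⟦ B w ∷ l ⟧ f x y)
          ≡⟨ S₂-cong (λ x y → solve 2 (λ u v → (con ½ :* (u :+ con 1ℚ :* v)) :* (con ½ :* (u :+ con 1ℚ :* v)) :+ (con ½ :* (u :+ con (- 1ℚ) :* v)) :* (con ½ :* (u :+ con (- 1ℚ) :* v)) := con ½ :* (u :* u :+ v :* v)) ≡.refl (g x y) (g (x ℤ.+ a) (y ℤ.+ b))) ⟩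
        S₂ (λ x y → ½ * (g x y * g x y + g (x ℤ.+ a) (y ℤ.+ b) * g (x ℤ.+ a) (y ℤ.+ b)))
          ≡⟨ ≡.trans (S₂-* ½ (λ x y → sq g x y + sq (shifted w g) x y)) (cong (½ *_) (≡.trans (S₂-+ (sq g) (sq (shifted w g))) (cong (Q g +_) (shiftQ l w)))) ⟩
        ½ * (Q g + Q g) ≡⟨ solve 1 (λ u → con ½ :* (u :+ u) := u) ≡.refl (Q g) ⟩
        Q g ∎
        where
        open ≡-Reasoning
        g = ⟦ l ⟧ f
      dbl′ : ∀ w l → Q (⟦ A w ∷ B w ∷ l ⟧ f) ≡ ¼ * Q (⟦ B (w ⊕ w) ∷ l ⟧ f)
      dbl′ w@(a , b) l = ≡.trans (S₂-cong (λ x y → ≡.trans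
          (solve 3 (λ u v t → (con ½ :* (con ½ :* (u :+ con (- 1ℚ) :* v) :+ con 1ℚ :* (con ½ :* (v :+ con (- 1ℚ) :* t)))) :* (con ½ :* (con ½ :* (u :+ con (- 1ℚ) :* v) :+ con 1ℚ :* (con ½ :* (v :+ con (- 1ℚ) :* t))))
             := con ¼ :* ((con ½ :* (u :+ con (- 1ℚ) :* t)) :* (con ½ :* (u :+ con (- 1ℚ) :* t)))) ≡.refl (g x y) (g (x ℤ.+ a) (y ℤ.+ b)) (g (x ℤ.+ a ℤ.+ a) (y ℤ.+ b ℤ.+ b)))
          (cong (λ t → ¼ * ((½ * (g x y + - 1ℚ * t)) * (½ * (g x y + - 1ℚ * t)))) (cong₂ g (ℤₚ.+-assoc x a a) (ℤₚ.+-assoc y b b))))) (S₂-* ¼ (sq (⟦ B (w ⊕ w) ∷ l ⟧ f)))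
        where g = ⟦ l ⟧ f
      tri′ : ∀ v w l → Q (⟦ B w ∷ l ⟧ f) ≤ (1ℚ + 1ℚ) * Q (⟦ B (v ⊕ w) ∷ l ⟧ f) + (1ℚ + 1ℚ) * Q (⟦ B v ∷ l ⟧ f)
      tri′ v@(a , b) w@(c , d) l = begin
        Q (⟦ B w ∷ l ⟧ f) ≡⟨ sym (shiftQ (B w ∷ l) v) ⟩
        S₂ (λ x y → ⟦ B w ∷ l ⟧ f (x ℤ.+ a) (y ℤ.+ b) * ⟦ B w ∷ l ⟧ f (x ℤ.+ a) (y ℤ.+ b)) ≤⟨ S₂-mono ptwise ⟩
        S₂ (λ x y → 2q * (⟦ B (v ⊕ w) ∷ l ⟧ f x y * ⟦ B (v ⊕ w) ∷ l ⟧ f x y) + 2q * (⟦ B v ∷ l ⟧ f x y * ⟦ B v ∷ l ⟧ f x y))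
          ≡⟨ ≡.trans (S₂-+ (λ x y → 2q * sq (⟦ B (v ⊕ w) ∷ l ⟧ f) x y) (λ x y → 2q * sq (⟦ B v ∷ l ⟧ f) x y)) (cong₂ _+_ (S₂-* 2q (sq (⟦ B (v ⊕ w) ∷ l ⟧ f))) (S₂-* 2q (sq (⟦ B v ∷ l ⟧ f)))) ⟩
        2q * Q (⟦ B (v ⊕ w) ∷ l ⟧ f) + 2q * Q (⟦ B v ∷ l ⟧ f) ∎
        where
        open ≤-Reasoning
        2q = 1ℚ + 1ℚ
        g = ⟦ l ⟧ f
        ptwise : ∀ x y → ⟦ B w ∷ l ⟧ f (x ℤ.+ a) (y ℤ.+ b) * ⟦ B w ∷ l ⟧ f (x ℤ.+ a) (y ℤ.+ b) ≤ 2q * (⟦ B (v ⊕ w) ∷ l ⟧ f x y * ⟦ B (v ⊕ w) ∷ l ⟧ f x y) + 2q * (⟦ B v ∷ l ⟧ f x y * ⟦ B v ∷ l ⟧ f x y)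
        ptwise x y = concl (sq-Nn (½ * (g x y + - 1ℚ * g₁) + ½ * (g x y + - 1ℚ * g₂))) (≡.trans
          (cong (λ z → 2q * ((½ * (g x y + - 1ℚ * g₁)) * (½ * (g x y + - 1ℚ * g₁))) + 2q * ((½ * (g x y + - 1ℚ * g₂)) * (½ * (g x y + - 1ℚ * g₂))) - (½ * (g₂ + - 1ℚ * z)) * (½ * (g₂ + - 1ℚ * z))) (cong₂ g (ℤₚ.+-assoc x a c) (ℤₚ.+-assoc y b d)))
          (solve 3 (λ u t₁ t₂ → con 2q :* ((con ½ :* (u :+ con (- 1ℚ) :* t₁)) :* (con ½ :* (u :+ con (- 1ℚ) :* t₁))) :+ con 2q :* ((con ½ :* (u :+ con (- 1ℚ) :* t₂)) :* (con ½ :* (u :+ con (- 1ℚ) :* t₂))) :- (con ½ :* (t₂ :+ con (- 1ℚ) :* t₁)) :* (con ½ :* (t₂ :+ con (- 1ℚ) :* t₁))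
            := (con ½ :* (u :+ con (- 1ℚ) :* t₁) :+ con ½ :* (u :+ con (- 1ℚ) :* t₂)) :* (con ½ :* (u :+ con (- 1ℚ) :* t₁) :+ con ½ :* (u :+ con (- 1ℚ) :* t₂))) ≡.refl (g x y) g₁ g₂))
          where
          g₁ = g (x ℤ.+ (a ℤ.+ c)) (y ℤ.+ (b ℤ.+ d))
          g₂ = g (x ℤ.+ a) (y ℤ.+ b)

-- A crude Poincaré inequality on the torus.

module Poincaré where

  open import Data.Nat as ℕ using (ℕ; zero; suc)
  import Data.Nat.Properties as ℕₚ
  open import Data.Integer as ℤ using (ℤ)
  import Data.Integer.Properties as ℤₚ
  open import Data.Rational
  open import Data.Rational.Properties
  open import Data.Rational.Solver
  open +-*-Solver using (solve; _:=_; _:+_; _:*_; _:-_; con)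
  open import Data.List using ([]; _∷_)
  open import Relation.Binary.PropositionalEquality
  open import Data.Product using (_,_; proj₁; proj₂)
  open RationalSums
  open ShiftEnergies
  open PeriodicFunctions
  open Periodic

  mapOp : (W → W) → Op → Op
  mapOp H (A w) = A (H w)
  mapOp H (B w) = B (H w)

  2ℚ 4ℚ : ℚ
  2ℚ = 1ℚ + 1ℚ
  4ℚ = 2ℚ + 2ℚ

  p4 : ℕ → ℚ
  p4 zero = 1ℚ
  p4 (suc k) = 4ℚ * p4 k

  1≤p4 : ∀ k → 1ℚ ≤ p4 k
  1≤p4 zero = ≤-refl
  1≤p4 (suc k) = concl (nonNegative⁻¹ 4ℚ ⊡ diff (1≤p4 k) ⊞ nonNegative⁻¹ (2ℚ + 1ℚ))
    (solve 1 (λ p → con 4ℚ :* p :- con 1ℚ := con 4ℚ :* (p :- con 1ℚ) :+ con (2ℚ + 1ℚ)) refl (p4 k))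

  p4-mono : ∀ {i k} → i ℕ.≤ k → p4 i ≤ p4 k
  p4-mono {zero} {k} _ = 1≤p4 k
  p4-mono {suc i} {suc k} (ℕ.s≤s h) = *-monoˡ-≤-nonNeg 4ℚ (p4-mono h)

  p4c4 : ∀ k m → p4 k * c4 (k ℕ.+ m) ≡ c4 m
  p4c4 zero m = *-identityˡ (c4 m)
  p4c4 (suc k) m = trans (solve 2 (λ p c → con 4ℚ :* p :* (con ¼ :* c) := p :* c) refl (p4 k) (c4 (k ℕ.+ m))) (p4c4 k m)

  module _ (q : ℕ) where

    _⊖_ : Fn → Fn → Fn
    (f ⊖ g) x y = f x y - g x y

    Mean0 : Fn → Set
    Mean0 f = S₂ q f ≡ 0ℚ

    mean-⟦⟧ : ∀ l {f} → Periodic q f → Mean0 f → Mean0 (⟦_⟧ q l f)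
    mean-⟦⟧ [] p m = m
    mean-⟦⟧ (o ∷ l) {f} p m = begin
      S₂ q (⟦_⟧ q (o ∷ l) f) ≡⟨ S₂-* q ½ (λ x y → g x y + sgn q o * shifted q (vec q o) g x y) ⟩
      ½ * S₂ q (λ x y → g x y + sgn q o * shifted q (vec q o) g x y) ≡⟨ cong (½ *_) (S₂-+ q g (λ x y → sgn q o * shifted q (vec q o) g x y)) ⟩
      ½ * (S₂ q g + S₂ q (λ x y → sgn q o * shifted q (vec q o) g x y)) ≡⟨ cong (λ z → ½ * (S₂ q g + z)) (S₂-* q (sgn q o) (shifted q (vec q o) g)) ⟩
      ½ * (S₂ q g + sgn q o * S₂ q (shifted q (vec q o) g)) ≡⟨ cong₂ (λ u v → ½ * (u + sgn q o * v)) ih (trans (S₂-shift q (⟦⟧-per q l p) (proj₁ (vec q o)) (proj₂ (vec q o))) ih) ⟩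
      ½ * (0ℚ + sgn q o * 0ℚ) ≡⟨ cong (λ z → ½ * (0ℚ + z)) (*-zeroʳ (sgn q o)) ⟩
      0ℚ ∎
      where
      open ≡-Reasoning
      g = ⟦_⟧ q l f
      ih = mean-⟦⟧ l p m

    ⟦⟧-⊖ : ∀ l f g x y → ⟦_⟧ q l (f ⊖ g) x y ≡ ⟦_⟧ q l f x y - ⟦_⟧ q l g x y
    ⟦⟧-⊖ [] f g x y = refl
    ⟦⟧-⊖ (o ∷ l) f g x y = trans (cong₂ (λ u v → ½ * (u + sgn q o * v)) (⟦⟧-⊖ l f g x y) (⟦⟧-⊖ l f g x′ y′))
      (solve 5 (λ s a b c d → con ½ :* (a :- b :+ s :* (c :- d)) := con ½ :* (a :+ s :* c) :- con ½ :* (b :+ s :* d)) refl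
        (sgn q o) (⟦_⟧ q l f x y) (⟦_⟧ q l g x y) (⟦_⟧ q l f x′ y′) (⟦_⟧ q l g x′ y′))
      where
      x′ = x ℤ.+ proj₁ (vec q o)
      y′ = y ℤ.+ proj₂ (vec q o)

    -- From 1 - τ_v τ_w = (1 - τ_v) + τ_v (1 - τ_w).
    tri-add : ∀ {g} → Periodic q g → ∀ v w → Q q (⟦_⟧ q (B (v ⊕ w) ∷ []) g) ≤ 2ℚ * Q q (⟦_⟧ q (B v ∷ []) g) + 2ℚ * Q q (⟦_⟧ q (B w ∷ []) g)
    tri-add {g} p v@(a , b) w@(c , d) = begin
      Q q (⟦_⟧ q (B (v ⊕ w) ∷ []) g) ≤⟨ S₂-mono q ptwise ⟩
      S₂ q (λ x y → 2ℚ * sq q gv x y + 2ℚ * sq q (shifted q v gw) x y)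
        ≡⟨ trans (S₂-+ q (λ x y → 2ℚ * sq q gv x y) (λ x y → 2ℚ * sq q (shifted q v gw) x y)) (cong₂ _+_ (S₂-* q 2ℚ (sq q gv)) (S₂-* q 2ℚ (sq q (shifted q v gw)))) ⟩
      2ℚ * Q q gv + 2ℚ * Q q (shifted q v gw) ≡⟨ cong (λ z → 2ℚ * Q q gv + 2ℚ * z) (S₂-shift q sq-per a b) ⟩
      2ℚ * Q q gv + 2ℚ * Q q gw ∎
      where
      open ≤-Reasoning
      gv = ⟦_⟧ q (B v ∷ []) g
      gw = ⟦_⟧ q (B w ∷ []) g
      pw′ = ⟦⟧-per q (B w ∷ []) p
      sq-per : Periodic q (sq q gw)
      sq-per = record { per₁ = λ x y → cong (λ z → z * z) (per₁ pw′ x y) ; per₂ = λ x y → cong (λ z → z * z) (per₂ pw′ x y) }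
      ptwise : ∀ x y → sq q (⟦_⟧ q (B (v ⊕ w) ∷ []) g) x y ≤ 2ℚ * sq q gv x y + 2ℚ * sq q (shifted q v gw) x y
      ptwise x y = concl (sq-Nn (gv x y - shifted q v gw x y)) (trans
        (cong (λ z → 2ℚ * sq q gv x y + 2ℚ * sq q (shifted q v gw) x y - (½ * (g x y + - 1ℚ * z)) * (½ * (g x y + - 1ℚ * z))) (cong₂ g (sym (ℤₚ.+-assoc x a c)) (sym (ℤₚ.+-assoc y b d))))
        (solve 3 (λ u s t → let gv = con ½ :* (u :+ con (- 1ℚ) :* s) ; gw = con ½ :* (s :+ con (- 1ℚ) :* t) ; gs = con ½ :* (u :+ con (- 1ℚ) :* t) in
           con 2ℚ :* (gv :* gv) :+ con 2ℚ :* (gw :* gw) :- gs :* gs := (gv :- gw) :* (gv :- gw)) refl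
           (g x y) (g (x ℤ.+ a) (y ℤ.+ b)) (g (x ℤ.+ a ℤ.+ c) (y ℤ.+ b ℤ.+ d))))

    NB : Fn → W → ℚ
    NB g w = Q q (⟦_⟧ q (B w ∷ []) g)

    -- Repeated use of `tri-add` costs a factor 4 for each step, so the growth is exponential rather
    -- than quadratic in i. This is harmless: the constant only has to be beaten by sufficiently
    -- many levels of the ladder.
    NB-multiple : ∀ {g} → Periodic q g → ∀ (e : ℕ → W) → e 0 ≡ (ℤ.+ 0 , ℤ.+ 0) → (∀ i → e (suc i) ≡ e i ⊕ e 1) → ∀ i → NB g (e i) ≤ p4 i * NB g (e 1)
    NB-multiple {g} p e e0 es zero = begin
      NB g (e 0) ≡⟨ cong (NB g) e0 ⟩
      NB g (ℤ.+ 0 , ℤ.+ 0) ≡⟨ S₂-cong q (λ x y → trans (cong (λ z → (½ * (g x y + - 1ℚ * z)) * (½ * (g x y + - 1ℚ * z))) (cong₂ g (ℤₚ.+-identityʳ x) (ℤₚ.+-identityʳ y)))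
          (solve 1 (λ u → (con ½ :* (u :+ con (- 1ℚ) :* u)) :* (con ½ :* (u :+ con (- 1ℚ) :* u)) := con 0ℚ :* con 0ℚ) refl (g x y))) ⟩
      S₂ q (λ _ _ → 0ℚ * 0ℚ) ≡⟨ trans (S₂-* q 0ℚ (λ _ _ → 0ℚ)) (*-zeroˡ (S₂ q (λ _ _ → 0ℚ))) ⟩
      0ℚ ≤⟨ Q-Nn q (⟦_⟧ q (B (e 1) ∷ []) g) ⟩
      NB g (e 1) ≡⟨ sym (*-identityˡ (NB g (e 1))) ⟩
      1ℚ * NB g (e 1) ∎
      where open ≤-Reasoning
    NB-multiple {g} p e e0 es (suc i) = ≤-trans (subst (λ z → NB g z ≤ 2ℚ * NB g (e i) + 2ℚ * NB g (e 1)) (sym (es i)) (tri-add p (e i) (e 1)))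
      (concl (nonNegative⁻¹ 2ℚ ⊡ diff (NB-multiple p e e0 es i) ⊞ nonNegative⁻¹ 2ℚ ⊡ (diff (1≤p4 i) ⊡ Q-Nn q (⟦_⟧ q (B (e 1) ∷ []) g)))
        (solve 3 (λ p n m → con 4ℚ :* p :* m :- (con 2ℚ :* n :+ con 2ℚ :* m) := con 2ℚ :* (p :* m :- n) :+ con 2ℚ :* ((p :- con 1ℚ) :* m)) refl (p4 i) (NB g (e i)) (NB g (e 1))))

    vol : ℚ
    vol = S₂ q (λ _ _ → 1ℚ)

    S₂-const : ∀ c → S₂ q (λ _ _ → c) ≡ vol * c
    S₂-const c = trans (S₂-cong q (λ _ _ → sym (*-identityʳ c))) (trans (S₂-* q c (λ _ _ → 1ℚ)) (*-comm c vol))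

    S₂-swap : ∀ (f : ℤ → ℤ → ℤ → ℤ → ℚ) → S₂ q (λ a b → S₂ q (f a b)) ≡ S₂ q (λ x y → S₂ q (λ a b → f a b x y))
    S₂-swap f = begin
      sum q (λ b → sum q (λ a → sum q (λ y → sum q (λ x → F a b x y)))) ≡⟨ sum-cong q (λ b → sum-swap q q (λ a y → sum q (λ x → F a b x y))) ⟩
      sum q (λ b → sum q (λ y → sum q (λ a → sum q (λ x → F a b x y)))) ≡⟨ sum-swap q q (λ b y → sum q (λ a → sum q (λ x → F a b x y))) ⟩
      sum q (λ y → sum q (λ b → sum q (λ a → sum q (λ x → F a b x y)))) ≡⟨ sum-cong q (λ y → trans (sum-cong q (λ b → sum-swap q q (λ a x → F a b x y))) (sum-swap q q (λ b x → sum q (λ a → F a b x y)))) ⟩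
      sum q (λ y → sum q (λ x → sum q (λ b → sum q (λ a → F a b x y)))) ∎
      where
      open ≡-Reasoning
      F : ℕ → ℕ → ℕ → ℕ → ℚ
      F a b x y = f (ℤ.+ a) (ℤ.+ b) (ℤ.+ x) (ℤ.+ y)

    -- Expanding the square leaves the energy and an autocorrelation; summed over all translations,
    -- the autocorrelation is the square of the sum of g, hence zero.
    NB-total : ∀ {g} → Periodic q g → Mean0 g → S₂ q (λ a b → NB g (a , b)) ≡ vol * (½ * Q q g)
    NB-total {g} p m = begin
      S₂ q (λ a b → NB g (a , b)) ≡⟨ S₂-cong q expand ⟩
      S₂ q (λ a b → ½ * Q q g + - ½ * corr a b) ≡⟨ S₂-+ q (λ _ _ → ½ * Q q g) (λ a b → - ½ * corr a b) ⟩
      S₂ q (λ a b → ½ * Q q g) + S₂ q (λ a b → - ½ * corr a b) ≡⟨ cong₂ _+_ (S₂-const (½ * Q q g)) (trans (S₂-* q (- ½) corr) (cong (- ½ *_) corr0)) ⟩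
      vol * (½ * Q q g) + - ½ * 0ℚ ≡⟨ +-identityʳ (vol * (½ * Q q g)) ⟩
      vol * (½ * Q q g) ∎
      where
      open ≡-Reasoning
      corr : Fn
      corr a b = S₂ q (λ x y → g x y * g (x ℤ.+ a) (y ℤ.+ b))
      sq-per : Periodic q (sq q g)
      sq-per = record { per₁ = λ x y → cong (λ z → z * z) (per₁ p x y) ; per₂ = λ x y → cong (λ z → z * z) (per₂ p x y) }
      expand : ∀ a b → NB g (a , b) ≡ ½ * Q q g + - ½ * corr a b
      expand a b = begin
        NB g (a , b) ≡⟨ S₂-cong q (λ x y → solve 2 (λ u v → (con ½ :* (u :+ con (- 1ℚ) :* v)) :* (con ½ :* (u :+ con (- 1ℚ) :* v)) := con ¼ :* (u :* u :+ v :* v) :+ con (- ½) :* (u :* v)) refl (g x y) (g (x ℤ.+ a) (y ℤ.+ b))) ⟩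
        S₂ q (λ x y → ¼ * (sq q g x y + sq q (shifted q (a , b) g) x y) + - ½ * (g x y * g (x ℤ.+ a) (y ℤ.+ b)))
          ≡⟨ trans (S₂-+ q (λ x y → ¼ * (sq q g x y + sq q (shifted q (a , b) g) x y)) (λ x y → - ½ * (g x y * g (x ℤ.+ a) (y ℤ.+ b)))) (cong₂ _+_ (trans (S₂-* q ¼ (λ x y → sq q g x y + sq q (shifted q (a , b) g) x y)) (cong (¼ *_) (S₂-+ q (sq q g) (sq q (shifted q (a , b) g))))) (S₂-* q (- ½) (λ x y → g x y * g (x ℤ.+ a) (y ℤ.+ b)))) ⟩
        ¼ * (Q q g + Q q (shifted q (a , b) g)) + - ½ * corr a b ≡⟨ cong (λ z → ¼ * (Q q g + z) + - ½ * corr a b) (S₂-shift q sq-per a b) ⟩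
        ¼ * (Q q g + Q q g) + - ½ * corr a b ≡⟨ solve 2 (λ u c → con ¼ :* (u :+ u) :+ c := con ½ :* u :+ c) refl (Q q g) (- ½ * corr a b) ⟩
        ½ * Q q g + - ½ * corr a b ∎
      corr0 : S₂ q corr ≡ 0ℚ
      corr0 = begin
        S₂ q corr ≡⟨ S₂-swap (λ a b x y → g x y * g (x ℤ.+ a) (y ℤ.+ b)) ⟩
        S₂ q (λ x y → S₂ q (λ a b → g x y * g (x ℤ.+ a) (y ℤ.+ b))) ≡⟨ S₂-cong q (λ x y → begin
          S₂ q (λ a b → g x y * g (x ℤ.+ a) (y ℤ.+ b)) ≡⟨ S₂-* q (g x y) (λ a b → g (x ℤ.+ a) (y ℤ.+ b)) ⟩
          g x y * S₂ q (λ a b → g (x ℤ.+ a) (y ℤ.+ b)) ≡⟨ cong (g x y *_) (S₂-cong q (λ a b → cong₂ g (ℤₚ.+-comm x a) (ℤₚ.+-comm y b))) ⟩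
          g x y * S₂ q (λ a b → g (a ℤ.+ x) (b ℤ.+ y)) ≡⟨ cong (g x y *_) (trans (S₂-shift q p x y) m) ⟩
          g x y * 0ℚ ≡⟨ *-zeroʳ (g x y) ⟩
          0ℚ ∎) ⟩
        S₂ q (λ _ _ → 0ℚ) ≡⟨ trans (S₂-const 0ℚ) (*-zeroʳ vol) ⟩
        0ℚ ∎

  e₁ e₂ : W
  e₁ = ℤ.+ 1 , ℤ.+ 0
  e₂ = ℤ.+ 0 , ℤ.+ 1

  vol-pos : ∀ q′ → Positive (vol (suc q′))
  vol-pos q′ = positive (≤-<-trans (sum-Nn q′ (λ _ → nn)) (subst (_< vol (suc q′)) (+-identityʳ _) (+-monoʳ-< (sum q′ (λ _ → n)) (<-≤-trans (positive⁻¹ 1ℚ) n≥1))))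
    where
    n = sum (suc q′) (λ _ → 1ℚ)
    nn : Nn n
    nn = sum-Nn (suc q′) (λ _ → nonNegative⁻¹ 1ℚ)
    n≥1 : 1ℚ ≤ n
    n≥1 = subst (_≤ n) (+-identityˡ 1ℚ) (+-monoˡ-≤ 1ℚ (sum-Nn q′ (λ _ → nonNegative⁻¹ 1ℚ)))

  -- By `NB-total` half the energy is the mean of `NB` over all translations (i , j) with i, j < q,
  -- and each of those is reached by i steps along `e₁` and j along `e₂`.
  poincaré : ∀ q′ {g} → let q = suc q′ in Periodic q g → Mean0 q g → Q q g ≤ 4ℚ * p4 q * (NB q g e₁ + NB q g e₂)
  poincaré q′ {g} p m = ≤-trans (≤-reflexive (solve 1 (λ u → u := con 2ℚ :* (con ½ :* u)) refl (Q q g)))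
    (≤-trans (*-monoˡ-≤-nonNeg 2ℚ half) (≤-reflexive (solve 2 (λ c d → con 2ℚ :* (con 2ℚ :* c :* d) := con 4ℚ :* c :* d) refl (p4 q) d)))
    where
    q = suc q′
    d = NB q g e₁ + NB q g e₂
    bound : ∀ i j → i ℕ.< q → j ℕ.< q → NB q g (ℤ.+ i , ℤ.+ j) ≤ 2ℚ * p4 q * d
    bound i j i<q j<q = ≤-trans (subst (λ z → NB q g z ≤ 2ℚ * NB q g (ℤ.+ i , ℤ.+ 0) + 2ℚ * NB q g (ℤ.+ 0 , ℤ.+ j)) (cong₂ _,_ (ℤₚ.+-identityʳ (ℤ.+ i)) (ℤₚ.+-identityˡ (ℤ.+ j))) (tri-add q p (ℤ.+ i , ℤ.+ 0) (ℤ.+ 0 , ℤ.+ j)))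
      (concl (nonNegative⁻¹ 2ℚ ⊡ diff (NB-multiple q p (λ i → ℤ.+ i , ℤ.+ 0) refl (λ i → cong₂ _,_ (cong ℤ.+_ (ℕₚ.+-comm 1 i)) refl) i) ⊞ nonNegative⁻¹ 2ℚ ⊡ (diff (p4-mono (ℕₚ.<⇒≤ i<q)) ⊡ Q-Nn q (⟦_⟧ q (B e₁ ∷ []) g))
          ⊞ nonNegative⁻¹ 2ℚ ⊡ diff (NB-multiple q p (λ i → ℤ.+ 0 , ℤ.+ i) refl (λ i → cong₂ _,_ refl (cong ℤ.+_ (ℕₚ.+-comm 1 i))) j) ⊞ nonNegative⁻¹ 2ℚ ⊡ (diff (p4-mono (ℕₚ.<⇒≤ j<q)) ⊡ Q-Nn q (⟦_⟧ q (B e₂ ∷ []) g)))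
        (solve 7 (λ P pi pj ni nj m₁ m₂ → con 2ℚ :* P :* (m₁ :+ m₂) :- (con 2ℚ :* ni :+ con 2ℚ :* nj)
           := con 2ℚ :* (pi :* m₁ :- ni) :+ con 2ℚ :* ((P :- pi) :* m₁) :+ con 2ℚ :* (pj :* m₂ :- nj) :+ con 2ℚ :* ((P :- pj) :* m₂)) refl
          (p4 q) (p4 i) (p4 j) (NB q g (ℤ.+ i , ℤ.+ 0)) (NB q g (ℤ.+ 0 , ℤ.+ j)) (NB q g e₁) (NB q g e₂)))
    half : ½ * Q q g ≤ 2ℚ * p4 q * d
    half = *-cancelˡ-≤-pos (vol q) {{vol-pos q′}} (subst₂ _≤_ (NB-total q p m) (S₂-const q (2ℚ * p4 q * d))
      (sum-mono< q (λ j j<q → sum-mono< q (λ i i<q → bound i j i<q j<q))))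

-- The spectral gap for bounded shears and translations.

module SpectralGap where

  open import Data.Nat as ℕ using (ℕ; zero; suc)
  open import Data.Integer as ℤ using (ℤ)
  import Data.Integer.Properties as ℤₚ
  import Data.Integer.Tactic.RingSolver as ℤR
  open import Data.Rational
  open import Data.Rational.Properties
  open import Data.Rational.Solver
  open +-*-Solver using (solve; _:=_; _:+_; _:*_; _:-_; con)
  open import Data.List using (List; []; _∷_; _++_; map)
  open import Data.List.Properties using (map-++; ++-identityʳ)
  open import Data.List.Relation.Binary.Permutation.Propositional using (_↭_; prep; ↭-trans)
  open import Data.List.Relation.Binary.Permutation.Propositional.Properties using (shift; ++⁺ˡ)
  open import Relation.Binary.PropositionalEquality hiding (J)
  open import Data.Product using (_×_; _,_; proj₁; proj₂)
  open RationalSums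
  open ShiftEnergies
  open PeriodicFunctions
  open Poincaré
  open Periodic

  module _ (q : ℕ) where

    -- Composition with a map φ whose linear part is H turns filters along w into filters along H w.
    -- It is used for shears and for the exchange of the coordinates.
    transport : ∀ (H : W → W) (φ : ℤ → ℤ → ℤ × ℤ)
      → (∀ x y a b → φ (x ℤ.+ a) (y ℤ.+ b) ≡ φ x y ⊕ H (a , b))
      → ∀ l f x y → ⟦_⟧ q l (λ x y → f (proj₁ (φ x y)) (proj₂ (φ x y))) x y ≡ ⟦_⟧ q (map (mapOp H) l) f (proj₁ (φ x y)) (proj₂ (φ x y))
    transport H φ h [] f x y = refl
    transport H φ h (o ∷ l) f x y = trans (cong₂ (λ u v → ½ * (u + sgn q o * v)) (transport H φ h l f x y) (trans (transport H φ h l f _ _)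
        (cong (λ z → ⟦_⟧ q (map (mapOp H) l) f (proj₁ z) (proj₂ z)) (h x y _ _)))) (fix o)
      where
      fix : ∀ o → ½ * (⟦_⟧ q (map (mapOp H) l) f (proj₁ (φ x y)) (proj₂ (φ x y)) + sgn q o * ⟦_⟧ q (map (mapOp H) l) f (proj₁ (φ x y ⊕ H (vec q o))) (proj₂ (φ x y ⊕ H (vec q o)))) ≡ ⟦_⟧ q (mapOp H o ∷ map (mapOp H) l) f (proj₁ (φ x y)) (proj₂ (φ x y))
      fix (A w) = refl
      fix (B w) = refl

    E-map : ∀ (H : W → W) → (∀ v w → H (v ⊕ w) ≡ H v ⊕ H w) → ∀ w j → map (mapOp H) (E w j) ≡ E (H w) j
    pw-map : ∀ (H : W → W) → (∀ v w → H (v ⊕ w) ≡ H v ⊕ H w) → ∀ w j → H (pw j w) ≡ pw j (H w)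
    pw-map H h w zero = refl
    pw-map H h w (suc j) = trans (h (pw j w) (pw j w)) (cong (λ z → z ⊕ z) (pw-map H h w j))
    E-map H h w zero = refl
    E-map H h w (suc j) = cong₂ _∷_ (cong A (pw-map H h w j)) (E-map H h w j)

    xshear : ℤ → Fn → Fn
    xshear n f x y = f (x ℤ.+ n ℤ.* y) y

    xshear-per : ∀ n {f} → Periodic q f → Periodic q (xshear n f)
    xshear-per n {f} p = record
      { per₁ = λ x y → trans (cong (λ z → f z y) (lem x (ℤ.+ q) (n ℤ.* y))) (per₁ p (x ℤ.+ n ℤ.* y) y)
      ; per₂ = λ x y → trans (per₂ p _ y) (trans (cong (λ z → f z y) (lem₂ x y n (ℤ.+ q))) (shift-multiple q (λ x → per₁ p x y) n (x ℤ.+ n ℤ.* y))) }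
      where
      lem : ∀ x q a → x ℤ.+ q ℤ.+ a ≡ x ℤ.+ a ℤ.+ q
      lem = ℤR.solve-∀
      lem₂ : ∀ x y n q → x ℤ.+ n ℤ.* (y ℤ.+ q) ≡ x ℤ.+ n ℤ.* y ℤ.+ n ℤ.* q
      lem₂ = ℤR.solve-∀

    D : Fn → Fn → ℚ
    D f g = Q q (λ x y → f x y - g x y)

    -- The constants of `cross` for directions that differ by 2^6 e₁ and by 2^7 e₁, approximately
    -- 0.029 and 0.022.
    c₆ c₇ : ℚ
    c₆ = (4ℚ * c4 6) * (1ℚ + 1ℚ + 1ℚ + 1ℚ + 1ℚ + 1ℚ + 1ℚ + 1ℚ + 1ℚ + 1ℚ) + c4 4 * (1ℚ + 1ℚ + 1ℚ + 1ℚ + 1ℚ)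
    c₇ = (4ℚ * c4 7) * (1ℚ + 1ℚ + 1ℚ + 1ℚ + 1ℚ + 1ℚ + 1ℚ + 1ℚ + 1ℚ + 1ℚ) + c4 4 * (1ℚ + 1ℚ + 1ℚ + 1ℚ + 1ℚ)

    module Half {f : Fn} (p : Periodic q f) (J : ℕ) where
      open Energy (energy q f p)
      open Props (energy q f p) hiding (4ℚ; 2ℚ)

      tail-band : ℕ → List Op
      tail-band j = band e₁ (j ℕ.+ 7) []

      v₁ v₂ : W
      v₁ = e₂ ⊕ pw 6 e₁
      v₂ = e₂ ⊕ pw 7 e₁

      -- Energy that oscillates along `e₁` at some scale while being smooth along `v` at the same
      -- scale. The levels start at 7 because a difference over 2^(j+7) steps along `e₁` must be one
      -- along 2^6 e₁ or 2^7 e₁.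
      Φ : W → ℚ
      Φ v = sum J (λ j → N (E v (j ℕ.+ 7) ++ tail-band j))

      cr : W → W → ℚ
      cr v w = sum J (λ j → N (E v (j ℕ.+ 7) ++ E w (j ℕ.+ 7) ++ tail-band j))

      into : ∀ j a b → E a j ++ E b j ++ band e₁ j [] ↭ B (pw j e₁) ∷ E a j ++ E b j ++ E e₁ j ++ []
      into j a b = ↭-trans (++⁺ˡ (E a j) (shift (B (pw j e₁)) (E b j) _)) (shift (B (pw j e₁)) (E a j) _)

      N0 : ℚ
      N0 = N []

      cr₁ : cr e₂ v₁ ≤ c₆ * N0
      cr₁ = ≤-trans (≤-reflexive (sum-cong J (λ j → perm (↭-trans (swap++ (E e₂ (j ℕ.+ 7)) (E v₁ (j ℕ.+ 7)) _) (into (j ℕ.+ 7) v₁ e₂))))) (cross e₁ e₂ 3 1 J refl)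

      cr₂ : cr e₂ v₂ ≤ c₇ * N0
      cr₂ = ≤-trans (≤-reflexive (sum-cong J (λ j → perm (↭-trans (swap++ (E e₂ (j ℕ.+ 7)) (E v₂ (j ℕ.+ 7)) _) (into (j ℕ.+ 7) v₂ e₂))))) (cross e₁ e₂ 4 0 J refl)

      cr₃ : cr v₁ v₂ ≤ c₆ * N0
      cr₃ = ≤-trans (≤-reflexive (sum-cong J (λ j → perm (↭-trans (swap++ (E v₁ (j ℕ.+ 7)) (E v₂ (j ℕ.+ 7)) _) (into (j ℕ.+ 7) v₂ v₁))))) (cross e₁ v₁ 3 1 J refl)

      -- The pieces for `e₂`, `v₁`, `v₂` are almost orthogonal: the directions differ pairwise by 64
      -- e₁ or 128 e₁, so `cross` bounds all three intersections in `bonferroni₃`, while the bands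
      -- along `e₁` together have at most the full energy.
      three : Φ e₂ + Φ v₁ + Φ v₂ ≤ N0 + c₆ * N0 + c₇ * N0 + c₆ * N0
      three = begin
        Φ e₂ + Φ v₁ + Φ v₂ ≡⟨ sym (trans (sum-+ J _ (λ j → n v₂ j)) (cong (_+ Φ v₂) (sum-+ J (n e₂) (n v₁)))) ⟩
        sum J (λ j → n e₂ j + n v₁ j + n v₂ j) ≤⟨ sum-mono J (λ j → bonferroni₃ e₂ v₁ v₂ (j ℕ.+ 7) (tail-band j)) ⟩
        sum J (λ j → N (tail-band j) + c e₂ v₁ j + c e₂ v₂ j + c v₁ v₂ j)
          ≡⟨ trans (sum-+ J _ (c v₁ v₂)) (cong (_+ cr v₁ v₂) (trans (sum-+ J _ (c e₂ v₂)) (cong (_+ cr e₂ v₂) (sum-+ J _ (c e₂ v₁))))) ⟩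
        sum J (λ j → N (tail-band j)) + cr e₂ v₁ + cr e₂ v₂ + cr v₁ v₂
          ≤⟨ +-mono-≤ (+-mono-≤ (+-mono-≤ (≤-trans (sum-tail 7 J (λ j → N≥0 (band e₁ j []))) (bands≤ e₁ (J ℕ.+ 7) [])) cr₁) cr₂) cr₃ ⟩
        N0 + c₆ * N0 + c₇ * N0 + c₆ * N0 ∎
        where
        open ≤-Reasoning
        n : W → ℕ → ℚ
        n v j = N (E v (j ℕ.+ 7) ++ tail-band j)
        c : W → W → ℕ → ℚ
        c v w j = N (E v (j ℕ.+ 7) ++ E w (j ℕ.+ 7) ++ tail-band j)

    Φ-def : ∀ {f} → Periodic q f → ℕ → W → ℚ
    Φ-def p J v = Half.Φ p J v

    9/8 9ℚ : ℚ
    9/8 = ℤ.+ 9 / 8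
    9ℚ = ℤ.+ 9 / 1

    -- Pointwise F² ≤ (1 + 1/8) G² + (1 + 8)(F - G)²; the weight 1/8 keeps the main coefficient near
    -- 1 at the price of 9 on the small error.
    stretch : ∀ (f g : Fn) (p : Periodic q f) (r : Periodic q g) l → Q q (⟦_⟧ q l f) ≤ 9/8 * Q q (⟦_⟧ q l g) + 9ℚ * Q q (⟦_⟧ q l (λ x y → f x y - g x y))
    stretch f g p r l = ≤-trans (S₂-mono q ptwise) (≤-reflexive (trans (S₂-+ q (λ x y → 9/8 * sq q G x y) (λ x y → 9ℚ * sq q d x y)) (cong₂ _+_ (S₂-* q 9/8 (sq q G)) (S₂-* q 9ℚ (sq q d)))))
      where
      F = ⟦_⟧ q l f
      G = ⟦_⟧ q l g
      d = ⟦_⟧ q l (λ x y → f x y - g x y)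
      ptwise : ∀ x y → sq q F x y ≤ 9/8 * sq q G x y + 9ℚ * sq q d x y
      ptwise x y = concl (nonNegative⁻¹ (ℤ.+ 1 / 8) ⊡ sq-Nn (F x y - 9ℚ * (F x y - G x y)))
        (trans (cong (λ z → 9/8 * sq q G x y + 9ℚ * (z * z) - sq q F x y) (⟦⟧-⊖ q l f g x y))
         (solve 2 (λ F G → con 9/8 :* (G :* G) :+ con 9ℚ :* ((F :- G) :* (F :- G)) :- F :* F := con (ℤ.+ 1 / 8) :* ((F :- con 9ℚ :* (F :- G)) :* (F :- con 9ℚ :* (F :- G)))) refl (F x y) (G x y)))

    diff-per : ∀ {f g} → Periodic q f → Periodic q g → Periodic q (λ x y → f x y - g x y)
    diff-per p r = record { per₁ = λ x y → cong₂ _-_ (per₁ p x y) (per₁ r x y) ; per₂ = λ x y → cong₂ _-_ (per₂ p x y) (per₂ r x y) }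

    -- The shear by n fixes `e₁` and sends `e₂` to `v`, so the `e₂`-piece of the sheared function is
    -- the `v`-piece of f. The error f - g passes through all bands at once and, these being bounded
    -- in total, is paid for only once.
    xshear-Φ : ∀ {f} (p : Periodic q f) J n v → (ℤ.+ n , ℤ.+ 1) ≡ v → Φ-def p J e₂ ≤ 9/8 * Φ-def p J v + 9ℚ * D f (xshear (ℤ.+ n) f)
    xshear-Φ {f} p J n v hv = begin
      sum J (λ j → Q q (⟦_⟧ q (L e₂ j) f)) ≤⟨ sum-mono J (λ j → stretch f g p (xshear-per (ℤ.+ n) p) (L e₂ j)) ⟩
      sum J (λ j → 9/8 * Q q (⟦_⟧ q (L e₂ j) g) + 9ℚ * Q q (⟦_⟧ q (L e₂ j) d))
        ≡⟨ trans (sum-+ J (λ j → 9/8 * Q q (⟦_⟧ q (L e₂ j) g)) (λ j → 9ℚ * Q q (⟦_⟧ q (L e₂ j) d))) (cong₂ _+_ (sum-* J 9/8 (λ j → Q q (⟦_⟧ q (L e₂ j) g))) (sum-* J 9ℚ (λ j → Q q (⟦_⟧ q (L e₂ j) d)))) ⟩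
      9/8 * sum J (λ j → Q q (⟦_⟧ q (L e₂ j) g)) + 9ℚ * sum J (λ j → Q q (⟦_⟧ q (L e₂ j) d))
        ≤⟨ +-mono-≤ (≤-reflexive (cong (9/8 *_) (sum-cong J moved))) (*-monoˡ-≤-nonNeg 9ℚ small) ⟩
      9/8 * Φ-def p J v + 9ℚ * D f g ∎
      where
      open ≤-Reasoning
      g = xshear (ℤ.+ n) f
      d : Fn
      d x y = f x y - g x y
      L : W → ℕ → List Op
      L v j = E v (j ℕ.+ 7) ++ (B (pw (j ℕ.+ 7) e₁) ∷ E e₁ (j ℕ.+ 7) ++ [])
      H : W → W
      H (a , b) = a ℤ.+ ℤ.+ n ℤ.* b , b
      H-lin : ∀ v w → H (v ⊕ w) ≡ H v ⊕ H w
      H-lin (a , b) (c , d) = cong (_, b ℤ.+ d) (lem a b c d (ℤ.+ n))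
        where
        lem : ∀ a b c d n → a ℤ.+ c ℤ.+ n ℤ.* (b ℤ.+ d) ≡ a ℤ.+ n ℤ.* b ℤ.+ (c ℤ.+ n ℤ.* d)
        lem = ℤR.solve-∀
      H-e₁ : H e₁ ≡ e₁
      H-e₁ = cong (_, ℤ.+ 0) (trans (cong (λ z → ℤ.+ 1 ℤ.+ z) (ℤₚ.*-zeroʳ (ℤ.+ n))) refl)
      H-e₂ : H e₂ ≡ v
      H-e₂ = trans (cong (_, ℤ.+ 1) (trans (ℤₚ.+-identityˡ (ℤ.+ n ℤ.* ℤ.+ 1)) (ℤₚ.*-identityʳ (ℤ.+ n)))) hv
      HL : ∀ j → map (mapOp H) (L e₂ j) ≡ L v j
      HL j = trans (map-++ (mapOp H) (E e₂ (j ℕ.+ 7)) _) (cong₂ _++_ (trans (E-map H H-lin e₂ (j ℕ.+ 7)) (cong (λ z → E z (j ℕ.+ 7)) H-e₂))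
        (cong₂ _∷_ (cong B (trans (pw-map H H-lin e₁ (j ℕ.+ 7)) (cong (pw (j ℕ.+ 7)) H-e₁)))
          (trans (map-++ (mapOp H) (E e₁ (j ℕ.+ 7)) []) (cong (_++ []) (trans (E-map H H-lin e₁ (j ℕ.+ 7)) (cong (λ z → E z (j ℕ.+ 7)) H-e₁))))))
      φ : ℤ → ℤ → ℤ × ℤ
      φ x y = x ℤ.+ ℤ.+ n ℤ.* y , y
      φ-H : ∀ x y a b → φ (x ℤ.+ a) (y ℤ.+ b) ≡ φ x y ⊕ H (a , b)
      φ-H x y a b = cong (_, y ℤ.+ b) (lem x y a b (ℤ.+ n))
        where
        lem : ∀ x y a b n → x ℤ.+ a ℤ.+ n ℤ.* (y ℤ.+ b) ≡ x ℤ.+ n ℤ.* y ℤ.+ (a ℤ.+ n ℤ.* b)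
        lem = ℤR.solve-∀
      moved : ∀ j → Q q (⟦_⟧ q (L e₂ j) g) ≡ Q q (⟦_⟧ q (L v j) f)
      moved j = trans (S₂-cong q (λ x y → cong (λ z → z * z) (trans (transport H φ φ-H (L e₂ j) f x y) (cong (λ l → ⟦_⟧ q l f (x ℤ.+ ℤ.+ n ℤ.* y) y) (HL j)))))
        (S₂-shear q {sq q (⟦_⟧ q (L v j) f)} (record { per₁ = λ x y → cong (λ z → z * z) (per₁ (⟦⟧-per q (L v j) p) x y) ; per₂ = λ x y → cong (λ z → z * z) (per₂ (⟦⟧-per q (L v j) p) x y) }) (λ y → ℤ.+ n ℤ.* y))
      dp = diff-per p (xshear-per (ℤ.+ n) p)
      small : sum J (λ j → Q q (⟦_⟧ q (L e₂ j) d)) ≤ D f g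
      small = ≤-trans (sum-mono J (λ j → mono++ (E e₂ (j ℕ.+ 7)) (band e₁ (j ℕ.+ 7) []))) (≤-trans (sum-tail 7 J (λ j → Energy.N≥0 (energy q d dp) (band e₁ j []))) (bands≤ e₁ (J ℕ.+ 7) []))
        where open Props (energy q d dp)

    half : ∀ {f} (p : Periodic q f) J → (1ℚ + 1ℚ + 1ℚ) * Φ-def p J e₂ ≤ 9/8 * ((1ℚ + c₆ + c₇ + c₆) * Q q f) + 9ℚ * (D f (xshear (ℤ.+ 64) f) + D f (xshear (ℤ.+ 128) f))
    -- Of the three copies of Φ e₂, two are compared with `v₁` and `v₂`; the third is Φ e₂ itself,
    -- and the factor 9/8 given to it too leaves the nonnegative surplus of one eighth.
    half {f} p J = concl (nonNegative⁻¹ 9/8 ⊡ diff three ⊞ diff (xshear-Φ p J 64 v₁ refl) ⊞ diff (xshear-Φ p J 128 v₂ refl) ⊞ nonNegative⁻¹ (ℤ.+ 1 / 8) ⊡ sum-Nn J (λ j → Energy.N≥0 (energy q f p) (E e₂ (j ℕ.+ 7) ++ band e₁ (j ℕ.+ 7) [])))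
      (solve 6 (λ a b c n d₁ d₂ → con 9/8 :* ((con (1ℚ + c₆ + c₇ + c₆)) :* n) :+ con 9ℚ :* (d₁ :+ d₂) :- con (1ℚ + 1ℚ + 1ℚ) :* a
        := con 9/8 :* (n :+ con c₆ :* n :+ con c₇ :* n :+ con c₆ :* n :- (a :+ b :+ c)) :+ (con 9/8 :* b :+ con 9ℚ :* d₁ :- a) :+ (con 9/8 :* c :+ con 9ℚ :* d₂ :- a) :+ con (ℤ.+ 1 / 8) :* a) refl
        (Φ e₂) (Φ v₁) (Φ v₂) (Q q f) (D f (xshear (ℤ.+ 64) f)) (D f (xshear (ℤ.+ 128) f)))
      where
      open Half p J
      open Props (energy q f p) using (band)

    flip-Q : ∀ {f} l → Q q (⟦_⟧ q l (λ x y → f y x)) ≡ Q q (⟦_⟧ q (map (mapOp (λ w → proj₂ w , proj₁ w)) l) f)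
    flip-Q {f} l = trans (S₂-cong q (λ x y → cong (λ z → z * z) (transport (λ w → proj₂ w , proj₁ w) (λ x y → y , x) (λ _ _ _ _ → refl) l f x y)))
      (S₂-transpose q (sq q (⟦_⟧ q (map (mapOp (λ w → proj₂ w , proj₁ w)) l) f)))

    yshear : ℤ → Fn → Fn
    yshear n f x y = f x (y ℤ.+ n ℤ.* x)

  -- Small enough for the constant `K` in `gap` to be positive (about 0.1); η / 2 is the growth rate
  -- of sets below.
  η : ℚ
  η = ℤ.+ 1 / 100

  record AlmostInvariant (q : ℕ) (f : Fn) : Set where
    field
      xsh₁ : D q f (xshear q (ℤ.+ 64) f) ≤ η * Q q f
      xsh₂ : D q f (xshear q (ℤ.+ 128) f) ≤ η * Q q f
      ysh₁ : D q f (yshear q (ℤ.+ 64) f) ≤ η * Q q f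
      ysh₂ : D q f (yshear q (ℤ.+ 128) f) ≤ η * Q q f
      xtr  : ∀ j → j ℕ.< 7 → D q f (shifted q (pw j e₁) f) ≤ η * Q q f
      ytr  : ∀ j → j ℕ.< 7 → D q f (shifted q (pw j e₂) f) ≤ η * Q q f

  -- The ladder splits the energy n into the top, seven low levels and two mirror halves. Each half
  -- is at most (9/8 C + 18 η) n / 3 < 0.47 n, and the remainder is below 0.04 n, so n ≤ 0. With two
  -- almost orthogonal pieces instead of three the halves could exceed n, which is why two shears in
  -- each direction are used.
  gap : ∀ q′ {f} → let q = suc q′ in Periodic q f → Mean0 q f → AlmostInvariant q f → Q q f ≤ 0ℚ
  gap q′ {f} p m ai = *-cancelˡ-≤-pos K (subst (K * n ≤_) (sym (*-zeroʳ K)) (concl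
      (nonNegative⁻¹ 3ℚ ⊡ diff split-total ⊞ nonNegative⁻¹ 3ℚ ⊡ diff top ⊞ nonNegative⁻¹ 3ℚ ⊡ diff low ⊞ diff (half q p J) ⊞ diff half₂
        ⊞ nonNegative⁻¹ 9ℚ′ ⊡ diff xsh₁ ⊞ nonNegative⁻¹ 9ℚ′ ⊡ diff xsh₂ ⊞ nonNegative⁻¹ 9ℚ′ ⊡ diff ysh₁ ⊞ nonNegative⁻¹ 9ℚ′ ⊡ diff ysh₂)
      (solve 9 (λ n t s Φ₁ Φ₂ a b c d → con 0ℚ :- con K :* n :=
          con 3ℚ :* (t :+ s :+ Φ₁ :+ Φ₂ :- n) :+ con 3ℚ :* (con ε :* n :- t) :+ con 3ℚ :* (con (ℤ.+ 7 / 2 * η) :* n :- s)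
          :+ (con 9/8′ :* (con C :* n) :+ con 9ℚ′ :* (a :+ b) :- con 3ℚ :* Φ₁) :+ (con 9/8′ :* (con C :* n) :+ con 9ℚ′ :* (c :+ d) :- con 3ℚ :* Φ₂)
          :+ con 9ℚ′ :* (con η :* n :- a) :+ con 9ℚ′ :* (con η :* n :- b) :+ con 9ℚ′ :* (con η :* n :- c) :+ con 9ℚ′ :* (con η :* n :- d)) refl
        n (N (E e₂ (J ℕ.+ 7) ++ E e₁ (J ℕ.+ 7) ++ [])) (sum 7 F) Φ₁ Φ₂ (D q f (xshear q (ℤ.+ 64) f)) (D q f (xshear q (ℤ.+ 128) f)) (D q f (yshear q (ℤ.+ 64) f)) (D q f (yshear q (ℤ.+ 128) f)))))
    where
    q = suc q′
    -- With q levels beyond the first seven the filters gain 4^(-q), which cancels the factor 4^q in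
    -- `poincaré`.
    J = q
    open AlmostInvariant ai
    open Energy (energy q f p)
    open Props (energy q f p) hiding (4ℚ; 2ℚ)
    n = Q q f
    3ℚ 9ℚ′ 9/8′ C ε K : ℚ
    3ℚ = 1ℚ + 1ℚ + 1ℚ
    9ℚ′ = ℤ.+ 9 / 1
    9/8′ = ℤ.+ 9 / 8
    C = 1ℚ + c₆ q + c₇ q + c₆ q
    -- The constant of `poincaré` times two differences that each keep 4^(-(q + 7)) of the energy: 4
    -- · 4^q · 2 · 4^(-(q + 7)) = 1/2048.
    ε = ℤ.+ 1 / 2048
    K = 3ℚ - 3ℚ * ε - 3ℚ * (ℤ.+ 7 / 2 * η) - 9/8′ * C - 9/8′ * C - 9ℚ′ * η - 9ℚ′ * η - 9ℚ′ * η - 9ℚ′ * η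
    fT : Fn
    fT x y = f y x
    pT = transpose-per q p
    Φ₁ = Φ-def q p J e₂
    Φ₂ = Φ-def q pT J e₂
    F : ℕ → ℚ
    F j = N (band e₁ j (E e₂ j ++ [])) + N (band e₂ j (E e₁ j ++ []))
    half₂ : 3ℚ * Φ₂ ≤ 9/8′ * (C * n) + 9ℚ′ * (D q f (yshear q (ℤ.+ 64) f) + D q f (yshear q (ℤ.+ 128) f))
    half₂ = subst (3ℚ * Φ₂ ≤_) (cong₂ (λ u v → 9/8′ * (C * u) + 9ℚ′ * v) (S₂-transpose q (sq q f))
      (cong₂ _+_ (S₂-transpose q (sq q (λ x y → f x y - yshear q (ℤ.+ 64) f x y))) (S₂-transpose q (sq q (λ x y → f x y - yshear q (ℤ.+ 128) f x y))))) (half q pT J)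
    swapW : W → W
    swapW w = proj₂ w , proj₁ w
    mirror : ∀ j → N (band e₂ j (E e₁ j ++ [])) ≡ Q q (⟦_⟧ q (E e₂ j ++ band e₁ j []) fT)
    mirror j = sym (trans (flip-Q q {f} (E e₂ j ++ band e₁ j [])) (trans (cong N eq) (perm (swap++ (E e₁ j) (B (pw j e₂) ∷ E e₂ j) []))))
      where
      lin : ∀ v w → swapW (v ⊕ w) ≡ swapW v ⊕ swapW w
      lin v w = refl
      eq : map (mapOp swapW) (E e₂ j ++ band e₁ j []) ≡ E e₁ j ++ (B (pw j e₂) ∷ E e₂ j) ++ []
      eq = trans (map-++ (mapOp swapW) (E e₂ j) (band e₁ j [])) (cong₂ _++_ (E-map q swapW lin e₂ j)
        (cong₂ _∷_ (cong B (pw-map q swapW lin e₁ j)) (trans (map-++ (mapOp swapW) (E e₁ j) []) (cong (_++ []) (E-map q swapW lin e₁ j)))))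
    split-total : n ≤ N (E e₂ (J ℕ.+ 7) ++ E e₁ (J ℕ.+ 7) ++ []) + sum 7 F + Φ₁ + Φ₂
    split-total = ≤-trans (ladder e₂ e₁ (J ℕ.+ 7)) (≤-reflexive (trans (cong (t +_) (trans (sum-split 7 J F) (cong (sum 7 F +_) (trans (sum-+ J (λ j → N (band e₁ (j ℕ.+ 7) (E e₂ (j ℕ.+ 7) ++ []))) (λ j → N (band e₂ (j ℕ.+ 7) (E e₁ (j ℕ.+ 7) ++ []))))
        (cong₂ _+_ (sum-cong J (λ j → perm (swap++ (B (pw (j ℕ.+ 7) e₁) ∷ E e₁ (j ℕ.+ 7)) (E e₂ (j ℕ.+ 7)) []))) (sum-cong J (λ j → mirror (j ℕ.+ 7))))))))
      (solve 4 (λ a b c d → a :+ (b :+ (c :+ d)) := a :+ b :+ c :+ d) refl t (sum 7 F) Φ₁ Φ₂)))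
      where t = N (E e₂ (J ℕ.+ 7) ++ E e₁ (J ℕ.+ 7) ++ [])
    quarter : ∀ w → N (B w ∷ []) ≡ ¼ * D q f (shifted q w f)
    quarter w = trans (S₂-cong q (λ x y → solve 2 (λ u v → (con ½ :* (u :+ con (- 1ℚ) :* v)) :* (con ½ :* (u :+ con (- 1ℚ) :* v)) := con ¼ :* ((u :- v) :* (u :- v))) refl (f x y) (shifted q w f x y)))
      (S₂-* q ¼ (sq q (λ x y → f x y - shifted q w f x y)))
    low : sum 7 F ≤ ℤ.+ 7 / 2 * η * n
    -- Levels 0 to 6 are too coarse for `cross`, but their differences are translations by at most
    -- 64, which almost preserve f by hypothesis: fourteen bands, each at most η n / 4.
    low = ≤-trans (≤-trans (sum-mono< 7 each) (≤-reflexive (solve 1 (λ z → let k = con ¼ :* z :+ con ¼ :* z in con 0ℚ :+ k :+ k :+ k :+ k :+ k :+ k :+ k := con (ℤ.+ 7 / 2) :* z) refl (η * n)))) (≤-reflexive (sym (*-assoc (ℤ.+ 7 / 2) η n)))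
      where
      one : ∀ w l → D q f (shifted q w f) ≤ η * n → N (B w ∷ l ++ []) ≤ ¼ * (η * n)
      one w l h = ≤-trans (drop-mid (B w) l []) (≤-trans (≤-reflexive (quarter w)) (*-monoˡ-≤-nonNeg ¼ h))
      each : ∀ j → j ℕ.< 7 → F j ≤ ¼ * (η * n) + ¼ * (η * n)
      each j j<7 = +-mono-≤ (≤-trans (drop-mid2 (B (pw j e₁) ∷ E e₁ j) (E e₂ j) []) (one (pw j e₁) (E e₁ j) (xtr j j<7)))
                            (≤-trans (drop-mid2 (B (pw j e₂) ∷ E e₂ j) (E e₁ j) []) (one (pw j e₂) (E e₂ j) (ytr j j<7)))
    top : N (E e₂ (J ℕ.+ 7) ++ E e₁ (J ℕ.+ 7) ++ []) ≤ ε * n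
    top = ≤-trans (poincaré q′ (⟦⟧-per q L p) (mean-⟦⟧ q L p m)) (concl
        ((nonNegative⁻¹ (ℤ.+ 4 / 1) ⊡ (≤-trans (nonNegative⁻¹ 1ℚ) (1≤p4 q))) ⊡ (diff b₁ ⊞ diff b₂))
        (trans (cong (λ z → ε * z - x) (sym (*-identityˡ n))) (trans
          (trans (solve 2 (λ n x → con ε :* (con 1ℚ :* n) :- x := con 4ℚ :* ((con (c4 7) :* n) :+ (con (c4 7) :* n)) :- x) refl n x)
            (cong (λ c → 4ℚ * ((c * n) + (c * n)) - x) (sym (p4c4 q 7))))
          (solve 5 (λ P c n u v → con 4ℚ :* (P :* c :* n :+ P :* c :* n) :- con 4ℚ :* P :* (u :+ v) := con 4ℚ :* P :* (c :* n :- u :+ (c :* n :- v))) refl (p4 q) (c4 (q ℕ.+ 7)) n (NB q g e₁) (NB q g e₂)))))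
      where
      K′ = J ℕ.+ 7
      L = E e₂ K′ ++ E e₁ K′ ++ []
      g = ⟦_⟧ q L f
      x = 4ℚ * p4 q * (NB q g e₁ + NB q g e₂)
      low-end : ∀ w l → N (B w ∷ E w K′ ++ l) ≤ c4 K′ * n
      low-end w l = ≤-trans (≤-reflexive (lowpass-eq w K′ l)) (*-monoˡ-≤-nonNeg (c4 K′) {{nonNegative (c4-Nn K′)}} (≤-trans (mono (B (pw K′ w)) l) (subst (λ z → N z ≤ N []) (++-identityʳ l) (mono++ l []))))
      b₁ : NB q g e₁ ≤ c4 K′ * n
      b₁ = ≤-trans (perm≤ (prep (B e₁) (swap++ (E e₂ K′) (E e₁ K′) []))) (low-end e₁ (E e₂ K′ ++ []))
      b₂ : NB q g e₂ ≤ c4 K′ * n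
      b₂ = low-end e₂ (E e₁ K′ ++ [])

-- Integer 3 × 3 matrices with bounded entries.

module Matrices where

  open import Data.Nat as ℕ using (ℕ)
  import Data.Nat.Properties as ℕₚ
  open import Data.Integer using (ℤ; +_; -_; _+_; _*_; _-_; ∣_∣)
  import Data.Integer.Properties as ℤₚ
  open import Data.Integer.Tactic.RingSolver using (solve-∀)
  open import Relation.Binary.PropositionalEquality

  record V3 : Set where
    constructor v3
    field
      x y z : ℤ
  open V3 public

  infix 8 _·_
  _·_ : V3 → V3 → ℤ
  a · b = x a * x b + y a * y b + z a * z b

  record M3 : Set where
    constructor m3
    field
      r₁ r₂ r₃ : V3
  open M3 public

  det : M3 → ℤ
  det (m3 (v3 a b c) (v3 d e f) (v3 g h i)) = a * (e * i - f * h) - b * (d * i - f * g) + c * (d * h - e * g)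

  apply : M3 → V3 → V3
  apply m v = v3 (r₁ m · v) (r₂ m · v) (r₃ m · v)

  rowMul : V3 → M3 → V3
  rowMul (v3 a b c) (m3 (v3 d e f) (v3 g h i) (v3 j k l)) = v3 (a * d + b * g + c * j) (a * e + b * h + c * k) (a * f + b * i + c * l)

  mul : M3 → M3 → M3
  mul m n = m3 (rowMul (r₁ m) n) (rowMul (r₂ m) n) (rowMul (r₃ m) n)

  I₃ : M3
  I₃ = m3 (v3 (+ 1) (+ 0) (+ 0)) (v3 (+ 0) (+ 1) (+ 0)) (v3 (+ 0) (+ 0) (+ 1))

  V3-≡ : ∀ {a b c d e f} → a ≡ d → b ≡ e → c ≡ f → v3 a b c ≡ v3 d e f
  V3-≡ refl refl refl = refl

  rowMul-· : ∀ r m v → rowMul r m · v ≡ r · apply m v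
  rowMul-· (v3 a b c) (m3 (v3 d e f) (v3 g h i) (v3 j k l)) (v3 u v w) = lem a b c d e f g h i j k l u v w
    where
    lem : ∀ a b c d e f g h i j k l u v w → (a * d + b * g + c * j) * u + (a * e + b * h + c * k) * v + (a * f + b * i + c * l) * w
      ≡ a * (d * u + e * v + f * w) + b * (g * u + h * v + i * w) + c * (j * u + k * v + l * w)
    lem = solve-∀

  apply-mul : ∀ m n v → apply (mul m n) v ≡ apply m (apply n v)
  apply-mul m n v = V3-≡ (rowMul-· (r₁ m) n v) (rowMul-· (r₂ m) n v) (rowMul-· (r₃ m) n v)

  apply-I : ∀ v → apply I₃ v ≡ v
  apply-I (v3 a b c) = V3-≡ (l₁ a b c) (l₂ a b c) (l₃ a b c)
    where
    l₁ : ∀ a b c → + 1 * a + + 0 * b + + 0 * c ≡ a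
    l₁ = solve-∀
    l₂ : ∀ a b c → + 0 * a + + 1 * b + + 0 * c ≡ b
    l₂ = solve-∀
    l₃ : ∀ a b c → + 0 * a + + 0 * b + + 1 * c ≡ c
    l₃ = solve-∀

  det-mul : ∀ m n → det (mul m n) ≡ det m * det n
  det-mul (m3 (v3 a b c) (v3 d e f) (v3 g h i)) (m3 (v3 A B C) (v3 D E F) (v3 G H I)) = lem a b c d e f g h i A B C D E F G H I
    where
    lem : ∀ a b c d e f g h i A B C D E F G H I →
      (a * A + b * D + c * G) * ((d * B + e * E + f * H) * (g * C + h * F + i * I) - (d * C + e * F + f * I) * (g * B + h * E + i * H))
      - (a * B + b * E + c * H) * ((d * A + e * D + f * G) * (g * C + h * F + i * I) - (d * C + e * F + f * I) * (g * A + h * D + i * G))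
      + (a * C + b * F + c * I) * ((d * A + e * D + f * G) * (g * B + h * E + i * H) - (d * B + e * E + f * H) * (g * A + h * D + i * G))
      ≡ (a * (e * i - f * h) - b * (d * i - f * g) + c * (d * h - e * g)) * (A * (E * I - F * H) - B * (D * I - F * G) + C * (D * H - E * G))
    lem = solve-∀

  record VBound (B : ℕ) (v : V3) : Set where
    constructor vb
    field
      bx : ∣ x v ∣ ℕ.≤ B
      by : ∣ y v ∣ ℕ.≤ B
      bz : ∣ z v ∣ ℕ.≤ B

  record MBound (B : ℕ) (m : M3) : Set where
    constructor mb
    field
      b₁ : VBound B (r₁ m)
      b₂ : VBound B (r₂ m)
      b₃ : VBound B (r₃ m)

  ∣sum₃∣ : ∀ {B C} a b c d e f → ∣ a ∣ ℕ.≤ B → ∣ b ∣ ℕ.≤ B → ∣ c ∣ ℕ.≤ B → ∣ d ∣ ℕ.≤ C → ∣ e ∣ ℕ.≤ C → ∣ f ∣ ℕ.≤ C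
    → ∣ a * d + b * e + c * f ∣ ℕ.≤ 3 ℕ.* (B ℕ.* C)
  ∣sum₃∣ {B} {C} a b c d e f ha hb hc hd he hf = ℕₚ.≤-trans (ℤₚ.∣i+j∣≤∣i∣+∣j∣ (a * d + b * e) (c * f))
    (ℕₚ.≤-trans (ℕₚ.+-mono-≤ (ℕₚ.≤-trans (ℤₚ.∣i+j∣≤∣i∣+∣j∣ (a * d) (b * e)) (ℕₚ.+-mono-≤ (m a d ha hd) (m b e hb he))) (m c f hc hf))
     (ℕₚ.≤-reflexive (trans (ℕₚ.+-assoc (B ℕ.* C) (B ℕ.* C) (B ℕ.* C)) (cong (λ t → B ℕ.* C ℕ.+ (B ℕ.* C ℕ.+ t)) (sym (ℕₚ.+-identityʳ (B ℕ.* C)))))))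
    where
    m : ∀ a d → ∣ a ∣ ℕ.≤ B → ∣ d ∣ ℕ.≤ C → ∣ a * d ∣ ℕ.≤ B ℕ.* C
    m a d p q = subst (ℕ._≤ B ℕ.* C) (sym (ℤₚ.∣i*j∣≡∣i∣*∣j∣ a d)) (ℕₚ.*-mono-≤ p q)

  mul-bound : ∀ {B C m n} → MBound B m → MBound C n → MBound (3 ℕ.* (B ℕ.* C)) (mul m n)
  mul-bound {B} {C} {m} {n} (mb p₁ p₂ p₃) (mb (vb q₁ q₂ q₃) (vb q₄ q₅ q₆) (vb q₇ q₈ q₉)) = mb (row p₁) (row p₂) (row p₃)
    where
    row : ∀ {r} → VBound B r → VBound (3 ℕ.* (B ℕ.* C)) (rowMul r n)
    row {r} (vb h₁ h₂ h₃) = vb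
      (∣sum₃∣ (x r) (y r) (z r) (x (r₁ n)) (x (r₂ n)) (x (r₃ n)) h₁ h₂ h₃ q₁ q₄ q₇)
      (∣sum₃∣ (x r) (y r) (z r) (y (r₁ n)) (y (r₂ n)) (y (r₃ n)) h₁ h₂ h₃ q₂ q₅ q₈)
      (∣sum₃∣ (x r) (y r) (z r) (z (r₁ n)) (z (r₂ n)) (z (r₃ n)) h₁ h₂ h₃ q₃ q₆ q₉)

  MBound-weaken : ∀ {B C m} → B ℕ.≤ C → MBound B m → MBound C m
  MBound-weaken h (mb (vb q₁ q₂ q₃) (vb q₄ q₅ q₆) (vb q₇ q₈ q₉)) = mb (vb (w q₁) (w q₂) (w q₃)) (vb (w q₄) (w q₅) (w q₆)) (vb (w q₇) (w q₈) (w q₉))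
    where
    w : ∀ {a} → a ℕ.≤ _ → a ℕ.≤ _
    w p = ℕₚ.≤-trans p h

-- Growth of a set under one generator.

module SetGrowth where

  open import Data.Nat as ℕ using (ℕ; zero; suc)
  import Data.Nat.Properties as ℕₚ
  open import Data.Integer as ℤ using (ℤ)
  import Data.Integer.Properties as ℤₚ
  import Data.Integer.Tactic.RingSolver as ℤR
  open import Data.Rational
  open import Data.Rational.Properties
  open import Data.Rational.Solver
  open +-*-Solver using (solve; _:=_; _:+_; _:*_; _:-_; :-_; con)
  open import Data.Bool using (Bool; true; false; _∨_)
  open import Data.Sum using (_⊎_; inj₁; inj₂; map₂)
  open import Relation.Nullary using (Dec; yes; no; recompute)
  open import Relation.Binary.PropositionalEquality hiding (J)
  open import Data.Product using (Σ; _×_; _,_; proj₁; proj₂)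
  open RationalSums
  open ShiftEnergies using (W; pw)
  open PeriodicFunctions
  open Poincaré using (Mean0; vol; S₂-const; e₁; e₂; 2ℚ)
  open SpectralGap
  open Matrices
  open Periodic

  ι : Bool → ℚ
  ι true = 1ℚ
  ι false = 0ℚ

  Region : Set
  Region = ℤ → ℤ → Bool

  record PeriodicSet (q : ℕ) (χ : Region) : Set where
    field
      pset₁ : ∀ x y → χ (x ℤ.+ ℤ.+ q) y ≡ χ x y
      pset₂ : ∀ x y → χ x (y ℤ.+ ℤ.+ q) ≡ χ x y
  open PeriodicSet

  -- The equations hold over ℤ, before any reduction modulo q. Both directions carry the same bound
  -- because a source will be moved by `fwd`, whereas a target has to be reached, by `bwd`.
  record Move (B : ℕ) (p p′ : ℤ × ℤ) : Set where
    field
      fwd bwd : M3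
      det-fwd : det fwd ≡ ℤ.+ 1
      det-bwd : det bwd ≡ ℤ.+ 1
      fwd-bound : MBound B fwd
      bwd-bound : MBound B bwd
      fwd-eq : apply fwd (v3 (ℤ.+ 1) (proj₁ p) (proj₂ p)) ≡ v3 (ℤ.+ 1) (proj₁ p′) (proj₂ p′)
      bwd-eq : apply bwd (v3 (ℤ.+ 1) (proj₁ p′) (proj₂ p′)) ≡ v3 (ℤ.+ 1) (proj₁ p) (proj₂ p)

  data Gen : Set where
    xs ys : (n : ℕ) → .(n ℕ.≤ 128) → Gen
    tr : (w : W) → .(ℤ.∣ proj₁ w ∣ ℕ.≤ 128) → .(ℤ.∣ proj₂ w ∣ ℕ.≤ 128) → Gen

  act : Gen → ℤ → ℤ → ℤ × ℤ
  act (xs n _) x y = x ℤ.+ ℤ.+ n ℤ.* y , y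
  act (ys n _) x y = x , y ℤ.+ ℤ.+ n ℤ.* x
  act (tr w _ _) x y = x ℤ.+ proj₁ w , y ℤ.+ proj₂ w

  ≤128 : ∀ {n} → .(n ℕ.≤ 128) → n ℕ.≤ 128
  ≤128 {n} h = recompute (n ℕₚ.≤? 128) h

  ∣-∣≤ : ∀ {a} → ℤ.∣ a ∣ ℕ.≤ 128 → ℤ.∣ ℤ.- a ∣ ℕ.≤ 128
  ∣-∣≤ {a} h = subst (ℕ._≤ 128) (sym (ℤₚ.∣-i∣≡∣i∣ a)) h

  gen-move : ∀ g x y → Move 128 (x , y) (act g x y)
  gen-move (xs n h) x y = record
    { fwd = M (ℤ.+ n) ; bwd = M (ℤ.- (ℤ.+ n)) ; det-fwd = d (ℤ.+ n) ; det-bwd = d (ℤ.- (ℤ.+ n)) ; fwd-bound = b (≤128 h) ; bwd-bound = b (∣-∣≤ {ℤ.+ n} (≤128 h))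
    ; fwd-eq = V3-≡ (l₁ x y) (l₂ x y (ℤ.+ n)) (l₃ x y) ; bwd-eq = V3-≡ (l₁ (x ℤ.+ ℤ.+ n ℤ.* y) y) (l₄ x y (ℤ.+ n)) (l₃ (x ℤ.+ ℤ.+ n ℤ.* y) y) }
    where
    M : ℤ → M3
    M n = m3 (v3 (ℤ.+ 1) (ℤ.+ 0) (ℤ.+ 0)) (v3 (ℤ.+ 0) (ℤ.+ 1) n) (v3 (ℤ.+ 0) (ℤ.+ 0) (ℤ.+ 1))
    d : ∀ n → det (M n) ≡ ℤ.+ 1
    d n = lem n
      where
      lem : ∀ n → ℤ.+ 1 ℤ.* (ℤ.+ 1 ℤ.* ℤ.+ 1 ℤ.- n ℤ.* ℤ.+ 0) ℤ.- ℤ.+ 0 ℤ.* (ℤ.+ 0 ℤ.* ℤ.+ 1 ℤ.- n ℤ.* ℤ.+ 0) ℤ.+ ℤ.+ 0 ℤ.* (ℤ.+ 0 ℤ.* ℤ.+ 0 ℤ.- ℤ.+ 1 ℤ.* ℤ.+ 0) ≡ ℤ.+ 1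
      lem = ℤR.solve-∀
    b : ∀ {n} → ℤ.∣ n ∣ ℕ.≤ 128 → MBound 128 (M n)
    b h = mb (vb (ℕ.s≤s ℕ.z≤n) ℕ.z≤n ℕ.z≤n) (vb ℕ.z≤n (ℕ.s≤s ℕ.z≤n) h) (vb ℕ.z≤n ℕ.z≤n (ℕ.s≤s ℕ.z≤n))
    l₁ : ∀ x y → ℤ.+ 1 ℤ.* ℤ.+ 1 ℤ.+ ℤ.+ 0 ℤ.* x ℤ.+ ℤ.+ 0 ℤ.* y ≡ ℤ.+ 1
    l₁ = ℤR.solve-∀
    l₂ : ∀ x y n → ℤ.+ 0 ℤ.* ℤ.+ 1 ℤ.+ ℤ.+ 1 ℤ.* x ℤ.+ n ℤ.* y ≡ x ℤ.+ n ℤ.* y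
    l₂ = ℤR.solve-∀
    l₃ : ∀ x y → ℤ.+ 0 ℤ.* ℤ.+ 1 ℤ.+ ℤ.+ 0 ℤ.* x ℤ.+ ℤ.+ 1 ℤ.* y ≡ y
    l₃ = ℤR.solve-∀
    l₄ : ∀ x y n → ℤ.+ 0 ℤ.* ℤ.+ 1 ℤ.+ ℤ.+ 1 ℤ.* (x ℤ.+ n ℤ.* y) ℤ.+ (ℤ.- n) ℤ.* y ≡ x
    l₄ = ℤR.solve-∀
  gen-move (ys n h) x y = record
    { fwd = M (ℤ.+ n) ; bwd = M (ℤ.- (ℤ.+ n)) ; det-fwd = d (ℤ.+ n) ; det-bwd = d (ℤ.- (ℤ.+ n)) ; fwd-bound = b (≤128 h) ; bwd-bound = b (∣-∣≤ {ℤ.+ n} (≤128 h))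
    ; fwd-eq = V3-≡ (l₁ x y) (l₃ x y) (l₂ x y (ℤ.+ n)) ; bwd-eq = V3-≡ (l₁ x (y ℤ.+ ℤ.+ n ℤ.* x)) (l₃ x (y ℤ.+ ℤ.+ n ℤ.* x)) (l₄ x y (ℤ.+ n)) }
    where
    M : ℤ → M3
    M n = m3 (v3 (ℤ.+ 1) (ℤ.+ 0) (ℤ.+ 0)) (v3 (ℤ.+ 0) (ℤ.+ 1) (ℤ.+ 0)) (v3 (ℤ.+ 0) n (ℤ.+ 1))
    d : ∀ n → det (M n) ≡ ℤ.+ 1
    d n = lem n
      where
      lem : ∀ n → ℤ.+ 1 ℤ.* (ℤ.+ 1 ℤ.* ℤ.+ 1 ℤ.- ℤ.+ 0 ℤ.* n) ℤ.- ℤ.+ 0 ℤ.* (ℤ.+ 0 ℤ.* ℤ.+ 1 ℤ.- ℤ.+ 0 ℤ.* ℤ.+ 0) ℤ.+ ℤ.+ 0 ℤ.* (ℤ.+ 0 ℤ.* n ℤ.- ℤ.+ 1 ℤ.* ℤ.+ 0) ≡ ℤ.+ 1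
      lem = ℤR.solve-∀
    b : ∀ {n} → ℤ.∣ n ∣ ℕ.≤ 128 → MBound 128 (M n)
    b h = mb (vb (ℕ.s≤s ℕ.z≤n) ℕ.z≤n ℕ.z≤n) (vb ℕ.z≤n (ℕ.s≤s ℕ.z≤n) ℕ.z≤n) (vb ℕ.z≤n h (ℕ.s≤s ℕ.z≤n))
    l₁ : ∀ x y → ℤ.+ 1 ℤ.* ℤ.+ 1 ℤ.+ ℤ.+ 0 ℤ.* x ℤ.+ ℤ.+ 0 ℤ.* y ≡ ℤ.+ 1
    l₁ = ℤR.solve-∀
    l₂ : ∀ x y n → ℤ.+ 0 ℤ.* ℤ.+ 1 ℤ.+ n ℤ.* x ℤ.+ ℤ.+ 1 ℤ.* y ≡ y ℤ.+ n ℤ.* x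
    l₂ = ℤR.solve-∀
    l₃ : ∀ x y → ℤ.+ 0 ℤ.* ℤ.+ 1 ℤ.+ ℤ.+ 1 ℤ.* x ℤ.+ ℤ.+ 0 ℤ.* y ≡ x
    l₃ = ℤR.solve-∀
    l₄ : ∀ x y n → ℤ.+ 0 ℤ.* ℤ.+ 1 ℤ.+ (ℤ.- n) ℤ.* x ℤ.+ ℤ.+ 1 ℤ.* (y ℤ.+ n ℤ.* x) ≡ y
    l₄ = ℤR.solve-∀
  gen-move (tr (a , c) h k) x y = record
    { fwd = M a c ; bwd = M (ℤ.- a) (ℤ.- c) ; det-fwd = d a c ; det-bwd = d (ℤ.- a) (ℤ.- c)
    ; fwd-bound = b (≤128 h) (≤128 k) ; bwd-bound = b (∣-∣≤ {a} (≤128 h)) (∣-∣≤ {c} (≤128 k))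
    ; fwd-eq = V3-≡ (l₁ x y) (l₂ x y a) (l₃ x y c) ; bwd-eq = V3-≡ (l₁ (x ℤ.+ a) (y ℤ.+ c)) (l₄ x y a c) (l₅ x y a c) }
    where
    M : ℤ → ℤ → M3
    M a c = m3 (v3 (ℤ.+ 1) (ℤ.+ 0) (ℤ.+ 0)) (v3 a (ℤ.+ 1) (ℤ.+ 0)) (v3 c (ℤ.+ 0) (ℤ.+ 1))
    d : ∀ a c → det (M a c) ≡ ℤ.+ 1
    d a c = lem a c
      where
      lem : ∀ a c → ℤ.+ 1 ℤ.* (ℤ.+ 1 ℤ.* ℤ.+ 1 ℤ.- ℤ.+ 0 ℤ.* ℤ.+ 0) ℤ.- ℤ.+ 0 ℤ.* (a ℤ.* ℤ.+ 1 ℤ.- ℤ.+ 0 ℤ.* c) ℤ.+ ℤ.+ 0 ℤ.* (a ℤ.* ℤ.+ 0 ℤ.- ℤ.+ 1 ℤ.* c) ≡ ℤ.+ 1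
      lem = ℤR.solve-∀
    b : ∀ {a c} → ℤ.∣ a ∣ ℕ.≤ 128 → ℤ.∣ c ∣ ℕ.≤ 128 → MBound 128 (M a c)
    b h k = mb (vb (ℕ.s≤s ℕ.z≤n) ℕ.z≤n ℕ.z≤n) (vb h (ℕ.s≤s ℕ.z≤n) ℕ.z≤n) (vb k ℕ.z≤n (ℕ.s≤s ℕ.z≤n))
    l₁ : ∀ x y → ℤ.+ 1 ℤ.* ℤ.+ 1 ℤ.+ ℤ.+ 0 ℤ.* x ℤ.+ ℤ.+ 0 ℤ.* y ≡ ℤ.+ 1
    l₁ = ℤR.solve-∀
    l₂ : ∀ x y n → n ℤ.* ℤ.+ 1 ℤ.+ ℤ.+ 1 ℤ.* x ℤ.+ ℤ.+ 0 ℤ.* y ≡ x ℤ.+ n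
    l₂ = ℤR.solve-∀
    l₃ : ∀ x y n → n ℤ.* ℤ.+ 1 ℤ.+ ℤ.+ 0 ℤ.* x ℤ.+ ℤ.+ 1 ℤ.* y ≡ y ℤ.+ n
    l₃ = ℤR.solve-∀
    l₄ : ∀ x y a c → (ℤ.- a) ℤ.* ℤ.+ 1 ℤ.+ ℤ.+ 1 ℤ.* (x ℤ.+ a) ℤ.+ ℤ.+ 0 ℤ.* (y ℤ.+ c) ≡ x
    l₄ = ℤR.solve-∀
    l₅ : ∀ x y a c → (ℤ.- c) ℤ.* ℤ.+ 1 ℤ.+ ℤ.+ 0 ℤ.* (x ℤ.+ a) ℤ.+ ℤ.+ 1 ℤ.* (y ℤ.+ c) ≡ y
    l₅ = ℤR.solve-∀

  id-move : ∀ p → Move 1 p p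
  id-move p = record { fwd = I₃ ; bwd = I₃ ; det-fwd = refl ; det-bwd = refl ; fwd-bound = b ; bwd-bound = b ; fwd-eq = apply-I _ ; bwd-eq = apply-I _ }
    where
    1≤ = ℕ.s≤s ℕ.z≤n
    b : MBound 1 I₃
    b = mb (vb 1≤ ℕ.z≤n ℕ.z≤n) (vb ℕ.z≤n 1≤ ℕ.z≤n) (vb ℕ.z≤n ℕ.z≤n 1≤)

  _then_ : ∀ {B C p p′ p″} → Move B p p′ → Move C p′ p″ → Move (3 ℕ.* (B ℕ.* C)) p p″
  _then_ {B} {C} m n = record
    { fwd = mul (fwd n) (fwd m) ; bwd = mul (bwd m) (bwd n)
    ; det-fwd = trans (det-mul (fwd n) (fwd m)) (cong₂ ℤ._*_ (det-fwd n) (det-fwd m))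
    ; det-bwd = trans (det-mul (bwd m) (bwd n)) (cong₂ ℤ._*_ (det-bwd m) (det-bwd n))
    ; fwd-bound = subst (λ k → MBound (3 ℕ.* k) (mul (fwd n) (fwd m))) (ℕₚ.*-comm C B) (mul-bound (fwd-bound n) (fwd-bound m))
    ; bwd-bound = mul-bound (bwd-bound m) (bwd-bound n)
    ; fwd-eq = trans (apply-mul (fwd n) (fwd m) _) (trans (cong (apply (fwd n)) (fwd-eq m)) (fwd-eq n))
    ; bwd-eq = trans (apply-mul (bwd m) (bwd n) _) (trans (cong (apply (bwd m)) (bwd-eq n)) (bwd-eq m)) }
    where open Move

  Move-weaken : ∀ {B C p p′} → B ℕ.≤ C → Move B p p′ → Move C p p′
  Move-weaken h m = record { Move m using (fwd; bwd; det-fwd; det-bwd; fwd-eq; bwd-eq) ; fwd-bound = MBound-weaken h (Move.fwd-bound m) ; bwd-bound = MBound-weaken h (Move.bwd-bound m) }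

  module _ (q : ℕ) where

    ιχ : Region → Fn
    ιχ χ x y = ι (χ x y)

    card : Region → ℚ
    card χ = S₂ q (ιχ χ)

    _∘act_ : ∀ {A : Set} → (ℤ → ℤ → A) → Gen → ℤ → ℤ → A
    (f ∘act g) x y = f (proj₁ (act g x y)) (proj₂ (act g x y))

    ι-per : ∀ {χ} → PeriodicSet q χ → Periodic q (ιχ χ)
    ι-per p = record { per₁ = λ x y → cong ι (pset₁ p x y) ; per₂ = λ x y → cong ι (pset₂ p x y) }

    S₂-act : ∀ g {f} → Periodic q f → S₂ q (f ∘act g) ≡ S₂ q f
    S₂-act (xs n _) p = S₂-shear q p (λ y → ℤ.+ n ℤ.* y)
    S₂-act (ys n h) {f} p = trans (sym (S₂-transpose q (f ∘act ys n h))) (trans (S₂-shear q (transpose-per q p) (λ y → ℤ.+ n ℤ.* y)) (S₂-transpose q f))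
    S₂-act (tr w _ _) p = S₂-shift q p (proj₁ w) (proj₂ w)

    act-per : ∀ g {χ} → PeriodicSet q χ → PeriodicSet q (χ ∘act g)
    act-per (xs n _) {χ} p = record
      { pset₁ = λ x y → trans (cong (λ z → χ z y) (l₁ x (ℤ.+ q) (ℤ.+ n ℤ.* y))) (pset₁ p _ y)
      ; pset₂ = λ x y → trans (pset₂ p _ y) (trans (cong (λ z → χ z y) (l₂ x y (ℤ.+ n) (ℤ.+ q))) (shift-multiple q (λ x → pset₁ p x y) (ℤ.+ n) (x ℤ.+ ℤ.+ n ℤ.* y))) }
      where
      l₁ : ∀ x q a → x ℤ.+ q ℤ.+ a ≡ x ℤ.+ a ℤ.+ q
      l₁ = ℤR.solve-∀
      l₂ : ∀ x y n q → x ℤ.+ n ℤ.* (y ℤ.+ q) ≡ x ℤ.+ n ℤ.* y ℤ.+ n ℤ.* q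
      l₂ = ℤR.solve-∀
    act-per (ys n _) {χ} p = record
      { pset₁ = λ x y → trans (pset₁ p x _) (trans (cong (χ x) (l₂ y x (ℤ.+ n) (ℤ.+ q))) (shift-multiple q (pset₂ p x) (ℤ.+ n) (y ℤ.+ ℤ.+ n ℤ.* x)))
      ; pset₂ = λ x y → trans (cong (χ x) (l₁ y (ℤ.+ q) (ℤ.+ n ℤ.* x))) (pset₂ p x _) }
      where
      l₁ : ∀ x q a → x ℤ.+ q ℤ.+ a ≡ x ℤ.+ a ℤ.+ q
      l₁ = ℤR.solve-∀
      l₂ : ∀ x y n q → x ℤ.+ n ℤ.* (y ℤ.+ q) ≡ x ℤ.+ n ℤ.* y ℤ.+ n ℤ.* q
      l₂ = ℤR.solve-∀
    act-per (tr (a , c) _ _) {χ} p = record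
      { pset₁ = λ x y → trans (cong (λ z → χ z (y ℤ.+ c)) (l₁ x (ℤ.+ q) a)) (pset₁ p _ _)
      ; pset₂ = λ x y → trans (cong (χ (x ℤ.+ a)) (l₁ y (ℤ.+ q) c)) (pset₂ p _ _) }
      where
      l₁ : ∀ x q a → x ℤ.+ q ℤ.+ a ≡ x ℤ.+ a ℤ.+ q
      l₁ = ℤR.solve-∀

    _∪_ : Region → Region → Region
    (χ ∪ ψ) x y = χ x y ∨ ψ x y

    ∪-per : ∀ {χ ψ} → PeriodicSet q χ → PeriodicSet q ψ → PeriodicSet q (χ ∪ ψ)
    ∪-per p r = record { pset₁ = λ x y → cong₂ _∨_ (pset₁ p x y) (pset₁ r x y) ; pset₂ = λ x y → cong₂ _∨_ (pset₂ p x y) (pset₂ r x y) }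

    card-mono-∪ : ∀ χ ψ → card χ ≤ card (χ ∪ ψ)
    card-mono-∪ χ ψ = S₂-mono q (λ x y → lem (χ x y) (ψ x y))
      where
      lem : ∀ a b → ι a ≤ ι (a ∨ b)
      lem true b = ≤-refl
      lem false true = nonNegative⁻¹ 1ℚ
      lem false false = ≤-refl

    -- The squared distance of indicators is the size of the symmetric difference, 2 |A ∪ B| - |A| -
    -- |B|. This turns a lower bound for displacement into growth of the union.
    sym-diff : ∀ χ ψ → card χ ≡ card ψ → D q (ιχ χ) (ιχ ψ) ≡ 2ℚ * (card (χ ∪ ψ) - card χ)
    sym-diff χ ψ h = begin
      D q (ιχ χ) (ιχ ψ) ≡⟨ S₂-cong q (λ x y → lem (χ x y) (ψ x y)) ⟩
      S₂ q (λ x y → 2ℚ * ιχ (χ ∪ ψ) x y + - 1ℚ * (ιχ χ x y + ιχ ψ x y))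
        ≡⟨ trans (S₂-+ q (λ x y → 2ℚ * ιχ (χ ∪ ψ) x y) (λ x y → - 1ℚ * (ιχ χ x y + ιχ ψ x y))) (cong₂ _+_ (S₂-* q 2ℚ (ιχ (χ ∪ ψ))) (trans (S₂-* q (- 1ℚ) (λ x y → ιχ χ x y + ιχ ψ x y)) (cong (- 1ℚ *_) (S₂-+ q (ιχ χ) (ιχ ψ))))) ⟩
      2ℚ * card (χ ∪ ψ) + - 1ℚ * (card χ + card ψ) ≡⟨ cong (λ z → 2ℚ * card (χ ∪ ψ) + - 1ℚ * (card χ + z)) (sym h) ⟩
      2ℚ * card (χ ∪ ψ) + - 1ℚ * (card χ + card χ) ≡⟨ solve 2 (λ u n → con 2ℚ :* u :+ con (- 1ℚ) :* (n :+ n) := con 2ℚ :* (u :- n)) refl (card (χ ∪ ψ)) (card χ) ⟩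
      2ℚ * (card (χ ∪ ψ) - card χ) ∎
      where
      open ≡-Reasoning
      lem : ∀ a b → (ι a - ι b) * (ι a - ι b) ≡ 2ℚ * ι (a ∨ b) + - 1ℚ * (ι a + ι b)
      lem true true = refl
      lem true false = refl
      lem false true = refl
      lem false false = refl

    small-step : ∀ j → j ℕ.< 7 → ∀ w → ℤ.∣ proj₁ w ∣ ℕ.≤ 1 → ℤ.∣ proj₂ w ∣ ℕ.≤ 1 → (ℤ.∣ proj₁ (pw j w) ∣ ℕ.≤ 128) × (ℤ.∣ proj₂ (pw j w) ∣ ℕ.≤ 128)
    small-step j j<7 w h k = ℕₚ.≤-trans (proj₁ (go j)) (pow j<7) , ℕₚ.≤-trans (proj₂ (go j)) (pow j<7)
      where
      pow : ∀ {j} → j ℕ.< 7 → 2 ℕ.^ j ℕ.≤ 128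
      pow {j} h = ℕₚ.^-monoʳ-≤ 2 {j} {7} (ℕₚ.<⇒≤ h)
      twice : ∀ a j → ℤ.∣ a ∣ ℕ.≤ 2 ℕ.^ j → ℤ.∣ a ℤ.+ a ∣ ℕ.≤ 2 ℕ.^ suc j
      twice a j h = ℕₚ.≤-trans (ℤₚ.∣i+j∣≤∣i∣+∣j∣ a a) (ℕₚ.+-mono-≤ h (ℕₚ.≤-trans h (ℕₚ.≤-reflexive (sym (ℕₚ.+-identityʳ (2 ℕ.^ j))))))
      go : ∀ j → (ℤ.∣ proj₁ (pw j w) ∣ ℕ.≤ 2 ℕ.^ j) × (ℤ.∣ proj₂ (pw j w) ∣ ℕ.≤ 2 ℕ.^ j)
      go zero = h , k
      go (suc j) = twice (proj₁ (pw j w)) j (proj₁ (go j)) , twice (proj₂ (pw j w)) j (proj₂ (go j))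

    search : ∀ (F : ℕ → ℚ) c n → (Σ ℕ λ j → (j ℕ.< n) × c < F j) ⊎ (∀ j → j ℕ.< n → F j ≤ c)
    search F c zero = inj₂ (λ _ ())
    search F c (suc n) with c <? F n | search F c n
    ... | yes p | _ = inj₁ (n , ℕₚ.≤-refl , p)
    ... | no _ | inj₁ (j , j<n , r) = inj₁ (j , ℕₚ.m<n⇒m<1+n j<n , r)
    ... | no p | inj₂ a = inj₂ all
      where
      all : ∀ j → j ℕ.< suc n → F j ≤ c
      all j j<1+n with ℕₚ.m<1+n⇒m<n∨m≡n j<1+n
      ... | inj₁ j<n = a j j<n
      ... | inj₂ refl = ≮⇒≥ p

    private
      64≤ : 64 ℕ.≤ 128
      64≤ = ℕₚ.m≤m+n 64 64

    xs-moves : ∀ f c n .(h : n ℕ.≤ 128) → c < D q f (xshear q (ℤ.+ n) f) → Σ Gen λ g → c < D q f (f ∘act g)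
    xs-moves f c n h r = xs n h , r

    ys-moves : ∀ f c n .(h : n ℕ.≤ 128) → c < D q f (yshear q (ℤ.+ n) f) → Σ Gen λ g → c < D q f (f ∘act g)
    ys-moves f c n h r = ys n h , r

    tr-moves : ∀ f c w j → j ℕ.< 7 → ℤ.∣ proj₁ w ∣ ℕ.≤ 1 → ℤ.∣ proj₂ w ∣ ℕ.≤ 1 → c < D q f (shifted q (pw j w) f) → Σ Gen λ g → c < D q f (f ∘act g)
    tr-moves f c w j j<7 h k r = tr (pw j w) (proj₁ b) (proj₂ b) , r
      where b = small-step j j<7 w h k

    -- Rational inequalities are decidable, so the finitely many conditions of `AlmostInvariant` are
    -- tested one by one and the first failure names the generator.
    moved-or-invariant : ∀ f → (Σ Gen λ g → η * Q q f < D q f (f ∘act g)) ⊎ AlmostInvariant q f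
    moved-or-invariant f = decide (c <? D q f (xshear q (ℤ.+ 64) f)) (c <? D q f (xshear q (ℤ.+ 128) f))
        (c <? D q f (yshear q (ℤ.+ 64) f)) (c <? D q f (yshear q (ℤ.+ 128) f))
        (search (λ j → D q f (shifted q (pw j e₁) f)) c 7) (search (λ j → D q f (shifted q (pw j e₂) f)) c 7)
      where
      c = η * Q q f
      Small : (ℕ → ℚ) → Set
      Small F = (Σ ℕ λ j → (j ℕ.< 7) × c < F j) ⊎ (∀ j → j ℕ.< 7 → F j ≤ c)
      decide : Dec (c < D q f (xshear q (ℤ.+ 64) f)) → Dec (c < D q f (xshear q (ℤ.+ 128) f))
        → Dec (c < D q f (yshear q (ℤ.+ 64) f)) → Dec (c < D q f (yshear q (ℤ.+ 128) f))
        → Small (λ j → D q f (shifted q (pw j e₁) f)) → Small (λ j → D q f (shifted q (pw j e₂) f))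
        → (Σ Gen λ g → c < D q f (f ∘act g)) ⊎ AlmostInvariant q f
      decide (yes r) _ _ _ _ _ = inj₁ (xs-moves f c 64 64≤ r)
      decide _ (yes r) _ _ _ _ = inj₁ (xs-moves f c 128 ℕₚ.≤-refl r)
      decide _ _ (yes r) _ _ _ = inj₁ (ys-moves f c 64 64≤ r)
      decide _ _ _ (yes r) _ _ = inj₁ (ys-moves f c 128 ℕₚ.≤-refl r)
      decide _ _ _ _ (inj₁ (j , j<7 , r)) _ = inj₁ (tr-moves f c e₁ j j<7 ℕₚ.≤-refl ℕ.z≤n r)
      decide _ _ _ _ _ (inj₁ (j , j<7 , r)) = inj₁ (tr-moves f c e₂ j j<7 ℕ.z≤n ℕₚ.≤-refl r)
      decide (no a) (no b) (no d) (no e) (inj₂ h) (inj₂ k) = inj₂ (record { xsh₁ = ≮⇒≥ a ; xsh₂ = ≮⇒≥ b ; ysh₁ = ≮⇒≥ d ; ysh₂ = ≮⇒≥ e ; xtr = h ; ytr = k })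

  mean-alg : ∀ V n → V * n + V * (- n) ≡ 0ℚ
  mean-alg = solve 2 (λ V n → V :* n :+ V :* (:- n) := con 0ℚ) refl

  energy-alg : ∀ V n → (V * V - 2ℚ * (V * n)) * n + V * (n * n) ≡ V * (n * (V - n))
  energy-alg = solve 2 (λ V n → (V :* V :- con 2ℚ :* (V :* n)) :* n :+ V :* (n :* n) := V :* (n :* (V :- n))) refl

  point-alg : ∀ V n b → (V * ι b - n) * (V * ι b - n) ≡ (V * V - 2ℚ * (V * n)) * ι b + n * n
  point-alg V n true = solve 2 (λ V n → (V :* con 1ℚ :- n) :* (V :* con 1ℚ :- n) := (V :* V :- con 2ℚ :* (V :* n)) :* con 1ℚ :+ n :* n) refl V n
  point-alg V n false = solve 2 (λ V n → (V :* con 0ℚ :- n) :* (V :* con 0ℚ :- n) := (V :* V :- con 2ℚ :* (V :* n)) :* con 0ℚ :+ n :* n) refl V n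

  diff-alg : ∀ V n a b → (V * a - n - (V * b - n)) * (V * a - n - (V * b - n)) ≡ V * V * ((a - b) * (a - b))
  diff-alg = solve 4 (λ V n a b → (V :* a :- n :- (V :* b :- n)) :* (V :* a :- n :- (V :* b :- n)) := V :* V :* ((a :- b) :* (a :- b))) refl

  -- The discrete logistic inequality n′ - n ≥ (η / 2) n (1 - n / V), cleared of denominators.
  record Grows (V n n′ : ℚ) : Set where
    constructor grows
    field growth : η * (n * (V - n)) ≤ 2ℚ * V * (n′ - n)

  cancel-growth : ∀ V {{_ : Positive V}} n n′ → η * (V * (n * (V - n))) < V * V * (2ℚ * (n′ - n)) → Grows V n n′
  cancel-growth V n n′ h = grows (*-cancelˡ-≤-pos V (subst₂ _≤_
    (solve 3 (λ e V c → e :* (V :* c) := V :* (e :* c)) refl η V (n * (V - n)))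
    (solve 2 (λ V d → V :* V :* (con 2ℚ :* d) := V :* (con 2ℚ :* V :* d)) refl V (n′ - n)) (<⇒≤ h)))

  trivial-growth : ∀ V {{_ : Positive V}} n n′ → V * (n * (V - n)) ≤ 0ℚ → n ≤ n′ → Grows V n n′
  trivial-growth V n n′ h k = grows (≤-trans (concl (nonNegative⁻¹ η ⊡ diff small) (solve 2 (λ e c → con 0ℚ :- e :* c := e :* (con 0ℚ :- c)) refl η (n * (V - n))))
    (nonNegative⁻¹ 2ℚ ⊡ <⇒≤ (positive⁻¹ V) ⊡ diff k))
    where
    small : n * (V - n) ≤ 0ℚ
    small = *-cancelˡ-≤-pos V (subst (V * (n * (V - n)) ≤_) (sym (*-zeroʳ V)) h)

  module _ (q : ℕ) {{vpos : Positive (vol q)}} (gap-q : ∀ {f} → Periodic q f → Mean0 q f → AlmostInvariant q f → Q q f ≤ 0ℚ) where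

    expanding-generator : ∀ {f} → Periodic q f → Mean0 q f → (Σ Gen λ g → η * Q q f < D q f (_∘act_ q f g)) ⊎ (Q q f ≤ 0ℚ)
    expanding-generator {f} p m = map₂ (gap-q p m) (moved-or-invariant q f)

    module Centred {χ : Region} (p : PeriodicSet q χ) where
      V n : ℚ
      V = vol q
      n = card q χ

      -- V times the centred indicator of the set. The scaling spares the division by V, and
      -- displacement and energy acquire the same factor V².
      f : Fn
      f x y = V * ι (χ x y) - n

      f-per : Periodic q f
      f-per = record { per₁ = λ x y → cong (λ b → V * ι b - n) (pset₁ p x y) ; per₂ = λ x y → cong (λ b → V * ι b - n) (pset₂ p x y) }

      mean0 : Mean0 q f
      mean0 = begin
        S₂ q f ≡⟨ S₂-+ q (λ x y → V * ιχ q χ x y) (λ _ _ → - n) ⟩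
        S₂ q (λ x y → V * ιχ q χ x y) + S₂ q (λ _ _ → - n) ≡⟨ cong₂ _+_ (S₂-* q V (ιχ q χ)) (S₂-const q (- n)) ⟩
        V * n + V * (- n) ≡⟨ mean-alg V n ⟩
        0ℚ ∎
        where open ≡-Reasoning

      Q-f : Q q f ≡ V * (n * (V - n))
      Q-f = begin
        Q q f ≡⟨ S₂-cong q (λ x y → point-alg V n (χ x y)) ⟩
        S₂ q (λ x y → c * ιχ q χ x y + n * n) ≡⟨ S₂-+ q (λ x y → c * ιχ q χ x y) (λ _ _ → n * n) ⟩
        S₂ q (λ x y → c * ιχ q χ x y) + S₂ q (λ _ _ → n * n) ≡⟨ cong₂ _+_ (S₂-* q c (ιχ q χ)) (S₂-const q (n * n)) ⟩
        c * n + V * (n * n) ≡⟨ energy-alg V n ⟩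
        V * (n * (V - n)) ∎
        where
        open ≡-Reasoning
        c = V * V - 2ℚ * (V * n)

      grown : Gen → ℚ
      grown g = card q (_∪_ q χ (_∘act_ q χ g))

      D-f : ∀ g → D q f (_∘act_ q f g) ≡ V * V * (2ℚ * (grown g - n))
      D-f g = trans (S₂-cong q (λ x y → diff-alg V n (ι (χ x y)) (ι (_∘act_ q χ g x y))))
        (trans (S₂-* q (V * V) (sq q (λ x y → ιχ q χ x y - ιχ q (_∘act_ q χ g) x y))) (cong (V * V *_) (sym-diff q χ (_∘act_ q χ g) (sym (S₂-act q g (ι-per q p))))))

      abstract
       grow-one : Σ Gen λ g → Grows V n (grown g)
       grow-one = pick (expanding-generator f-per mean0)
         where
         g₀ : Gen
         -- The identity. It is used when the gap gives energy at most zero, so n (V - n) ≤ 0 and no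
         -- growth is asked for.
         g₀ = xs 0 ℕ.z≤n
         pick : (Σ Gen λ g → η * Q q f < D q f (_∘act_ q f g)) ⊎ (Q q f ≤ 0ℚ) → Σ Gen λ g → Grows V n (grown g)
         pick (inj₁ (g , h)) = g , cancel-growth V n (grown g) (subst₂ (λ a b → η * a < b) Q-f (D-f g) h)
         pick (inj₂ h) = g₀ , trivial-growth V n (grown g₀) (subst (_≤ 0ℚ) Q-f h) (card-mono-∪ q χ (_∘act_ q χ g₀))

-- Logistic growth up to almost full density.

module Saturation where

  open import Data.Nat as ℕ using (ℕ; zero; suc)
  import Data.Nat.Properties as ℕₚ
  open import Data.Integer as ℤ using (ℤ)
  open import Data.Rational
  open import Data.Rational.Properties
  open import Data.Rational.Solver
  open +-*-Solver using (solve; _:=_; _:+_; _:*_; _:-_; :-_; con)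
  open import Data.Bool using (true; false; _∨_)
  open import Data.Sum using (_⊎_; inj₁; inj₂)
  open import Relation.Nullary using (Dec; yes; no)
  open import Relation.Binary.PropositionalEquality hiding (J)
  open import Data.Product using (Σ; _×_; _,_; proj₁; proj₂)
  open RationalSums
  open PeriodicFunctions
  open Poincaré using (Mean0; vol; 2ℚ)
  open SpectralGap
  open Matrices
  open SetGrowth

  T P2 : ℕ → ℚ
  T zero = 0ℚ
  T (suc t) = T t + 1ℚ
  P2 zero = 1ℚ
  P2 (suc k) = 2ℚ * P2 k

  P2-Nn : ∀ k → Nn (P2 k)
  P2-Nn zero = nonNegative⁻¹ 1ℚ
  P2-Nn (suc k) = nonNegative⁻¹ 2ℚ ⊡ P2-Nn k

  400ℚ 200ℚ : ℚ
  400ℚ = ℤ.+ 400 / 1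
  200ℚ = ℤ.+ 200 / 1

  T-+ : ∀ m n → T (m ℕ.+ n) ≡ T m + T n
  T-+ zero n = sym (+-identityˡ (T n))
  T-+ (suc m) n = trans (cong (_+ 1ℚ) (T-+ m n)) (solve 2 (λ a b → a :+ b :+ con 1ℚ := a :+ con 1ℚ :+ b) refl (T m) (T n))

  T-* : ∀ m n → T (m ℕ.* n) ≡ T m * T n
  T-* zero n = sym (*-zeroˡ (T n))
  T-* (suc m) n = trans (T-+ n (m ℕ.* n)) (trans (cong (λ z → T n + z) (T-* m n)) (solve 2 (λ a b → b :+ a :* b := (a :+ con 1ℚ) :* b) refl (T m) (T n)))

  -- phase: the logistic growth rate is η / 2 = 1 / 200, so 400 steps double a sparse set or halve the complement of
  -- a dense one.  stretchFactor: a generator has entries at most 128, and multiplying 3 × 3 matrices costs a factor 3.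
  abstract
    phase stretchFactor : ℕ
    phase = 400
    stretchFactor = 384

    T-phase : T phase ≡ 400ℚ
    T-phase = T-* 20 20

    stretchFactor-eq : ∀ k → 3 ℕ.* (128 ℕ.* k) ≡ stretchFactor ℕ.* k
    stretchFactor-eq k = sym (ℕₚ.*-assoc 3 128 k)

    stretchFactor-pos : ∀ k → k ℕ.≤ stretchFactor ℕ.* k
    stretchFactor-pos k = ℕₚ.m≤n*m k 384

  -- In the sparse range V - a ≥ V / 2, so each step adds at least the fraction η / 4 = 1/400 of the
  -- set.
  sparse-step : ∀ V {{_ : Positive V}} a a′ → Nn a → 2ℚ * a ≤ V → Grows V a a′ → a ≤ 400ℚ * (a′ - a)
  sparse-step V a a′ a≥0 h (grows g) = *-cancelˡ-≤-pos V (concl (nonNegative⁻¹ 200ℚ ⊡ diff g ⊞ a≥0 ⊡ diff h)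
    (solve 3 (λ V a b → V :* (con 400ℚ :* (b :- a)) :- V :* a := con 200ℚ :* (con 2ℚ :* V :* (b :- a) :- con η :* (a :* (V :- a))) :+ a :* (V :- con 2ℚ :* a)) refl V a a′))

  dense-step : ∀ V {{_ : Positive V}} a a′ → a ≤ V → V ≤ 2ℚ * a → Grows V a a′ → V - a ≤ 400ℚ * (a′ - a)
  dense-step V a a′ a≤V h (grows g) = *-cancelˡ-≤-pos V (concl (nonNegative⁻¹ 200ℚ ⊡ diff g ⊞ diff h ⊡ diff a≤V)
    (solve 3 (λ V a b → V :* (con 400ℚ :* (b :- a)) :- V :* (V :- a) := con 200ℚ :* (con 2ℚ :* V :* (b :- a) :- con η :* (a :* (V :- a))) :+ (con 2ℚ :* a :- V) :* (V :- a)) refl V a a′))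

  module Logistic (V : ℚ) {{_ : Positive V}} (a : ℕ → ℚ) (a≥0 : ∀ i → Nn (a i)) (a≤V : ∀ i → a i ≤ V)
    (incr : ∀ i → a i ≤ a (suc i)) (step : ∀ i → Grows V (a i) (a (suc i))) where

    monotone : ∀ t i → a i ≤ a (t ℕ.+ i)
    monotone zero i = ≤-refl
    monotone (suc t) i = ≤-trans (monotone t i) (incr (t ℕ.+ i))

    still-dense : ∀ t i → V ≤ 2ℚ * a i → V ≤ 2ℚ * a (t ℕ.+ i)
    still-dense t i h = ≤-trans h (*-monoˡ-≤-nonNeg 2ℚ (monotone t i))

    -- Linear growth from the starting value is enough: as long as density 1/2 is not reached, every
    -- step adds 1/400 of the later, larger set and hence of the set at time i.
    sparse-phase : ∀ t i → (V ≤ 2ℚ * a (t ℕ.+ i)) ⊎ (T t * a i ≤ 400ℚ * (a (t ℕ.+ i) - a i))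
    sparse-phase zero i = inj₂ (≤-reflexive (solve 1 (λ a → con 0ℚ :* a := con 400ℚ :* (a :- a)) refl (a i)))
    sparse-phase (suc t) i = go (V ≤? 2ℚ * a (t ℕ.+ i)) (sparse-phase t i)
      where
      j = t ℕ.+ i
      go : Dec (V ≤ 2ℚ * a j) → (V ≤ 2ℚ * a j) ⊎ (T t * a i ≤ 400ℚ * (a j - a i)) → (V ≤ 2ℚ * a (suc j)) ⊎ ((T t + 1ℚ) * a i ≤ 400ℚ * (a (suc j) - a i))
      go (yes h) _ = inj₁ (still-dense 1 j h)
      go (no _) (inj₁ h) = inj₁ (still-dense 1 j h)
      go (no h) (inj₂ ih) = inj₂ (concl (diff ih ⊞ diff (sparse-step V (a j) (a (suc j)) (a≥0 j) (<⇒≤ (≰⇒> h)) (step j)) ⊞ diff (monotone t i))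
        (solve 4 (λ T x y z → con 400ℚ :* (z :- x) :- (T :+ con 1ℚ) :* x := con 400ℚ :* (y :- x) :- T :* x :+ (con 400ℚ :* (z :- y) :- y) :+ (y :- x)) refl (T t) (a i) (a j) (a (suc j))))

    doubling : ∀ i → (V ≤ 2ℚ * a (phase ℕ.+ i)) ⊎ (2ℚ * a i ≤ a (phase ℕ.+ i))
    doubling i = go (sparse-phase phase i)
      where
      go : (V ≤ 2ℚ * a (phase ℕ.+ i)) ⊎ (T phase * a i ≤ 400ℚ * (a (phase ℕ.+ i) - a i)) → (V ≤ 2ℚ * a (phase ℕ.+ i)) ⊎ (2ℚ * a i ≤ a (phase ℕ.+ i))
      go (inj₁ h) = inj₁ h
      go (inj₂ h) = inj₂ (concl (diff cancelled)
        (solve 2 (λ x y → y :- con 2ℚ :* x := y :- x :- x) refl (a i) (a (phase ℕ.+ i))))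
        where
        cancelled : a i ≤ a (phase ℕ.+ i) - a i
        cancelled = *-cancelˡ-≤-pos 400ℚ (subst (λ z → z * a i ≤ 400ℚ * (a (phase ℕ.+ i) - a i)) T-phase h)

    sparse-phases : ∀ k i → (V ≤ 2ℚ * a (k ℕ.* phase ℕ.+ i)) ⊎ (P2 k * a i ≤ a (k ℕ.* phase ℕ.+ i))
    sparse-phases zero i = inj₂ (≤-reflexive (*-identityˡ (a i)))
    sparse-phases (suc k) i = subst (λ j → (V ≤ 2ℚ * a j) ⊎ (P2 (suc k) * a i ≤ a j)) (sym (ℕₚ.+-assoc phase (k ℕ.* phase) i)) (go (sparse-phases k i) (doubling j))
      where
      j = k ℕ.* phase ℕ.+ i
      go : (V ≤ 2ℚ * a j) ⊎ (P2 k * a i ≤ a j) → (V ≤ 2ℚ * a (phase ℕ.+ j)) ⊎ (2ℚ * a j ≤ a (phase ℕ.+ j)) → (V ≤ 2ℚ * a (phase ℕ.+ j)) ⊎ (P2 (suc k) * a i ≤ a (phase ℕ.+ j))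
      go (inj₁ h) _ = inj₁ (still-dense phase j h)
      go (inj₂ _) (inj₁ h) = inj₁ h
      go (inj₂ ih) (inj₂ h) = inj₂ (≤-trans (≤-reflexive (*-assoc 2ℚ (P2 k) (a i))) (≤-trans (*-monoˡ-≤-nonNeg 2ℚ ih) h))

    -- Dual to `sparse-phase`: every step removes at least 1/400 of the current complement, which is
    -- never smaller than the complement at the end.
    dense-phase : ∀ t i → V ≤ 2ℚ * a i → T t * (V - a (t ℕ.+ i)) ≤ 400ℚ * (a (t ℕ.+ i) - a i)
    dense-phase zero i _ = ≤-reflexive (solve 2 (λ V a → con 0ℚ :* (V :- a) := con 400ℚ :* (a :- a)) refl V (a i))
    dense-phase (suc t) i h = concl (diff (dense-phase t i h) ⊞ diff (dense-step V (a j) (a (suc j)) (a≤V j) (still-dense t i h) (step j)) ⊞ (T≥0 t ⊞ nonNegative⁻¹ 1ℚ) ⊡ diff (incr j))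
        (solve 5 (λ V T x y z → con 400ℚ :* (z :- x) :- (T :+ con 1ℚ) :* (V :- z) := con 400ℚ :* (y :- x) :- T :* (V :- y) :+ (con 400ℚ :* (z :- y) :- (V :- y)) :+ (T :+ con 1ℚ) :* (z :- y)) refl V (T t) (a i) (a j) (a (suc j)))
      where
      j = t ℕ.+ i
      T≥0 : ∀ t → Nn (T t)
      T≥0 zero = ≤-refl
      T≥0 (suc t) = T≥0 t ⊞ nonNegative⁻¹ 1ℚ

    halving : ∀ i → V ≤ 2ℚ * a i → 2ℚ * (V - a (phase ℕ.+ i)) ≤ V - a i
    halving i h = concl (diff cancelled)
      (solve 3 (λ V x y → V :- x :- con 2ℚ :* (V :- y) := y :- x :- (V :- y)) refl V (a i) (a (phase ℕ.+ i)))
      where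
      cancelled : V - a (phase ℕ.+ i) ≤ a (phase ℕ.+ i) - a i
      cancelled = *-cancelˡ-≤-pos 400ℚ (subst (λ z → z * (V - a (phase ℕ.+ i)) ≤ 400ℚ * (a (phase ℕ.+ i) - a i)) T-phase (dense-phase phase i h))

    dense-phases : ∀ k i → V ≤ 2ℚ * a i → P2 k * (V - a (k ℕ.* phase ℕ.+ i)) ≤ V - a i
    dense-phases zero i h = ≤-reflexive (*-identityˡ (V - a i))
    dense-phases (suc k) i h = subst (λ j → P2 (suc k) * (V - a j) ≤ V - a i) (sym (ℕₚ.+-assoc phase (k ℕ.* phase) i))
      (concl (P2-Nn k ⊡ diff (halving j (still-dense (k ℕ.* phase) i h)) ⊞ diff (dense-phases k i h))
        (solve 5 (λ V P x y z → V :- x :- con 2ℚ :* P :* (V :- z) := P :* (V :- y :- con 2ℚ :* (V :- z)) :+ (V :- x :- P :* (V :- y))) refl V (P2 k) (a i) (a j) (a (phase ℕ.+ j))))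
      where j = k ℕ.* phase ℕ.+ i

    -- k₁ doublings bring density 2^(-k₁) to one half, and k₂ halvings of the complement follow;
    -- whenever half is reached early, monotonicity preserves it.
    saturation : ∀ k₁ k₂ → V ≤ P2 k₁ * a 0 → P2 k₂ * (V - a (k₂ ℕ.* phase ℕ.+ (k₁ ℕ.* phase ℕ.+ 0))) ≤ V
    saturation k₁ k₂ h = ≤-trans (dense-phases k₂ j (dense (sparse-phases k₁ 0))) (concl (a≥0 j) (solve 2 (λ V x → V :- (V :- x) := x) refl V (a j)))
      where
      j = k₁ ℕ.* phase ℕ.+ 0
      dense : (V ≤ 2ℚ * a j) ⊎ (P2 k₁ * a 0 ≤ a j) → V ≤ 2ℚ * a j
      dense (inj₁ d) = d
      dense (inj₂ d) = ≤-trans h (≤-trans d (concl (a≥0 j) (solve 1 (λ x → con 2ℚ :* x :- x := x) refl (a j))))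

  module Iterate (q : ℕ) {{vpos : Positive (vol q)}} (gap-q : ∀ {f} → Periodic q f → Mean0 q f → AlmostInvariant q f → Q q f ≤ 0ℚ) where

    record PSet : Set where
      constructor pset
      field
        set : Region
        per : PeriodicSet q set
    open PSet public

    nextGen : PSet → Gen
    nextGen s = proj₁ (Centred.grow-one q {{vpos}} gap-q (per s))

    extend : PSet → Gen → PSet
    extend s g = pset (_∪_ q (set s) (_∘act_ q (set s) g)) (∪-per q {set s} {_∘act_ q (set s) g} (per s) (act-per q g (per s)))

    next : PSet → PSet
    next s = extend s (nextGen s)

    size : PSet → ℚ
    size s = card q (set s)

    next-grows : ∀ s → Grows (vol q) (size s) (size (next s))
    next-grows s = proj₂ (Centred.grow-one q {{vpos}} gap-q (per s))

    next-incr : ∀ s → size s ≤ size (next s)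
    next-incr s = card-mono-∪ q (set s) (_∘act_ q (set s) (nextGen s))

    iterate : ℕ → PSet → PSet
    iterate zero s = s
    iterate (suc k) s = next (iterate k s)

    size≤vol : ∀ s → size s ≤ vol q
    size≤vol s = S₂-mono q (λ x y → lem (set s x y))
      where
      lem : ∀ b → ι b ≤ 1ℚ
      lem true = ≤-refl
      lem false = nonNegative⁻¹ 1ℚ

    size≥0 : ∀ s → Nn (size s)
    size≥0 s = S₂-Nn q (λ x y → lem (set s x y))
      where
      lem : ∀ b → Nn (ι b)
      lem true = nonNegative⁻¹ 1ℚ
      lem false = ≤-refl

    saturate : ∀ k₁ k₂ s → vol q ≤ P2 k₁ * size s → P2 k₂ * (vol q - size (iterate (k₂ ℕ.* phase ℕ.+ (k₁ ℕ.* phase ℕ.+ 0)) s)) ≤ vol q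
    saturate k₁ k₂ s = Logistic.saturation (vol q) {{vpos}} (λ i → size (iterate i s)) (λ i → size≥0 (iterate i s)) (λ i → size≤vol (iterate i s))
      (λ i → next-incr (iterate i s)) (λ i → next-grows (iterate i s)) k₁ k₂

    -- The set grows by preimages: a new point is one that the generator of that stage sends into
    -- the earlier set. Following the stages back from the last leads into the initial set, at a
    -- fixed cost per stage.
    reach : ∀ k s x y → set (iterate k s) x y ≡ true → Σ (ℤ × ℤ) λ p → Move (stretchFactor ℕ.^ k) (x , y) p × set s (proj₁ p) (proj₂ p) ≡ true
    reach zero s x y h = (x , y) , id-move (x , y) , h
    reach (suc k) s x y h = go (set (iterate k s) x y) refl h
      where
      s′ = iterate k s
      g = nextGen s′
      p′ = act g x y
      go : ∀ b → set s′ x y ≡ b → (b ∨ set s′ (proj₁ p′) (proj₂ p′)) ≡ true → Σ (ℤ × ℤ) λ p → Move (stretchFactor ℕ.^ suc k) (x , y) p × set s (proj₁ p) (proj₂ p) ≡ true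
      go true e _ = let (p , m , r) = reach k s x y e in p , Move-weaken (stretchFactor-pos (stretchFactor ℕ.^ k)) m , r
      go false e h = let (p , m , r) = reach k s (proj₁ p′) (proj₂ p′) h in
        p , Move-weaken (ℕₚ.≤-reflexive (stretchFactor-eq (stretchFactor ℕ.^ k))) (gen-move g x y then m) , r

-- Sums and injections over duplicate-free lists.

module Counting where

  open import Data.Nat
  open import Data.Nat.Properties
  open import Data.Nat.Solver using (module +-*-Solver)
  open import Data.List using (List; []; _∷_; _++_; map; length; filter; cartesianProduct; upTo)
  open import Data.List.Properties using (length-++; length-map; upTo-∷ʳ)
  open import Data.List.Membership.Propositional using (_∈_)
  open import Data.List.Membership.Propositional.Properties using (∈-∃++; ∈-++⁻; ∈-++⁺ˡ; ∈-++⁺ʳ; ∈-map⁻)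
  open import Data.List.Relation.Unary.Any using (here; there)
  open import Data.List.Relation.Unary.All as All using (All; []; _∷_)
  open import Data.List.Relation.Unary.AllPairs using ([]; _∷_)
  open import Data.List.Relation.Unary.Unique.Propositional using (Unique)
  open import Data.Product using (Σ; _×_; _,_)
  open import Data.Sum using (inj₁; inj₂)
  open import Data.Empty using (⊥-elim)
  open import Relation.Nullary using (Dec; yes; no)
  open import Relation.Binary.PropositionalEquality

  private variable
    A B : Set

  sumL : List A → (A → ℕ) → ℕ
  sumL [] f = 0
  sumL (x ∷ xs) f = f x + sumL xs f

  𝟙 : ∀ {P : Set} → Dec P → ℕ
  𝟙 (yes _) = 1
  𝟙 (no _) = 0

  𝟙-yes : ∀ {P : Set} (d : Dec P) → P → 𝟙 d ≡ 1
  𝟙-yes (yes _) p = refl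
  𝟙-yes (no ¬p) p = ⊥-elim (¬p p)

  sumL-cong : ∀ (xs : List A) {f g : A → ℕ} → (∀ x → f x ≡ g x) → sumL xs f ≡ sumL xs g
  sumL-cong [] h = refl
  sumL-cong (x ∷ xs) h = cong₂ _+_ (h x) (sumL-cong xs h)

  sumL-mono : ∀ (xs : List A) {f g : A → ℕ} → (∀ x → x ∈ xs → f x ≤ g x) → sumL xs f ≤ sumL xs g
  sumL-mono [] h = z≤n
  sumL-mono (x ∷ xs) h = +-mono-≤ (h x (here refl)) (sumL-mono xs (λ y p → h y (there p)))

  +-swap₄ : ∀ a b c d → a + b + (c + d) ≡ a + c + (b + d)
  +-swap₄ = +-*-Solver.solve 4 (λ a b c d → a :+ b :+ (c :+ d) := a :+ c :+ (b :+ d)) refl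
    where open +-*-Solver

  sumL-+ : ∀ (xs : List A) (f g : A → ℕ) → sumL xs (λ x → f x + g x) ≡ sumL xs f + sumL xs g
  sumL-+ [] f g = refl
  sumL-+ (x ∷ xs) f g = trans (cong (f x + g x +_) (sumL-+ xs f g)) (+-swap₄ (f x) (g x) (sumL xs f) (sumL xs g))

  sumL-* : ∀ (xs : List A) c (f : A → ℕ) → sumL xs (λ x → c * f x) ≡ c * sumL xs f
  sumL-* [] c f = sym (*-zeroʳ c)
  sumL-* (x ∷ xs) c f = trans (cong (c * f x +_) (sumL-* xs c f)) (sym (*-distribˡ-+ c (f x) (sumL xs f)))

  sumL-const : ∀ (xs : List A) c → sumL xs (λ _ → c) ≡ length xs * c
  sumL-const [] c = refl
  sumL-const (x ∷ xs) c = cong (c +_) (sumL-const xs c)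

  sumL-swap : ∀ (xs : List A) (ys : List B) (f : A → B → ℕ) → sumL xs (λ x → sumL ys (f x)) ≡ sumL ys (λ y → sumL xs (λ x → f x y))
  sumL-swap [] ys f = sym (trans (sumL-const ys 0) (*-zeroʳ (length ys)))
  sumL-swap (x ∷ xs) ys f = trans (cong (sumL ys (f x) +_) (sumL-swap xs ys f)) (sym (sumL-+ ys (f x) (λ y → sumL xs (λ x → f x y))))

  sumL-++ : ∀ (xs ys : List A) f → sumL (xs ++ ys) f ≡ sumL xs f + sumL ys f
  sumL-++ [] ys f = refl
  sumL-++ (x ∷ xs) ys f = trans (cong (f x +_) (sumL-++ xs ys f)) (sym (+-assoc (f x) (sumL xs f) (sumL ys f)))

  sumL-map : ∀ (g : A → B) xs f → sumL (map g xs) f ≡ sumL xs (λ x → f (g x))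
  sumL-map g [] f = refl
  sumL-map g (x ∷ xs) f = cong (f (g x) +_) (sumL-map g xs f)

  sumL-product : ∀ (xs : List A) (ys : List B) f → sumL (cartesianProduct xs ys) f ≡ sumL xs (λ x → sumL ys (λ y → f (x , y)))
  sumL-product [] ys f = refl
  sumL-product (x ∷ xs) ys f = trans (sumL-++ (map (x ,_) ys) (cartesianProduct xs ys) f) (cong₂ _+_ (sumL-map (x ,_) ys f) (sumL-product xs ys f))

  sumL-upTo : ∀ n f → sumL (upTo (suc n)) f ≡ sumL (upTo n) f + f n
  sumL-upTo n f = trans (cong (λ l → sumL l f) (sym (upTo-∷ʳ n))) (trans (sumL-++ (upTo n) (n ∷ []) f) (cong (sumL (upTo n) f +_) (+-identityʳ (f n))))

  length-sumL : ∀ (xs : List A) → length xs ≡ sumL xs (λ _ → 1)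
  length-sumL [] = refl
  length-sumL (x ∷ xs) = cong suc (length-sumL xs)

  length-product : ∀ (xs : List A) (ys : List B) → length (cartesianProduct xs ys) ≡ length xs * length ys
  length-product xs ys = trans (length-sumL (cartesianProduct xs ys)) (trans (sumL-product xs ys (λ _ → 1)) (trans (sumL-cong xs (λ _ → sym (length-sumL ys))) (sumL-const xs (length ys))))

  length-filter : ∀ {P : A → Set} (P? : ∀ x → Dec (P x)) xs → length (filter P? xs) ≡ sumL xs (λ x → 𝟙 (P? x))
  length-filter P? [] = refl
  length-filter P? (x ∷ xs) with P? x
  ... | yes _ = cong suc (length-filter P? xs)
  ... | no _ = length-filter P? xs

  sumL-member : ∀ (xs : List A) (f : A → ℕ) {x} → x ∈ xs → f x ≤ sumL xs f
  sumL-member (_ ∷ xs) f (here refl) = m≤m+n _ _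
  sumL-member (y ∷ xs) f (there p) = ≤-trans (sumL-member xs f p) (m≤n+m _ _)

  double-count : ∀ {Rel : A → B → Set} (Rel? : ∀ x y → Dec (Rel x y)) (xs : List A) (ys : List B) (w : B → ℕ)
    → (∀ x → x ∈ xs → Σ B λ y → (y ∈ ys) × Rel x y)
    → (∀ y → y ∈ ys → length (filter (λ x → Rel? x y) xs) ≤ w y)
    → length xs ≤ sumL ys w
  double-count Rel? xs ys w cover bound = begin
    length xs ≡⟨ length-sumL xs ⟩
    sumL xs (λ _ → 1) ≤⟨ sumL-mono xs (λ x p → let (y , q , r) = cover x p in ≤-trans (≤-reflexive (sym (𝟙-yes (Rel? x y) r))) (sumL-member ys (λ y → 𝟙 (Rel? x y)) q)) ⟩
    sumL xs (λ x → sumL ys (λ y → 𝟙 (Rel? x y))) ≡⟨ sumL-swap xs ys (λ x y → 𝟙 (Rel? x y)) ⟩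
    sumL ys (λ y → sumL xs (λ x → 𝟙 (Rel? x y))) ≤⟨ sumL-mono ys (λ y q → ≤-trans (≤-reflexive (sym (length-filter (λ x → Rel? x y) xs))) (bound y q)) ⟩
    sumL ys w ∎
    where open ≤-Reasoning

  subset-length : ∀ {xs ys : List A} → Unique xs → (∀ {x} → x ∈ xs → x ∈ ys) → length xs ≤ length ys
  subset-length {xs = []} _ _ = z≤n
  subset-length {xs = x ∷ xs} {ys} (x∉ ∷ u) sub with ∈-∃++ (sub (here refl))
  ... | as , bs , refl = ≤-trans (s≤s (subset-length u sub′)) (≤-reflexive (trans (cong suc (length-++ as)) (sym (trans (length-++ as) (+-suc (length as) (length bs))))))
    where
    sub′ : ∀ {y} → y ∈ xs → y ∈ as ++ bs
    sub′ {y} p with ∈-++⁻ as (sub (there p))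
    ... | inj₁ q = ∈-++⁺ˡ q
    ... | inj₂ (here refl) = ⊥-elim (All.lookup x∉ p refl)
    ... | inj₂ (there q) = ∈-++⁺ʳ as q

  map-unique : ∀ {f : A → B} {xs} → Unique xs → (∀ {x y} → x ∈ xs → y ∈ xs → f x ≡ f y → x ≡ y) → Unique (map f xs)
  map-unique {xs = []} _ _ = []
  map-unique {f = f} {xs = x ∷ xs} (x∉ ∷ u) inj = go xs x∉ (λ p → inj (here refl) (there p)) ∷ map-unique u (λ p q → inj (there p) (there q))
    where
    go : ∀ ys → All (λ y → x ≢ y) ys → (∀ {y} → y ∈ ys → f x ≡ f y → x ≡ y) → All (λ y → f x ≢ y) (map f ys)
    go [] _ _ = []
    go (y ∷ ys) (p ∷ ps) h = (λ e → p (h (here refl) e)) ∷ go ys ps (λ q → h (there q))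

  inject-length : ∀ {f : A → B} {xs : List A} {ys : List B} → Unique xs → (∀ {x y} → x ∈ xs → y ∈ xs → f x ≡ f y → x ≡ y)
    → (∀ {x} → x ∈ xs → f x ∈ ys) → length xs ≤ length ys
  inject-length {f = f} {xs} {ys} u inj into = subst (_≤ length ys) (length-map f xs) (subset-length (map-unique u inj) sub)
    where
    sub : ∀ {y} → y ∈ map f xs → y ∈ ys
    sub p with ∈-map⁻ f p
    ... | x , q , refl = into q

  at-most-one : ∀ {xs : List A} → Unique xs → (∀ {x y} → x ∈ xs → y ∈ xs → x ≡ y) → length xs ≤ 1
  at-most-one {xs = []} _ _ = z≤n
  at-most-one {xs = x ∷ []} _ _ = ≤-refl
  at-most-one {xs = x ∷ y ∷ xs} ((p ∷ _) ∷ _) h = ⊥-elim (p (h (here refl) (there (here refl))))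

  four-distinct : ∀ (xs : List A) → Unique xs → 4 ≤ length xs → Σ A λ a → Σ A λ b → Σ A λ c → Σ A λ d →
    (a ∈ xs × b ∈ xs × c ∈ xs × d ∈ xs) × (a ≢ b) × (a ≢ c) × (a ≢ d) × (b ≢ c) × (b ≢ d) × (c ≢ d)
  four-distinct (a ∷ []) _ (s≤s ())
  four-distinct (a ∷ b ∷ []) _ (s≤s (s≤s ()))
  four-distinct (a ∷ b ∷ c ∷ []) _ (s≤s (s≤s (s≤s ())))
  four-distinct (a ∷ b ∷ c ∷ d ∷ xs) ((ab ∷ ac ∷ ad ∷ _) ∷ (bc ∷ bd ∷ _) ∷ (cd ∷ _) ∷ _) _ =
    a , b , c , d , (here refl , there (here refl) , there (there (here refl)) , there (there (there (here refl)))) , ab , ac , ad , bc , bd , cd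

  -- Induction on the list, with every cross term 2 f(x) f(y) replaced by f(x)² + f(y)².
  cauchy-schwarz : ∀ (xs : List A) (f : A → ℕ) → sumL xs f * sumL xs f ≤ length xs * sumL xs (λ x → f x * f x)
  cauchy-schwarz [] f = z≤n
  cauchy-schwarz (x ∷ xs) f = begin
    (a + s) * (a + s) ≡⟨ e₁ a s ⟩
    a * a + (2 * (a * s)) + s * s ≤⟨ +-mono-≤ (+-monoʳ-≤ (a * a) (cross xs)) (cauchy-schwarz xs f) ⟩
    a * a + (length xs * (a * a) + t) + length xs * t ≡⟨ e₂ (a * a) (length xs) t ⟩
    suc (length xs) * (a * a + t) ∎
    where
    open ≤-Reasoning
    open +-*-Solver
    a = f x
    s = sumL xs f
    t = sumL xs (λ x → f x * f x)
    e₁ : ∀ a s → (a + s) * (a + s) ≡ a * a + (2 * (a * s)) + s * s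
    e₁ = solve 2 (λ a s → (a :+ s) :* (a :+ s) := a :* a :+ (con 2 :* (a :* s)) :+ s :* s) refl
    e₂ : ∀ a l t → a + (l * a + t) + l * t ≡ suc l * (a + t)
    e₂ = solve 3 (λ a l t → a :+ (l :* a :+ t) :+ l :* t := (con 1 :+ l) :* (a :+ t)) refl
    amgm : ∀ a b → 2 * (a * b) ≤ a * a + b * b
    amgm a b with ≤-total a b
    ... | inj₁ p = go a b p
      where
      go : ∀ a b → a ≤ b → 2 * (a * b) ≤ a * a + b * b
      go a b p with m≤n⇒∃[o]m+o≡n p
      ... | d , refl = ≤-trans (m≤m+n (2 * (a * (a + d))) (d * d)) (≤-reflexive (solve 2 (λ a d → con 2 :* (a :* (a :+ d)) :+ d :* d := a :* a :+ (a :+ d) :* (a :+ d)) refl a d))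
    ... | inj₂ p with m≤n⇒∃[o]m+o≡n p
    ...   | d , refl = ≤-trans (m≤m+n (2 * ((b + d) * b)) (d * d)) (≤-reflexive (solve 2 (λ b d → con 2 :* ((b :+ d) :* b) :+ d :* d := (b :+ d) :* (b :+ d) :+ b :* b) refl b d))
    cross : ∀ ys → 2 * (a * sumL ys f) ≤ length ys * (a * a) + sumL ys (λ x → f x * f x)
    cross [] = ≤-reflexive (cong (2 *_) (*-zeroʳ a))
    cross (y ∷ ys) = begin
      2 * (a * (f y + sumL ys f)) ≡⟨ solve 3 (λ a b s → con 2 :* (a :* (b :+ s)) := con 2 :* (a :* b) :+ con 2 :* (a :* s)) refl a (f y) (sumL ys f) ⟩
      2 * (a * f y) + 2 * (a * sumL ys f) ≤⟨ +-mono-≤ (amgm a (f y)) (cross ys) ⟩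
      a * a + f y * f y + (length ys * (a * a) + sumL ys (λ x → f x * f x)) ≡⟨ +-swap₄ (a * a) (f y * f y) (length ys * (a * a)) _ ⟩
      a * a + length ys * (a * a) + (f y * f y + sumL ys (λ x → f x * f x)) ∎

-- A positive proportion of pairs is coprime.

module CoprimePairs where

  open import Data.Nat
  open import Data.Nat.Properties
  open import Data.Nat.DivMod
  open import Data.Nat.Coprimality using (Coprime; coprime?; coprime-/gcd)
  open import Data.Nat.GCD using (gcd; gcd[m,n]∣m; gcd[m,n]∣n; gcd[m,n]≢0)
  open import Data.Nat.Solver using (module +-*-Solver)
  open import Data.List using (List; length; filter; cartesianProduct; upTo; map; _++_)
  open import Data.List.Properties using (length-++; length-map; length-upTo)
  open import Data.List.Membership.Propositional using (_∈_)
  open import Data.List.Membership.Propositional.Properties using (∈-filter⁺; ∈-filter⁻; ∈-cartesianProduct⁺; ∈-cartesianProduct⁻; ∈-upTo⁺; ∈-upTo⁻; ∈-map⁺; ∈-++⁺ˡ; ∈-++⁺ʳ)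
  open import Data.List.Relation.Unary.Unique.Propositional using (Unique)
  open import Data.List.Relation.Unary.Unique.Propositional.Properties using (upTo⁺; cartesianProduct⁺; filter⁺)
  open import Data.Product using (_×_; _,_; proj₁; proj₂)
  open import Data.Sum using (_⊎_; inj₁; inj₂)
  open import Data.Sum.Properties using (inj₁-injective; inj₂-injective)
  open import Data.Product.Properties using (,-injective)
  open import Relation.Nullary using (Dec; yes; no)
  open import Relation.Binary.PropositionalEquality
  open Counting

  -- The first entry is comparable to m from both sides. The lower bound m / 4 is what later permits
  -- division by it when the other entries are estimated.
  record IsCop (m : ℕ) (p : ℕ × ℕ) : Set where
    constructor isCop
    field
      c≥1 : 1 ≤ proj₂ p
      c<a : proj₂ p < proj₁ p
      a≤  : proj₁ p ≤ 2 * m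
      a>  : m < 4 * proj₁ p
      cop : Coprime (proj₁ p) (proj₂ p)

  isCop? : ∀ m p → Dec (IsCop m p)
  isCop? m (a , c) with 1 ≤? c | c <? a | a ≤? 2 * m | m <? 4 * a | coprime? a c
  ... | no n | _ | _ | _ | _ = no (λ h → n (IsCop.c≥1 h))
  ... | _ | no n | _ | _ | _ = no (λ h → n (IsCop.c<a h))
  ... | _ | _ | no n | _ | _ = no (λ h → n (IsCop.a≤ h))
  ... | _ | _ | _ | no n | _ = no (λ h → n (IsCop.a> h))
  ... | _ | _ | _ | _ | no n = no (λ h → n (IsCop.cop h))
  ... | yes a | yes b | yes c | yes d | yes e = yes (isCop a b c d e)

  range² : ℕ → List (ℕ × ℕ)
  range² n = cartesianProduct (upTo n) (upTo n)

  range²-unique : ∀ n → Unique (range² n)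
  range²-unique n = cartesianProduct⁺ (upTo⁺ n) (upTo⁺ n)

  Cop : ℕ → List (ℕ × ℕ)
  Cop m = filter (isCop? m) (range² (suc (2 * m)))

  Cop-unique : ∀ m → Unique (Cop m)
  Cop-unique m = filter⁺ (isCop? m) (range²-unique (suc (2 * m)))

  Cop-sound : ∀ {m p} → p ∈ Cop m → IsCop m p
  Cop-sound {m} h = proj₂ (∈-filter⁻ (isCop? m) {xs = range² (suc (2 * m))} h)

  Cop-complete : ∀ {m p} → IsCop m p → p ∈ Cop m
  Cop-complete {m} {a , c} h = ∈-filter⁺ (isCop? m) (∈-cartesianProduct⁺ (∈-upTo⁺ (s≤s (IsCop.a≤ h))) (∈-upTo⁺ (s≤s (≤-trans (<⇒≤ (IsCop.c<a h)) (IsCop.a≤ h))))) h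

  length-range² : ∀ n → length (range² n) ≡ n * n
  length-range² n = trans (length-product (upTo n) (upTo n)) (cong₂ _*_ (length-upTo n) (length-upTo n))

  record Reduced (i k : ℕ) : Set where
    field
      a c g : ℕ
      i-eq : i ≡ a * g
      k-eq : k ≡ c * g
      cop  : Coprime a c

  reduce : ∀ i k → Reduced (suc i) k
  reduce i k = record { a = suc i / g ; c = k / g ; g = g ; i-eq = sym (m/n*n≡m (gcd[m,n]∣m (suc i) k)) ; k-eq = sym (m/n*n≡m (gcd[m,n]∣n (suc i) k)) ; cop = coprime-/gcd (suc i) k }
    where
    g = gcd (suc i) k
    instance
      g≢0 : NonZero g
      g≢0 = ≢-nonZero (gcd[m,n]≢0 (suc i) k (inj₁ λ ()))

  digits-unique : ∀ a {r r′ g g′} → r < a → r′ < a → r + g * a ≡ r′ + g′ * a → r ≡ r′ × g ≡ g′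
  digits-unique a@(suc _) {r} {r′} {g} {g′} h h′ e = r≡ , *-cancelʳ-≡ g g′ a (+-cancelˡ-≡ r′ (g * a) (g′ * a) (subst (λ z → z + g * a ≡ r′ + g′ * a) r≡ e))
    where
    r≡ : r ≡ r′
    r≡ = trans (sym (trans ([m+kn]%n≡m%n r g a) (m<n⇒m%n≡m h))) (trans (cong (_% a) e) (trans ([m+kn]%n≡m%n r′ g′ a) (m<n⇒m%n≡m h′)))

  module _ (m : ℕ) where
    private
      K : ℕ × ℕ → ℕ
      K p = suc (proj₂ p)

      module R (p : ℕ × ℕ) = Reduced (reduce (m + proj₁ p) (K p))

    Code : Set
    Code = (ℕ × ℕ) ⊎ ((ℕ × ℕ) × ℕ)

    -- The pair (m + s + 1 , t + 1) is reduced to a / c with cofactor g. If a ≤ m / 4, the triple is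
    -- packed as a - 1 and a two-digit number in base a below a g ≤ 2m: about m² / 2 codes.
    -- Otherwise (a , c) belongs to `Cop m` and g - 1 < 7.
    code : (p : ℕ × ℕ) → Dec (4 * R.a p ≤ m) → Code
    code p (yes _) = inj₁ (pred (R.a p) , pred (R.c p) + pred (R.g p) * R.a p)
    code p (no _) = inj₂ ((R.a p , R.c p) , pred (R.g p))

    codes : List Code
    codes = map inj₁ (cartesianProduct (upTo (m / 4)) (upTo (2 * m))) ++ map inj₂ (cartesianProduct (Cop m) (upTo 7))

    private
      pos : ∀ {x y} → 1 ≤ x * y → 1 ≤ x × 1 ≤ y
      pos {suc x} {suc y} _ = s≤s z≤n , s≤s z≤n
      pos {suc x} {zero} h with () ← subst (1 ≤_) (*-zeroʳ x) h

      module Facts {p : ℕ × ℕ} (h : p ∈ range² m) where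
        open R p public
        s<m : proj₁ p < m
        s<m = ∈-upTo⁻ (proj₁ (∈-cartesianProduct⁻ (upTo m) (upTo m) h))
        t<m : proj₂ p < m
        t<m = ∈-upTo⁻ (proj₂ (∈-cartesianProduct⁻ (upTo m) (upTo m) h))
        a≥1 : 1 ≤ a
        a≥1 = proj₁ (pos {a} {g} (subst (1 ≤_) i-eq (s≤s z≤n)))
        g≥1 : 1 ≤ g
        g≥1 = proj₂ (pos {a} {g} (subst (1 ≤_) i-eq (s≤s z≤n)))
        c≥1 : 1 ≤ c
        c≥1 = proj₁ (pos {c} {g} (subst (1 ≤_) k-eq (s≤s z≤n)))
        I≤ : a * g ≤ 2 * m
        I≤ = subst (_≤ 2 * m) i-eq (subst (suc (m + proj₁ p) ≤_) (cong (m +_) (sym (+-identityʳ m))) (+-monoʳ-< m s<m))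
        c<a : c < a
        c<a = *-cancelʳ-< g c a (subst₂ _<_ k-eq i-eq (s≤s (≤-trans t<m (m≤m+n m (proj₁ p)))))
        digit : pred c < a
        digit = ≤-<-trans pred[n]≤n c<a

      unpred : ∀ {x y} → 1 ≤ x → 1 ≤ y → pred x ≡ pred y → x ≡ y
      unpred {suc x} {suc y} _ _ e = cong suc e

      recover : ∀ {p r} (hp : p ∈ range² m) (hr : r ∈ range² m) → R.a p ≡ R.a r → R.c p ≡ R.c r → R.g p ≡ R.g r → p ≡ r
      recover {p} {r} hp hr ea ec eg = cong₂ _,_
        (+-cancelˡ-≡ m _ _ (suc-injective (trans (R.i-eq p) (trans (cong₂ _*_ ea eg) (sym (R.i-eq r))))))
        (suc-injective (trans (R.k-eq p) (trans (cong₂ _*_ ec eg) (sym (R.k-eq r)))))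

      code-inj : ∀ {p r} (hp : p ∈ range² m) (hr : r ∈ range² m) dp dr → code p dp ≡ code r dr → p ≡ r
      code-inj {p} {r} hp hr (yes _) (yes _) e = recover hp hr a≡ (unpred (Facts.c≥1 hp) (Facts.c≥1 hr) (proj₁ d)) (unpred (Facts.g≥1 hp) (Facts.g≥1 hr) (proj₂ d))
        where
        e₁ = ,-injective (inj₁-injective e)
        a≡ : R.a p ≡ R.a r
        a≡ = unpred (Facts.a≥1 hp) (Facts.a≥1 hr) (proj₁ e₁)
        d : pred (R.c p) ≡ pred (R.c r) × pred (R.g p) ≡ pred (R.g r)
        d = digits-unique (R.a p) (Facts.digit hp) (subst (pred (R.c r) <_) (sym a≡) (Facts.digit hr)) (trans (proj₂ e₁) (cong (λ z → pred (R.c r) + pred (R.g r) * z) (sym a≡)))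
      code-inj {p} {r} hp hr (no _) (no _) e = recover hp hr (proj₁ e₂) (proj₂ e₂) (unpred (Facts.g≥1 hp) (Facts.g≥1 hr) (proj₂ e₁))
        where
        e₁ = ,-injective (inj₂-injective e)
        e₂ = ,-injective (proj₁ e₁)

      code-into : ∀ {p} (hp : p ∈ range² m) d → code p d ∈ codes
      code-into {p} hp (yes h) = ∈-++⁺ˡ (∈-map⁺ inj₁ (∈-cartesianProduct⁺ (∈-upTo⁺ low) (∈-upTo⁺ (<-≤-trans high I≤))))
        where
        open Facts hp
        low : pred a < m / 4
        low = subst (_≤ m / 4) (sym (suc-pred a {{>-nonZero a≥1}})) (subst (_≤ m / 4) (m*n/n≡m a 4) (/-monoˡ-≤ 4 (subst (_≤ m) (*-comm 4 a) h)))
        high : pred c + pred g * a < a * g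
        high = subst (pred c + pred g * a <_) (trans (cong (λ z → z * a) (suc-pred g {{>-nonZero g≥1}})) (*-comm g a)) (+-monoˡ-< (pred g * a) digit)
      code-into {p} hp (no h) = ∈-++⁺ʳ _ (∈-map⁺ inj₂ (∈-cartesianProduct⁺ (Cop-complete (isCop c≥1 c<a a≤2m (≰⇒> h) cop)) (∈-upTo⁺ g<8)))
        where
        open Facts hp
        a≤2m : a ≤ 2 * m
        a≤2m = ≤-trans (m≤m*n a g {{>-nonZero g≥1}}) I≤
        g<8 : pred g < 7
        -- From a g ≤ 2m and m < 4a: a g < 8a.
        g<8 = s≤s⁻¹ (subst (_< 8) (sym (suc-pred g {{>-nonZero g≥1}})) (*-cancelˡ-< a g 8 (≤-<-trans I≤ (<-≤-trans (*-monoʳ-< 2 (≰⇒> h)) (≤-reflexive (trans (sym (*-assoc 2 4 a)) (*-comm 8 a)))))))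

    -- The codes with small a can account for at most half of the m² pairs, so seven copies of
    -- `Cop m` must cover the other half.
    Cop-large : m * m ≤ 14 * length (Cop m)
    Cop-large = +-cancelˡ-≤ (m * m) (m * m) (14 * k) (begin
      m * m + m * m ≤⟨ +-mono-≤ cover cover ⟩
      (m / 4) * (2 * m) + k * 7 + ((m / 4) * (2 * m) + k * 7) ≡⟨ solve 3 (λ x m k → x :* (con 2 :* m) :+ k :* con 7 :+ (x :* (con 2 :* m) :+ k :* con 7) := x :* con 4 :* m :+ con 14 :* k) refl (m / 4) m k ⟩
      (m / 4) * 4 * m + 14 * k ≤⟨ +-monoˡ-≤ (14 * k) (*-monoˡ-≤ m (m/n*n≤m m 4)) ⟩
      m * m + 14 * k ∎)
      where
      open ≤-Reasoning
      open +-*-Solver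
      k = length (Cop m)
      test : ∀ p → Dec (4 * R.a p ≤ m)
      test p = 4 * R.a p ≤? m
      cover : m * m ≤ (m / 4) * (2 * m) + k * 7
      cover = begin
        m * m ≡⟨ sym (length-range² m) ⟩
        length (range² m) ≤⟨ inject-length {f = λ p → code p (test p)} (range²-unique m) (λ {p} {r} hp hr → code-inj hp hr (test p) (test r)) (λ {p} hp → code-into hp (test p)) ⟩
        length codes ≡⟨ trans (length-++ (map inj₁ (cartesianProduct (upTo (m / 4)) (upTo (2 * m)))))
            (cong₂ _+_ (trans (length-map inj₁ (cartesianProduct (upTo (m / 4)) (upTo (2 * m)))) (trans (length-product (upTo (m / 4)) (upTo (2 * m))) (cong₂ _*_ (length-upTo (m / 4)) (length-upTo (2 * m)))))
                       (trans (length-map inj₂ (cartesianProduct (Cop m) (upTo 7))) (length-product (Cop m) (upTo 7)))) ⟩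
        (m / 4) * (2 * m) + k * 7 ∎

-- Arithmetic modulo a prime.

module Residues where

  open import Data.Nat as ℕ using (ℕ; zero; suc)
  import Data.Nat.Properties as ℕₚ
  import Data.Nat.Divisibility as ℕ∣
  open import Data.Nat.Primality using (Prime; euclidsLemma; prime⇒nonZero)
  open import Data.Nat.Coprimality using (prime⇒coprime; coprime-Bézout)
  open import Data.Nat.GCD using (module Bézout)
  open import Data.Integer using (ℤ; +_; -_; _+_; _*_; _-_; ∣_∣)
  import Data.Integer.Properties as ℤₚ
  open import Data.Integer.DivMod using (_%ℕ_; _/ℕ_; n%ℕd<d; a≡a%ℕn+[a/ℕn]*n)
  open import Data.Integer.Divisibility.Signed using (_∣_; divides; ∣ᵤ⇒∣; ∣⇒∣ᵤ; _∣?_)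
  open import Data.Integer.Tactic.RingSolver using (solve-∀)
  open import Data.List using (List; length; filter; upTo)
  open import Data.List.Properties using (length-upTo)
  open import Data.List.Membership.Propositional using (_∈_)
  open import Data.List.Membership.Propositional.Properties using (∈-filter⁻; ∈-cartesianProduct⁻; ∈-upTo⁺; ∈-upTo⁻)
  open import Data.List.Relation.Unary.Unique.Propositional.Properties using (filter⁺)
  open import Data.Product using (Σ; _×_; _,_; proj₁; proj₂)
  open import Data.Sum using (_⊎_; inj₁; inj₂)
  open import Data.Empty using (⊥; ⊥-elim)
  open import Relation.Nullary using (Dec; yes; no; ¬_)
  open import Relation.Binary.PropositionalEquality
  open Counting
  open Matrices
  open CoprimePairs using (range²; range²-unique)

  Point : Set
  Point = ℕ × ℕ

  pt : Point → V3
  pt (b , c) = v3 (+ 1) (+ b) (+ c)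

  module _ (q : ℕ) where

    Z : ℤ → Set
    Z a = + q ∣ a

    Z? : ∀ a → Dec (Z a)
    Z? a = + q ∣? a

    lin₁ : ∀ {a x} c → Z a → x ≡ c * a → Z x
    lin₁ {a} c (divides k refl) refl = divides (c * k) (sym (ℤₚ.*-assoc c k (+ q)))

    lin₂ : ∀ {a b x} c d → Z a → Z b → x ≡ c * a + d * b → Z x
    lin₂ c d (divides k refl) (divides l refl) refl = divides (c * k + d * l) (lem c d k l (+ q))
      where
      lem : ∀ c d k l q → c * (k * q) + d * (l * q) ≡ (c * k + d * l) * q
      lem = solve-∀

    lin₃ : ∀ {a b c x} k l m → Z a → Z b → Z c → x ≡ k * a + l * b + m * c → Z x
    lin₃ {a} {b} {c} k l m za zb zc e = lin₂ (+ 1) m (lin₂ k l za zb refl) zc (trans e (cong (_+ m * c) (sym (ℤₚ.*-identityˡ (k * a + l * b)))))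

    Z-small : ∀ {a} → Z a → ∣ a ∣ ℕ.< q → a ≡ + 0
    Z-small {a} z h with ∣ a ∣ in e | ∣⇒∣ᵤ z
    ... | zero | _ = ℤₚ.∣i∣≡0⇒i≡0 e
    ... | suc n | d = ⊥-elim (ℕₚ.<⇒≱ h (ℕ∣.∣⇒≤ d))

    ∣-∣<q : ∀ {b c} → b ℕ.< q → c ℕ.< q → ∣ + b - + c ∣ ℕ.< q
    ∣-∣<q {b} {c} hb hc = subst (ℕ._< q) (sym (trans (cong ∣_∣ (ℤₚ.m-n≡m⊖n b c)) (ℤₚ.∣m⊖n∣≡∣n⊖m∣ b c))) (helper (ℕₚ.≤-total b c))
      where
      helper : (b ℕ.≤ c) ⊎ (c ℕ.≤ b) → ∣ c Data.Integer.⊖ b ∣ ℕ.< q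
      helper (inj₁ p) = subst (ℕ._< q) (sym (cong ∣_∣ (ℤₚ.⊖-≥ p))) (ℕₚ.≤-<-trans (ℕₚ.m∸n≤m c b) hc)
      helper (inj₂ p) = subst (ℕ._< q) (sym (trans (ℤₚ.∣m⊖n∣≡∣n⊖m∣ c b) (cong ∣_∣ (ℤₚ.⊖-≥ p)))) (ℕₚ.≤-<-trans (ℕₚ.m∸n≤m b c) hb)

    residue-unique : ∀ {b c} → b ℕ.< q → c ℕ.< q → Z (+ b - + c) → b ≡ c
    residue-unique {b} {c} hb hc z = ℤₚ.+-injective (ℤₚ.i-j≡0⇒i≡j (+ b) (+ c) (Z-small z (∣-∣<q hb hc)))

    module _ (pr : Prime q) where

      private instance
        q≢0 : ℕ.NonZero q
        q≢0 = prime⇒nonZero pr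

      euclid : ∀ a b → Z (a * b) → Z a ⊎ Z b
      euclid a b z with euclidsLemma ∣ a ∣ ∣ b ∣ pr (subst (q ℕ∣.∣_) (ℤₚ.∣i*j∣≡∣i∣*∣j∣ a b) (∣⇒∣ᵤ z))
      ... | inj₁ d = inj₁ (∣ᵤ⇒∣ d)
      ... | inj₂ d = inj₂ (∣ᵤ⇒∣ d)

      cancelZ : ∀ a {b} → ¬ Z a → Z (a * b) → Z b
      cancelZ a {b} h z with euclid a b z
      ... | inj₁ d = ⊥-elim (h d)
      ... | inj₂ d = d

      res : ℤ → ℕ
      res a = a %ℕ q

      res< : ∀ a → res a ℕ.< q
      res< a = n%ℕd<d a q

      res-≡ : ∀ a → Z (a - + res a)
      res-≡ a = divides (a /ℕ q) (trans (cong (_- + res a) (a≡a%ℕn+[a/ℕn]*n a q)) (lem (+ res a) ((a /ℕ q) * + q)))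
        where
        lem : ∀ r k → r + k - r ≡ k
        lem = solve-∀

      inverse : ∀ a → ¬ Z a → Σ ℤ λ b → Z (a * b - + 1)
      inverse a h with res a in e | res-≡ a | res< a
      ... | zero | za | _ = ⊥-elim (h (subst Z (ℤₚ.+-identityʳ a) za))
      ... | suc r | za | r<q with coprime-Bézout (prime⇒coprime pr r<q)
      ...   | Bézout.+- x y eq = - (+ y) , lin₂ (- (+ y)) (- (+ x)) za (divides (+ 1) (sym (ℤₚ.*-identityˡ (+ q)))) (trans (lem a (+ suc r) (+ y)) (trans (cong (λ z → (- (+ y)) * (a - + suc r) - z) eq′) (lem₂ ((- (+ y)) * (a - + suc r)) (+ x) (+ q))))
        where
        lem₂ : ∀ A x q → A - x * q ≡ A + (- x) * q
        lem₂ = solve-∀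
        lem : ∀ a r y → a * (- y) - + 1 ≡ (- y) * (a - r) - (+ 1 + y * r)
        lem = solve-∀
        eq′ : + 1 + + y * + suc r ≡ + x * + q
        eq′ = trans (cong (λ z → + 1 + z) (sym (ℤₚ.pos-* y (suc r)))) (trans (cong +_ eq) (ℤₚ.pos-* x q))
      ...   | Bézout.-+ x y eq = + y , lin₂ (+ y) (+ x) za (divides (+ 1) (sym (ℤₚ.*-identityˡ (+ q)))) (trans (lem a (+ suc r) (+ y)) (cong (λ z → + y * (a - + suc r) + z) (trans (cong (_- + 1) (sym eq′)) (lem₂ (+ x * + q)))))
        where
        lem : ∀ a r y → a * y - + 1 ≡ y * (a - r) + (y * r - + 1)
        lem = solve-∀
        lem₂ : ∀ k → + 1 + k - + 1 ≡ k
        lem₂ = solve-∀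
        eq′ : + 1 + + x * + q ≡ + y * + suc r
        eq′ = trans (cong (λ z → + 1 + z) (sym (ℤₚ.pos-* x q))) (trans (cong +_ eq) (ℤₚ.pos-* y (suc r)))

      line? : ∀ d (p : Point) → Dec (Z (d · pt p))
      line? d p = Z? (d · pt p)

      line-count : ∀ d → ¬ (Z (x d) × Z (y d) × Z (z d)) → length (filter (line? d) (range² q)) ℕ.≤ q
      line-count d@(v3 d₁ d₂ d₃) nz = by (Z? d₃) (Z? d₂) (Z? d₁)
        where
        L = filter (line? d) (range² q)
        uniq = filter⁺ (line? d) (range²-unique q)
        mem : ∀ {p} → p ∈ L → (proj₁ p ℕ.< q) × (proj₂ p ℕ.< q) × Z (d · pt p)
        mem {p} h = let (r , l) = ∈-filter⁻ (line? d) {xs = range² q} h ; (h₁ , h₂) = ∈-cartesianProduct⁻ (upTo q) (upTo q) r in ∈-upTo⁻ h₁ , ∈-upTo⁻ h₂ , l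
        by : Dec (Z d₃) → Dec (Z d₂) → Dec (Z d₁) → length L ℕ.≤ q
        by (no n) _ _ = ℕₚ.≤-trans (inject-length {f = proj₁} uniq inj (λ h → ∈-upTo⁺ (proj₁ (mem h)))) (ℕₚ.≤-reflexive (length-upTo q))
          where
          inj : ∀ {p r} → p ∈ L → r ∈ L → proj₁ p ≡ proj₁ r → p ≡ r
          inj {b , c} {_ , c′} hp hr refl = let (_ , c< , zp) = mem hp ; (_ , c′< , zr) = mem hr in
            cong (b ,_) (residue-unique c< c′< (cancelZ d₃ n (lin₂ (+ 1) (- (+ 1)) zp zr (lem d₁ d₂ d₃ (+ b) (+ c) (+ c′)))))
            where
            lem : ∀ d₁ d₂ d₃ b c c′ → d₃ * (c - c′) ≡ + 1 * (d₁ * + 1 + d₂ * b + d₃ * c) + (- (+ 1)) * (d₁ * + 1 + d₂ * b + d₃ * c′)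
            lem = solve-∀
        by (yes z₃) (no n) _ = ℕₚ.≤-trans (inject-length {f = proj₂} uniq inj (λ h → ∈-upTo⁺ (proj₁ (proj₂ (mem h))))) (ℕₚ.≤-reflexive (length-upTo q))
          where
          inj : ∀ {p r} → p ∈ L → r ∈ L → proj₂ p ≡ proj₂ r → p ≡ r
          inj {b , c} {b′ , _} hp hr refl = let (b< , _ , zp) = mem hp ; (b′< , _ , zr) = mem hr in
            cong (_, c) (residue-unique b< b′< (cancelZ d₂ n (lin₂ (+ 1) (- (+ 1)) zp zr (lem d₁ d₂ d₃ (+ b) (+ b′) (+ c)))))
            where
            lem : ∀ d₁ d₂ d₃ b b′ c → d₂ * (b - b′) ≡ + 1 * (d₁ * + 1 + d₂ * b + d₃ * c) + (- (+ 1)) * (d₁ * + 1 + d₂ * b′ + d₃ * c)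
            lem = solve-∀
        by (yes z₃) (yes z₂) (yes z₁) = ⊥-elim (nz (z₁ , z₂ , z₃))
        -- The form reduces to its constant coefficient: this is the line at infinity, and it has no
        -- affine points.
        by (yes z₃) (yes z₂) (no n) = ℕₚ.≤-trans (at-most-one uniq (λ h _ → ⊥-elim (empty h))) (ℕ.>-nonZero⁻¹ q)
          where
          empty : ∀ {p} → p ∈ L → ⊥
          empty {b , c} h = n (lin₃ (+ 1) (- (+ b)) (- (+ c)) (proj₂ (proj₂ (mem h))) z₂ z₃ (lem d₁ d₂ d₃ (+ b) (+ c)))
            where
            lem : ∀ d₁ d₂ d₃ b c → d₁ ≡ + 1 * (d₁ * + 1 + d₂ * b + d₃ * c) + (- b) * d₂ + (- c) * d₃
            lem = solve-∀

      -- Successive divided differences: distinct arguments allow the differences to be cancelled,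
      -- and the third divided difference of a cubic is its leading coefficient.
      cubic : ∀ a b c d → ¬ Z d → ∀ x y z t → ¬ Z (x - y) → ¬ Z (x - z) → ¬ Z (x - t) → ¬ Z (y - z) → ¬ Z (y - t) → ¬ Z (z - t)
        → let f = λ w → a + b * w + c * (w * w) + d * (w * (w * w)) in Z (f x) → Z (f y) → Z (f z) → Z (f t) → ⊥
      cubic a b c d nd x y z t xy xz xt yz yt zt fx fy fz ft = nd (cancelZ (z - t) zt (lin₂ (+ 1) (- (+ 1)) (h₂ z yz gz) (h₂ t yt gt) (e₃ c d x y z t)))
        where
        g : ℤ → ℤ
        g w = b + c * (x + w) + d * (x * x + x * w + w * w)
        e₁ : ∀ a b c d x w → (x - w) * (b + c * (x + w) + d * (x * x + x * w + w * w)) ≡ + 1 * (a + b * x + c * (x * x) + d * (x * (x * x))) + (- (+ 1)) * (a + b * w + c * (w * w) + d * (w * (w * w)))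
        e₁ = solve-∀
        gy : Z (g y)
        gy = cancelZ (x - y) xy (lin₂ (+ 1) (- (+ 1)) fx fy (e₁ a b c d x y))
        gz : Z (g z)
        gz = cancelZ (x - z) xz (lin₂ (+ 1) (- (+ 1)) fx fz (e₁ a b c d x z))
        gt : Z (g t)
        gt = cancelZ (x - t) xt (lin₂ (+ 1) (- (+ 1)) fx ft (e₁ a b c d x t))
        e₂ : ∀ b c d x y w → (y - w) * (c + d * (x + y + w)) ≡ + 1 * (b + c * (x + y) + d * (x * x + x * y + y * y)) + (- (+ 1)) * (b + c * (x + w) + d * (x * x + x * w + w * w))
        e₂ = solve-∀
        h₂ : ∀ w → ¬ Z (y - w) → Z (g w) → Z (c + d * (x + y + w))
        h₂ w n gw = cancelZ (y - w) n (lin₂ (+ 1) (- (+ 1)) gy gw (e₂ b c d x y w))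
        e₃ : ∀ c d x y z t → (z - t) * d ≡ + 1 * (c + d * (x + y + z)) + (- (+ 1)) * (c + d * (x + y + t))
        e₃ = solve-∀

-- Packing bound for lattice points on a hyperplane of ℤ⁴.

module Hyperplanes where

  open import Data.Nat as ℕ using (ℕ; suc; s≤s)
  import Data.Nat.Properties as ℕₚ
  open import Data.Integer using (ℤ; +_; -_; _+_; _*_; _-_; ∣_∣; NonZero; ≢-nonZero)
  import Data.Integer as ℤ
  import Data.Integer.Properties as ℤₚ
  open import Data.Integer.DivMod using (_%_; _/_; n%d<d; a≡a%n+[a/n]*n)
  open import Data.Integer.Tactic.RingSolver using (solve-∀)
  open import Data.List using (List; length; upTo; map; cartesianProduct)
  open import Data.List.Properties using (length-upTo; length-map)
  open import Data.List.Membership.Propositional using (_∈_)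
  open import Data.List.Membership.Propositional.Properties using (∈-cartesianProduct⁺; ∈-cartesianProduct⁻; ∈-upTo⁺; ∈-upTo⁻; ∈-map⁺; ∈-map⁻)
  open import Data.List.Relation.Unary.Unique.Propositional using (Unique)
  open import Data.List.Relation.Unary.Unique.Propositional.Properties using (upTo⁺; cartesianProduct⁺)
  open import Data.Product using (_×_; _,_; proj₁; proj₂)
  open import Data.Sum using (_⊎_; inj₁; inj₂)
  open import Relation.Binary.PropositionalEquality
  open Counting
  open Matrices using (∣sum₃∣)

  V4 : Set
  V4 = ℤ × ℤ × ℤ × ℤ

  V4-≡ : ∀ {a b c d a′ b′ c′ d′ : ℤ} → a ≡ a′ → b ≡ b′ → c ≡ c′ → d ≡ d′ → (a , b , c , d) ≡ (a′ , b′ , c′ , d′)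
  V4-≡ refl refl refl refl = refl

  infixl 6 _⊹_
  _⊹_ : V4 → V4 → V4
  (a , b , c , d) ⊹ (e , f , g , h) = a + e , b + f , c + g , d + h

  infixr 7 _⊛_
  _⊛_ : ℤ → V4 → V4
  k ⊛ (a , b , c , d) = k * a , k * b , k * c , k * d

  infix 7 _∙_
  _∙_ : V4 → V4 → ℤ
  (a , b , c , d) ∙ (e , f , g , h) = a * e + b * f + c * g + d * h

  ∙-⊹ : ∀ c u v → c ∙ (u ⊹ v) ≡ c ∙ u + c ∙ v
  ∙-⊹ (c₁ , c₂ , c₃ , c₄) (a , b , c , d) (e , f , g , h) = lem c₁ c₂ c₃ c₄ a b c d e f g h
    where
    lem : ∀ c₁ c₂ c₃ c₄ a b c d e f g h → c₁ * (a + e) + c₂ * (b + f) + c₃ * (c + g) + c₄ * (d + h) ≡ c₁ * a + c₂ * b + c₃ * c + c₄ * d + (c₁ * e + c₂ * f + c₃ * g + c₄ * h)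
    lem = solve-∀

  ∙-⊛ : ∀ c k v → c ∙ (k ⊛ v) ≡ k * (c ∙ v)
  ∙-⊛ (c₁ , c₂ , c₃ , c₄) k (a , b , c , d) = lem c₁ c₂ c₃ c₄ k a b c d
    where
    lem : ∀ c₁ c₂ c₃ c₄ k a b c d → c₁ * (k * a) + c₂ * (k * b) + c₃ * (k * c) + c₄ * (k * d) ≡ k * (c₁ * a + c₂ * b + c₃ * c + c₄ * d)
    lem = solve-∀

  ⊛-∙ : ∀ k c v → (k ⊛ c) ∙ v ≡ k * (c ∙ v)
  ⊛-∙ k (c₁ , c₂ , c₃ , c₄) (a , b , c , d) = lem c₁ c₂ c₃ c₄ k a b c d
    where
    lem : ∀ c₁ c₂ c₃ c₄ k a b c d → k * c₁ * a + k * c₂ * b + k * c₃ * c + k * c₄ * d ≡ k * (c₁ * a + c₂ * b + c₃ * c + c₄ * d)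
    lem = solve-∀

  record In (B : ℕ) (v : V4) : Set where
    constructor inb
    field
      i₁ : ∣ proj₁ v ∣ ℕ.≤ B
      i₂ : ∣ proj₁ (proj₂ v) ∣ ℕ.≤ B
      i₃ : ∣ proj₁ (proj₂ (proj₂ v)) ∣ ℕ.≤ B
      i₄ : ∣ proj₂ (proj₂ (proj₂ v)) ∣ ℕ.≤ B

  D3 : ℤ → ℤ → ℤ → ℤ → ℤ → ℤ → ℤ → ℤ → ℤ → ℤ
  D3 a b c d e f g h i = a * (e * i - f * h) - b * (d * i - f * g) + c * (d * h - e * g)

  tail-det : V4 → V4 → V4 → ℤ
  tail-det (_ , a , b , c) (_ , d , e , f) (_ , g , h , i) = D3 a b c d e f g h i

  -- The generalised cross product: orthogonal to its three arguments.
  minors : V4 → V4 → V4 → V4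
  minors (p₁ , p₂ , p₃ , p₄) (q₁ , q₂ , q₃ , q₄) (r₁ , r₂ , r₃ , r₄) =
    D3 p₂ p₃ p₄ q₂ q₃ q₄ r₂ r₃ r₄ , - D3 p₁ p₃ p₄ q₁ q₃ q₄ r₁ r₃ r₄ , D3 p₁ p₂ p₄ q₁ q₂ q₄ r₁ r₂ r₄ , - D3 p₁ p₂ p₃ q₁ q₂ q₃ r₁ r₂ r₃

  module Babai (p q r : V4) where
    D : ℤ
    D = tail-det p q r

    E₁ E₂ E₃ : V4 → ℤ
    E₁ m = tail-det m q r
    E₂ m = tail-det p m r
    E₃ m = tail-det p q m

    module _ {{D≢0 : NonZero D}} where
     abstract
      -- Rounding modulo the lattice spanned by p, q, r: the last three coordinates of m are solved
      -- for by Cramer's rule, with numerators `E₁`, `E₂`, `E₃` over D, and the integral parts are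
      -- subtracted.
      babai : V4 → V4
      babai m = m ⊹ ((- (E₁ m / D)) ⊛ p ⊹ (- (E₂ m / D)) ⊛ q ⊹ (- (E₃ m / D)) ⊛ r)

      babai-∙ : ∀ c → c ∙ p ≡ + 0 → c ∙ q ≡ + 0 → c ∙ r ≡ + 0 → ∀ m → c ∙ babai m ≡ c ∙ m
      babai-∙ c hp hq hr m = trans (∙-⊹ c m ((- (E₁ m / D)) ⊛ p ⊹ (- (E₂ m / D)) ⊛ q ⊹ (- (E₃ m / D)) ⊛ r)) (trans (cong (λ t → c ∙ m + t) zero-part) (ℤₚ.+-identityʳ (c ∙ m)))
        where
        kill : ∀ k v → c ∙ v ≡ + 0 → c ∙ (k ⊛ v) ≡ + 0
        kill k v h = trans (∙-⊛ c k v) (trans (cong (λ t → k * t) h) (ℤₚ.*-zeroʳ k))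
        zero-part : c ∙ ((- (E₁ m / D)) ⊛ p ⊹ (- (E₂ m / D)) ⊛ q ⊹ (- (E₃ m / D)) ⊛ r) ≡ + 0
        zero-part = trans (∙-⊹ c ((- (E₁ m / D)) ⊛ p ⊹ (- (E₂ m / D)) ⊛ q) ((- (E₃ m / D)) ⊛ r)) (cong₂ _+_ (trans (∙-⊹ c ((- (E₁ m / D)) ⊛ p) ((- (E₂ m / D)) ⊛ q)) (cong₂ _+_ (kill (- (E₁ m / D)) p hp) (kill (- (E₂ m / D)) q hq))) (kill (- (E₃ m / D)) r hr))

      private
        cancelD : ∀ {n x} → ∣ D * x ∣ ℕ.≤ n ℕ.* ∣ D ∣ → ∣ x ∣ ℕ.≤ n
        cancelD {n} {x} h = ℕₚ.*-cancelʳ-≤ (∣ x ∣) n (∣ D ∣) {{nz}} (subst (ℕ._≤ n ℕ.* ∣ D ∣) (trans (ℤₚ.∣i*j∣≡∣i∣*∣j∣ D x) (ℕₚ.*-comm (∣ D ∣) (∣ x ∣))) h)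
          where
          nz : ℕ.NonZero ∣ D ∣
          nz = D≢0

        remainders : ∀ {B} m x y z → ∣ x ∣ ℕ.≤ B → ∣ y ∣ ℕ.≤ B → ∣ z ∣ ℕ.≤ B → ∣ + (E₁ m % D) * x + + (E₂ m % D) * y + + (E₃ m % D) * z ∣ ℕ.≤ 3 ℕ.* B ℕ.* ∣ D ∣
        remainders {B} m x y z hx hy hz = ℕₚ.≤-trans (∣sum₃∣ {∣ D ∣} {B} (+ (E₁ m % D)) (+ (E₂ m % D)) (+ (E₃ m % D)) x y z (rem (E₁ m)) (rem (E₂ m)) (rem (E₃ m)) hx hy hz)
          (ℕₚ.≤-reflexive (trans (cong (3 ℕ.*_) (ℕₚ.*-comm (∣ D ∣) B)) (sym (ℕₚ.*-assoc 3 B (∣ D ∣)))))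
          where
          rem : ∀ e → ∣ + (e % D) ∣ ℕ.≤ ∣ D ∣
          rem e = ℕₚ.<⇒≤ (n%d<d e D)

        division : ∀ m x y z → E₁ m * x + E₂ m * y + E₃ m * z - D * ((E₁ m / D) * x + (E₂ m / D) * y + (E₃ m / D) * z)
          ≡ + (E₁ m % D) * x + + (E₂ m % D) * y + + (E₃ m % D) * z
        division m x y z = trans (cong₂ (λ s t → s + t + E₃ m * z - D * ((E₁ m / D) * x + (E₂ m / D) * y + (E₃ m / D) * z)) (cong (_* x) (a≡a%n+[a/n]*n (E₁ m) D)) (cong (_* y) (a≡a%n+[a/n]*n (E₂ m) D)))
          (trans (cong (λ s → (+ (E₁ m % D) + (E₁ m / D) * D) * x + (+ (E₂ m % D) + (E₂ m / D) * D) * y + s * z - D * ((E₁ m / D) * x + (E₂ m / D) * y + (E₃ m / D) * z)) (a≡a%n+[a/n]*n (E₃ m) D))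
            (lem (+ (E₁ m % D)) (+ (E₂ m % D)) (+ (E₃ m % D)) (E₁ m / D) (E₂ m / D) (E₃ m / D) D x y z))
          where
          lem : ∀ r₁ r₂ r₃ k₁ k₂ k₃ D x y z → (r₁ + k₁ * D) * x + (r₂ + k₂ * D) * y + (r₃ + k₃ * D) * z - D * (k₁ * x + k₂ * y + k₃ * z) ≡ r₁ * x + r₂ * y + r₃ * z
          lem = solve-∀

        coordinate : ∀ m₀ x y z m {e} → D * m₀ ≡ E₁ m * x + E₂ m * y + E₃ m * z + e
          → D * (m₀ + ((- (E₁ m / D)) * x + (- (E₂ m / D)) * y + (- (E₃ m / D)) * z)) ≡ + (E₁ m % D) * x + + (E₂ m % D) * y + + (E₃ m % D) * z + e
        coordinate m₀ x y z m {e} h = trans (lem D m₀ (E₁ m / D) (E₂ m / D) (E₃ m / D) x y z)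
          (trans (cong (_- D * ((E₁ m / D) * x + (E₂ m / D) * y + (E₃ m / D) * z)) h)
            (trans (lem₂ (E₁ m * x + E₂ m * y + E₃ m * z) e (D * ((E₁ m / D) * x + (E₂ m / D) * y + (E₃ m / D) * z))) (cong (_+ e) (division m x y z))))
          where
          lem : ∀ D m k₁ k₂ k₃ x y z → D * (m + ((- k₁) * x + (- k₂) * y + (- k₃) * z)) ≡ D * m - D * (k₁ * x + k₂ * y + k₃ * z)
          lem = solve-∀
          lem₂ : ∀ s e t → s + e - t ≡ s - t + e
          lem₂ = solve-∀

      -- The fractional parts leave at most 3B in the last three coordinates. The first coordinate
      -- has, by Laplace expansion, the additional term (minors · m) / D, which the hypothesis
      -- limits to B; hence 4B.
      babai-bound : ∀ {B} → In B p → In B q → In B r → ∀ m → ∣ minors p q r ∙ m ∣ ℕ.≤ B ℕ.* ∣ D ∣ → In (4 ℕ.* B) (babai m)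
      babai-bound {B} (inb a₁ a₂ a₃ a₄) (inb b₁ b₂ b₃ b₄) (inb c₁ c₂ c₃ c₄) m h = inb
        (cancelD {4 ℕ.* B} (subst (λ t → ∣ t ∣ ℕ.≤ 4 ℕ.* B ℕ.* ∣ D ∣) (sym (coordinate (proj₁ m) (proj₁ p) (proj₁ q) (proj₁ r) m (laplace p q r m)))
          (ℕₚ.≤-trans (ℤₚ.∣i+j∣≤∣i∣+∣j∣ (+ (E₁ m % D) * proj₁ p + + (E₂ m % D) * proj₁ q + + (E₃ m % D) * proj₁ r) (minors p q r ∙ m)) (ℕₚ.≤-trans (ℕₚ.+-mono-≤ (remainders m (proj₁ p) (proj₁ q) (proj₁ r) a₁ b₁ c₁) h)
            (ℕₚ.≤-reflexive (trans (sym (ℕₚ.*-distribʳ-+ (∣ D ∣) (3 ℕ.* B) B)) (cong (ℕ._* ∣ D ∣) (ℕₚ.+-comm (3 ℕ.* B) B))))))))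
        (other (proj₁ (proj₂ m)) (proj₁ (proj₂ p)) (proj₁ (proj₂ q)) (proj₁ (proj₂ r)) a₂ b₂ c₂ (cramer₂ p q r m))
        (other (proj₁ (proj₂ (proj₂ m))) (proj₁ (proj₂ (proj₂ p))) (proj₁ (proj₂ (proj₂ q))) (proj₁ (proj₂ (proj₂ r))) a₃ b₃ c₃ (cramer₃ p q r m))
        (other (proj₂ (proj₂ (proj₂ m))) (proj₂ (proj₂ (proj₂ p))) (proj₂ (proj₂ (proj₂ q))) (proj₂ (proj₂ (proj₂ r))) a₄ b₄ c₄ (cramer₄ p q r m))
        where
        other : ∀ m₀ x y z → ∣ x ∣ ℕ.≤ B → ∣ y ∣ ℕ.≤ B → ∣ z ∣ ℕ.≤ B → D * m₀ ≡ E₁ m * x + E₂ m * y + E₃ m * z + + 0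
          → ∣ m₀ + ((- (E₁ m / D)) * x + (- (E₂ m / D)) * y + (- (E₃ m / D)) * z) ∣ ℕ.≤ 4 ℕ.* B
        other m₀ x y z hx hy hz e = ℕₚ.≤-trans (cancelD {3 ℕ.* B} (subst (λ t → ∣ t ∣ ℕ.≤ 3 ℕ.* B ℕ.* ∣ D ∣) (sym (trans (coordinate m₀ x y z m e) (ℤₚ.+-identityʳ (+ (E₁ m % D) * x + + (E₂ m % D) * y + + (E₃ m % D) * z)))) (remainders m x y z hx hy hz))) (ℕₚ.m≤n+m (3 ℕ.* B) B)
        laplace : ∀ p q r m → tail-det p q r * proj₁ m ≡ tail-det m q r * proj₁ p + tail-det p m r * proj₁ q + tail-det p q m * proj₁ r + minors p q r ∙ m
        laplace (a , b , c , d) (e , f , g , h) (i , j , k , l) (s , t , u , v) = lem a b c d e f g h i j k l s t u v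
          where
          lem : ∀ a b c d e f g h i j k l s t u v →
            (b * (g * l - h * k) - c * (f * l - h * j) + d * (f * k - g * j)) * s ≡
            (t * (g * l - h * k) - u * (f * l - h * j) + v * (f * k - g * j)) * a + (b * (u * l - v * k) - c * (t * l - v * j) + d * (t * k - u * j)) * e + (b * (g * v - h * u) - c * (f * v - h * t) + d * (f * u - g * t)) * i
            + ((b * (g * l - h * k) - c * (f * l - h * j) + d * (f * k - g * j)) * s + (- (a * (g * l - h * k) - c * (e * l - h * i) + d * (e * k - g * i))) * t
               + (a * (f * l - h * j) - b * (e * l - h * i) + d * (e * j - f * i)) * u + (- (a * (f * k - g * j) - b * (e * k - g * i) + c * (e * j - f * i))) * v)
          lem = solve-∀
        cramer₂ : ∀ p q r m → tail-det p q r * proj₁ (proj₂ m) ≡ tail-det m q r * proj₁ (proj₂ p) + tail-det p m r * proj₁ (proj₂ q) + tail-det p q m * proj₁ (proj₂ r) + + 0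
        cramer₂ (a , b , c , d) (e , f , g , h) (i , j , k , l) (s , t , u , v) = lem b c d f g h j k l t u v
          where
          lem : ∀ b c d f g h j k l t u v → (b * (g * l - h * k) - c * (f * l - h * j) + d * (f * k - g * j)) * t ≡
            (t * (g * l - h * k) - u * (f * l - h * j) + v * (f * k - g * j)) * b + (b * (u * l - v * k) - c * (t * l - v * j) + d * (t * k - u * j)) * f + (b * (g * v - h * u) - c * (f * v - h * t) + d * (f * u - g * t)) * j + + 0
          lem = solve-∀
        cramer₃ : ∀ p q r m → tail-det p q r * proj₁ (proj₂ (proj₂ m)) ≡ tail-det m q r * proj₁ (proj₂ (proj₂ p)) + tail-det p m r * proj₁ (proj₂ (proj₂ q)) + tail-det p q m * proj₁ (proj₂ (proj₂ r)) + + 0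
        cramer₃ (a , b , c , d) (e , f , g , h) (i , j , k , l) (s , t , u , v) = lem b c d f g h j k l t u v
          where
          lem : ∀ b c d f g h j k l t u v → (b * (g * l - h * k) - c * (f * l - h * j) + d * (f * k - g * j)) * u ≡
            (t * (g * l - h * k) - u * (f * l - h * j) + v * (f * k - g * j)) * c + (b * (u * l - v * k) - c * (t * l - v * j) + d * (t * k - u * j)) * g + (b * (g * v - h * u) - c * (f * v - h * t) + d * (f * u - g * t)) * k + + 0
          lem = solve-∀
        cramer₄ : ∀ p q r m → tail-det p q r * proj₂ (proj₂ (proj₂ m)) ≡ tail-det m q r * proj₂ (proj₂ (proj₂ p)) + tail-det p m r * proj₂ (proj₂ (proj₂ q)) + tail-det p q m * proj₂ (proj₂ (proj₂ r)) + + 0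
        cramer₄ (a , b , c , d) (e , f , g , h) (i , j , k , l) (s , t , u , v) = lem b c d f g h j k l t u v
          where
          lem : ∀ b c d f g h j k l t u v → (b * (g * l - h * k) - c * (f * l - h * j) + d * (f * k - g * j)) * v ≡
            (t * (g * l - h * k) - u * (f * l - h * j) + v * (f * k - g * j)) * d + (b * (u * l - v * k) - c * (t * l - v * j) + d * (t * k - u * j)) * h + (b * (g * v - h * u) - c * (f * v - h * t) + d * (f * u - g * t)) * l + + 0
          lem = solve-∀

  ints : ℕ → List ℤ
  ints n = map (λ k → + k - + n) (upTo (suc (2 ℕ.* n)))

  length-ints : ∀ n → length (ints n) ≡ suc (2 ℕ.* n)
  length-ints n = trans (length-map (λ k → + k - + n) (upTo (suc (2 ℕ.* n)))) (length-upTo (suc (2 ℕ.* n)))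

  ints-complete : ∀ {n z} → ∣ z ∣ ℕ.≤ n → z ∈ ints n
  ints-complete {n} {+ k} h = subst (_∈ ints n) (trans (cong (_- + n) (ℤₚ.pos-+ k n)) (lem (+ k) (+ n))) (∈-map⁺ (λ k → + k - + n) (∈-upTo⁺ (s≤s (subst (k ℕ.+ n ℕ.≤_) (cong (n ℕ.+_) (sym (ℕₚ.+-identityʳ n))) (ℕₚ.+-monoˡ-≤ n h)))))
    where
    lem : ∀ k n → k + n - n ≡ k
    lem = solve-∀
  ints-complete {n} { ℤ.-[1+ k ] } h = subst (_∈ ints n) (trans (cong (_- + n) (sym (trans (ℤₚ.m-n≡m⊖n n (suc k)) (ℤₚ.⊖-≥ h)))) (lem (+ n) (+ suc k))) (∈-map⁺ (λ k → + k - + n) (∈-upTo⁺ (s≤s (ℕₚ.≤-trans (ℕₚ.m∸n≤m n (suc k)) (ℕₚ.m≤m+n n _)))))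
    where
    lem : ∀ n k → n - k - n ≡ - k
    lem = solve-∀

  ints-sound : ∀ {n z} → z ∈ ints n → ∣ z ∣ ℕ.≤ n
  ints-sound {n} h with ∈-map⁻ (λ k → + k - + n) h
  ... | k , k∈ , refl = subst (ℕ._≤ n) (sym (cong ∣_∣ (ℤₚ.m-n≡m⊖n k n))) (by (ℕₚ.≤-total k n))
    where
    k≤ : k ℕ.≤ n ℕ.+ n
    k≤ = subst (k ℕ.≤_) (cong (n ℕ.+_) (ℕₚ.+-identityʳ n)) (ℕₚ.m<1+n⇒m≤n (∈-upTo⁻ k∈))
    by : (k ℕ.≤ n) ⊎ (n ℕ.≤ k) → ∣ k ℤ.⊖ n ∣ ℕ.≤ n
    by (inj₁ p) = subst (ℕ._≤ n) (sym (trans (ℤₚ.∣m⊖n∣≡∣n⊖m∣ k n) (cong ∣_∣ (ℤₚ.⊖-≥ p)))) (ℕₚ.m∸n≤m n k)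
    by (inj₂ p) = subst (ℕ._≤ n) (sym (cong ∣_∣ (ℤₚ.⊖-≥ p))) (ℕₚ.m≤n+o⇒m∸n≤o k n k≤)

  ints-unique : ∀ n → Unique (ints n)
  ints-unique n = map-unique (upTo⁺ (suc (2 ℕ.* n))) (λ {i} {j} _ _ e → ℤₚ.+-injective (trans (lem (+ i) (+ n)) (trans (cong (_+ + n) e) (sym (lem (+ j) (+ n))))))
    where
    lem : ∀ x z → x ≡ x - z + z
    lem = solve-∀

  box-size : ℕ → ℕ
  box-size n = suc (2 ℕ.* n) ℕ.* (suc (2 ℕ.* n) ℕ.* (suc (2 ℕ.* n) ℕ.* suc (2 ℕ.* n)))

  abstract
    box : ℕ → List V4
    box n = cartesianProduct (ints n) (cartesianProduct (ints n) (cartesianProduct (ints n) (ints n)))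

    length-box : ∀ n → length (box n) ≡ box-size n
    length-box n = go (ints n) (length-ints n)
      where
      go : ∀ {k} (I : List ℤ) → length I ≡ k → length (cartesianProduct I (cartesianProduct I (cartesianProduct I I))) ≡ k ℕ.* (k ℕ.* (k ℕ.* k))
      go I refl = trans (length-product I (cartesianProduct I (cartesianProduct I I))) (cong (length I ℕ.*_)
        (trans (length-product I (cartesianProduct I I)) (cong (length I ℕ.*_) (length-product I I))))

    box-complete : ∀ {n v} → In n v → v ∈ box n
    box-complete (inb a b c d) = ∈-cartesianProduct⁺ (ints-complete a) (∈-cartesianProduct⁺ (ints-complete b) (∈-cartesianProduct⁺ (ints-complete c) (ints-complete d)))

    box-sound : ∀ {n v} → v ∈ box n → In n v
    box-sound {n} h =
      let (h₁ , h′) = ∈-cartesianProduct⁻ (ints n) (cartesianProduct (ints n) (cartesianProduct (ints n) (ints n))) h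
          (h₂ , h″) = ∈-cartesianProduct⁻ (ints n) (cartesianProduct (ints n) (ints n)) h′
          (h₃ , h₄) = ∈-cartesianProduct⁻ (ints n) (ints n) h″
      in inb (ints-sound h₁) (ints-sound h₂) (ints-sound h₃) (ints-sound h₄)

    box-unique : ∀ n → Unique (box n)
    box-unique n = go (ints-unique n)
      where
      go : ∀ {I : List ℤ} → Unique I → Unique (cartesianProduct I (cartesianProduct I (cartesianProduct I I)))
      go u = cartesianProduct⁺ u (cartesianProduct⁺ u (cartesianProduct⁺ u u))

  ⊹-bound : ∀ {B C u v} → In B u → In C v → In (B ℕ.+ C) (u ⊹ v)
  ⊹-bound {u = u₁ , u₂ , u₃ , u₄} {v₁ , v₂ , v₃ , v₄} (inb a b c d) (inb e f g h) = inb (s u₁ v₁ a e) (s u₂ v₂ b f) (s u₃ v₃ c g) (s u₄ v₄ d h)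
    where
    s : ∀ x y {B C} → ∣ x ∣ ℕ.≤ B → ∣ y ∣ ℕ.≤ C → ∣ x + y ∣ ℕ.≤ B ℕ.+ C
    s x y h k = ℕₚ.≤-trans (ℤₚ.∣i+j∣≤∣i∣+∣j∣ x y) (ℕₚ.+-mono-≤ h k)

  ⊹-cancel : ∀ u v w → u ⊹ w ≡ v ⊹ w → u ≡ v
  ⊹-cancel (a , b , c , d) (a′ , b′ , c′ , d′) (e , f , g , h) eq = V4-≡ (k (cong proj₁ eq)) (k (cong (λ t → proj₁ (proj₂ t)) eq)) (k (cong (λ t → proj₁ (proj₂ (proj₂ t))) eq)) (k (cong (λ t → proj₂ (proj₂ (proj₂ t))) eq))
    where
    k : ∀ {x y z} → x + z ≡ y + z → x ≡ y
    k {x} {y} {z} e = trans (lem x z) (trans (cong (_- z) e) (sym (lem y z)))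
      where
      lem : ∀ x z → x ≡ x + z - z
      lem = solve-∀

  -- A certificate that c is primitive, with ζ on level one, and that its orthogonal hyperplane is
  -- spanned over ℚ by three integer vectors of size B. If c₁ ≠ 0 the determinant D of the rounding
  -- is g c₁ ≠ 0.
  record Plane (B : ℕ) (c : V4) : Set where
    field
      p q r ζ : V4
      g       : ℤ
      p-in : In B p
      q-in : In B q
      r-in : In B r
      g≢0 : g ≢ + 0
      normal : minors p q r ≡ g ⊛ c
      bezout : c ∙ ζ ≡ + 1
      ⊥p : c ∙ p ≡ + 0
      ⊥q : c ∙ q ≡ + 0
      ⊥r : c ∙ r ≡ + 0

  -- Packing: the level sets c ∙ m = i for 0 ≤ i < B |c₁| all meet the box of radius 4B, so translates of the
  -- points of A by representatives of these levels are disjoint in the box of radius 5B.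
  plane-count : ∀ {B c} → Plane B c → proj₁ c ≢ + 0 → (A : List V4) → Unique A → (∀ {v} → v ∈ A → In B v × c ∙ v ≡ + 0)
    → length A ℕ.* (B ℕ.* ∣ proj₁ c ∣) ℕ.≤ box-size (5 ℕ.* B)
  plane-count {B} {c} P c₁≢0 A uA hA = subst₂ ℕ._≤_ (trans (length-product A (upTo N)) (cong (length A ℕ.*_) (length-upTo N))) (length-box (5 ℕ.* B))
    (inject-length {f = shift} {cartesianProduct A (upTo N)} {box (5 ℕ.* B)} (cartesianProduct⁺ uA (upTo⁺ N)) inj into)
    where
    open Plane P
    N = B ℕ.* ∣ proj₁ c ∣
    open Babai p q r
    D-eq : D ≡ g * proj₁ c
    D-eq = cong proj₁ normal
    instance
      D≢0 : NonZero D
      D≢0 = ≢-nonZero (λ e → case (ℤₚ.i*j≡0⇒i≡0∨j≡0 g (trans (sym D-eq) e)))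
        where
        open import Data.Empty using (⊥)
        case : (g ≡ + 0) ⊎ (proj₁ c ≡ + 0) → ⊥
        case (inj₁ e) = g≢0 e
        case (inj₂ e) = c₁≢0 e
    rep : ℕ → V4
    rep i = babai ((+ i) ⊛ ζ)
    level : ∀ i → c ∙ ((+ i) ⊛ ζ) ≡ + i
    level i = trans (∙-⊛ c (+ i) ζ) (trans (cong (λ t → + i * t) bezout) (ℤₚ.*-identityʳ (+ i)))
    rep-level : ∀ i → c ∙ rep i ≡ + i
    rep-level i = trans (babai-∙ c ⊥p ⊥q ⊥r ((+ i) ⊛ ζ)) (level i)
    rep-in : ∀ {i} → i ℕ.< N → In (4 ℕ.* B) (rep i)
    rep-in {i} h = babai-bound p-in q-in r-in ((+ i) ⊛ ζ) (subst (ℕ._≤ B ℕ.* ∣ D ∣) (sym eq) (subst (∣ g ∣ ℕ.* i ℕ.≤_) eq₂ (ℕₚ.*-monoʳ-≤ (∣ g ∣) (ℕₚ.<⇒≤ h))))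
      where
      eq : ∣ minors p q r ∙ ((+ i) ⊛ ζ) ∣ ≡ ∣ g ∣ ℕ.* i
      eq = trans (cong ∣_∣ (trans (cong (_∙ ((+ i) ⊛ ζ)) normal) (trans (⊛-∙ g c ((+ i) ⊛ ζ)) (cong (λ t → g * t) (level i))))) (ℤₚ.∣i*j∣≡∣i∣*∣j∣ g (+ i))
      eq₂ : ∣ g ∣ ℕ.* (B ℕ.* ∣ proj₁ c ∣) ≡ B ℕ.* ∣ D ∣
      eq₂ = trans (sym (ℕₚ.*-assoc (∣ g ∣) B (∣ proj₁ c ∣))) (trans (cong (ℕ._* ∣ proj₁ c ∣) (ℕₚ.*-comm (∣ g ∣) B)) (trans (ℕₚ.*-assoc B (∣ g ∣) (∣ proj₁ c ∣)) (cong (B ℕ.*_) (trans (sym (ℤₚ.∣i*j∣≡∣i∣*∣j∣ g (proj₁ c))) (cong ∣_∣ (sym D-eq))))))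
    shift : V4 × ℕ → V4
    shift (a , i) = a ⊹ rep i
    parts : ∀ {t} → t ∈ cartesianProduct A (upTo N) → proj₁ t ∈ A × proj₂ t ℕ.< N
    parts h = let (a , b) = ∈-cartesianProduct⁻ A (upTo N) h in a , ∈-upTo⁻ b
    value : ∀ {t} → t ∈ cartesianProduct A (upTo N) → c ∙ shift t ≡ + proj₂ t
    value {a , i} h = trans (∙-⊹ c a (rep i)) (trans (cong₂ _+_ (proj₂ (hA (proj₁ (parts h)))) (rep-level i)) (ℤₚ.+-identityˡ (+ i)))
    inj : ∀ {s t} → s ∈ cartesianProduct A (upTo N) → t ∈ cartesianProduct A (upTo N) → shift s ≡ shift t → s ≡ t
    inj {a , i} {b , j} hs ht e = same (ℤₚ.+-injective (trans (sym (value hs)) (trans (cong (c ∙_) e) (value ht)))) e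
      where
      same : i ≡ j → shift (a , i) ≡ shift (b , j) → (a , i) ≡ (b , j)
      same refl e = cong (_, i) (⊹-cancel a b (rep i) e)
    into : ∀ {t} → t ∈ cartesianProduct A (upTo N) → shift t ∈ box (5 ℕ.* B)
    into h = box-complete (⊹-bound (proj₁ (hA (proj₁ (parts h)))) (rep-in (proj₂ (parts h))))

-- Counting triples of vectors with a degenerate normal.

module DegenerateTriples where

  open import Data.Nat as ℕ using (ℕ; zero; suc; z≤n; s≤s; _/_; NonZero)
  import Data.Nat.Properties as ℕₚ
  open import Data.Nat.DivMod using (m*n/n≡m; /-monoˡ-≤; /-monoʳ-≤; m/n*n≤m; n/1≡n)
  open import Data.Nat.Divisibility using (divides)
  open import Data.Nat.GCD using (module Bézout; GCD)
  open import Data.Nat.Primality using (Prime)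
  open import Data.Integer using (ℤ; +_; -_; _+_; _*_; _-_; ∣_∣; -[1+_])
  import Data.Integer as ℤ
  import Data.Integer.Properties as ℤₚ
  open import Data.Integer.Tactic.RingSolver using (solve-∀)
  open import Data.List using (List; []; _∷_; length; filter; upTo; map; cartesianProduct; _++_)
  open import Data.List.Properties using (length-upTo; length-map)
  open import Data.List.Membership.Propositional using (_∈_)
  open import Data.List.Membership.Propositional.Properties using (∈-cartesianProduct⁺; ∈-upTo⁺; ∈-map⁺; ∈-map⁻; ∈-filter⁺; ∈-filter⁻; ∈-++⁺ˡ; ∈-++⁺ʳ)
  open import Data.List.Relation.Unary.Any using (here)
  open import Data.List.Relation.Unary.Unique.Propositional using (Unique)
  open import Data.List.Relation.Unary.Unique.Propositional.Properties using (filter⁺)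
  open import Data.Product using (Σ; _×_; _,_; proj₁; proj₂)
  open import Data.Product.Properties using (≡-dec)
  open import Relation.Nullary using (Dec; yes; no; ¬_)
  open import Relation.Binary.PropositionalEquality
  open Counting
  open Hyperplanes
  open Residues hiding (pt)
  open Matrices using (∣sum₃∣)

  sign-split : ∀ a → Σ ℤ λ s → (a ≡ s * + ∣ a ∣) × (+ ∣ a ∣ ≡ s * a)
  sign-split (+ n) = + 1 , sym (ℤₚ.*-identityˡ (+ n)) , sym (ℤₚ.*-identityˡ (+ n))
  sign-split -[1+ n ] = - (+ 1) , sym (ℤₚ.-1*i≡-i (+ suc n)) , sym (ℤₚ.-1*i≡-i -[1+ n ])

  record Bez (a b : ℤ) : Set where
    field
      g a′ b′ u v : ℤ
      a-eq : a ≡ g * a′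
      b-eq : b ≡ g * b′
      comb : g ≡ u * a + v * b

  bez : ∀ a b → Bez a b
  bez a b = from (Bézout.lemma (∣ a ∣) (∣ b ∣)) (sign-split a) (sign-split b)
    where
    pos : ∀ k m d → k ≡ m ℕ.* d → + k ≡ + d * + m
    pos k m d e = trans (cong +_ (trans e (ℕₚ.*-comm m d))) (ℤₚ.pos-* d m)
    from : Bézout.Lemma (∣ a ∣) (∣ b ∣) → (Σ ℤ λ s → (a ≡ s * + ∣ a ∣) × (+ ∣ a ∣ ≡ s * a)) → (Σ ℤ λ s → (b ≡ s * + ∣ b ∣) × (+ ∣ b ∣ ≡ s * b)) → Bez a b
    from (Bézout.result d isg id) (s , ea , ea′) (t , eb , eb′) with GCD.gcd∣m isg | GCD.gcd∣n isg
    ... | divides m em | divides n en = record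
      { g = + d ; a′ = s * + m ; b′ = t * + n ; u = proj₁ uv ; v = proj₁ (proj₂ uv)
      ; a-eq = trans ea (trans (cong (λ z → s * z) (pos (∣ a ∣) m d em)) (lem s (+ d) (+ m)))
      ; b-eq = trans eb (trans (cong (λ z → t * z) (pos (∣ b ∣) n d en)) (lem t (+ d) (+ n)))
      ; comb = proj₂ (proj₂ uv) }
      where
      lem : ∀ s d m → s * (d * m) ≡ d * (s * m)
      lem = solve-∀
      uv : Σ ℤ λ u → Σ ℤ λ v → + d ≡ u * a + v * b
      uv = comb id
        where
        comb : Bézout.Identity d (∣ a ∣) (∣ b ∣) → Σ ℤ λ u → Σ ℤ λ v → + d ≡ u * a + v * b
        comb (Bézout.+- x y e) = + x * s , - (+ y * t) , trans (l₁ (+ d) (+ y * + ∣ b ∣)) (trans (cong (_- + y * + ∣ b ∣) e′) (trans (cong₂ (λ α β → + x * α - + y * β) ea′ eb′) (l₂ (+ x) (+ y) s t a b)))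
          where
          e′ : + d + + y * + ∣ b ∣ ≡ + x * + ∣ a ∣
          e′ = trans (cong (λ z → + d + z) (sym (ℤₚ.pos-* y (∣ b ∣)))) (trans (cong +_ e) (ℤₚ.pos-* x (∣ a ∣)))
          l₁ : ∀ d k → d ≡ d + k - k
          l₁ = solve-∀
          l₂ : ∀ x y s t a b → x * (s * a) - y * (t * b) ≡ (x * s) * a + (- (y * t)) * b
          l₂ = solve-∀
        comb (Bézout.-+ x y e) = - (+ x * s) , + y * t , trans (l₁ (+ d) (+ x * + ∣ a ∣)) (trans (cong (_- + x * + ∣ a ∣) e′) (trans (cong₂ (λ β α → + y * β - + x * α) eb′ ea′) (l₂ (+ x) (+ y) s t a b)))
          where
          e′ : + d + + x * + ∣ a ∣ ≡ + y * + ∣ b ∣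
          e′ = trans (cong (λ z → + d + z) (sym (ℤₚ.pos-* x (∣ a ∣)))) (trans (cong +_ e) (ℤₚ.pos-* y (∣ b ∣)))
          l₁ : ∀ d k → d ≡ d + k - k
          l₁ = solve-∀
          l₂ : ∀ x y s t a b → y * (t * b) - x * (s * a) ≡ (- (x * s)) * a + (y * t) * b
          l₂ = solve-∀

  record Content (μ : V4) : Set where
    field
      g : ℤ
      c ζ : V4
      factor : μ ≡ g ⊛ c
      comb   : g ≡ μ ∙ ζ

  abstract
    -- The greatest common divisor of four integers, as the one of the two pairwise ones; the Bézout
    -- coefficients multiply along, and the signs are carried by the cofactors.
    content : ∀ μ → Content μ
    content (a , b , c , d) = record
      { g = X.g ; c = (Y.a′ * X.a′ , Y.b′ * X.a′ , T.a′ * X.b′ , T.b′ * X.b′) ; ζ = (X.u * Y.u , X.u * Y.v , X.v * T.u , X.v * T.v)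
      ; factor = V4-≡ (trans Y.a-eq (trans (cong (_* Y.a′) X.a-eq) (lem X.g X.a′ Y.a′))) (trans Y.b-eq (trans (cong (_* Y.b′) X.a-eq) (lem X.g X.a′ Y.b′)))
          (trans T.a-eq (trans (cong (_* T.a′) X.b-eq) (lem X.g X.b′ T.a′))) (trans T.b-eq (trans (cong (_* T.b′) X.b-eq) (lem X.g X.b′ T.b′)))
      ; comb = trans X.comb (trans (cong₂ (λ α β → X.u * α + X.v * β) Y.comb T.comb) (lem₂ X.u X.v Y.u Y.v T.u T.v a b c d)) }
      where
      module Y = Bez (bez a b)
      module T = Bez (bez c d)
      module X = Bez (bez Y.g T.g)
      lem : ∀ g x y → g * x * y ≡ g * (y * x)
      lem = solve-∀
      lem₂ : ∀ x x′ y y′ t t′ a b c d → x * (y * a + y′ * b) + x′ * (t * c + t′ * d) ≡ a * (x * y) + b * (x * y′) + c * (x′ * t) + d * (x′ * t′)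
      lem₂ = solve-∀

  content-bezout : ∀ {μ} (K : Content μ) → Content.g K ≢ + 0 → Content.c K ∙ Content.ζ K ≡ + 1
  content-bezout {μ} K g≢0 = ℤₚ.*-cancelˡ-≡ g (c ∙ ζ) (+ 1) {{ℤ.≢-nonZero g≢0}} (trans (sym (⊛-∙ g c ζ)) (trans (cong (_∙ ζ) (sym factor)) (trans (sym comb) (sym (ℤₚ.*-identityʳ g)))))
    where open Content K

  -- Transpositions of coordinates. `plane-count` measures by the first coordinate of the normal
  -- only; these carry it over to the second and third.
  sw₂ sw₃ : V4 → V4
  sw₂ (a , b , c , d) = b , a , c , d
  sw₃ (a , b , c , d) = c , b , a , d

  In-sw₂ : ∀ {B v} → In B v → In B (sw₂ v)
  In-sw₂ (inb a b c d) = inb b a c d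
  In-sw₃ : ∀ {B v} → In B v → In B (sw₃ v)
  In-sw₃ (inb a b c d) = inb c b a d

  ∙-sw₂ : ∀ u v → sw₂ u ∙ sw₂ v ≡ u ∙ v
  ∙-sw₂ (a , b , c , d) (e , f , g , h) = lem a b c d e f g h
    where
    lem : ∀ a b c d e f g h → b * f + a * e + c * g + d * h ≡ a * e + b * f + c * g + d * h
    lem = solve-∀
  ∙-sw₃ : ∀ u v → sw₃ u ∙ sw₃ v ≡ u ∙ v
  ∙-sw₃ (a , b , c , d) (e , f , g , h) = lem a b c d e f g h
    where
    lem : ∀ a b c d e f g h → c * g + b * f + a * e + d * h ≡ a * e + b * f + c * g + d * h
    lem = solve-∀

  minors-sw₂ : ∀ p q r → minors (sw₂ p) (sw₂ q) (sw₂ r) ≡ (- (+ 1)) ⊛ sw₂ (minors p q r)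
  minors-sw₂ (a , b , c , d) (e , f , g , h) (i , j , k , l) = V4-≡ (l₁ a c d e g h i k l) (l₂ b c d f g h j k l) (l₃ a b d e f h i j l) (l₄ a b c e f g i j k)
    where
    l₁ : ∀ a c d e g h i k l → a * (g * l - h * k) - c * (e * l - h * i) + d * (e * k - g * i) ≡ (- (+ 1)) * (- (a * (g * l - h * k) - c * (e * l - h * i) + d * (e * k - g * i)))
    l₁ = solve-∀
    l₂ : ∀ b c d f g h j k l → - (b * (g * l - h * k) - c * (f * l - h * j) + d * (f * k - g * j)) ≡ (- (+ 1)) * (b * (g * l - h * k) - c * (f * l - h * j) + d * (f * k - g * j))
    l₂ = solve-∀
    l₃ : ∀ a b d e f h i j l → b * (e * l - h * i) - a * (f * l - h * j) + d * (f * i - e * j) ≡ (- (+ 1)) * (a * (f * l - h * j) - b * (e * l - h * i) + d * (e * j - f * i))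
    l₃ = solve-∀
    l₄ : ∀ a b c e f g i j k → - (b * (e * k - g * i) - a * (f * k - g * j) + c * (f * i - e * j)) ≡ (- (+ 1)) * (- (a * (f * k - g * j) - b * (e * k - g * i) + c * (e * j - f * i)))
    l₄ = solve-∀

  minors-sw₃ : ∀ p q r → minors (sw₃ p) (sw₃ q) (sw₃ r) ≡ (- (+ 1)) ⊛ sw₃ (minors p q r)
  minors-sw₃ (a , b , c , d) (e , f , g , h) (i , j , k , l) = V4-≡ (l₁ a b d e f h i j l) (l₂ a c d e g h i k l) (l₃ b c d f g h j k l) (l₄ a b c e f g i j k)
    where
    l₁ : ∀ a b d e f h i j l → b * (e * l - h * i) - a * (f * l - h * j) + d * (f * i - e * j) ≡ (- (+ 1)) * (a * (f * l - h * j) - b * (e * l - h * i) + d * (e * j - f * i))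
    l₁ = solve-∀
    l₂ : ∀ a c d e g h i k l → - (c * (e * l - h * i) - a * (g * l - h * k) + d * (g * i - e * k)) ≡ (- (+ 1)) * (- (a * (g * l - h * k) - c * (e * l - h * i) + d * (e * k - g * i)))
    l₂ = solve-∀
    l₃ : ∀ b c d f g h j k l → c * (f * l - h * j) - b * (g * l - h * k) + d * (g * j - f * k) ≡ (- (+ 1)) * (b * (g * l - h * k) - c * (f * l - h * j) + d * (f * k - g * j))
    l₃ = solve-∀
    l₄ : ∀ a b c e f g i j k → - (c * (f * i - e * j) - b * (g * i - e * k) + a * (g * j - f * k)) ≡ (- (+ 1)) * (- (a * (f * k - g * j) - b * (e * k - g * i) + c * (e * j - f * i)))
    l₄ = solve-∀

  Plane-sw : ∀ {B c} (sw : V4 → V4) → (∀ {v} → In B v → In B (sw v)) → (∀ u v → sw u ∙ sw v ≡ u ∙ v)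
    → (∀ p q r → minors (sw p) (sw q) (sw r) ≡ (- (+ 1)) ⊛ sw (minors p q r)) → (∀ k v → sw (k ⊛ v) ≡ k ⊛ sw v) → Plane B c → Plane B (sw c)
  Plane-sw {B} {c} sw inS dotS minS linS P = record
    { p = sw p ; q = sw q ; r = sw r ; ζ = sw ζ ; g = - g ; p-in = inS p-in ; q-in = inS q-in ; r-in = inS r-in
    ; g≢0 = λ e → g≢0 (trans (sym (ℤₚ.neg-involutive g)) (cong -_ e))
    ; normal = trans (minS p q r) (trans (cong (λ z → (- (+ 1)) ⊛ sw z) normal) (trans (cong ((- (+ 1)) ⊛_) (linS g c)) (neg⊛ g (sw c))))
    ; bezout = trans (dotS c ζ) bezout ; ⊥p = trans (dotS c p) ⊥p ; ⊥q = trans (dotS c q) ⊥q ; ⊥r = trans (dotS c r) ⊥r }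
    where
    open Plane P
    neg⊛ : ∀ g c → (- (+ 1)) ⊛ (g ⊛ c) ≡ (- g) ⊛ c
    neg⊛ g (a , b , c , d) = V4-≡ (l g a) (l g b) (l g c) (l g d)
      where
      l : ∀ g a → (- (+ 1)) * (g * a) ≡ (- g) * a
      l = solve-∀

  -- max (1 , |z|)
  ht : ℤ → ℕ
  ht z = suc (ℕ.pred ∣ z ∣)

  ht-nonzero : ∀ z → z ≢ + 0 → ht z ≡ ∣ z ∣
  ht-nonzero z h = ℕₚ.suc-pred (∣ z ∣) {{ℕ.≢-nonZero (λ e → h (ℤₚ.∣i∣≡0⇒i≡0 e))}}

  module PlanePoints {B c} (P : Plane B c) (c₁≢0 : proj₁ c ≢ + 0) where

    on? : ∀ v → Dec (c ∙ v ≡ + 0)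
    on? v = c ∙ v ℤ.≟ + 0

    points : List V4
    points = filter on? (box B)

    points-unique : Unique points
    points-unique = filter⁺ on? (box-unique B)

    points-complete : ∀ {v} → In B v → c ∙ v ≡ + 0 → v ∈ points
    points-complete i e = ∈-filter⁺ on? (box-complete i) e

    points-sound : ∀ {v} → v ∈ points → In B v × c ∙ v ≡ + 0
    points-sound h = let (i , e) = ∈-filter⁻ on? {xs = box B} h in box-sound i , e

    N : ℕ
    N = length points

    via : (sw : V4 → V4) → (∀ {v} → In B v → In B (sw v)) → (∀ u v → sw u ∙ sw v ≡ u ∙ v) → (∀ u v → sw u ≡ sw v → u ≡ v)
      → Plane B (sw c) → proj₁ (sw c) ≢ + 0 → N ℕ.* (B ℕ.* ∣ proj₁ (sw c) ∣) ℕ.≤ box-size (5 ℕ.* B)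
    via sw inS dotS injS P′ nz = subst (λ n → n ℕ.* (B ℕ.* ∣ proj₁ (sw c) ∣) ℕ.≤ box-size (5 ℕ.* B)) (length-map sw points)
      (plane-count P′ nz (map sw points) (map-unique points-unique (λ {u} {v} _ _ e → injS u v e)) sound)
      where
      sound : ∀ {v} → v ∈ map sw points → In B v × sw c ∙ v ≡ + 0
      sound h with ∈-map⁻ sw h
      ... | u , u∈ , refl = inS (proj₁ (points-sound u∈)) , trans (dotS c u) (proj₂ (points-sound u∈))

    bound₁ : N ℕ.* (B ℕ.* ht (proj₁ c)) ℕ.≤ box-size (5 ℕ.* B)
    bound₁ = subst (λ h → N ℕ.* (B ℕ.* h) ℕ.≤ box-size (5 ℕ.* B)) (sym (ht-nonzero (proj₁ c) c₁≢0)) (plane-count P c₁≢0 points points-unique points-sound)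

    bound : ∀ (sw : V4 → V4) → (∀ {v} → In B v → In B (sw v)) → (∀ u v → sw u ∙ sw v ≡ u ∙ v) → (∀ u v → sw u ≡ sw v → u ≡ v)
      → Plane B (sw c) → N ℕ.* (B ℕ.* ht (proj₁ (sw c))) ℕ.≤ box-size (5 ℕ.* B)
    bound sw inS dotS injS P′ = by (proj₁ (sw c) ℤ.≟ + 0)
      where
      by : Dec (proj₁ (sw c) ≡ + 0) → N ℕ.* (B ℕ.* ht (proj₁ (sw c))) ℕ.≤ box-size (5 ℕ.* B)
      by (no nz) = subst (λ h → N ℕ.* (B ℕ.* h) ℕ.≤ box-size (5 ℕ.* B)) (sym (ht-nonzero (proj₁ (sw c)) nz)) (via sw inS dotS injS P′ nz)
      -- A vanishing coordinate has height 1, which is at most the height of c₁, so the bound for c₁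
      -- covers it.
      by (yes e) = ℕₚ.≤-trans (ℕₚ.*-monoʳ-≤ N (ℕₚ.*-monoʳ-≤ B (subst (λ z → ht z ℕ.≤ ht (proj₁ c)) (sym e) (s≤s z≤n)))) bound₁

    bound₂ : N ℕ.* (B ℕ.* ht (proj₁ (proj₂ c))) ℕ.≤ box-size (5 ℕ.* B)
    bound₂ = bound sw₂ In-sw₂ ∙-sw₂ (λ u v e → cong sw₂ e) (Plane-sw sw₂ In-sw₂ ∙-sw₂ minors-sw₂ (λ k v → refl) P)

    bound₃ : N ℕ.* (B ℕ.* ht (proj₁ (proj₂ (proj₂ c)))) ℕ.≤ box-size (5 ℕ.* B)
    bound₃ = bound sw₃ In-sw₃ ∙-sw₃ (λ u v e → cong sw₃ e) (Plane-sw sw₃ In-sw₃ ∙-sw₃ minors-sw₃ (λ k v → refl) P)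

  le-div : ∀ m n o .{{_ : NonZero n}} → m ℕ.* n ℕ.≤ o → m ℕ.≤ o / n
  le-div m n o h = subst (ℕ._≤ o / n) (m*n/n≡m m n) (/-monoˡ-≤ n h)

  Key : Set
  Key = ℤ × ℤ × ℤ

  -- V / (|a| |b| |c|) with zeros counted as one; the divisions are nested so that the sum over keys
  -- can be taken one coordinate at a time.
  weight : ℕ → Key → ℕ
  weight V (a , b , c) = V / ht a / ht b / ht c

  signed : ℕ → List ℤ
  signed ℓ = map +_ (upTo (2 ℕ.^ ℓ)) ++ map (λ n → - (+ n)) (upTo (2 ℕ.^ ℓ))

  signed-complete : ∀ {ℓ z} → ∣ z ∣ ℕ.< 2 ℕ.^ ℓ → z ∈ signed ℓ
  signed-complete {ℓ} {+ n} h = ∈-++⁺ˡ (∈-map⁺ +_ (∈-upTo⁺ h))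
  signed-complete {ℓ} { -[1+ n ] } h = ∈-++⁺ʳ (map +_ (upTo (2 ℕ.^ ℓ))) (∈-map⁺ (λ n → - (+ n)) (∈-upTo⁺ h))

  upTo-split : ∀ m n (f : ℕ → ℕ) → sumL (upTo (n ℕ.+ m)) f ≡ sumL (upTo m) f ℕ.+ sumL (upTo n) (λ i → f (i ℕ.+ m))
  upTo-split m zero f = sym (ℕₚ.+-identityʳ _)
  upTo-split m (suc n) f = trans (sumL-upTo (n ℕ.+ m) f) (trans (cong (ℕ._+ f (n ℕ.+ m)) (upTo-split m n f))
      (trans (ℕₚ.+-assoc (sumL (upTo m) f) (sumL (upTo n) (λ i → f (i ℕ.+ m))) (f (n ℕ.+ m))) (cong (sumL (upTo m) f ℕ.+_) (sym (sumL-upTo n (λ i → f (i ℕ.+ m)))))))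

  -- Dyadic blocks: the 2^ℓ terms of the next block are each at most W / 2^ℓ. The term at 0 counts
  -- as W, which is the starting value.
  harmonic : ∀ W ℓ → sumL (upTo (2 ℕ.^ ℓ)) (λ n → W / suc (ℕ.pred n)) ℕ.≤ W ℕ.* suc ℓ
  harmonic W zero = ℕₚ.≤-reflexive (trans (ℕₚ.+-identityʳ (W / 1)) (trans (n/1≡n W) (sym (ℕₚ.*-identityʳ W))))
  harmonic W (suc ℓ) = begin
    sumL (upTo (2 ℕ.^ suc ℓ)) f ≡⟨ cong (λ k → sumL (upTo k) f) (cong (p ℕ.+_) (ℕₚ.+-identityʳ p)) ⟩
    sumL (upTo (p ℕ.+ p)) f ≡⟨ upTo-split p p f ⟩
    sumL (upTo p) f ℕ.+ sumL (upTo p) (λ i → f (i ℕ.+ p)) ≤⟨ ℕₚ.+-mono-≤ (harmonic W ℓ) (sumL-mono (upTo p) (λ i _ → small i)) ⟩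
    W ℕ.* suc ℓ ℕ.+ sumL (upTo p) (λ _ → W / p) ≡⟨ cong (W ℕ.* suc ℓ ℕ.+_) (trans (sumL-const (upTo p) (W / p)) (trans (cong (ℕ._* (W / p)) (length-upTo p)) (ℕₚ.*-comm p (W / p)))) ⟩
    W ℕ.* suc ℓ ℕ.+ (W / p) ℕ.* p ≤⟨ ℕₚ.+-monoʳ-≤ (W ℕ.* suc ℓ) (m/n*n≤m W p) ⟩
    W ℕ.* suc ℓ ℕ.+ W ≡⟨ trans (ℕₚ.+-comm (W ℕ.* suc ℓ) W) (sym (ℕₚ.*-suc W (suc ℓ))) ⟩
    W ℕ.* suc (suc ℓ) ∎
    where
    open ℕₚ.≤-Reasoning
    f : ℕ → ℕ
    f n = W / suc (ℕ.pred n)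
    p = 2 ℕ.^ ℓ
    instance
      p≢0 : NonZero p
      p≢0 = ℕₚ.m^n≢0 2 ℓ
    small : ∀ i → f (i ℕ.+ p) ℕ.≤ W / p
    small i = /-monoʳ-≤ W (ℕₚ.≤-trans (ℕₚ.m≤n+m p i) (ℕₚ.≤-reflexive (sym (ℕₚ.suc-pred (i ℕ.+ p) {{ℕ.>-nonZero (ℕₚ.<-≤-trans (ℕ.>-nonZero⁻¹ p) (ℕₚ.m≤n+m p i))}}))))

  signed-sum : ∀ W ℓ → sumL (signed ℓ) (λ z → W / ht z) ℕ.≤ W ℕ.* (2 ℕ.* suc ℓ)
  signed-sum W ℓ = begin
    sumL (signed ℓ) f ≡⟨ sumL-++ (map +_ (upTo p)) (map (λ n → - (+ n)) (upTo p)) f ⟩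
    sumL (map +_ (upTo p)) f ℕ.+ sumL (map (λ n → - (+ n)) (upTo p)) f ≡⟨ cong₂ ℕ._+_ (sumL-map +_ (upTo p) f) (trans (sumL-map (λ n → - (+ n)) (upTo p) f) (sumL-cong (upTo p) (λ n → cong (λ k → W / suc (ℕ.pred k)) (ℤₚ.∣-i∣≡∣i∣ (+ n))))) ⟩
    sumL (upTo p) (λ n → W / suc (ℕ.pred n)) ℕ.+ sumL (upTo p) (λ n → W / suc (ℕ.pred n)) ≤⟨ ℕₚ.+-mono-≤ (harmonic W ℓ) (harmonic W ℓ) ⟩
    W ℕ.* suc ℓ ℕ.+ W ℕ.* suc ℓ ≡⟨ trans (sym (ℕₚ.*-distribˡ-+ W (suc ℓ) (suc ℓ))) (cong (λ k → W ℕ.* (suc ℓ ℕ.+ k)) (sym (ℕₚ.+-identityʳ (suc ℓ)))) ⟩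
    W ℕ.* (2 ℕ.* suc ℓ) ∎
    where
    open ℕₚ.≤-Reasoning
    p = 2 ℕ.^ ℓ
    f : ℤ → ℕ
    f z = W / ht z

  keys : ℕ → List Key
  keys ℓ = cartesianProduct (signed ℓ) (cartesianProduct (signed ℓ) (signed ℓ))

  keys-sum : ∀ V ℓ → let L = 2 ℕ.* suc ℓ in sumL (keys ℓ) (weight V) ℕ.≤ V ℕ.* L ℕ.* L ℕ.* L
  keys-sum V ℓ = begin
    sumL (keys ℓ) (weight V) ≡⟨ trans (sumL-product R (cartesianProduct R R) (weight V)) (sumL-cong R (λ a → sumL-product R R (λ t → weight V (a , t)))) ⟩
    sumL R (λ a → sumL R (λ b → sumL R (λ c → V / ht a / ht b / ht c))) ≤⟨ sumL-mono R (λ a _ → sumL-mono R (λ b _ → signed-sum (V / ht a / ht b) ℓ)) ⟩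
    sumL R (λ a → sumL R (λ b → V / ht a / ht b ℕ.* L)) ≡⟨ sumL-cong R (λ a → pull (λ b → V / ht a / ht b)) ⟩
    sumL R (λ a → sumL R (λ b → V / ht a / ht b) ℕ.* L) ≤⟨ sumL-mono R (λ a _ → ℕₚ.*-monoˡ-≤ L (signed-sum (V / ht a) ℓ)) ⟩
    sumL R (λ a → V / ht a ℕ.* L ℕ.* L) ≡⟨ trans (pull (λ a → V / ht a ℕ.* L)) (cong (ℕ._* L) (pull (λ a → V / ht a))) ⟩
    sumL R (λ a → V / ht a) ℕ.* L ℕ.* L ≤⟨ ℕₚ.*-monoˡ-≤ L (ℕₚ.*-monoˡ-≤ L (signed-sum V ℓ)) ⟩
    V ℕ.* L ℕ.* L ℕ.* L ∎
    where
    open ℕₚ.≤-Reasoning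
    R = signed ℓ
    L = 2 ℕ.* suc ℓ
    pull : ∀ (f : ℤ → ℕ) → sumL R (λ a → f a ℕ.* L) ≡ sumL R f ℕ.* L
    pull f = trans (sumL-cong R (λ a → ℕₚ.*-comm (f a) L)) (trans (sumL-* R L f) (ℕₚ.*-comm L (sumL R f)))

  minorBound : ℕ → ℕ
  minorBound B = 3 ℕ.* (B ℕ.* (B ℕ.* B ℕ.+ B ℕ.* B))

  D3-bound : ∀ {B} a b c d e f g h i → ∣ a ∣ ℕ.≤ B → ∣ b ∣ ℕ.≤ B → ∣ c ∣ ℕ.≤ B → ∣ d ∣ ℕ.≤ B → ∣ e ∣ ℕ.≤ B → ∣ f ∣ ℕ.≤ B → ∣ g ∣ ℕ.≤ B → ∣ h ∣ ℕ.≤ B → ∣ i ∣ ℕ.≤ B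
    → ∣ D3 a b c d e f g h i ∣ ℕ.≤ minorBound B
  D3-bound {B} a b c d e f g h i ha hb hc hd he hf hg hh hi = subst (λ t → ∣ t ∣ ℕ.≤ minorBound B) (lem a b c (e * i - f * h) (d * i - f * g) (d * h - e * g))
    (∣sum₃∣ {B} {B ℕ.* B ℕ.+ B ℕ.* B} a (- b) c (e * i - f * h) (d * i - f * g) (d * h - e * g) ha (subst (ℕ._≤ B) (sym (ℤₚ.∣-i∣≡∣i∣ b)) hb) hc (two e i f h he hi hf hh) (two d i f g hd hi hf hg) (two d h e g hd hh he hg))
    where
    lem : ∀ a b c x y z → a * x + (- b) * y + c * z ≡ a * x - b * y + c * z
    lem = solve-∀
    prod : ∀ x y → ∣ x ∣ ℕ.≤ B → ∣ y ∣ ℕ.≤ B → ∣ x * y ∣ ℕ.≤ B ℕ.* B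
    prod x y hx hy = subst (ℕ._≤ B ℕ.* B) (sym (ℤₚ.∣i*j∣≡∣i∣*∣j∣ x y)) (ℕₚ.*-mono-≤ hx hy)
    two : ∀ x y z w → ∣ x ∣ ℕ.≤ B → ∣ y ∣ ℕ.≤ B → ∣ z ∣ ℕ.≤ B → ∣ w ∣ ℕ.≤ B → ∣ x * y - z * w ∣ ℕ.≤ B ℕ.* B ℕ.+ B ℕ.* B
    two x y z w hx hy hz hw = ℕₚ.≤-trans (ℤₚ.∣i-j∣≤∣i∣+∣j∣ (x * y) (z * w)) (ℕₚ.+-mono-≤ (prod x y hx hy) (prod z w hz hw))

  minors-bound : ∀ {B p q r} → In B p → In B q → In B r → In (minorBound B) (minors p q r)
  minors-bound {B} {p₁ , p₂ , p₃ , p₄} {q₁ , q₂ , q₃ , q₄} {r₁ , r₂ , r₃ , r₄} (inb a₁ a₂ a₃ a₄) (inb b₁ b₂ b₃ b₄) (inb c₁ c₂ c₃ c₄) = inb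
    (D3-bound p₂ p₃ p₄ q₂ q₃ q₄ r₂ r₃ r₄ a₂ a₃ a₄ b₂ b₃ b₄ c₂ c₃ c₄)
    (neg (D3 p₁ p₃ p₄ q₁ q₃ q₄ r₁ r₃ r₄) (D3-bound p₁ p₃ p₄ q₁ q₃ q₄ r₁ r₃ r₄ a₁ a₃ a₄ b₁ b₃ b₄ c₁ c₃ c₄))
    (D3-bound p₁ p₂ p₄ q₁ q₂ q₄ r₁ r₂ r₄ a₁ a₂ a₄ b₁ b₂ b₄ c₁ c₂ c₄)
    (neg (D3 p₁ p₂ p₃ q₁ q₂ q₃ r₁ r₂ r₃) (D3-bound p₁ p₂ p₃ q₁ q₂ q₃ r₁ r₂ r₃ a₁ a₂ a₃ b₁ b₂ b₃ c₁ c₂ c₃))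
    where
    neg : ∀ x {n} → ∣ x ∣ ℕ.≤ n → ∣ - x ∣ ℕ.≤ n
    neg x {n} h = subst (ℕ._≤ n) (sym (ℤₚ.∣-i∣≡∣i∣ x)) h

  minors-⊥ : ∀ p q r → (minors p q r ∙ p ≡ + 0) × (minors p q r ∙ q ≡ + 0) × (minors p q r ∙ r ≡ + 0)
  minors-⊥ (a , b , c , d) (e , f , g , h) (i , j , k , l) = l₁ a b c d e f g h i j k l , l₂ a b c d e f g h i j k l , l₃ a b c d e f g h i j k l
    where
    l₁ : ∀ a b c d e f g h i j k l → (b * (g * l - h * k) - c * (f * l - h * j) + d * (f * k - g * j)) * a + (- (a * (g * l - h * k) - c * (e * l - h * i) + d * (e * k - g * i))) * b
       + (a * (f * l - h * j) - b * (e * l - h * i) + d * (e * j - f * i)) * c + (- (a * (f * k - g * j) - b * (e * k - g * i) + c * (e * j - f * i))) * d ≡ + 0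
    l₁ = solve-∀
    l₂ : ∀ a b c d e f g h i j k l → (b * (g * l - h * k) - c * (f * l - h * j) + d * (f * k - g * j)) * e + (- (a * (g * l - h * k) - c * (e * l - h * i) + d * (e * k - g * i))) * f
       + (a * (f * l - h * j) - b * (e * l - h * i) + d * (e * j - f * i)) * g + (- (a * (f * k - g * j) - b * (e * k - g * i) + c * (e * j - f * i))) * h ≡ + 0
    l₂ = solve-∀
    l₃ : ∀ a b c d e f g h i j k l → (b * (g * l - h * k) - c * (f * l - h * j) + d * (f * k - g * j)) * i + (- (a * (g * l - h * k) - c * (e * l - h * i) + d * (e * k - g * i))) * j
       + (a * (f * l - h * j) - b * (e * l - h * i) + d * (e * j - f * i)) * k + (- (a * (f * k - g * j) - b * (e * k - g * i) + c * (e * j - f * i))) * l ≡ + 0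
    l₃ = solve-∀

  Triple : Set
  Triple = V4 × V4 × V4

  normalVec : Triple → V4
  normalVec (p , q , r) = minors p q r

  p₁ p₂ p₃ p₄ : V4 → ℤ
  p₁ (a , _ , _ , _) = a
  p₂ (_ , b , _ , _) = b
  p₃ (_ , _ , c , _) = c
  p₄ (_ , _ , _ , d) = d

  module _ (q : ℕ) (pr : Prime q) (B ℓ : ℕ) {{B≢0 : NonZero B}} (hq : minorBound B ℕ.+ minorBound B ℕ.< q) (hℓ : minorBound B ℕ.< 2 ℕ.^ ℓ) where

    private
      Y : ℕ
      Y = minorBound B

    -- The three vectors are the rows of a 3 × 4 matrix whose columns will be u, v, u′, v′ in some
    -- order. `normalVec` is the linear relation between the columns, and `μ-det` is the congruence
    -- forced by two collisions for the same κ.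
    record Degenerate (t : Triple) : Set where
      field
        in₁ : In B (proj₁ t)
        in₂ : In B (proj₁ (proj₂ t))
        in₃ : In B (proj₂ (proj₂ t))
        μ₁≢0 : p₁ (normalVec t) ≢ + 0
        μ-det : Z q (p₁ (normalVec t) * p₄ (normalVec t) - p₂ (normalVec t) * p₃ (normalVec t))

    prim : Triple → V4
    prim t = Content.c (content (normalVec t))

    module Facts {t : Triple} (d : Degenerate t) where
      open Degenerate d
      open Content (content (normalVec t)) public
      μ : V4
      μ = normalVec t
      μ-in : In Y μ
      μ-in = minors-bound in₁ in₂ in₃
      g≢0 : g ≢ + 0
      g≢0 e = μ₁≢0 (trans (cong p₁ factor) (trans (cong (λ z → z * p₁ c) e) (ℤₚ.*-zeroˡ (p₁ c))))
      c₁≢0 : p₁ c ≢ + 0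
      c₁≢0 e = μ₁≢0 (trans (cong p₁ factor) (trans (cong (λ z → g * z) e) (ℤₚ.*-zeroʳ g)))
      ∣g∣≥1 : 1 ℕ.≤ ∣ g ∣
      ∣g∣≥1 = ℕₚ.n≢0⇒n>0 (λ e → g≢0 (ℤₚ.∣i∣≡0⇒i≡0 e))
      shrink : ∀ {x y} → y ≡ g * x → ∣ y ∣ ℕ.≤ Y → ∣ x ∣ ℕ.≤ Y
      shrink {x} {y} e h = ℕₚ.≤-trans (ℕₚ.m≤n*m (∣ x ∣) (∣ g ∣) {{ℕ.>-nonZero ∣g∣≥1}}) (subst (ℕ._≤ Y) (trans (cong ∣_∣ e) (ℤₚ.∣i*j∣≡∣i∣*∣j∣ g x)) h)
      c-in : In Y c
      c-in = inb (shrink (cong p₁ factor) (In.i₁ μ-in)) (shrink (cong p₂ factor) (In.i₂ μ-in)) (shrink (cong p₃ factor) (In.i₃ μ-in)) (shrink (cong p₄ factor) (In.i₄ μ-in))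
      ∣g∣≤Y : ∣ g ∣ ℕ.≤ Y
      ∣g∣≤Y = ℕₚ.≤-trans (ℕₚ.m≤m*n (∣ g ∣) (∣ p₁ c ∣) {{ℕ.≢-nonZero (λ e → c₁≢0 (ℤₚ.∣i∣≡0⇒i≡0 e))}}) (subst (ℕ._≤ Y) (trans (cong ∣_∣ (cong p₁ factor)) (ℤₚ.∣i*j∣≡∣i∣*∣j∣ g (p₁ c))) (In.i₁ μ-in))
      Y<q : Y ℕ.< q
      Y<q = ℕₚ.≤-<-trans (ℕₚ.m≤m+n Y Y) hq
      ¬Zg : ¬ Z q g
      ¬Zg z = g≢0 (Z-small q z (ℕₚ.≤-<-trans ∣g∣≤Y Y<q))
      ¬Zc₁ : ¬ Z q (p₁ c)
      ¬Zc₁ z = c₁≢0 (Z-small q z (ℕₚ.≤-<-trans (In.i₁ c-in) Y<q))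
      c-det : Z q (p₁ c * p₄ c - p₂ c * p₃ c)
      c-det = cancelZ q pr g ¬Zg (cancelZ q pr g ¬Zg (subst (Z q) (trans (cong (λ v → p₁ v * p₄ v - p₂ v * p₃ v) factor) (lem g (p₁ c) (p₂ c) (p₃ c) (p₄ c))) μ-det))
        where
        lem : ∀ g a b c d → g * a * (g * d) - g * b * (g * c) ≡ g * (g * (a * d - b * c))
        lem = solve-∀
      plane : Plane B c
      plane = record
        { p = proj₁ t ; q = proj₁ (proj₂ t) ; r = proj₂ (proj₂ t) ; ζ = ζ ; g = g ; p-in = in₁ ; q-in = in₂ ; r-in = in₃ ; g≢0 = g≢0
        ; normal = factor ; bezout = content-bezout (content (normalVec t)) g≢0
        ; ⊥p = perp (proj₁ t) (proj₁ m) ; ⊥q = perp (proj₁ (proj₂ t)) (proj₁ (proj₂ m)) ; ⊥r = perp (proj₂ (proj₂ t)) (proj₂ (proj₂ m)) }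
        where
        m = minors-⊥ (proj₁ t) (proj₁ (proj₂ t)) (proj₂ (proj₂ t))
        perp : ∀ v → μ ∙ v ≡ + 0 → c ∙ v ≡ + 0
        perp v e = ℤₚ.*-cancelˡ-≡ g (c ∙ v) (+ 0) {{ℤ.≢-nonZero g≢0}} (trans (sym (⊛-∙ g c v)) (trans (cong (_∙ v) (sym factor)) (trans e (sym (ℤₚ.*-zeroʳ g)))))

    key : V4 → Key
    key (a , b , c , _) = a , b , c

    -- c₁ is nonzero and smaller than q, hence invertible, so c₁ c₄ ≡ c₂ c₃ fixes c₄ modulo q; two
    -- candidates differ by at most twice the minor bound, which is less than q.
    fourth : ∀ {t t′} → Degenerate t → Degenerate t′ → key (prim t) ≡ key (prim t′) → prim t ≡ prim t′
    fourth {t} {t′} d d′ e = V4-≡ e₁ e₂ e₃ (ℤₚ.i-j≡0⇒i≡j (p₄ c) (p₄ c′) (Z-small q same (ℕₚ.≤-<-trans (ℕₚ.≤-trans (ℤₚ.∣i-j∣≤∣i∣+∣j∣ (p₄ c) (p₄ c′)) (ℕₚ.+-mono-≤ (In.i₄ (Facts.c-in d)) (In.i₄ (Facts.c-in d′)))) hq)))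
      where
      c = prim t
      c′ = prim t′
      e₁ : p₁ c ≡ p₁ c′
      e₁ = cong proj₁ e
      e₂ : p₂ c ≡ p₂ c′
      e₂ = cong (λ k → proj₁ (proj₂ k)) e
      e₃ : p₃ c ≡ p₃ c′
      e₃ = cong (λ k → proj₂ (proj₂ k)) e
      lem : ∀ a b c d d′ → a * (d - d′) ≡ + 1 * (a * d - b * c) + (- (+ 1)) * (a * d′ - b * c)
      lem = solve-∀
      same : Z q (p₄ c - p₄ c′)
      same = cancelZ q pr (p₁ c) (Facts.¬Zc₁ d) (lin₂ q (+ 1) (- (+ 1)) (Facts.c-det d)
        (subst (Z q) (cong₂ (λ x y → x * p₄ c′ - y) (sym e₁) (cong₂ _*_ (sym e₂) (sym e₃))) (Facts.c-det d′)) (lem (p₁ c) (p₂ c) (p₃ c) (p₄ c) (p₄ c′)))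

    z₀ V : ℕ
    z₀ = box-size (5 ℕ.* B) / B
    V = z₀ ℕ.* z₀ ℕ.* z₀

    -- Each of the three factors N is bounded through a different coordinate of the normal. One
    -- coordinate alone would leave no decay in the sum over the other two.
    cube-weight : ∀ N a b c → N ℕ.* (B ℕ.* ht a) ℕ.≤ box-size (5 ℕ.* B) → N ℕ.* (B ℕ.* ht b) ℕ.≤ box-size (5 ℕ.* B) → N ℕ.* (B ℕ.* ht c) ℕ.≤ box-size (5 ℕ.* B)
      → N ℕ.* (N ℕ.* N) ℕ.≤ weight V (a , b , c)
    cube-weight N a b c ha hb hc = le-div _ (ht c) _ (le-div _ (ht b) _ (le-div _ (ht a) V
        (subst (ℕ._≤ V) (rearrange N (ht a) (ht b) (ht c)) (ℕₚ.*-mono-≤ (ℕₚ.*-mono-≤ (each (ht a) ha) (each (ht b) hb)) (each (ht c) hc)))))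
      where
      each : ∀ h → N ℕ.* (B ℕ.* h) ℕ.≤ box-size (5 ℕ.* B) → N ℕ.* h ℕ.≤ z₀
      each h p = le-div (N ℕ.* h) B (box-size (5 ℕ.* B)) (subst (ℕ._≤ box-size (5 ℕ.* B)) (trans (cong (N ℕ.*_) (ℕₚ.*-comm B h)) (sym (ℕₚ.*-assoc N h B))) p)
      open import Data.Nat.Solver using (module +-*-Solver)
      open +-*-Solver
      rearrange : ∀ N a b c → N ℕ.* a ℕ.* (N ℕ.* b) ℕ.* (N ℕ.* c) ≡ N ℕ.* (N ℕ.* N) ℕ.* c ℕ.* b ℕ.* a
      rearrange = solve 4 (λ N a b c → N :* a :* (N :* b) :* (N :* c) := N :* (N :* N) :* c :* b :* a) refl

    -- Triples are grouped by the first three coordinates of their primitive normal. Within a group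
    -- the normal is constant by `fourth`, so all three vectors lie on one hyperplane, which gives
    -- at most N³ triples; the weights then sum to three logarithms.
    degenerate-count : ∀ (𝒯 : List Triple) → Unique 𝒯 → (∀ {t} → t ∈ 𝒯 → Degenerate t) → let L = 2 ℕ.* suc ℓ in length 𝒯 ℕ.≤ V ℕ.* L ℕ.* L ℕ.* L
    degenerate-count 𝒯 u deg = ℕₚ.≤-trans (double-count same? 𝒯 (keys ℓ) (weight V) cover fibre) (keys-sum V ℓ)
      where
      same? : ∀ t k → Dec (key (prim t) ≡ k)
      same? t k = ≡-dec ℤ._≟_ (≡-dec ℤ._≟_ ℤ._≟_) (key (prim t)) k
      cover : ∀ t → t ∈ 𝒯 → Σ Key λ k → (k ∈ keys ℓ) × key (prim t) ≡ k
      cover t h = key (prim t) , ∈-cartesianProduct⁺ (s (In.i₁ i)) (∈-cartesianProduct⁺ (s (In.i₂ i)) (s (In.i₃ i))) , refl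
        where
        i = Facts.c-in (deg h)
        s : ∀ {z} → ∣ z ∣ ℕ.≤ Y → z ∈ signed ℓ
        s h = signed-complete {ℓ} (ℕₚ.≤-<-trans h hℓ)
      fibre : ∀ k → k ∈ keys ℓ → length (filter (λ t → same? t k) 𝒯) ℕ.≤ weight V k
      fibre k _ = go (filter (λ t → same? t k) 𝒯) (filter⁺ (λ t → same? t k) u) (λ h → let (m , e) = ∈-filter⁻ (λ t → same? t k) {xs = 𝒯} h in deg m , e)
        where
        go : ∀ F → Unique F → (∀ {t} → t ∈ F → Degenerate t × key (prim t) ≡ k) → length F ℕ.≤ weight V k
        go [] _ _ = z≤n
        -- Any member of the group supplies the hyperplane and its certificate for all the others.
        go F@(t₀ ∷ _) uF hF = subst (λ κ → length F ℕ.≤ weight V κ) e₀ (ℕₚ.≤-trans (inject-length {f = λ t → t} {F} {cartesianProduct points (cartesianProduct points points)} uF (λ _ _ e → e) into)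
            (ℕₚ.≤-trans (ℕₚ.≤-reflexive (trans (length-product points (cartesianProduct points points)) (cong (N ℕ.*_) (length-product points points))))
              (cube-weight N (p₁ c₀) (p₂ c₀) (p₃ c₀) bound₁ bound₂ bound₃)))
          where
          d₀ = proj₁ (hF (here refl))
          e₀ : key (prim t₀) ≡ k
          e₀ = proj₂ (hF (here refl))
          c₀ = prim t₀
          open PlanePoints (Facts.plane d₀) (Facts.c₁≢0 d₀)
          into : ∀ {t} → t ∈ F → t ∈ cartesianProduct points (cartesianProduct points points)
          into {t} h = ∈-cartesianProduct⁺ (pt (Degenerate.in₁ d) (Plane.⊥p (Facts.plane d))) (∈-cartesianProduct⁺ (pt (Degenerate.in₂ d) (Plane.⊥q (Facts.plane d))) (pt (Degenerate.in₃ d) (Plane.⊥r (Facts.plane d))))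
            where
            d = proj₁ (hF h)
            c≡ : prim t ≡ c₀
            c≡ = fourth d d₀ (trans (proj₂ (hF h)) (sym e₀))
            pt : ∀ {v} → In B v → prim t ∙ v ≡ + 0 → v ∈ points
            pt {v} i e = points-complete i (trans (cong (_∙ v) (sym c≡)) e)

-- A family of small unimodular matrices.

module Family where

  open import Data.Nat as ℕ using (ℕ; zero; suc)
  import Data.Nat.Properties as ℕₚ
  open import Data.Nat.Coprimality using (Coprime; coprime?; coprime-Bézout)
  open import Data.Nat.GCD using (module Bézout)
  open import Data.Nat.Solver using (module +-*-Solver)
  open import Data.Integer using (ℤ; +_; -_; _+_; _*_; _-_; ∣_∣)
  import Data.Integer.Properties as ℤₚ
  open import Data.Integer.DivMod using (_%ℕ_; _/ℕ_; n%ℕd<d; a≡a%ℕn+[a/ℕn]*n)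
  open import Data.Integer.Tactic.RingSolver using (solve-∀)
  open import Data.Product using (_×_; _,_; proj₁; proj₂)
  open import Data.Empty using (⊥-elim)
  open import Relation.Nullary using (Dec; yes; no)
  open import Relation.Binary.PropositionalEquality
  open Matrices
  open CoprimePairs using (IsCop)

  -- ((a , c) , (D , e)): the leading entries of the first two rows u, v, and the minors u₁v₂ - v₁u₂
  -- and u₁v₃ - v₁u₃. These four numbers can be read off the two rows, so distinct parameters give
  -- distinct pairs of rows.
  Params : Set
  Params = (ℕ × ℕ) × (ℕ × ℕ)

  record Unimodular (a c : ℕ) : Set where
    field
      r s : ℤ
      unit : + a * r - + c * s ≡ + 1

  unimodular : ∀ {a c} → Coprime a c → Unimodular a c
  unimodular {a} {c} h = from (coprime-Bézout h)
    where
    from : Bézout.Identity 1 a c → Unimodular a c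
    from (Bézout.+- x y e) = record { r = + x ; s = + y ; unit = trans (cong (_- + c * + y) (lem (+ a) (+ c) (+ x) (+ y) e′)) (lem₂ (+ c) (+ y)) }
      where
      e′ : + 1 + + y * + c ≡ + x * + a
      e′ = trans (cong (λ z → + 1 + z) (sym (ℤₚ.pos-* y c))) (trans (cong +_ e) (ℤₚ.pos-* x a))
      lem : ∀ a c x y → + 1 + y * c ≡ x * a → a * x ≡ + 1 + y * c
      lem a c x y e = trans (ℤₚ.*-comm a x) (sym e)
      lem₂ : ∀ c y → + 1 + y * c - c * y ≡ + 1
      lem₂ = solve-∀
    from (Bézout.-+ x y e) = record { r = - (+ x) ; s = - (+ y) ; unit = trans (lem (+ a) (+ c) (+ x) (+ y)) (trans (cong (_- + x * + a) (sym e′)) (lem₂ (+ x * + a))) }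
      where
      e′ : + 1 + + x * + a ≡ + y * + c
      e′ = trans (cong (λ z → + 1 + z) (sym (ℤₚ.pos-* x a))) (trans (cong +_ e) (ℤₚ.pos-* y c))
      lem : ∀ a c x y → a * (- x) - c * (- y) ≡ y * c - x * a
      lem = solve-∀
      lem₂ : ∀ k → + 1 + k - k ≡ + 1
      lem₂ = solve-∀

  record Column (a c t : ℕ) : Set where
    field
      upper : ℕ
      lower : ℤ
      upper< : upper ℕ.< a
      cross : + a * lower - + c * + upper ≡ + t

  -- t times the Bézout pair solves the equation; subtracting a multiple of (a , c) brings the upper
  -- entry into the range from 0 to a - 1.
  column : ∀ a c t .{{_ : ℕ.NonZero a}} → Unimodular a c → Column a c t
  column a c t U = record
    { upper = n %ℕ a ; lower = + t * r - + c * (n /ℕ a) ; upper< = n%ℕd<d n a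
    ; cross = trans (lem (+ a) (+ c) (+ t) r (n /ℕ a) (+ (n %ℕ a))) (trans (cong (λ z → + t * (+ a * r) - + c * z) (sym (a≡a%ℕn+[a/ℕn]*n n a))) (trans (lem₂ (+ a) (+ c) (+ t) r s) (trans (cong (+ t *_) unit) (ℤₚ.*-identityʳ (+ t))))) }
    where
    open Unimodular U
    n = + t * s
    lem : ∀ a c t r k u → a * (t * r - c * k) - c * u ≡ t * (a * r) - c * (u + k * a)
    lem = solve-∀
    lem₂ : ∀ a c t r s → t * (a * r) - c * (t * s) ≡ t * (a * r - c * s)
    lem₂ = solve-∀

  -- The lower entry is (t + c · upper) / a. Since m < 4a, the first part is at most 2m² / a ≤ 8m,
  -- and the second is at most c ≤ 2m.
  ∣lower∣≤ : ∀ {m a c t} → IsCop m (a , c) → t ℕ.≤ 2 ℕ.* (m ℕ.* m) → (K : Column a c t) → ∣ Column.lower K ∣ ℕ.≤ 10 ℕ.* m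
  ∣lower∣≤ {m} {a@(suc _)} {c} {t} h t≤ K = ℕₚ.*-cancelˡ-≤ a (subst (ℕ._≤ a ℕ.* (10 ℕ.* m)) (sym size) (begin
    t ℕ.+ c ℕ.* upper ≤⟨ ℕₚ.+-mono-≤ t≤ (ℕₚ.*-mono-≤ (ℕₚ.≤-trans (ℕₚ.<⇒≤ (IsCop.c<a h)) (IsCop.a≤ h)) (ℕₚ.<⇒≤ upper<)) ⟩
    2 ℕ.* (m ℕ.* m) ℕ.+ 2 ℕ.* m ℕ.* a ≤⟨ ℕₚ.+-monoˡ-≤ (2 ℕ.* m ℕ.* a) (ℕₚ.*-monoʳ-≤ 2 (ℕₚ.*-monoʳ-≤ m (ℕₚ.<⇒≤ (IsCop.a> h)))) ⟩
    2 ℕ.* (m ℕ.* (4 ℕ.* a)) ℕ.+ 2 ℕ.* m ℕ.* a ≡⟨ solve 2 (λ m a → con 2 :* (m :* (con 4 :* a)) :+ con 2 :* m :* a := a :* (con 10 :* m)) refl m a ⟩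
    a ℕ.* (10 ℕ.* m) ∎))
    where
    open ℕₚ.≤-Reasoning
    open +-*-Solver
    open Column K
    lem : ∀ x y → x ≡ x - y + y
    lem = solve-∀
    size : a ℕ.* ∣ lower ∣ ≡ t ℕ.+ c ℕ.* upper
    size = trans (sym (ℤₚ.∣i*j∣≡∣i∣*∣j∣ (+ a) lower)) (cong ∣_∣ (trans (lem (+ a * lower) (+ c * + upper)) (trans (cong (_+ + c * + upper) cross) (trans (cong (λ z → + t + z) (sym (ℤₚ.pos-* c upper))) refl))))

  record Rows (p : Params) (γ : M3) : Set where
    private
      a = proj₁ (proj₁ p)
      c = proj₂ (proj₁ p)
      D = proj₁ (proj₂ p)
      e = proj₂ (proj₂ p)
    field
      xu : x (r₁ γ) ≡ + a
      xv : x (r₂ γ) ≡ + c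
      crossD : x (r₁ γ) * y (r₂ γ) - x (r₂ γ) * y (r₁ γ) ≡ + D
      crossE : x (r₁ γ) * z (r₂ γ) - x (r₂ γ) * z (r₁ γ) ≡ + e
      unit : det γ ≡ + 1

  record RowBounds (m : ℕ) (γ : M3) : Set where
    field
      u-bound : VBound (10 ℕ.* m) (r₁ γ)
      v-bound : VBound (10 ℕ.* m) (r₂ γ)
      w-bound : VBound (653 ℕ.* m) (r₃ γ)

  module Build (a c D e : ℕ) {{a≢0 : ℕ.NonZero a}} {{D≢0 : ℕ.NonZero D}} (U : Unimodular a c) (T : Unimodular D e) where
    module K₂ = Column (column a c D U)
    module K₃ = Column (column a c e U)
    open Unimodular T

    u₂ u₃ v₂ v₃ i j : ℤ
    u₂ = + K₂.upper
    u₃ = + K₃.upper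
    v₂ = K₂.lower
    v₃ = K₃.lower
    -- The row (0 , s , r) already completes u, v to determinant one, because D r - e s = 1. It may
    -- be changed by multiples of u and v; i and j are the integral parts of the coordinates -sc / D
    -- and as / D of (0 , s) in the basis (a , u₂), (c , v₂).
    i = (- s * + c) /ℕ D
    j = (+ a * s) /ℕ D

    w₁ w₂ w₃ n₁ : ℤ
    w₁ = - (i * + a) - j * + c
    w₂ = s - i * u₂ - j * v₂
    w₃ = r - i * u₃ - j * v₃
    n₁ = u₂ * v₃ - u₃ * v₂

    γ : M3
    γ = m3 (v3 (+ a) u₂ u₃) (v3 (+ c) v₂ v₃) (v3 w₁ w₂ w₃)

    det-γ : det γ ≡ + 1
    det-γ = trans (lem (+ a) u₂ u₃ (+ c) v₂ v₃ i j s r) (trans (cong₂ (λ p q → r * p - s * q) K₂.cross K₃.cross) (trans (cong₂ _-_ (ℤₚ.*-comm r (+ D)) (ℤₚ.*-comm s (+ e))) unit))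
      where
      lem : ∀ a u₂ u₃ c v₂ v₃ i j s r → a * (v₂ * (r - i * u₃ - j * v₃) - v₃ * (s - i * u₂ - j * v₂)) - u₂ * (c * (r - i * u₃ - j * v₃) - v₃ * (- (i * a) - j * c)) + u₃ * (c * (s - i * u₂ - j * v₂) - v₂ * (- (i * a) - j * c))
        ≡ r * (a * v₂ - c * u₂) - s * (a * v₃ - c * u₃)
      lem = solve-∀

    rows : Rows ((a , c) , (D , e)) γ
    rows = record { xu = refl ; xv = refl ; crossD = K₂.cross ; crossE = K₃.cross ; unit = det-γ }

    module Bounds {m} (m≥1 : 1 ℕ.≤ m) (hac : IsCop m (a , c)) (hde : IsCop (m ℕ.* m) (D , e)) where
      open ℕₚ.≤-Reasoning
      open +-*-Solver

      a≤ : a ℕ.≤ 2 ℕ.* m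
      a≤ = IsCop.a≤ hac
      c≤ : c ℕ.≤ 2 ℕ.* m
      c≤ = ℕₚ.≤-trans (ℕₚ.<⇒≤ (IsCop.c<a hac)) a≤
      2≤10 : 2 ℕ.* m ℕ.≤ 10 ℕ.* m
      2≤10 = ℕₚ.*-monoˡ-≤ m (ℕₚ.m≤m+n 2 8)
      up₂ : K₂.upper ℕ.≤ 2 ℕ.* m
      up₂ = ℕₚ.≤-trans (ℕₚ.<⇒≤ K₂.upper<) a≤
      up₃ : K₃.upper ℕ.≤ 2 ℕ.* m
      up₃ = ℕₚ.≤-trans (ℕₚ.<⇒≤ K₃.upper<) a≤
      lo₂ : ∣ v₂ ∣ ℕ.≤ 10 ℕ.* m
      lo₂ = ∣lower∣≤ hac (IsCop.a≤ hde) (column a c D U)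
      lo₃ : ∣ v₃ ∣ ℕ.≤ 10 ℕ.* m
      lo₃ = ∣lower∣≤ hac (ℕₚ.≤-trans (ℕₚ.<⇒≤ (IsCop.c<a hde)) (IsCop.a≤ hde)) (column a c e U)

      divide : ∀ x n → ∣ + D * x ∣ ℕ.≤ D ℕ.* n → ∣ x ∣ ℕ.≤ n
      divide x n h = ℕₚ.*-cancelˡ-≤ D (subst (ℕ._≤ D ℕ.* n) (ℤₚ.∣i*j∣≡∣i∣*∣j∣ (+ D) x) h)

      ρ₁ ρ₂ : ℕ
      ρ₁ = (- s * + c) %ℕ D
      ρ₂ = (+ a * s) %ℕ D

      -- Serves the first two entries of the third row alike: t = 0 with the column (a , c), and t =
      -- 1 with the column (u₂ , v₂). Only the remainders of the two divisions survive.
      reduced : ∀ p q t → t * + D ≡ + a * q - + c * p → + D * (s * t + - (i * p) - j * q) ≡ + ρ₁ * p + + ρ₂ * q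
      reduced p q t ht = trans (lem (+ D) s t i j p q) (trans (cong₂ (λ α β → s * (t * + D) - (α * p) - β * q) (quotient (- s * + c)) (quotient (+ a * s)))
          (trans (cong (λ α → s * α - (- s * + c - + ρ₁) * p - (+ a * s - + ρ₂) * q) ht) (lem₂ s (+ a) (+ c) p q (+ ρ₁) (+ ρ₂))))
        where
        quotient : ∀ n → n /ℕ D * + D ≡ n - + (n %ℕ D)
        quotient n = trans (lem₃ (+ (n %ℕ D)) (n /ℕ D * + D)) (cong (_- + (n %ℕ D)) (sym (a≡a%ℕn+[a/ℕn]*n n D)))
          where
          lem₃ : ∀ r k → k ≡ r + k - r
          lem₃ = solve-∀
        lem : ∀ D s t i j p q → D * (s * t + - (i * p) - j * q) ≡ s * (t * D) - (i * D * p) - j * D * q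
        lem = solve-∀
        lem₂ : ∀ s a c p q ρ₁ ρ₂ → s * (a * q - c * p) - (- s * c - ρ₁) * p - (a * s - ρ₂) * q ≡ ρ₁ * p + ρ₂ * q
        lem₂ = solve-∀

      combine : ∀ p q n k → ∣ p ∣ ℕ.≤ n → ∣ q ∣ ℕ.≤ k → ∣ + ρ₁ * p + + ρ₂ * q ∣ ℕ.≤ D ℕ.* (n ℕ.+ k)
      combine p q n k hp hq = begin
        ∣ + ρ₁ * p + + ρ₂ * q ∣ ≤⟨ ℤₚ.∣i+j∣≤∣i∣+∣j∣ (+ ρ₁ * p) (+ ρ₂ * q) ⟩
        ∣ + ρ₁ * p ∣ ℕ.+ ∣ + ρ₂ * q ∣ ≡⟨ cong₂ ℕ._+_ (ℤₚ.∣i*j∣≡∣i∣*∣j∣ (+ ρ₁) p) (ℤₚ.∣i*j∣≡∣i∣*∣j∣ (+ ρ₂) q) ⟩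
        ρ₁ ℕ.* ∣ p ∣ ℕ.+ ρ₂ ℕ.* ∣ q ∣ ≤⟨ ℕₚ.+-mono-≤ (ℕₚ.*-mono-≤ (ℕₚ.<⇒≤ (n%ℕd<d (- s * + c) D)) hp) (ℕₚ.*-mono-≤ (ℕₚ.<⇒≤ (n%ℕd<d (+ a * s) D)) hq) ⟩
        D ℕ.* n ℕ.+ D ℕ.* k ≡⟨ sym (ℕₚ.*-distribˡ-+ D n k) ⟩
        D ℕ.* (n ℕ.+ k) ∎

      w₁≤ : ∣ w₁ ∣ ℕ.≤ 4 ℕ.* m
      w₁≤ = divide w₁ (4 ℕ.* m) (subst (λ t → ∣ t ∣ ℕ.≤ D ℕ.* (4 ℕ.* m)) (sym eq) (ℕₚ.≤-trans (combine (+ a) (+ c) (2 ℕ.* m) (2 ℕ.* m) a≤ c≤) (ℕₚ.≤-reflexive (cong (D ℕ.*_) (sym (ℕₚ.*-distribʳ-+ m 2 2))))))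
        where
        eq : + D * w₁ ≡ + ρ₁ * + a + + ρ₂ * + c
        eq = trans (cong (+ D *_) (lem s i j (+ a) (+ c))) (reduced (+ a) (+ c) (+ 0) (sym (lem₂ (+ a) (+ c))))
          where
          lem : ∀ s i j a c → - (i * a) - j * c ≡ s * + 0 + - (i * a) - j * c
          lem = solve-∀
          lem₂ : ∀ a c → a * c - c * a ≡ + 0
          lem₂ = solve-∀

      w₂≤ : ∣ w₂ ∣ ℕ.≤ 12 ℕ.* m
      w₂≤ = divide w₂ (12 ℕ.* m) (subst (λ t → ∣ t ∣ ℕ.≤ D ℕ.* (12 ℕ.* m)) (sym eq) (ℕₚ.≤-trans (combine u₂ v₂ (2 ℕ.* m) (10 ℕ.* m) up₂ lo₂) (ℕₚ.≤-reflexive (cong (D ℕ.*_) (sym (ℕₚ.*-distribʳ-+ m 2 10))))))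
        where
        eq : + D * w₂ ≡ + ρ₁ * u₂ + + ρ₂ * v₂
        eq = trans (cong (+ D *_) (lem s i j u₂ v₂)) (reduced u₂ v₂ (+ 1) (trans (ℤₚ.*-identityˡ (+ D)) (sym K₂.cross)))
          where
          lem : ∀ s i j a c → s - i * a - j * c ≡ s * + 1 + - (i * a) - j * c
          lem = solve-∀

      n₁≤ : ∣ n₁ ∣ ℕ.≤ 40 ℕ.* (m ℕ.* m)
      n₁≤ = begin
        ∣ n₁ ∣ ≤⟨ ℤₚ.∣i-j∣≤∣i∣+∣j∣ (u₂ * v₃) (u₃ * v₂) ⟩
        ∣ u₂ * v₃ ∣ ℕ.+ ∣ u₃ * v₂ ∣ ≡⟨ cong₂ ℕ._+_ (ℤₚ.∣i*j∣≡∣i∣*∣j∣ u₂ v₃) (ℤₚ.∣i*j∣≡∣i∣*∣j∣ u₃ v₂) ⟩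
        ∣ u₂ ∣ ℕ.* ∣ v₃ ∣ ℕ.+ ∣ u₃ ∣ ℕ.* ∣ v₂ ∣ ≤⟨ ℕₚ.+-mono-≤ (ℕₚ.*-mono-≤ up₂ lo₃) (ℕₚ.*-mono-≤ up₃ lo₂) ⟩
        2 ℕ.* m ℕ.* (10 ℕ.* m) ℕ.+ 2 ℕ.* m ℕ.* (10 ℕ.* m) ≡⟨ solve 1 (λ m → con 2 :* m :* (con 10 :* m) :+ con 2 :* m :* (con 10 :* m) := con 40 :* (m :* m)) refl m ⟩
        40 ℕ.* (m ℕ.* m) ∎

      -- The third entry was not reduced directly; the determinant gives D w₃ = 1 - w₁ n₁ + w₂ e. As
      -- m² < 4D and e < D, this is at most (1 + 4 · 40 · 4 + 12) m D = 653 m D.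
      w₃≤ : ∣ w₃ ∣ ℕ.≤ 653 ℕ.* m
      w₃≤ = divide w₃ (653 ℕ.* m) (subst (λ t → ∣ t ∣ ℕ.≤ D ℕ.* (653 ℕ.* m)) (sym eq) (begin
        ∣ + 1 - w₁ * n₁ + w₂ * + e ∣ ≤⟨ ℤₚ.∣i+j∣≤∣i∣+∣j∣ (+ 1 - w₁ * n₁) (w₂ * + e) ⟩
        ∣ + 1 - w₁ * n₁ ∣ ℕ.+ ∣ w₂ * + e ∣ ≤⟨ ℕₚ.+-monoˡ-≤ (∣ w₂ * + e ∣) (ℤₚ.∣i-j∣≤∣i∣+∣j∣ (+ 1) (w₁ * n₁)) ⟩
        1 ℕ.+ ∣ w₁ * n₁ ∣ ℕ.+ ∣ w₂ * + e ∣ ≡⟨ cong₂ (λ p q → 1 ℕ.+ p ℕ.+ q) (ℤₚ.∣i*j∣≡∣i∣*∣j∣ w₁ n₁) (ℤₚ.∣i*j∣≡∣i∣*∣j∣ w₂ (+ e)) ⟩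
        1 ℕ.+ ∣ w₁ ∣ ℕ.* ∣ n₁ ∣ ℕ.+ ∣ w₂ ∣ ℕ.* e ≤⟨ ℕₚ.+-mono-≤ (ℕₚ.+-mono-≤ 1≤Dm (ℕₚ.*-mono-≤ w₁≤ n₁≤)) (ℕₚ.*-mono-≤ w₂≤ (ℕₚ.<⇒≤ (IsCop.c<a hde))) ⟩
        D ℕ.* m ℕ.+ 4 ℕ.* m ℕ.* (40 ℕ.* (m ℕ.* m)) ℕ.+ 12 ℕ.* m ℕ.* D ≤⟨ ℕₚ.+-monoˡ-≤ (12 ℕ.* m ℕ.* D) (ℕₚ.+-monoʳ-≤ (D ℕ.* m) (ℕₚ.*-monoʳ-≤ (4 ℕ.* m) (ℕₚ.*-monoʳ-≤ 40 (ℕₚ.<⇒≤ (IsCop.a> hde))))) ⟩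
        D ℕ.* m ℕ.+ 4 ℕ.* m ℕ.* (40 ℕ.* (4 ℕ.* D)) ℕ.+ 12 ℕ.* m ℕ.* D ≡⟨ solve 2 (λ m D → D :* m :+ con 4 :* m :* (con 40 :* (con 4 :* D)) :+ con 12 :* m :* D := D :* (con 653 :* m)) refl m D ⟩
        D ℕ.* (653 ℕ.* m) ∎))
        where
        1≤Dm : 1 ℕ.≤ D ℕ.* m
        1≤Dm = ℕₚ.*-mono-≤ (ℕ.>-nonZero⁻¹ D) m≥1
        eq : + D * w₃ ≡ + 1 - w₁ * n₁ + w₂ * + e
        eq = trans (cong (_* w₃) (sym K₂.cross)) (trans (lem (+ a) u₂ u₃ (+ c) v₂ v₃ w₁ w₂ w₃) (cong₂ (λ p q → p - w₁ * n₁ + w₂ * q) det-γ K₃.cross))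
          where
          lem : ∀ a u₂ u₃ c v₂ v₃ w₁ w₂ w₃ → (a * v₂ - c * u₂) * w₃ ≡ (a * (v₂ * w₃ - v₃ * w₂) - u₂ * (c * w₃ - v₃ * w₁) + u₃ * (c * w₂ - v₂ * w₁)) - w₁ * (u₂ * v₃ - u₃ * v₂) + w₂ * (a * v₃ - c * u₃)
          lem = solve-∀

      bounds : RowBounds m γ
      bounds = record
        { u-bound = vb (ℕₚ.≤-trans a≤ 2≤10) (ℕₚ.≤-trans up₂ 2≤10) (ℕₚ.≤-trans up₃ 2≤10)
        ; v-bound = vb (ℕₚ.≤-trans c≤ 2≤10) lo₂ lo₃
        ; w-bound = vb (ℕₚ.≤-trans w₁≤ (ℕₚ.*-monoˡ-≤ m (ℕₚ.m≤m+n 4 649))) (ℕₚ.≤-trans w₂≤ (ℕₚ.*-monoˡ-≤ m (ℕₚ.m≤m+n 12 641))) w₃≤ }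

  -- The value I₃ is junk: it occurs only for parameters that are not coprime.
  abstract
    matrix : Params → M3
    matrix ((zero , _) , _) = I₃
    matrix ((suc _ , _) , (zero , _)) = I₃
    matrix ((suc a , c) , (suc D , e)) = go (coprime? (suc a) c) (coprime? (suc D) e)
      where
      go : Dec (Coprime (suc a) c) → Dec (Coprime (suc D) e) → M3
      go (yes h) (yes k) = Build.γ (suc a) c (suc D) e (unimodular h) (unimodular k)
      go _ _ = I₃

    matrix-rows : ∀ {m} → 1 ℕ.≤ m → ∀ {p} → IsCop m (proj₁ p) → IsCop (m ℕ.* m) (proj₂ p) → Rows p (matrix p) × RowBounds m (matrix p)
    matrix-rows _ {(zero , c) , _} h _ with () ← IsCop.c<a h
    matrix-rows _ {(suc _ , _) , (zero , _)} _ h with () ← IsCop.c<a h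
    matrix-rows {m} m≥1 {(suc a , c) , (suc D , e)} hac hde with coprime? (suc a) c | coprime? (suc D) e
    ... | no n | _ = ⊥-elim (n (IsCop.cop hac))
    ... | yes _ | no n = ⊥-elim (n (IsCop.cop hde))
    ... | yes h | yes k = Build.rows (suc a) c (suc D) e (unimodular h) (unimodular k) , Build.Bounds.bounds (suc a) c (suc D) e (unimodular h) (unimodular k) m≥1 hac hde

-- Collisions of two matrices modulo q.

module Collision where

  open import Data.Nat as ℕ using (ℕ)
  import Data.Nat.Properties as ℕₚ
  open import Data.Nat.Divisibility as ℕ∣ using (divides)
  open import Data.Nat.Coprimality as Cop using (Coprime; coprime-divisor)
  open import Data.Nat.Primality using (Prime; prime⇒nonTrivial)
  open import Data.Integer using (ℤ; +_; -_; _+_; _*_; _-_; ∣_∣)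
  import Data.Integer.Properties as ℤₚ
  open import Data.Integer.Tactic.RingSolver using (solve-∀)
  open import Data.List using (List; length; filter; upTo; cartesianProduct)
  open import Data.List.Membership.Propositional using (_∈_)
  open import Data.List.Membership.Propositional.Properties using (∈-filter⁻; ∈-filter⁺; ∈-cartesianProduct⁻; ∈-upTo⁺; ∈-upTo⁻)
  open import Data.List.Relation.Unary.Unique.Propositional using (Unique)
  open import Data.List.Relation.Unary.Unique.Propositional.Properties using (filter⁺; upTo⁺; cartesianProduct⁺)
  open import Data.Product using (Σ; _×_; _,_; proj₁; proj₂)
  open import Data.Product.Properties using (≡-dec)
  open import Data.Empty using (⊥-elim)
  open import Relation.Nullary using (Dec; yes; no; ¬_)
  open import Relation.Nullary.Decidable using (_×-dec_; ¬?)
  open import Relation.Binary.PropositionalEquality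
  open Counting
  open Matrices
  open CoprimePairs using (range²; range²-unique; length-range²)
  open Residues
  open Family

  tri : V3 → V3 → V3 → ℤ
  tri a b c = det (m3 a b c)

  _⊖[_]_ : V3 → ℤ → V3 → V3
  r ⊖[ κ ] s = v3 (x r - κ * x s) (y r - κ * y s) (z r - κ * z s)

  pencil : M3 → ℤ → M3 → M3
  pencil γ κ γ′ = m3 (r₁ γ ⊖[ κ ] r₁ γ′) (r₂ γ ⊖[ κ ] r₂ γ′) (r₃ γ ⊖[ κ ] r₃ γ′)

  ⊖-· : ∀ r κ s v → (r ⊖[ κ ] s) · v ≡ r · v - κ * (s · v)
  ⊖-· (v3 a b c) κ (v3 d e f) (v3 g h i) = lem a b c κ d e f g h i
    where
    lem : ∀ a b c κ d e f g h i → (a - κ * d) * g + (b - κ * e) * h + (c - κ * f) * i ≡ a * g + b * h + c * i - κ * (d * g + e * h + f * i)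
    lem = solve-∀

  coprime-fractions : ∀ {a c a′ c′} → 1 ℕ.≤ a → Coprime a c → Coprime a′ c′ → a ℕ.* c′ ≡ a′ ℕ.* c → (a ≡ a′) × (c ≡ c′)
  coprime-fractions {a} {c} {a′} {c′} 1≤a h h′ e = a≡ , ℕₚ.*-cancelˡ-≡ c c′ a {{ℕ.>-nonZero 1≤a}} (trans (cong (ℕ._* c) a≡) (sym e))
    where
    a∣a′ : a ℕ∣.∣ a′
    a∣a′ = coprime-divisor h (subst (a ℕ∣.∣_) (trans e (ℕₚ.*-comm a′ c)) (divides c′ (ℕₚ.*-comm a c′)))
    a′∣a : a′ ℕ∣.∣ a
    a′∣a = coprime-divisor h′ (subst (a′ ℕ∣.∣_) (trans (sym e) (ℕₚ.*-comm a c′)) (divides c (ℕₚ.*-comm a′ c)))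
    a≡ : a ≡ a′
    a≡ = ℕ∣.∣-antisym a∣a′ a′∣a

  module Collide (q : ℕ) (pr : Prime q) where

    -- γ X is projectively equal to Y within the affine chart: the leading coordinate is invertible,
    -- and division by it is avoided by cross-multiplying.
    record Hit (γ : M3) (X Y : Point) : Set where
      constructor hit
      field
        h₀ : ¬ Z q (r₁ γ · pt X)
        h₁ : Z q (r₂ γ · pt X - (r₁ γ · pt X) * + proj₁ Y)
        h₂ : Z q (r₃ γ · pt X - (r₁ γ · pt X) * + proj₂ Y)

    Hit? : ∀ γ X Y → Dec (Hit γ X Y)
    Hit? γ X Y = go (¬? (Z? q (r₁ γ · pt X))) (Z? q (r₂ γ · pt X - (r₁ γ · pt X) * + proj₁ Y)) (Z? q (r₃ γ · pt X - (r₁ γ · pt X) * + proj₂ Y))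
      where
      go : Dec (¬ Z q (r₁ γ · pt X)) → Dec (Z q (r₂ γ · pt X - (r₁ γ · pt X) * + proj₁ Y)) → Dec (Z q (r₃ γ · pt X - (r₁ γ · pt X) * + proj₂ Y)) → Dec (Hit γ X Y)
      go (yes a) (yes b) (yes c) = yes (hit a b c)
      go (no n) _ _ = no (λ h → n (Hit.h₀ h))
      go (yes _) (no n) _ = no (λ h → n (Hit.h₁ h))
      go (yes _) (yes _) (no n) = no (λ h → n (Hit.h₂ h))

    InRange : Point → Set
    InRange X = (proj₁ X ℕ.< q) × (proj₂ X ℕ.< q)

    in-range : ∀ {X} → X ∈ range² q → InRange X
    in-range h = let (a , b) = ∈-cartesianProduct⁻ (upTo q) (upTo q) h in ∈-upTo⁻ a , ∈-upTo⁻ b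

    hit-exists : ∀ γ X → ¬ Z q (r₁ γ · pt X) → Σ Point λ Y → InRange Y × Hit γ X Y
    hit-exists γ X n = go (inverse q pr s n)
      where
      s = r₁ γ · pt X
      go : (Σ ℤ λ b → Z q (s * b - + 1)) → Σ Point λ Y → InRange Y × Hit γ X Y
      go (b , zb) = (res q pr (t₁ * b) , res q pr (t₂ * b)) , (res< q pr (t₁ * b) , res< q pr (t₂ * b)) , hit n (each t₁) (each t₂)
        where
        t₁ = r₂ γ · pt X
        t₂ = r₃ γ · pt X
        lem : ∀ t s b r → t - s * r ≡ (- t) * (s * b - + 1) + s * (t * b - r)
        lem = solve-∀
        each : ∀ t → Z q (t - s * + res q pr (t * b))
        each t = lin₂ q (- t) s zb (res-≡ q pr (t * b)) (lem t s b (+ res q pr (t * b)))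

    hit-unique : ∀ {γ X Y Y′} → InRange Y → InRange Y′ → Hit γ X Y → Hit γ X Y′ → Y ≡ Y′
    hit-unique {γ} {X} {Y} {Y′} (a , b) (c , d) (hit n h₁ h₂) (hit _ k₁ k₂) = cong₂ _,_ (each (r₂ γ · pt X) a c h₁ k₁) (each (r₃ γ · pt X) b d h₂ k₂)
      where
      s = r₁ γ · pt X
      lem : ∀ t s a b → s * (a - b) ≡ (- (+ 1)) * (t - s * a) + + 1 * (t - s * b)
      lem = solve-∀
      each : ∀ t {i j} → i ℕ.< q → j ℕ.< q → Z q (t - s * + i) → Z q (t - s * + j) → i ≡ j
      each t {i} {j} hi hj zi zj = residue-unique q hi hj (cancelZ q pr s n (lin₂ q (- (+ 1)) (+ 1) zi zj (lem t s (+ i) (+ j))))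

    record Ker (M : M3) (X : Point) : Set where
      constructor ker
      field
        k₁ : Z q (r₁ M · pt X)
        k₂ : Z q (r₂ M · pt X)
        k₃ : Z q (r₃ M · pt X)

    Ker? : ∀ M X → Dec (Ker M X)
    Ker? M X = go (Z? q (r₁ M · pt X)) (Z? q (r₂ M · pt X)) (Z? q (r₃ M · pt X))
      where
      go : Dec (Z q (r₁ M · pt X)) → Dec (Z q (r₂ M · pt X)) → Dec (Z q (r₃ M · pt X)) → Dec (Ker M X)
      go (yes a) (yes b) (yes c) = yes (ker a b c)
      go (no n) _ _ = no (λ h → n (Ker.k₁ h))
      go (yes _) (no n) _ = no (λ h → n (Ker.k₂ h))
      go (yes _) (yes _) (no n) = no (λ h → n (Ker.k₃ h))

    -- κ is the quotient of the leading coordinates of γ X and γ′ X. Both images are multiples of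
    -- the same vector (1 , Y), so γ - κ γ′ annihilates X.
    hit-kernel : ∀ {γ γ′ X Y} → Hit γ X Y → Hit γ′ X Y → Σ ℕ λ κ → (κ ℕ.< q) × Ker (pencil γ (+ κ) γ′) X
    hit-kernel {γ} {γ′} {X} {Y} (hit _ h₁ h₂) (hit n′ k₁ k₂) = go (inverse q pr s′ n′)
      where
      s = r₁ γ · pt X
      s′ = r₁ γ′ · pt X
      go : (Σ ℤ λ b → Z q (s′ * b - + 1)) → Σ ℕ λ κ → (κ ℕ.< q) × Ker (pencil γ (+ κ) γ′) X
      go (b , zb) = κ , res< q pr (s * b) , ker (subst (Z q) (sym (⊖-· (r₁ γ) (+ κ) (r₁ γ′) (pt X))) first) (other (r₂ γ) (r₂ γ′) (proj₁ Y) h₁ k₁) (other (r₃ γ) (r₃ γ′) (proj₂ Y) h₂ k₂)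
        where
        κ = res q pr (s * b)
        lem : ∀ s s′ b k → s - k * s′ ≡ (- s) * (s′ * b - + 1) + s′ * (s * b - k)
        lem = solve-∀
        first : Z q (s - + κ * s′)
        first = lin₂ q (- s) s′ zb (res-≡ q pr (s * b)) (lem s s′ b (+ κ))
        lem₂ : ∀ t t′ s s′ k y → t - k * t′ ≡ + 1 * (t - s * y) + (- k) * (t′ - s′ * y) + y * (s - k * s′)
        lem₂ = solve-∀
        other : ∀ r r′ i → Z q (r · pt X - s * + i) → Z q (r′ · pt X - s′ * + i) → Z q ((r ⊖[ + κ ] r′) · pt X)
        other r r′ i zi zi′ = subst (Z q) (sym (⊖-· r (+ κ) r′ (pt X))) (lin₃ q (+ 1) (- (+ κ)) (+ i) zi zi′ first (lem₂ (r · pt X) (r′ · pt X) s s′ (+ κ) (+ i)))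

    ker-det : ∀ {M X} → Ker M X → Z q (det M)
    ker-det {m3 (v3 a b c) (v3 d e f) (v3 g h i)} {s , t} (ker k₁ k₂ k₃) = lin₃ q (e * i - f * h) (c * h - b * i) (b * f - c * e) k₁ k₂ k₃ (lem a b c d e f g h i (+ s) (+ t))
      where
      lem : ∀ a b c d e f g h i s t → a * (e * i - f * h) - b * (d * i - f * g) + c * (d * h - e * g)
        ≡ (e * i - f * h) * (a * + 1 + b * s + c * t) + (c * h - b * i) * (d * + 1 + e * s + f * t) + (b * f - c * e) * (g * + 1 + h * s + i * t)
      lem = solve-∀

    linear quadratic : M3 → M3 → ℤ
    linear γ γ′ = - (tri (r₁ γ′) (r₂ γ) (r₃ γ) + tri (r₁ γ) (r₂ γ′) (r₃ γ) + tri (r₁ γ) (r₂ γ) (r₃ γ′))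
    quadratic γ γ′ = tri (r₁ γ) (r₂ γ′) (r₃ γ′) + tri (r₁ γ′) (r₂ γ) (r₃ γ′) + tri (r₁ γ′) (r₂ γ′) (r₃ γ)

    det-pencil : ∀ γ κ γ′ → det (pencil γ κ γ′) ≡ det γ + linear γ γ′ * κ + quadratic γ γ′ * (κ * κ) + (- det γ′) * (κ * (κ * κ))
    det-pencil (m3 (v3 a b c) (v3 d e f) (v3 g h i)) κ (m3 (v3 A B C) (v3 D E F) (v3 G H I)) = lem a b c d e f g h i A B C D E F G H I κ
      where
      lem : ∀ a b c d e f g h i A B C D E F G H I k →
        (a - k * A) * ((e - k * E) * (i - k * I) - (f - k * F) * (h - k * H)) - (b - k * B) * ((d - k * D) * (i - k * I) - (f - k * F) * (g - k * G)) + (c - k * C) * ((d - k * D) * (h - k * H) - (e - k * E) * (g - k * G))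
        ≡ a * (e * i - f * h) - b * (d * i - f * g) + c * (d * h - e * g)
         + (- ((A * (e * i - f * h) - B * (d * i - f * g) + C * (d * h - e * g)) + (a * (E * i - F * h) - b * (D * i - F * g) + c * (D * h - E * g)) + (a * (e * I - f * H) - b * (d * I - f * G) + c * (d * H - e * G)))) * k
         + ((a * (E * I - F * H) - b * (D * I - F * G) + c * (D * H - E * G)) + (A * (e * I - f * H) - B * (d * I - f * G) + C * (d * H - e * G)) + (A * (E * i - F * h) - B * (D * i - F * g) + C * (D * h - E * g))) * (k * k)
         + (- (A * (E * I - F * H) - B * (D * I - F * G) + C * (D * H - E * G))) * (k * (k * k))
      lem = solve-∀

    roots : M3 → M3 → List ℕ
    roots γ γ′ = filter (λ κ → Z? q (det (pencil γ (+ κ) γ′))) (upTo q)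

    2≤q : 2 ℕ.≤ q
    2≤q = ℕ.nonTrivial⇒n>1 q {{prime⇒nonTrivial pr}}

    unit-nonzero : ∀ {a} → a ≡ + 1 → ¬ Z q (- a)
    unit-nonzero refl h with Z-small q h 2≤q
    ... | ()

    -- The coefficient of κ³ in det (γ - κ γ′) is - det γ′ = -1, so the cubic does not degenerate
    -- modulo any prime.
    roots≤3 : ∀ γ γ′ → det γ′ ≡ + 1 → length (roots γ γ′) ℕ.≤ 3
    roots≤3 γ γ′ e = go (length (roots γ γ′) ℕₚ.≤? 3)
      where
      uniq : Unique (roots γ γ′)
      uniq = filter⁺ (λ κ → Z? q (det (pencil γ (+ κ) γ′))) (upTo⁺ q)
      root : ∀ {κ} → κ ∈ roots γ γ′ → (κ ℕ.< q) × Z q (det (pencil γ (+ κ) γ′))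
      root {κ} h = let (a , b) = ∈-filter⁻ (λ κ → Z? q (det (pencil γ (+ κ) γ′))) {xs = upTo q} h in ∈-upTo⁻ a , b
      differ : ∀ {i j} → i ∈ roots γ γ′ → j ∈ roots γ γ′ → i ≢ j → ¬ Z q (+ i - + j)
      differ hi hj n zz = n (residue-unique q (proj₁ (root hi)) (proj₁ (root hj)) zz)
      f : ∀ {i} → i ∈ roots γ γ′ → Z q (det γ + linear γ γ′ * + i + quadratic γ γ′ * (+ i * + i) + (- det γ′) * (+ i * (+ i * + i)))
      f {i} h = subst (Z q) (det-pencil γ (+ i) γ′) (proj₂ (root h))
      go : Dec (length (roots γ γ′) ℕ.≤ 3) → length (roots γ γ′) ℕ.≤ 3
      go (yes h) = h
      go (no n) with four-distinct (roots γ γ′) uniq (ℕₚ.≰⇒> n)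
      ... | i , j , k , l , (hi , hj , hk , hl) , ij , ik , il , jk , jl , kl =
        ⊥-elim (cubic q pr (det γ) (linear γ γ′) (quadratic γ γ′) (- det γ′) (unit-nonzero e) (+ i) (+ j) (+ k) (+ l) (differ hi hj ij) (differ hi hk ik) (differ hi hl il) (differ hj hk jk) (differ hj hl jl) (differ hk hl kl) (f hi) (f hj) (f hk) (f hl))

    -- Two independent vectors orthogonal to both d₁ and d₂ force d₁ × d₂ = 0.
    cross-zero : ∀ d₁ d₂ {X X′} → InRange X → InRange X′ → X ≢ X′ → Z q (d₁ · pt X) → Z q (d₁ · pt X′) → Z q (d₂ · pt X) → Z q (d₂ · pt X′)
      → ∀ t → Z q (tri d₁ d₂ t)
    cross-zero (v3 a b c) (v3 d e f) {i , j} {i′ , j′} (i< , j<) (i′< , j′<) X≢ z₁ z₁′ z₂ z₂′ (v3 g h k) = lin₃ q (g + + i * h + + j * k) (e * k - f * h) (c * h - b * k) (core (Z? q (+ i - + i′)) (Z? q (+ j - + j′))) z₁ z₂ (lem₃ a b c d e f g h k (+ i) (+ j))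
      where
      lem : ∀ a b c d e f i j i′ j′ → (i - i′) * (b * f - c * e) ≡ f * ((a * + 1 + b * i + c * j) - (a * + 1 + b * i′ + c * j′)) + (- c) * ((d * + 1 + e * i + f * j) - (d * + 1 + e * i′ + f * j′))
      lem = solve-∀
      lem₂ : ∀ a b c d e f i j i′ j′ → (j - j′) * (b * f - c * e) ≡ (- e) * ((a * + 1 + b * i + c * j) - (a * + 1 + b * i′ + c * j′)) + b * ((d * + 1 + e * i + f * j) - (d * + 1 + e * i′ + f * j′))
      lem₂ = solve-∀
      lem₃ : ∀ a b c d e f g h k i j → a * (e * k - f * h) - b * (d * k - f * g) + c * (d * h - e * g)
        ≡ (g + i * h + j * k) * (b * f - c * e) + (e * k - f * h) * (a * + 1 + b * i + c * j) + (c * h - b * k) * (d * + 1 + e * i + f * j)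
      lem₃ = solve-∀
      sub : ∀ {s t} → Z q s → Z q t → Z q (s - t)
      sub {s} {t} hs ht = lin₂ q (+ 1) (- (+ 1)) hs ht (l s t)
        where
        l : ∀ s t → s - t ≡ + 1 * s + (- (+ 1)) * t
        l = solve-∀
      core : Dec (Z q (+ i - + i′)) → Dec (Z q (+ j - + j′)) → Z q (b * f - c * e)
      core (no n) _ = cancelZ q pr (+ i - + i′) n (lin₂ q f (- c) (sub z₁ z₁′) (sub z₂ z₂′) (lem a b c d e f (+ i) (+ j) (+ i′) (+ j′)))
      core (yes _) (no n) = cancelZ q pr (+ j - + j′) n (lin₂ q (- e) b (sub z₁ z₁′) (sub z₂ z₂′) (lem₂ a b c d e f (+ i) (+ j) (+ i′) (+ j′)))
      core (yes p) (yes r) = ⊥-elim (X≢ (cong₂ _,_ (residue-unique q i< i′< p) (residue-unique q j< j′< r)))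

    A₁ A₂ A₃ A₄ : M3 → M3 → ℤ
    A₁ γ γ′ = tri (r₁ γ) (r₂ γ) (r₁ γ′)
    A₂ γ γ′ = tri (r₁ γ) (r₂ γ) (r₂ γ′)
    A₃ γ γ′ = tri (r₁ γ′) (r₂ γ′) (r₁ γ)
    A₄ γ γ′ = tri (r₁ γ′) (r₂ γ′) (r₂ γ)

    resultant : M3 → M3 → ℤ
    resultant γ γ′ = A₁ γ γ′ * A₄ γ γ′ - A₂ γ γ′ * A₃ γ γ′

    -- By `cross-zero` the first two rows of the pencil are parallel modulo q. Testing this against
    -- u′ and v′ gives A₁ + κ A₃ ≡ 0 and A₂ + κ A₄ ≡ 0, from which κ is eliminated.
    two-kernel-points : ∀ {γ γ′ X X′} κ → InRange X → InRange X′ → X ≢ X′ → Ker (pencil γ κ γ′) X → Ker (pencil γ κ γ′) X′ → Z q (resultant γ γ′)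
    two-kernel-points {γ} {γ′} κ hX hX′ n (ker z₁ z₂ _) (ker z₁′ z₂′ _) = lin₂ q (A₄ γ γ′) (- A₃ γ γ′)
        (subst (Z q) (on-u (r₁ γ) (r₂ γ) κ (r₁ γ′) (r₂ γ′)) (zero-on (r₁ γ′))) (subst (Z q) (on-v (r₁ γ) (r₂ γ) κ (r₁ γ′) (r₂ γ′)) (zero-on (r₂ γ′)))
        (lem (A₁ γ γ′) (A₂ γ γ′) (A₃ γ γ′) (A₄ γ γ′) κ)
      where
      zero-on : ∀ t → Z q (tri (r₁ γ ⊖[ κ ] r₁ γ′) (r₂ γ ⊖[ κ ] r₂ γ′) t)
      zero-on = cross-zero (r₁ γ ⊖[ κ ] r₁ γ′) (r₂ γ ⊖[ κ ] r₂ γ′) hX hX′ n z₁ z₁′ z₂ z₂′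
      lem : ∀ a b c d k → a * d - b * c ≡ d * (a + k * c) + (- c) * (b + k * d)
      lem = solve-∀
      on-u : ∀ u v κ u′ v′ → tri (u ⊖[ κ ] u′) (v ⊖[ κ ] v′) u′ ≡ tri u v u′ + κ * tri u′ v′ u
      on-u (v3 a b c) (v3 d e f) κ (v3 A B C) (v3 D E F) = l a b c d e f κ A B C D E F
        where
        l : ∀ a b c d e f k A B C D E F → (a - k * A) * ((e - k * E) * C - (f - k * F) * B) - (b - k * B) * ((d - k * D) * C - (f - k * F) * A) + (c - k * C) * ((d - k * D) * B - (e - k * E) * A)
          ≡ a * (e * C - f * B) - b * (d * C - f * A) + c * (d * B - e * A) + k * (A * (E * c - F * b) - B * (D * c - F * a) + C * (D * b - E * a))
        l = solve-∀
      on-v : ∀ u v κ u′ v′ → tri (u ⊖[ κ ] u′) (v ⊖[ κ ] v′) v′ ≡ tri u v v′ + κ * tri u′ v′ v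
      on-v (v3 a b c) (v3 d e f) κ (v3 A B C) (v3 D E F) = l a b c d e f κ A B C D E F
        where
        l : ∀ a b c d e f k A B C D E F → (a - k * A) * ((e - k * E) * F - (f - k * F) * E) - (b - k * B) * ((d - k * D) * F - (f - k * F) * D) + (c - k * C) * ((d - k * D) * E - (e - k * E) * D)
          ≡ a * (e * F - f * E) - b * (d * F - f * D) + c * (d * E - e * D) + k * (A * (E * f - F * e) - B * (D * f - F * d) + C * (D * e - E * d))
        l = solve-∀

    pairs : List (Point × Point)
    pairs = cartesianProduct (range² q) (range² q)

    pairs-unique : Unique pairs
    pairs-unique = cartesianProduct⁺ (range²-unique q) (range²-unique q)

    pair-range : ∀ {P} → P ∈ pairs → InRange (proj₁ P) × InRange (proj₂ P)
    pair-range h = let (a , b) = ∈-cartesianProduct⁻ (range² q) (range² q) h in in-range a , in-range b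

    Both? : ∀ γ γ′ (P : Point × Point) → Dec (Hit γ (proj₁ P) (proj₂ P) × Hit γ′ (proj₁ P) (proj₂ P))
    Both? γ γ′ P = Hit? γ (proj₁ P) (proj₂ P) ×-dec Hit? γ′ (proj₁ P) (proj₂ P)

    collisions : M3 → M3 → List (Point × Point)
    collisions γ γ′ = filter (Both? γ γ′) pairs

    collisions-unique : ∀ γ γ′ → Unique (collisions γ γ′)
    collisions-unique γ γ′ = filter⁺ (Both? γ γ′) pairs-unique

    collision-facts : ∀ {γ γ′ P} → P ∈ collisions γ γ′ → (P ∈ pairs) × Hit γ (proj₁ P) (proj₂ P) × Hit γ′ (proj₁ P) (proj₂ P)
    collision-facts {γ} {γ′} h = ∈-filter⁻ (Both? γ γ′) {xs = pairs} h

    same-first : ∀ {γ γ′ P P′} → P ∈ collisions γ γ′ → P′ ∈ collisions γ γ′ → proj₁ P ≡ proj₁ P′ → P ≡ P′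
    same-first {γ} {γ′} {X , Y} {_ , Y′} h h′ refl with collision-facts {γ} {γ′} h | collision-facts {γ} {γ′} h′
    ... | m , k , _ | m′ , k′ , _ = cong (X ,_) (hit-unique (proj₂ (pair-range m)) (proj₂ (pair-range m′)) k k′)

    self-collisions : ∀ γ → length (collisions γ γ) ℕ.≤ q ℕ.* q
    self-collisions γ = ℕₚ.≤-trans (inject-length {f = proj₁} (collisions-unique γ γ) (same-first {γ} {γ}) (λ h → proj₁ (∈-cartesianProduct⁻ (range² q) (range² q) (proj₁ (collision-facts {γ} {γ} h)))))
      (ℕₚ.≤-reflexive (length-range² q))

    Independent : M3 → M3 → Set
    Independent γ γ′ = ∀ κ → ¬ ((Z q (x (r₁ γ) - κ * x (r₁ γ′)) × Z q (y (r₁ γ) - κ * y (r₁ γ′)) × Z q (z (r₁ γ) - κ * z (r₁ γ′)))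
                              × (Z q (x (r₂ γ) - κ * x (r₂ γ′)) × Z q (y (r₂ γ) - κ * y (r₂ γ′)) × Z q (z (r₂ γ) - κ * z (r₂ γ′))))

    module _ {γ γ′ : M3} (unit : det γ′ ≡ + 1) where

      private
        Rel? : ∀ (P : Point × Point) κ → Dec (Ker (pencil γ (+ κ) γ′) (proj₁ P))
        Rel? P κ = Ker? (pencil γ (+ κ) γ′) (proj₁ P)

        cover : ∀ P → P ∈ collisions γ γ′ → Σ ℕ λ κ → (κ ∈ roots γ γ′) × Ker (pencil γ (+ κ) γ′) (proj₁ P)
        cover P h = go (hit-kernel (proj₁ (proj₂ f)) (proj₂ (proj₂ f)))
          where
          f = collision-facts {γ} {γ′} h
          go : (Σ ℕ λ κ → (κ ℕ.< q) × Ker (pencil γ (+ κ) γ′) (proj₁ P)) → Σ ℕ λ κ → (κ ∈ roots γ γ′) × Ker (pencil γ (+ κ) γ′) (proj₁ P)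
          go (κ , κ< , k) = κ , ∈-filter⁺ (λ κ → Z? q (det (pencil γ (+ κ) γ′))) (∈-upTo⁺ κ<) (ker-det k) , k

        by-roots : ∀ n → (∀ κ → length (filter (λ P → Rel? P κ) (collisions γ γ′)) ℕ.≤ n) → length (collisions γ γ′) ℕ.≤ 3 ℕ.* n
        by-roots n h = ℕₚ.≤-trans (double-count Rel? (collisions γ γ′) (roots γ γ′) (λ _ → n) cover (λ κ _ → h κ))
          (ℕₚ.≤-trans (ℕₚ.≤-reflexive (sumL-const (roots γ γ′) n)) (ℕₚ.*-monoˡ-≤ n (roots≤3 γ γ′ unit)))

        fibre-facts : ∀ {κ P} → P ∈ filter (λ P → Rel? P κ) (collisions γ γ′) → (P ∈ collisions γ γ′) × Ker (pencil γ (+ κ) γ′) (proj₁ P)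
        fibre-facts {κ} h = ∈-filter⁻ (λ P → Rel? P κ) {xs = collisions γ γ′} h

        fibre-unique : ∀ κ → Unique (filter (λ P → Rel? P κ) (collisions γ γ′))
        fibre-unique κ = filter⁺ (λ P → Rel? P κ) (collisions-unique γ γ′)

        ranged : ∀ {P} → P ∈ collisions γ γ′ → InRange (proj₁ P)
        ranged h = proj₁ (pair-range (proj₁ (collision-facts {γ} {γ′} h)))

      -- One point for each of at most three roots: a second point for the same root would make the
      -- resultant vanish, and the target is determined by the source.
      few-collisions : ¬ Z q (resultant γ γ′) → length (collisions γ γ′) ℕ.≤ 3
      few-collisions n = by-roots 1 (λ κ → at-most-one (fibre-unique κ) (single κ))
        where
        single : ∀ κ {P P′} → P ∈ filter (λ P → Rel? P κ) (collisions γ γ′) → P′ ∈ filter (λ P → Rel? P κ) (collisions γ γ′) → P ≡ P′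
        single κ {P} {P′} h h′ = go (≡-dec ℕₚ._≟_ ℕₚ._≟_ (proj₁ P) (proj₁ P′))
          where
          f = fibre-facts {κ} h
          f′ = fibre-facts {κ} h′
          go : Dec (proj₁ P ≡ proj₁ P′) → P ≡ P′
          go (yes e) = same-first {γ} {γ′} (proj₁ f) (proj₁ f′) e
          go (no ne) = ⊥-elim (n (two-kernel-points {γ} {γ′} {proj₁ P} {proj₁ P′} (+ κ) (ranged (proj₁ f)) (ranged (proj₁ f′)) ne (proj₂ f) (proj₂ f′)))

      -- For each root some row among the first two of the pencil is nonzero, so the kernel lies on
      -- a line with at most q affine points.
      collisions≤ : Independent γ γ′ → length (collisions γ γ′) ℕ.≤ 3 ℕ.* q
      collisions≤ ind = by-roots q fibre
        where
        fibre : ∀ κ → length (filter (λ P → Rel? P κ) (collisions γ γ′)) ℕ.≤ q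
        fibre κ = go (all? d₁) (all? d₂)
          where
          M = pencil γ (+ κ) γ′
          d₁ = r₁ M
          d₂ = r₂ M
          all? : ∀ d → Dec (Z q (x d) × Z q (y d) × Z q (z d))
          all? d = Z? q (x d) ×-dec (Z? q (y d) ×-dec Z? q (z d))
          on-line : ∀ d → (∀ {X} → Ker M X → Z q (d · pt X)) → ¬ (Z q (x d) × Z q (y d) × Z q (z d)) → length (filter (λ P → Rel? P κ) (collisions γ γ′)) ℕ.≤ q
          on-line d k n = ℕₚ.≤-trans (inject-length {f = proj₁} (fibre-unique κ) (λ h h′ → same-first {γ} {γ′} (proj₁ (fibre-facts {κ} h)) (proj₁ (fibre-facts {κ} h′)))
            (λ h → ∈-filter⁺ (line? q pr d) (proj₁ (∈-cartesianProduct⁻ (range² q) (range² q) (proj₁ (collision-facts {γ} {γ′} (proj₁ (fibre-facts {κ} h)))))) (k (proj₂ (fibre-facts {κ} h))))) (line-count q pr d n)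
          go : Dec (Z q (x d₁) × Z q (y d₁) × Z q (z d₁)) → Dec (Z q (x d₂) × Z q (y d₂) × Z q (z d₂)) → length (filter (λ P → Rel? P κ) (collisions γ γ′)) ℕ.≤ q
          go (no n) _ = on-line d₁ Ker.k₁ n
          go (yes _) (no n) = on-line d₂ Ker.k₂ n
          go (yes a) (yes b) = ⊥-elim (ind (+ κ) (a , b))

    -- If both rows of the pencil vanish, then a c′ ≡ a′ c, an equality by size, so the reduced
    -- fractions agree. This forces κ ≡ 1, hence congruent rows, hence D ≡ D′ and e ≡ e′, which are
    -- again equalities by size.
    independent : ∀ {p p′ γ γ′} → Rows p γ → Rows p′ γ′ → Coprime (proj₁ (proj₁ p)) (proj₂ (proj₁ p)) → Coprime (proj₁ (proj₁ p′)) (proj₂ (proj₁ p′))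
      → 1 ℕ.≤ proj₁ (proj₁ p) → proj₁ (proj₁ p) ℕ.< q → proj₁ (proj₁ p) ℕ.* proj₂ (proj₁ p′) ℕ.< q → proj₁ (proj₁ p′) ℕ.* proj₂ (proj₁ p) ℕ.< q
      → proj₁ (proj₂ p) ℕ.< q → proj₁ (proj₂ p′) ℕ.< q → proj₂ (proj₂ p) ℕ.< q → proj₂ (proj₂ p′) ℕ.< q → p ≢ p′ → Independent γ γ′
    independent {(a , c) , (D , e)} {(a′ , c′) , (D′ , e′)} {γ} {γ′} R R′ cop cop′ 1≤a a<q ac′< a′c< D< D′< e< e′< p≢ κ ((ux , uy , uz) , (vx , vy , vz)) =
        p≢ (cong₂ _,_ (cong₂ _,_ (proj₁ same) (proj₂ same)) (cong₂ _,_ (residue-unique q D< D′< ZD) (residue-unique q e< e′< Ze)))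
      where
      module R = Rows R
      module R′ = Rows R′
      ua : Z q (+ a - κ * + a′)
      ua = subst (Z q) (cong₂ (λ s t → s - κ * t) R.xu R′.xu) ux
      vc : Z q (+ c - κ * + c′)
      vc = subst (Z q) (cong₂ (λ s t → s - κ * t) R.xv R′.xv) vx
      lem : ∀ a a′ c c′ k → a * c′ - a′ * c ≡ c′ * (a - k * a′) + (- a′) * (c - k * c′)
      lem = solve-∀
      same : (a ≡ a′) × (c ≡ c′)
      same = coprime-fractions 1≤a cop cop′ (residue-unique q ac′< a′c< (subst (Z q) (cong₂ _-_ (sym (ℤₚ.pos-* a c′)) (sym (ℤₚ.pos-* a′ c))) (lin₂ q (+ c′) (- (+ a′)) ua vc (lem (+ a) (+ a′) (+ c) (+ c′) κ))))
      lem₂ : ∀ a k → a * (+ 1 - k) ≡ a - k * a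
      lem₂ = solve-∀
      ¬Za : ¬ Z q (+ a)
      ¬Za h = ℕₚ.<⇒≢ 1≤a (sym (ℤₚ.+-injective (Z-small q h a<q)))
      κ≡1 : Z q (+ 1 - κ)
      κ≡1 = cancelZ q pr (+ a) ¬Za (subst (Z q) (trans (cong (λ t → + a - κ * + t) (sym (proj₁ same))) (sym (lem₂ (+ a) κ))) ua)
      combine : ∀ {s t s′ t′} → Z q (s - κ * s′) → Z q (t - κ * t′) → Z q ((x (r₁ γ) * t - x (r₂ γ) * s) - (x (r₁ γ′) * t′ - x (r₂ γ′) * s′))
      combine {s} {t} {s′} {t′} zs zt = lin₂ q (+ 1) (+ 1) (lin₂ q (+ 1) (+ 1) (lin₂ q t (- s) ux vx refl) (lin₂ q (κ * x (r₁ γ′)) (- (κ * x (r₂ γ′))) zt zs refl) refl)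
          (lin₁ q (- (+ 1 + κ) * (x (r₁ γ′) * t′ - x (r₂ γ′) * s′)) κ≡1 refl) (l (x (r₁ γ)) (x (r₂ γ)) (x (r₁ γ′)) (x (r₂ γ′)) s t s′ t′ κ)
        where
        l : ∀ a c a′ c′ s t s′ t′ k → (a * t - c * s) - (a′ * t′ - c′ * s′) ≡
          + 1 * (+ 1 * (t * (a - k * a′) + (- s) * (c - k * c′)) + + 1 * ((k * a′) * (t - k * t′) + (- (k * c′)) * (s - k * s′))) + + 1 * ((- (+ 1 + k) * (a′ * t′ - c′ * s′)) * (+ 1 - k))
        l = solve-∀
      ZD : Z q (+ D - + D′)
      ZD = subst (Z q) (cong₂ _-_ R.crossD R′.crossD) (combine {y (r₁ γ)} {y (r₂ γ)} {y (r₁ γ′)} {y (r₂ γ′)} uy vy)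
      Ze : Z q (+ e - + e′)
      Ze = subst (Z q) (cong₂ _-_ R.crossE R′.crossE) (combine {z (r₁ γ)} {z (r₂ γ)} {z (r₁ γ′)} {z (r₂ γ′)} uz vz)

    -- A₁ = A₂ = 0 places u′ and v′ in the plane of u and v, so the cross products u × v and u′ × v′
    -- are parallel. Their coordinates D, e and D′, e′ are coprime pairs and therefore equal.
    zero-class : ∀ {p p′ γ γ′} → Rows p γ → Rows p′ γ′ → Coprime (proj₁ (proj₂ p)) (proj₂ (proj₂ p)) → Coprime (proj₁ (proj₂ p′)) (proj₂ (proj₂ p′))
      → 1 ℕ.≤ proj₁ (proj₂ p) → A₁ γ γ′ ≡ + 0 → A₂ γ γ′ ≡ + 0 → proj₂ p ≡ proj₂ p′
    zero-class {(a , c) , (D , e)} {(a′ , c′) , (D′ , e′)} {γ} {γ′} R R′ cop cop′ 1≤D z₁ z₂ = let (i , j) = coprime-fractions 1≤D cop cop′ De′≡ in cong₂ _,_ i j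
      where
      module R = Rows R
      module R′ = Rows R′
      lem : ∀ u v u′ v′ → (x u * y v - x v * y u) * (x u′ * z v′ - x v′ * z u′) ≡ (x u′ * y v′ - x v′ * y u′) * (x u * z v - x v * z u) + (x u′ * tri u v v′ - x v′ * tri u v u′)
      lem (v3 a b c) (v3 d e f) (v3 A B C) (v3 D E F) = l a b c d e f A B C D E F
        where
        l : ∀ a b c d e f A B C D E F → (a * e - d * b) * (A * F - D * C) ≡ (A * E - D * B) * (a * f - d * c) + (A * (a * (e * F - f * E) - b * (d * F - f * D) + c * (d * E - e * D)) - D * (a * (e * C - f * B) - b * (d * C - f * A) + c * (d * B - e * A)))
        l = solve-∀
      vanish : ∀ k s t → k + (s * + 0 - t * + 0) ≡ k
      vanish = solve-∀
      De′≡ : D ℕ.* e′ ≡ D′ ℕ.* e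
      De′≡ = ℤₚ.+-injective (trans (ℤₚ.pos-* D e′) (trans (cong₂ _*_ (sym R.crossD) (sym R′.crossE)) (trans (lem (r₁ γ) (r₂ γ) (r₁ γ′) (r₂ γ′))
        (trans (cong₂ (λ s t → (x (r₁ γ′) * y (r₂ γ′) - x (r₂ γ′) * y (r₁ γ′)) * (x (r₁ γ) * z (r₂ γ) - x (r₂ γ) * z (r₁ γ)) + (x (r₁ γ′) * s - x (r₂ γ′) * t)) z₂ z₁)
        (trans (vanish ((x (r₁ γ′) * y (r₂ γ′) - x (r₂ γ′) * y (r₁ γ′)) * (x (r₁ γ) * z (r₂ γ) - x (r₂ γ) * z (r₁ γ))) (x (r₁ γ′)) (x (r₂ γ′))) (trans (cong₂ _*_ R′.crossD R.crossE) (sym (ℤₚ.pos-* D′ e))))))))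

-- First and second moments of the number of hits.

module Moments where

  open import Data.Nat as ℕ using (ℕ; suc; z≤n; s≤s; NonZero)
  import Data.Nat.Properties as ℕₚ
  open import Data.Nat.Primality using (Prime)
  open import Data.Nat.Solver using (module +-*-Solver)
  open import Data.Integer as ℤ using (+_; -_; _+_; _*_; _-_; ∣_∣)
  import Data.Integer.Properties as ℤₚ
  open import Data.Integer.Tactic.RingSolver using (solve-∀)
  open import Data.List using (List; []; _∷_; length; filter; map; cartesianProduct)
  open import Data.List.Properties using (length-map)
  open import Data.List.Membership.Propositional using (_∈_)
  open import Data.List.Membership.Propositional.Properties using (∈-filter⁻; ∈-cartesianProduct⁻; ∈-cartesianProduct⁺; ∈-upTo⁺; ∈-map⁻)
  open import Data.List.Relation.Unary.Any using (here; there)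
  open import Data.List.Relation.Unary.Unique.Propositional using (Unique)
  open import Data.List.Relation.Unary.Unique.Propositional.Properties using (filter⁺; cartesianProduct⁺)
  open import Data.Product using (Σ; _×_; _,_; proj₁; proj₂)
  open import Data.Product.Properties using (≡-dec)
  open import Data.Sum using (_⊎_; inj₁; inj₂)
  open import Data.Empty using (⊥-elim)
  open import Relation.Nullary using (Dec; yes; no; ¬_)
  open import Relation.Nullary.Decidable using (_×-dec_; ¬?)
  open import Relation.Binary.PropositionalEquality
  open Counting
  open Matrices
  open CoprimePairs using (IsCop; Cop; Cop-sound; Cop-unique; range²; length-range²)
  open Residues
  open Hyperplanes using (inb)
  open DegenerateTriples using (Triple; normalVec; p₁; p₂; p₃; p₄; Degenerate; degenerate-count; minorBound; D3-bound)
  open Family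
  open Collision

  length-cover₃ : ∀ {A : Set} {P Q R : A → Set} (P? : ∀ x → Dec (P x)) (Q? : ∀ x → Dec (Q x)) (R? : ∀ x → Dec (R x)) (xs : List A)
    → (∀ {x} → x ∈ xs → ¬ P x → ¬ Q x → R x) → length xs ℕ.≤ length (filter P? xs) ℕ.+ length (filter Q? xs) ℕ.+ length (filter R? xs)
  length-cover₃ P? Q? R? xs cover = begin
    length xs ≡⟨ length-sumL xs ⟩
    sumL xs (λ _ → 1) ≤⟨ sumL-mono xs (λ x h → each (P? x) (Q? x) (R? x) (cover h)) ⟩
    sumL xs (λ x → 𝟙 (P? x) ℕ.+ 𝟙 (Q? x) ℕ.+ 𝟙 (R? x)) ≡⟨ trans (sumL-+ xs (λ x → 𝟙 (P? x) ℕ.+ 𝟙 (Q? x)) (λ x → 𝟙 (R? x))) (cong (ℕ._+ sumL xs (λ x → 𝟙 (R? x))) (sumL-+ xs (λ x → 𝟙 (P? x)) (λ x → 𝟙 (Q? x)))) ⟩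
    sumL xs (λ x → 𝟙 (P? x)) ℕ.+ sumL xs (λ x → 𝟙 (Q? x)) ℕ.+ sumL xs (λ x → 𝟙 (R? x)) ≡⟨ sym (cong₂ ℕ._+_ (cong₂ ℕ._+_ (length-filter P? xs) (length-filter Q? xs)) (length-filter R? xs)) ⟩
    length (filter P? xs) ℕ.+ length (filter Q? xs) ℕ.+ length (filter R? xs) ∎
    where
    open ℕₚ.≤-Reasoning
    each : ∀ {P Q R : Set} (p : Dec P) (q : Dec Q) (r : Dec R) → (¬ P → ¬ Q → R) → 1 ℕ.≤ 𝟙 p ℕ.+ 𝟙 q ℕ.+ 𝟙 r
    each (yes _) _ _ _ = s≤s z≤n
    each (no _) (yes _) _ _ = s≤s z≤n
    each (no _) (no _) (yes _) _ = s≤s z≤n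
    each (no p) (no q) (no r) h = ⊥-elim (r (h p q))

  𝟙-× : ∀ {P Q : Set} (p : Dec P) (q : Dec Q) → 𝟙 p ℕ.* 𝟙 q ≡ 𝟙 (p ×-dec q)
  𝟙-× (yes _) (yes _) = refl
  𝟙-× (yes _) (no _) = refl
  𝟙-× (no _) (yes _) = refl
  𝟙-× (no _) (no _) = refl

  sumL-square : ∀ {A : Set} (xs : List A) (f : A → ℕ) → sumL xs f ℕ.* sumL xs f ≡ sumL xs (λ x → sumL xs (λ y → f x ℕ.* f y))
  sumL-square xs f = sym (trans (sumL-cong xs (λ x → sumL-* xs (f x) f)) (trans (sumL-cong xs (λ x → ℕₚ.*-comm (f x) (sumL xs f))) (sumL-* xs (sumL xs f) f)))

  sumL-filter : ∀ {A : Set} {P : A → Set} (P? : ∀ x → Dec (P x)) (xs : List A) (f : A → ℕ) → (∀ x → ¬ P x → f x ≡ 0) → sumL (filter P? xs) f ≡ sumL xs f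
  sumL-filter P? [] f h = refl
  sumL-filter P? (x ∷ xs) f h with P? x
  ... | yes _ = cong (f x ℕ.+_) (sumL-filter P? xs f h)
  ... | no n = trans (sumL-filter P? xs f h) (cong (ℕ._+ sumL xs f) (sym (h x n)))

  sumL-positive : ∀ {A : Set} {P : A → Set} (P? : ∀ x → Dec (P x)) (xs : List A) → 1 ℕ.≤ sumL xs (λ x → 𝟙 (P? x)) → Σ A λ x → (x ∈ xs) × P x
  sumL-positive P? (x ∷ xs) h with P? x
  ... | yes p = x , here refl , p
  ... | no _ = let (y , i , p) = sumL-positive P? xs h in y , there i , p

  -- The rows of the 3 × 4 matrix with columns a, b, c, d. By Cramer's rule its normal vector
  -- consists of the signed determinants of three columns, which is the content of `normal₁` to
  -- `normal₄`.
  trip : V3 → V3 → V3 → V3 → Triple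
  trip a b c d = (x a , x b , x c , x d) , (y a , y b , y c , y d) , (z a , z b , z c , z d)

  trip-injective : ∀ {a b c d a′ b′ c′ d′} → trip a b c d ≡ trip a′ b′ c′ d′ → (a ≡ a′) × (b ≡ b′) × (c ≡ c′) × (d ≡ d′)
  trip-injective refl = refl , refl , refl , refl

  transpose : ∀ a b c d e f g h i → a * (e * i - h * f) - d * (b * i - h * c) + g * (b * f - e * c) ≡ a * (e * i - f * h) - b * (d * i - f * g) + c * (d * h - e * g)
  transpose = solve-∀

  normal₁ : ∀ a b c d → p₁ (normalVec (trip a b c d)) ≡ tri b c d
  normal₁ _ (v3 a b c) (v3 d e f) (v3 g h i) = transpose a b c d e f g h i

  normal₂ : ∀ a b c d → p₂ (normalVec (trip a b c d)) ≡ - tri a c d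
  normal₂ (v3 a b c) _ (v3 d e f) (v3 g h i) = cong -_ (transpose a b c d e f g h i)

  normal₃ : ∀ a b c d → p₃ (normalVec (trip a b c d)) ≡ tri a b d
  normal₃ (v3 a b c) (v3 d e f) _ (v3 g h i) = transpose a b c d e f g h i

  normal₄ : ∀ a b c d → p₄ (normalVec (trip a b c d)) ≡ - tri a b c
  normal₄ (v3 a b c) (v3 d e f) (v3 g h i) _ = cong -_ (transpose a b c d e f g h i)

  tri-cycle : ∀ a b c → tri a b c ≡ tri b c a
  tri-cycle (v3 a b c) (v3 d e f) (v3 g h i) = lem a b c d e f g h i
    where
    lem : ∀ a b c d e f g h i → a * (e * i - f * h) - b * (d * i - f * g) + c * (d * h - e * g) ≡ d * (h * c - i * b) - e * (g * c - i * a) + f * (g * b - h * a)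
    lem = solve-∀

  tri-swap : ∀ a b c → tri a b c ≡ - tri b a c
  tri-swap (v3 a b c) (v3 d e f) (v3 g h i) = lem a b c d e f g h i
    where
    lem : ∀ a b c d e f g h i → a * (e * i - f * h) - b * (d * i - f * g) + c * (d * h - e * g) ≡ - (d * (b * i - c * h) - e * (a * i - c * g) + f * (a * h - b * g))
    lem = solve-∀

  rows-determine : ∀ {p p′ γ γ′} → Rows p γ → Rows p′ γ′ → r₁ γ ≡ r₁ γ′ → r₂ γ ≡ r₂ γ′ → p ≡ p′
  rows-determine {(a , c) , (D , e)} {(a′ , c′) , (D′ , e′)} {m3 u v _} {m3 u v _} R R′ refl refl =
    cong₂ _,_ (cong₂ _,_ (eq (Rows.xu R) (Rows.xu R′)) (eq (Rows.xv R) (Rows.xv R′))) (cong₂ _,_ (eq (Rows.crossD R) (Rows.crossD R′)) (eq (Rows.crossE R) (Rows.crossE R′)))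
    where
    eq : ∀ {t i j} → t ≡ + i → t ≡ + j → i ≡ j
    eq h k = ℤₚ.+-injective (trans (sym h) k)

  module SecondMoment (q : ℕ) (pr : Prime q) (m ℓ : ℕ) (m≥1 : 1 ℕ.≤ m)
    (hq : minorBound (10 ℕ.* m) ℕ.+ minorBound (10 ℕ.* m) ℕ.< q) (hℓ : minorBound (10 ℕ.* m) ℕ.< 2 ℕ.^ ℓ) where

    private
      B Y : ℕ
      B = 10 ℕ.* m
      Y = minorBound B

    open Collide q pr

    instance
      B≢0 : NonZero B
      B≢0 = ℕ.>-nonZero (ℕₚ.*-mono-≤ (s≤s (z≤n {9})) m≥1)

    F : List Params
    F = cartesianProduct (Cop m) (Cop (m ℕ.* m))

    F-unique : Unique F
    F-unique = cartesianProduct⁺ (Cop-unique m) (Cop-unique (m ℕ.* m))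

    _≟F_ : (p p′ : Params) → Dec (p ≡ p′)
    _≟F_ = ≡-dec (≡-dec ℕₚ._≟_ ℕₚ._≟_) (≡-dec ℕₚ._≟_ ℕₚ._≟_)

    module Member {p} (h : p ∈ F) where
      small : IsCop m (proj₁ p)
      small = Cop-sound (proj₁ (∈-cartesianProduct⁻ (Cop m) (Cop (m ℕ.* m)) h))
      large : IsCop (m ℕ.* m) (proj₂ p)
      large = Cop-sound (proj₂ (∈-cartesianProduct⁻ (Cop m) (Cop (m ℕ.* m)) h))
      rows : Rows p (matrix p)
      rows = proj₁ (matrix-rows m≥1 small large)
      bounds : RowBounds m (matrix p)
      bounds = proj₂ (matrix-rows m≥1 small large)
      a≥1 : 1 ℕ.≤ proj₁ (proj₁ p)
      a≥1 = ℕₚ.≤-trans (s≤s z≤n) (IsCop.c<a small)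
      c≤ : proj₂ (proj₁ p) ℕ.≤ 2 ℕ.* m
      c≤ = ℕₚ.≤-trans (ℕₚ.<⇒≤ (IsCop.c<a small)) (IsCop.a≤ small)
      D≥1 : 1 ℕ.≤ proj₁ (proj₂ p)
      D≥1 = ℕₚ.≤-trans (s≤s z≤n) (IsCop.c<a large)

    Y<q : Y ℕ.< q
    Y<q = ℕₚ.≤-<-trans (ℕₚ.m≤m+n Y Y) hq

    BB≤Y : B ℕ.* B ℕ.≤ Y
    BB≤Y = ℕₚ.≤-trans (ℕₚ.m≤m+n (B ℕ.* B) (B ℕ.* B)) (ℕₚ.≤-trans (ℕₚ.m≤n*m (B ℕ.* B ℕ.+ B ℕ.* B) B) (ℕₚ.m≤n*m (B ℕ.* (B ℕ.* B ℕ.+ B ℕ.* B)) 3))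

    product<q : ∀ {i j} → i ℕ.≤ 2 ℕ.* m → j ℕ.≤ 2 ℕ.* m → i ℕ.* j ℕ.< q
    product<q hi hj = ℕₚ.≤-<-trans (ℕₚ.≤-trans (ℕₚ.*-mono-≤ (ℕₚ.≤-trans hi 2≤B) (ℕₚ.≤-trans hj 2≤B)) BB≤Y) Y<q
      where
      2≤B : 2 ℕ.* m ℕ.≤ B
      2≤B = ℕₚ.*-monoˡ-≤ m (ℕₚ.m≤m+n 2 8)

    D-bound : ∀ {D} → D ℕ.≤ 2 ℕ.* (m ℕ.* m) → D ℕ.< q
    D-bound h = ℕₚ.≤-<-trans (ℕₚ.≤-trans h (ℕₚ.≤-reflexive (sym (ℕₚ.*-assoc 2 m m)))) (product<q ℕₚ.≤-refl (ℕₚ.m≤n*m m 2))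

    a<q : ∀ {p} → p ∈ F → proj₁ (proj₁ p) ℕ.< q
    a<q h = subst (ℕ._< q) (ℕₚ.*-identityʳ _) (product<q (IsCop.a≤ (Member.small h)) (ℕₚ.*-mono-≤ (s≤s (z≤n {1})) m≥1))

    independent-pair : ∀ {p p′} → p ∈ F → p′ ∈ F → p ≢ p′ → Independent (matrix p) (matrix p′)
    independent-pair h h′ ne = independent (Member.rows h) (Member.rows h′) (IsCop.cop (Member.small h)) (IsCop.cop (Member.small h′)) (Member.a≥1 h) (a<q h)
      (product<q (IsCop.a≤ (Member.small h)) (Member.c≤ h′)) (product<q (IsCop.a≤ (Member.small h′)) (Member.c≤ h))
      (D-bound (IsCop.a≤ (Member.large h))) (D-bound (IsCop.a≤ (Member.large h′))) (D-bound (e≤ (Member.large h))) (D-bound (e≤ (Member.large h′))) ne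
      where
      e≤ : ∀ {n r} → IsCop n r → proj₂ r ℕ.≤ 2 ℕ.* n
      e≤ i = ℕₚ.≤-trans (ℕₚ.<⇒≤ (IsCop.c<a i)) (IsCop.a≤ i)

    Bad : Params × Params → Set
    Bad (p , p′) = p ≢ p′ × Z q (resultant (matrix p) (matrix p′))

    Bad? : ∀ P → Dec (Bad P)
    Bad? (p , p′) = ¬? (p ≟F p′) ×-dec Z? q (resultant (matrix p) (matrix p′))

    bad : List (Params × Params)
    bad = filter Bad? (cartesianProduct F F)

    pair-collisions : ∀ {p p′} → p ∈ F → p′ ∈ F → length (collisions (matrix p) (matrix p′)) ℕ.≤ q ℕ.* q ℕ.* 𝟙 (p ≟F p′) ℕ.+ (3 ℕ.+ 3 ℕ.* q ℕ.* 𝟙 (Bad? (p , p′)))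
    pair-collisions {p} {p′} h h′ = go (p ≟F p′) (Z? q (resultant (matrix p) (matrix p′)))
      where
      open ℕₚ.≤-Reasoning
      n = length (collisions (matrix p) (matrix p′))
      go : Dec (p ≡ p′) → Dec (Z q (resultant (matrix p) (matrix p′))) → n ℕ.≤ q ℕ.* q ℕ.* 𝟙 (p ≟F p′) ℕ.+ (3 ℕ.+ 3 ℕ.* q ℕ.* 𝟙 (Bad? (p , p′)))
      go (yes refl) _ = ℕₚ.≤-trans (self-collisions (matrix p)) (ℕₚ.≤-trans (ℕₚ.≤-reflexive (trans (sym (ℕₚ.*-identityʳ (q ℕ.* q))) (cong (q ℕ.* q ℕ.*_) (sym (𝟙-yes (p ≟F p) refl))))) (ℕₚ.m≤m+n _ _))
      go (no ne) (no nz) = ℕₚ.≤-trans (few-collisions {matrix p} {matrix p′} (Rows.unit (Member.rows h′)) nz) (ℕₚ.≤-trans (ℕₚ.m≤m+n 3 _) (ℕₚ.m≤n+m _ (q ℕ.* q ℕ.* 𝟙 (p ≟F p′))))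
      go (no ne) (yes zr) = ℕₚ.≤-trans (collisions≤ {matrix p} {matrix p′} (Rows.unit (Member.rows h′)) (independent-pair h h′ ne))
        (ℕₚ.≤-trans (ℕₚ.≤-reflexive (trans (sym (ℕₚ.*-identityʳ (3 ℕ.* q))) (cong (3 ℕ.* q ℕ.*_) (sym (𝟙-yes (Bad? (p , p′)) (ne , zr)))))) (ℕₚ.≤-trans (ℕₚ.m≤n+m _ 3) (ℕₚ.m≤n+m _ (q ℕ.* q ℕ.* 𝟙 (p ≟F p′)))))

    L W : ℕ
    L = 2 ℕ.* suc ℓ
    W = DegenerateTriples.V q pr B ℓ hq hℓ ℕ.* L ℕ.* L ℕ.* L

    tri-bound : ∀ {a b c} → VBound B a → VBound B b → VBound B c → ∣ tri a b c ∣ ℕ.≤ Y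
    tri-bound {v3 a b c} {v3 d e f} {v3 g h i} (vb q₁ q₂ q₃) (vb q₄ q₅ q₆) (vb q₇ q₈ q₉) = D3-bound a b c d e f g h i q₁ q₂ q₃ q₄ q₅ q₆ q₇ q₈ q₉

    -- Two orderings of u, v, u′, v′. They put A₁, respectively A₄, into the first component of the
    -- normal, which has to be nonzero, and both turn the resultant, up to sign, into the degeneracy
    -- condition.
    trip₁ trip₄ : Params × Params → Triple
    trip₁ (p , p′) = trip (r₂ (matrix p′)) (r₂ (matrix p)) (r₁ (matrix p′)) (r₁ (matrix p))
    trip₄ (p , p′) = trip (r₁ (matrix p)) (r₂ (matrix p)) (r₁ (matrix p′)) (r₂ (matrix p′))

    in-trip : ∀ {a b c d} → VBound B a → VBound B b → VBound B c → VBound B d → p₁ (normalVec (trip a b c d)) ≢ + 0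
      → Z q (p₁ (normalVec (trip a b c d)) * p₄ (normalVec (trip a b c d)) - p₂ (normalVec (trip a b c d)) * p₃ (normalVec (trip a b c d))) → Degenerate q pr B ℓ hq hℓ (trip a b c d)
    in-trip (vb a₁ a₂ a₃) (vb b₁ b₂ b₃) (vb c₁ c₂ c₃) (vb d₁ d₂ d₃) ne zd = record { in₁ = inb a₁ b₁ c₁ d₁ ; in₂ = inb a₂ b₂ c₂ d₂ ; in₃ = inb a₃ b₃ c₃ d₃ ; μ₁≢0 = ne ; μ-det = zd }

    degenerate₄ : ∀ {p p′} → p ∈ F → p′ ∈ F → A₄ (matrix p) (matrix p′) ≢ + 0 → Z q (resultant (matrix p) (matrix p′)) → Degenerate q pr B ℓ hq hℓ (trip₄ (p , p′))
    degenerate₄ {p} {p′} h h′ ne zr = in-trip (RowBounds.u-bound b) (RowBounds.v-bound b) (RowBounds.u-bound b′) (RowBounds.v-bound b′)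
        (λ e → ne (trans (sym p₁≡) e)) (lin₁ q (- (+ 1)) zr (trans (cong₂ _-_ (cong₂ _*_ p₁≡ (normal₄ u v u′ v′)) (cong₂ _*_ p₂≡ (normal₃ u v u′ v′))) (lem (A₁ (matrix p) (matrix p′)) (A₂ (matrix p) (matrix p′)) (A₃ (matrix p) (matrix p′)) (A₄ (matrix p) (matrix p′)))))
      where
      b = Member.bounds h
      b′ = Member.bounds h′
      u = r₁ (matrix p)
      v = r₂ (matrix p)
      u′ = r₁ (matrix p′)
      v′ = r₂ (matrix p′)
      p₁≡ : p₁ (normalVec (trip u v u′ v′)) ≡ tri u′ v′ v
      p₁≡ = trans (normal₁ u v u′ v′) (tri-cycle v u′ v′)
      p₂≡ : p₂ (normalVec (trip u v u′ v′)) ≡ - tri u′ v′ u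
      p₂≡ = trans (normal₂ u v u′ v′) (cong -_ (tri-cycle u u′ v′))
      lem : ∀ a b c d → d * (- a) - (- c) * b ≡ (- (+ 1)) * (a * d - b * c)
      lem = solve-∀

    degenerate₁ : ∀ {p p′} → p ∈ F → p′ ∈ F → A₁ (matrix p) (matrix p′) ≢ + 0 → Z q (resultant (matrix p) (matrix p′)) → Degenerate q pr B ℓ hq hℓ (trip₁ (p , p′))
    degenerate₁ {p} {p′} h h′ ne zr = in-trip (RowBounds.v-bound b′) (RowBounds.v-bound b) (RowBounds.u-bound b′) (RowBounds.u-bound b)
        (λ e → ne (trans (sym p₁≡) e)) (lin₁ q (- (+ 1)) zr (trans (cong₂ _-_ (cong₂ _*_ p₁≡ p₄≡) (cong₂ _*_ p₂≡ p₃≡)) (lem (A₁ (matrix p) (matrix p′)) (A₂ (matrix p) (matrix p′)) (A₃ (matrix p) (matrix p′)) (A₄ (matrix p) (matrix p′)))))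
      where
      b = Member.bounds h
      b′ = Member.bounds h′
      u = r₁ (matrix p)
      v = r₂ (matrix p)
      u′ = r₁ (matrix p′)
      v′ = r₂ (matrix p′)
      p₁≡ : p₁ (normalVec (trip v′ v u′ u)) ≡ tri u v u′
      p₁≡ = trans (normal₁ v′ v u′ u) (sym (tri-cycle u v u′))
      p₂≡ : p₂ (normalVec (trip v′ v u′ u)) ≡ tri u′ v′ u
      p₂≡ = trans (normal₂ v′ v u′ u) (sym (tri-swap u′ v′ u))
      p₃≡ : p₃ (normalVec (trip v′ v u′ u)) ≡ - tri u v v′
      p₃≡ = trans (normal₃ v′ v u′ u) (trans (tri-cycle v′ v u) (trans (tri-swap v u v′) refl))
      p₄≡ : p₄ (normalVec (trip v′ v u′ u)) ≡ - tri u′ v′ v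
      p₄≡ = trans (normal₄ v′ v u′ u) (cong -_ (sym (tri-cycle u′ v′ v)))
      lem : ∀ a b c d → a * (- d) - c * (- b) ≡ (- (+ 1)) * (a * d - b * c)
      lem = solve-∀

    bad-facts : ∀ {P} → P ∈ bad → (proj₁ P ∈ F) × (proj₂ P ∈ F) × Bad P
    bad-facts h = let (i , b) = ∈-filter⁻ Bad? {xs = cartesianProduct F F} h ; (j , k) = ∈-cartesianProduct⁻ F F i in j , k , b

    bad-unique : Unique bad
    bad-unique = filter⁺ Bad? (cartesianProduct⁺ F-unique F-unique)

    class-count : ∀ {P : Params × Params → Set} (P? : ∀ s → Dec (P s)) (t : Params × Params → Triple)
      → (∀ {s s′} → s ∈ bad → s′ ∈ bad → t s ≡ t s′ → s ≡ s′) → (∀ {s} → s ∈ bad → P s → Degenerate q pr B ℓ hq hℓ (t s)) → length (filter P? bad) ℕ.≤ W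
    class-count P? t inj deg = subst (ℕ._≤ W) (length-map t xs) (degenerate-count q pr B ℓ hq hℓ (map t xs)
        (map-unique (filter⁺ P? bad-unique) (λ h h′ → inj (proj₁ (facts h)) (proj₁ (facts h′)))) good)
      where
      xs = filter P? bad
      facts : ∀ {s} → s ∈ xs → _
      facts h = ∈-filter⁻ P? {xs = bad} h
      good : ∀ {τ} → τ ∈ map t xs → Degenerate q pr B ℓ hq hℓ τ
      good h with ∈-map⁻ t h
      ... | s , i , refl = deg (proj₁ (facts i)) (proj₂ (facts i))

    pair-determined : ∀ {p p′ s s′} → p ∈ F → p′ ∈ F → s ∈ F → s′ ∈ F → r₁ (matrix p) ≡ r₁ (matrix s) → r₂ (matrix p) ≡ r₂ (matrix s) → r₁ (matrix p′) ≡ r₁ (matrix s′) → r₂ (matrix p′) ≡ r₂ (matrix s′) → (p , p′) ≡ (s , s′)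
    pair-determined h h′ k k′ e₁ e₂ e₃ e₄ = cong₂ _,_ (rows-determine (Member.rows h) (Member.rows k) e₁ e₂) (rows-determine (Member.rows h′) (Member.rows k′) e₃ e₄)

    -- Pairs with A₁ ≠ 0 or A₄ ≠ 0 are degenerate triples in the ordering `trip₁` or `trip₄`. If
    -- both vanish, the rows span the same plane and (D , e) is shared, so a pair is given by one
    -- member of the family and one further (a , c).
    bad-count : length bad ℕ.≤ W ℕ.+ W ℕ.+ length F ℕ.* length (Cop m)
    bad-count = ℕₚ.≤-trans (length-cover₃ P₁? P₄? Same? bad cover) (ℕₚ.+-mono-≤ (ℕₚ.+-mono-≤
        (class-count P₁? trip₁ inj₁′ (λ h n → let (i , j , b) = bad-facts h in degenerate₁ i j n (proj₂ b)))
        (class-count P₄? trip₄ inj₄ (λ h n → let (i , j , b) = bad-facts h in degenerate₄ i j n (proj₂ b))))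
        (subst (length (filter Same? bad) ℕ.≤_) (length-product F (Cop m)) (inject-length {f = λ s → proj₁ s , proj₁ (proj₂ s)} (filter⁺ Same? bad-unique) same-inj
          (λ h → let (i , j , _) = bad-facts (proj₁ (∈-filter⁻ Same? {xs = bad} h)) in ∈-cartesianProduct⁺ i (proj₁ (∈-cartesianProduct⁻ (Cop m) (Cop (m ℕ.* m)) j))))))
      where
      P₁? : ∀ (s : Params × Params) → Dec (A₁ (matrix (proj₁ s)) (matrix (proj₂ s)) ≢ + 0)
      P₁? s = ¬? (A₁ (matrix (proj₁ s)) (matrix (proj₂ s)) ℤₚ.≟ + 0)
      P₄? : ∀ (s : Params × Params) → Dec (A₄ (matrix (proj₁ s)) (matrix (proj₂ s)) ≢ + 0)
      P₄? s = ¬? (A₄ (matrix (proj₁ s)) (matrix (proj₂ s)) ℤₚ.≟ + 0)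
      Same? : ∀ (s : Params × Params) → Dec (proj₂ (proj₁ s) ≡ proj₂ (proj₂ s))
      Same? s = ≡-dec ℕₚ._≟_ ℕₚ._≟_ (proj₂ (proj₁ s)) (proj₂ (proj₂ s))
      same-inj : ∀ {s s′} → s ∈ filter Same? bad → s′ ∈ filter Same? bad → (proj₁ s , proj₁ (proj₂ s)) ≡ (proj₁ s′ , proj₁ (proj₂ s′)) → s ≡ s′
      same-inj {(_ , _) , (_ , _)} {(_ , _) , (_ , _)} h h′ refl with proj₂ (∈-filter⁻ Same? {xs = bad} h) | proj₂ (∈-filter⁻ Same? {xs = bad} h′)
      ... | refl | refl = refl
      inj₁′ : ∀ {s s′} → s ∈ bad → s′ ∈ bad → trip₁ s ≡ trip₁ s′ → s ≡ s′
      inj₁′ {p , p′} {s , s′} h h′ e = let (i , j , _) = bad-facts h ; (i′ , j′ , _) = bad-facts h′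
                                           (e₁ , e₂ , e₃ , e₄) = trip-injective {r₂ (matrix p′)} {r₂ (matrix p)} {r₁ (matrix p′)} {r₁ (matrix p)} {r₂ (matrix s′)} {r₂ (matrix s)} {r₁ (matrix s′)} {r₁ (matrix s)} e in
        pair-determined i j i′ j′ e₄ e₂ e₃ e₁
      inj₄ : ∀ {s s′} → s ∈ bad → s′ ∈ bad → trip₄ s ≡ trip₄ s′ → s ≡ s′
      inj₄ {p , p′} {s , s′} h h′ e = let (i , j , _) = bad-facts h ; (i′ , j′ , _) = bad-facts h′
                                          (e₁ , e₂ , e₃ , e₄) = trip-injective {r₁ (matrix p)} {r₂ (matrix p)} {r₁ (matrix p′)} {r₂ (matrix p′)} {r₁ (matrix s)} {r₂ (matrix s)} {r₁ (matrix s′)} {r₂ (matrix s′)} e in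
        pair-determined i j i′ j′ e₁ e₂ e₃ e₄
      decide : ∀ {t} → ¬ (t ≢ + 0) → t ≡ + 0
      decide {t} n with t ℤₚ.≟ + 0
      ... | yes e = e
      ... | no ne = ⊥-elim (n ne)
      cover : ∀ {s} → s ∈ bad → ¬ (A₁ (matrix (proj₁ s)) (matrix (proj₂ s)) ≢ + 0) → ¬ (A₄ (matrix (proj₁ s)) (matrix (proj₂ s)) ≢ + 0) → proj₂ (proj₁ s) ≡ proj₂ (proj₂ s)
      cover {p , p′} h n₁ n₄ = go (euclid q pr (A₂ γ γ′) (A₃ γ γ′) (lin₁ q (- (+ 1)) (proj₂ (proj₂ (proj₂ (bad-facts h)))) (trans (vanish (A₂ γ γ′ * A₃ γ γ′)) (cong (λ t → (- (+ 1)) * (t - A₂ γ γ′ * A₃ γ γ′)) (sym (cong₂ _*_ z₁ z₄))))))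
        where
        γ = matrix p
        γ′ = matrix p′
        z₁ : A₁ γ γ′ ≡ + 0
        z₁ = decide n₁
        z₄ : A₄ γ γ′ ≡ + 0
        z₄ = decide n₄
        hp = proj₁ (bad-facts h)
        hp′ = proj₁ (proj₂ (bad-facts h))
        module M = Member hp
        module M′ = Member hp′
        vanish : ∀ t → t ≡ (- (+ 1)) * (+ 0 * + 0 - t)
        vanish = solve-∀
        vanishing : ∀ {a b c} → VBound B a → VBound B b → VBound B c → Z q (tri a b c) → tri a b c ≡ + 0
        vanishing ha hb hc zt = Z-small q zt (ℕₚ.≤-<-trans (tri-bound ha hb hc) Y<q)
        go : Z q (A₂ γ γ′) ⊎ Z q (A₃ γ γ′) → proj₂ p ≡ proj₂ p′
        -- A₂ and A₃ are smaller than q, so a residue zero is an actual zero. In the other case the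
        -- two matrices exchange roles: A₃ and A₄ are the first two determinants of the reversed
        -- pair.
        go (inj₁ zz) = zero-class {p} {p′} {γ} {γ′} M.rows M′.rows (IsCop.cop M.large) (IsCop.cop M′.large) M.D≥1 z₁ (vanishing (RowBounds.u-bound M.bounds) (RowBounds.v-bound M.bounds) (RowBounds.v-bound M′.bounds) zz)
        go (inj₂ zz) = sym (zero-class {p′} {p} {γ′} {γ} M′.rows M.rows (IsCop.cop M′.large) (IsCop.cop M.large) M′.D≥1 (vanishing (RowBounds.u-bound M′.bounds) (RowBounds.v-bound M′.bounds) (RowBounds.u-bound M.bounds) zz) z₄)

    N : Point × Point → ℕ
    N P = sumL F (λ p → 𝟙 (Hit? (matrix p) (proj₁ P) (proj₂ P)))

    Reached? : ∀ P → Dec (1 ℕ.≤ N P)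
    Reached? P = 1 ℕₚ.≤? N P

    reached : List (Point × Point)
    reached = filter Reached? pairs

    reached-hit : ∀ {P} → 1 ℕ.≤ N P → Σ Params λ p → (p ∈ F) × Hit (matrix p) (proj₁ P) (proj₂ P)
    reached-hit {P} h = sumL-positive (λ p → Hit? (matrix p) (proj₁ P) (proj₂ P)) F h

    -- The sum of N² counts ordered pairs of matrices with a common source and target, so it is a
    -- sum of collision numbers.
    second-moment : sumL pairs (λ P → N P ℕ.* N P) ℕ.≤ length F ℕ.* (q ℕ.* q) ℕ.+ (length F ℕ.* (length F ℕ.* 3) ℕ.+ 3 ℕ.* q ℕ.* length bad)
    second-moment = begin
      sumL pairs (λ P → N P ℕ.* N P) ≡⟨ sumL-cong pairs (λ P → trans (sumL-square F (λ p → 𝟙 (H p P))) (sumL-cong F (λ p → sumL-cong F (λ p′ → 𝟙-× (H p P) (H p′ P))))) ⟩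
      sumL pairs (λ P → sumL F (λ p → sumL F (λ p′ → 𝟙 (Both? (matrix p) (matrix p′) P)))) ≡⟨ sumL-swap pairs F (λ P p → sumL F (λ p′ → 𝟙 (Both? (matrix p) (matrix p′) P))) ⟩
      sumL F (λ p → sumL pairs (λ P → sumL F (λ p′ → 𝟙 (Both? (matrix p) (matrix p′) P)))) ≡⟨ sumL-cong F (λ p → trans (sumL-swap pairs F (λ P p′ → 𝟙 (Both? (matrix p) (matrix p′) P))) (sumL-cong F (λ p′ → sym (length-filter (Both? (matrix p) (matrix p′)) pairs)))) ⟩
      sumL F (λ p → sumL F (λ p′ → length (collisions (matrix p) (matrix p′)))) ≤⟨ sumL-mono F (λ p h → sumL-mono F (λ p′ h′ → pair-collisions h h′)) ⟩
      sumL F (λ p → sumL F (λ p′ → q ℕ.* q ℕ.* 𝟙 (p ≟F p′) ℕ.+ (3 ℕ.+ 3 ℕ.* q ℕ.* 𝟙 (Bad? (p , p′))))) ≡⟨ sumL-cong F (λ p → trans (sumL-+ F (λ p′ → q ℕ.* q ℕ.* 𝟙 (p ≟F p′)) (λ p′ → 3 ℕ.+ 3 ℕ.* q ℕ.* 𝟙 (Bad? (p , p′)))) (cong (sumL F (λ p′ → q ℕ.* q ℕ.* 𝟙 (p ≟F p′)) ℕ.+_) (sumL-+ F (λ _ → 3) (λ p′ → 3 ℕ.* q ℕ.* 𝟙 (Bad? (p , p′)))))) ⟩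
      sumL F (λ p → sumL F (λ p′ → q ℕ.* q ℕ.* 𝟙 (p ≟F p′)) ℕ.+ (sumL F (λ _ → 3) ℕ.+ sumL F (λ p′ → 3 ℕ.* q ℕ.* 𝟙 (Bad? (p , p′)))))
        ≤⟨ sumL-mono F (λ p _ → ℕₚ.+-mono-≤ (diagonal p) (ℕₚ.+-mono-≤ (ℕₚ.≤-reflexive (sumL-const F 3)) (ℕₚ.≤-reflexive (sumL-* F (3 ℕ.* q) (λ p′ → 𝟙 (Bad? (p , p′))))))) ⟩
      sumL F (λ p → q ℕ.* q ℕ.+ (length F ℕ.* 3 ℕ.+ 3 ℕ.* q ℕ.* sumL F (λ p′ → 𝟙 (Bad? (p , p′))))) ≡⟨ trans (sumL-+ F (λ _ → q ℕ.* q) (λ p → length F ℕ.* 3 ℕ.+ 3 ℕ.* q ℕ.* sumL F (λ p′ → 𝟙 (Bad? (p , p′)))))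
          (cong₂ ℕ._+_ (sumL-const F (q ℕ.* q)) (trans (sumL-+ F (λ _ → length F ℕ.* 3) (λ p → 3 ℕ.* q ℕ.* sumL F (λ p′ → 𝟙 (Bad? (p , p′))))) (cong₂ ℕ._+_ (sumL-const F (length F ℕ.* 3)) (trans (sumL-* F (3 ℕ.* q) (λ p → sumL F (λ p′ → 𝟙 (Bad? (p , p′))))) (cong (3 ℕ.* q ℕ.*_) (trans (sym (sumL-product F F (λ s → 𝟙 (Bad? s)))) (sym (length-filter Bad? (cartesianProduct F F))))))))) ⟩
      length F ℕ.* (q ℕ.* q) ℕ.+ (length F ℕ.* (length F ℕ.* 3) ℕ.+ 3 ℕ.* q ℕ.* length bad) ∎
      where
      open ℕₚ.≤-Reasoning
      H : ∀ p (P : Point × Point) → Dec (Hit (matrix p) (proj₁ P) (proj₂ P))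
      H p P = Hit? (matrix p) (proj₁ P) (proj₂ P)
      diagonal : ∀ p → sumL F (λ p′ → q ℕ.* q ℕ.* 𝟙 (p ≟F p′)) ℕ.≤ q ℕ.* q
      diagonal p = ℕₚ.≤-trans (ℕₚ.≤-reflexive (trans (sumL-* F (q ℕ.* q) (λ p′ → 𝟙 (p ≟F p′))) (cong (q ℕ.* q ℕ.*_) (sym (length-filter (p ≟F_) F)))))
        (ℕₚ.≤-trans (ℕₚ.*-monoʳ-≤ (q ℕ.* q) (at-most-one (filter⁺ (p ≟F_) F-unique) (λ h h′ → trans (sym (proj₂ (∈-filter⁻ (p ≟F_) {xs = F} h))) (proj₂ (∈-filter⁻ (p ≟F_) {xs = F} h′))))) (ℕₚ.≤-reflexive (ℕₚ.*-identityʳ (q ℕ.* q))))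

    -- Sources are lost only when they lie on the line where the first row vanishes. That row is
    -- nonzero modulo q because 1 ≤ a < q.
    hits : ∀ {p} → p ∈ F → q ℕ.* q ℕ.≤ sumL pairs (λ P → 𝟙 (Hit? (matrix p) (proj₁ P) (proj₂ P))) ℕ.+ q
    hits {p} h = begin
      q ℕ.* q ≡⟨ trans (sym (length-range² q)) (length-sumL (range² q)) ⟩
      sumL (range² q) (λ _ → 1) ≤⟨ sumL-mono (range² q) (λ X _ → each X (line? q pr u X)) ⟩
      sumL (range² q) (λ X → sumL (range² q) (λ Y → 𝟙 (Hit? γ X Y)) ℕ.+ 𝟙 (line? q pr u X)) ≡⟨ sumL-+ (range² q) (λ X → sumL (range² q) (λ Y → 𝟙 (Hit? γ X Y))) (λ X → 𝟙 (line? q pr u X)) ⟩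
      sumL (range² q) (λ X → sumL (range² q) (λ Y → 𝟙 (Hit? γ X Y))) ℕ.+ sumL (range² q) (λ X → 𝟙 (line? q pr u X)) ≡⟨ cong₂ ℕ._+_ (sym (sumL-product (range² q) (range² q) (λ P → 𝟙 (Hit? γ (proj₁ P) (proj₂ P))))) (sym (length-filter (line? q pr u) (range² q))) ⟩
      sumL pairs (λ P → 𝟙 (Hit? γ (proj₁ P) (proj₂ P))) ℕ.+ length (filter (line? q pr u) (range² q)) ≤⟨ ℕₚ.+-monoʳ-≤ (sumL pairs (λ P → 𝟙 (Hit? γ (proj₁ P) (proj₂ P)))) (line-count q pr u (λ zs → ¬Za (proj₁ zs))) ⟩
      sumL pairs (λ P → 𝟙 (Hit? γ (proj₁ P) (proj₂ P))) ℕ.+ q ∎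
      where
      open ℕₚ.≤-Reasoning
      γ = matrix p
      u = r₁ γ
      ¬Za : ¬ Z q (x u)
      ¬Za zz = ℕₚ.<⇒≢ (Member.a≥1 h) (sym (ℤₚ.+-injective (Z-small q (subst (Z q) (Rows.xu (Member.rows h)) zz) (a<q h))))
      each : ∀ X → (d : Dec (Z q (u · pt X))) → 1 ℕ.≤ sumL (range² q) (λ Y → 𝟙 (Hit? γ X Y)) ℕ.+ 𝟙 d
      each X (yes _) = ℕₚ.m≤n+m 1 _
      each X (no n) = go (hit-exists γ X n)
        where
        go : (Σ Point λ Y → InRange Y × Hit γ X Y) → 1 ℕ.≤ sumL (range² q) (λ Y → 𝟙 (Hit? γ X Y)) ℕ.+ 0
        go (Y , (b , c) , k) = ℕₚ.≤-trans (ℕₚ.≤-reflexive (sym (𝟙-yes (Hit? γ X Y) k))) (ℕₚ.≤-trans (sumL-member (range² q) (λ Y → 𝟙 (Hit? γ X Y)) (∈-cartesianProduct⁺ (∈-upTo⁺ b) (∈-upTo⁺ c))) (ℕₚ.m≤m+n _ 0))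

    first-moment : length F ℕ.* (q ℕ.* q) ℕ.≤ 2 ℕ.* sumL pairs N
    first-moment = begin
      length F ℕ.* (q ℕ.* q) ≡⟨ sym (sumL-const F (q ℕ.* q)) ⟩
      sumL F (λ _ → q ℕ.* q) ≤⟨ sumL-mono F (λ p h → double (hits h)) ⟩
      sumL F (λ p → 2 ℕ.* sumL pairs (λ P → 𝟙 (Hit? (matrix p) (proj₁ P) (proj₂ P)))) ≡⟨ sumL-* F 2 (λ p → sumL pairs (λ P → 𝟙 (Hit? (matrix p) (proj₁ P) (proj₂ P)))) ⟩
      2 ℕ.* sumL F (λ p → sumL pairs (λ P → 𝟙 (Hit? (matrix p) (proj₁ P) (proj₂ P)))) ≡⟨ cong (2 ℕ.*_) (sumL-swap F pairs (λ p P → 𝟙 (Hit? (matrix p) (proj₁ P) (proj₂ P)))) ⟩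
      2 ℕ.* sumL pairs N ∎
      where
      open ℕₚ.≤-Reasoning
      double : ∀ {s} → q ℕ.* q ℕ.≤ s ℕ.+ q → q ℕ.* q ℕ.≤ 2 ℕ.* s
      double {s} h = ℕₚ.+-cancelʳ-≤ (q ℕ.* q) (q ℕ.* q) (2 ℕ.* s) (begin
        q ℕ.* q ℕ.+ q ℕ.* q ≡⟨ cong (q ℕ.* q ℕ.+_) (sym (ℕₚ.+-identityʳ (q ℕ.* q))) ⟩
        2 ℕ.* (q ℕ.* q) ≤⟨ ℕₚ.*-monoʳ-≤ 2 h ⟩
        2 ℕ.* (s ℕ.+ q) ≡⟨ ℕₚ.*-distribˡ-+ 2 s q ⟩
        2 ℕ.* s ℕ.+ 2 ℕ.* q ≤⟨ ℕₚ.+-monoʳ-≤ (2 ℕ.* s) (ℕₚ.*-monoˡ-≤ q 2≤q) ⟩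
        2 ℕ.* s ℕ.+ q ℕ.* q ∎)

    moments : (length F ℕ.* (q ℕ.* q)) ℕ.* (length F ℕ.* (q ℕ.* q)) ℕ.≤ 4 ℕ.* (length reached ℕ.* (length F ℕ.* (q ℕ.* q) ℕ.+ (length F ℕ.* (length F ℕ.* 3) ℕ.+ 3 ℕ.* q ℕ.* length bad)))
    moments = begin
      f ℕ.* f ≤⟨ ℕₚ.*-mono-≤ first-moment first-moment ⟩
      2 ℕ.* I ℕ.* (2 ℕ.* I) ≡⟨ solve 1 (λ i → con 2 :* i :* (con 2 :* i) := con 4 :* (i :* i)) refl I ⟩
      4 ℕ.* (I ℕ.* I) ≡⟨ cong (λ t → 4 ℕ.* (t ℕ.* t)) (sym (sumL-filter Reached? pairs N unreached)) ⟩
      4 ℕ.* (sumL reached N ℕ.* sumL reached N) ≤⟨ ℕₚ.*-monoʳ-≤ 4 (cauchy-schwarz reached N) ⟩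
      4 ℕ.* (length reached ℕ.* sumL reached (λ P → N P ℕ.* N P)) ≡⟨ cong (λ t → 4 ℕ.* (length reached ℕ.* t)) (sumL-filter Reached? pairs (λ P → N P ℕ.* N P) (λ P n → cong (λ t → t ℕ.* t) (unreached P n))) ⟩
      4 ℕ.* (length reached ℕ.* sumL pairs (λ P → N P ℕ.* N P)) ≤⟨ ℕₚ.*-monoʳ-≤ 4 (ℕₚ.*-monoʳ-≤ (length reached) second-moment) ⟩
      4 ℕ.* (length reached ℕ.* (length F ℕ.* (q ℕ.* q) ℕ.+ (length F ℕ.* (length F ℕ.* 3) ℕ.+ 3 ℕ.* q ℕ.* length bad))) ∎
      where
      open ℕₚ.≤-Reasoning
      open +-*-Solver
      f = length F ℕ.* (q ℕ.* q)
      I = sumL pairs N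
      unreached : ∀ P → ¬ (1 ℕ.≤ N P) → N P ≡ 0
      unreached P n = ℕₚ.n≤0⇒n≡0 (ℕₚ.≤-pred (ℕₚ.≰⇒> n))

    -- With q² ≤ c |F| and z₀ ≤ q every term of the second moment is O(|F|² L³): the diagonal |F|
    -- q², the generic 3 |F|², and q times the bad pairs, which is at most of order q · q³ L³.
    -- Dividing by |F|² leaves a density of order L^(-3).
    many-reached : ∀ c → 1 ℕ.≤ length F → q ℕ.* q ℕ.≤ c ℕ.* length F → length (Cop m) ℕ.≤ q → DegenerateTriples.z₀ q pr B ℓ hq hℓ ℕ.≤ q
      → (q ℕ.* q) ℕ.* (q ℕ.* q) ℕ.≤ 4 ℕ.* ((3 ℕ.+ 4 ℕ.* c ℕ.+ 6 ℕ.* (c ℕ.* c)) ℕ.* (L ℕ.* (L ℕ.* L))) ℕ.* length reached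
    many-reached c 1≤F hc hcop hz = ℕₚ.*-cancelˡ-≤ (f ℕ.* f) {{ℕ.>-nonZero (ℕₚ.*-mono-≤ 1≤F 1≤F)}} (begin
      f ℕ.* f ℕ.* (qq ℕ.* qq) ≡⟨ solve 2 (λ f k → f :* f :* (k :* k) := f :* k :* (f :* k)) refl f qq ⟩
      f ℕ.* qq ℕ.* (f ℕ.* qq) ≤⟨ moments ⟩
      4 ℕ.* (S ℕ.* (f ℕ.* qq ℕ.+ (f ℕ.* (f ℕ.* 3) ℕ.+ 3 ℕ.* q ℕ.* length bad))) ≤⟨ ℕₚ.*-monoʳ-≤ 4 (ℕₚ.*-monoʳ-≤ S total) ⟩
      4 ℕ.* (S ℕ.* (f ℕ.* f ℕ.* (K ℕ.* T))) ≡⟨ solve 4 (λ f S K T → con 4 :* (S :* (f :* f :* (K :* T))) := f :* f :* (con 4 :* (K :* T) :* S)) refl f S K T ⟩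
      f ℕ.* f ℕ.* (4 ℕ.* (K ℕ.* T) ℕ.* S) ∎)
      where
      open ℕₚ.≤-Reasoning
      open +-*-Solver
      f = length F
      qq = q ℕ.* q
      S = length reached
      T = L ℕ.* (L ℕ.* L)
      K = 3 ℕ.+ 4 ℕ.* c ℕ.+ 6 ℕ.* (c ℕ.* c)
      v = DegenerateTriples.V q pr B ℓ hq hℓ
      1≤T : 1 ℕ.≤ T
      1≤T = ℕₚ.*-mono-≤ (s≤s (z≤n {ℓ ℕ.+ 1 ℕ.* suc ℓ})) (ℕₚ.*-mono-≤ (s≤s (z≤n {ℓ ℕ.+ 1 ℕ.* suc ℓ})) (s≤s (z≤n {ℓ ℕ.+ 1 ℕ.* suc ℓ})))
      scale : ∀ {n k} → n ℕ.≤ k → n ℕ.≤ k ℕ.* T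
      scale {n} {k} h = ℕₚ.≤-trans h (ℕₚ.≤-trans (ℕₚ.≤-reflexive (sym (ℕₚ.*-identityʳ k))) (ℕₚ.*-monoʳ-≤ k 1≤T))
      diag : f ℕ.* qq ℕ.≤ c ℕ.* (f ℕ.* f)
      diag = ℕₚ.≤-trans (ℕₚ.*-monoʳ-≤ f hc) (ℕₚ.≤-reflexive (solve 2 (λ f c → f :* (c :* f) := c :* (f :* f)) refl f c))
      w-bound : q ℕ.* W ℕ.≤ c ℕ.* c ℕ.* (f ℕ.* f) ℕ.* T
      w-bound = begin
        q ℕ.* (v ℕ.* L ℕ.* L ℕ.* L) ≤⟨ ℕₚ.*-monoʳ-≤ q (ℕₚ.*-monoˡ-≤ L (ℕₚ.*-monoˡ-≤ L (ℕₚ.*-monoˡ-≤ L (ℕₚ.*-mono-≤ (ℕₚ.*-mono-≤ hz hz) hz)))) ⟩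
        q ℕ.* (q ℕ.* q ℕ.* q ℕ.* L ℕ.* L ℕ.* L) ≡⟨ solve 2 (λ q L → q :* (q :* q :* q :* L :* L :* L) := q :* q :* (q :* q) :* (L :* (L :* L))) refl q L ⟩
        qq ℕ.* qq ℕ.* T ≤⟨ ℕₚ.*-monoˡ-≤ T (ℕₚ.*-mono-≤ hc hc) ⟩
        c ℕ.* f ℕ.* (c ℕ.* f) ℕ.* T ≡⟨ cong (ℕ._* T) (solve 2 (λ c f → c :* f :* (c :* f) := c :* c :* (f :* f)) refl c f) ⟩
        c ℕ.* c ℕ.* (f ℕ.* f) ℕ.* T ∎
      bad-bound : 3 ℕ.* q ℕ.* length bad ℕ.≤ (6 ℕ.* (c ℕ.* c) ℕ.+ 3 ℕ.* c) ℕ.* (f ℕ.* f) ℕ.* T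
      bad-bound = begin
        3 ℕ.* q ℕ.* length bad ≤⟨ ℕₚ.*-monoʳ-≤ (3 ℕ.* q) bad-count ⟩
        3 ℕ.* q ℕ.* (W ℕ.+ W ℕ.+ f ℕ.* length (Cop m)) ≤⟨ ℕₚ.*-monoʳ-≤ (3 ℕ.* q) (ℕₚ.+-monoʳ-≤ (W ℕ.+ W) (ℕₚ.*-monoʳ-≤ f hcop)) ⟩
        3 ℕ.* q ℕ.* (W ℕ.+ W ℕ.+ f ℕ.* q) ≡⟨ solve 3 (λ q w f → con 3 :* q :* (w :+ w :+ f :* q) := con 6 :* (q :* w) :+ con 3 :* (f :* (q :* q))) refl q W f ⟩
        6 ℕ.* (q ℕ.* W) ℕ.+ 3 ℕ.* (f ℕ.* qq) ≤⟨ ℕₚ.+-mono-≤ (ℕₚ.*-monoʳ-≤ 6 w-bound) (ℕₚ.*-monoʳ-≤ 3 (scale diag)) ⟩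
        6 ℕ.* (c ℕ.* c ℕ.* (f ℕ.* f) ℕ.* T) ℕ.+ 3 ℕ.* (c ℕ.* (f ℕ.* f) ℕ.* T) ≡⟨ solve 3 (λ c f T → con 6 :* (c :* c :* (f :* f) :* T) :+ con 3 :* (c :* (f :* f) :* T) := (con 6 :* (c :* c) :+ con 3 :* c) :* (f :* f) :* T) refl c f T ⟩
        (6 ℕ.* (c ℕ.* c) ℕ.+ 3 ℕ.* c) ℕ.* (f ℕ.* f) ℕ.* T ∎
      total : f ℕ.* qq ℕ.+ (f ℕ.* (f ℕ.* 3) ℕ.+ 3 ℕ.* q ℕ.* length bad) ℕ.≤ f ℕ.* f ℕ.* (K ℕ.* T)
      total = begin
        f ℕ.* qq ℕ.+ (f ℕ.* (f ℕ.* 3) ℕ.+ 3 ℕ.* q ℕ.* length bad) ≤⟨ ℕₚ.+-mono-≤ (scale diag) (ℕₚ.+-mono-≤ (scale ℕₚ.≤-refl) bad-bound) ⟩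
        c ℕ.* (f ℕ.* f) ℕ.* T ℕ.+ (f ℕ.* (f ℕ.* 3) ℕ.* T ℕ.+ (6 ℕ.* (c ℕ.* c) ℕ.+ 3 ℕ.* c) ℕ.* (f ℕ.* f) ℕ.* T)
          ≡⟨ solve 3 (λ c f T → c :* (f :* f) :* T :+ (f :* (f :* con 3) :* T :+ (con 6 :* (c :* c) :+ con 3 :* c) :* (f :* f) :* T) := f :* f :* ((con 3 :+ con 4 :* c :+ con 6 :* (c :* c)) :* T)) refl c f T ⟩
        f ℕ.* f ℕ.* (K ℕ.* T) ∎

-- Saturation for finite sets of residues.

module Amplify where

  open import Data.Nat as ℕ using (ℕ; zero; suc; NonZero)
  import Data.Nat.Properties as ℕₚ
  open import Data.Nat.DivMod using (m<n⇒m%n≡m)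
  open import Data.Integer as ℤ using (ℤ)
  open import Data.Integer.DivMod using (_%ℕ_; _/ℕ_; n%ℕd<d; a≡a%ℕn+[a/ℕn]*n)
  open import Data.Integer.Divisibility.Signed using (divides)
  import Data.Integer.Tactic.RingSolver as ℤR
  open import Data.Rational hiding (NonZero)
  open import Data.Rational.Properties
  open import Data.Rational.Solver
  open +-*-Solver using (solve; _:=_; _:+_; _:*_; _:-_)
  open import Data.Bool using (Bool; true; false)
  open import Data.List using (List; upTo)
  open import Data.List.Membership.Propositional.Properties using (∈-cartesianProduct⁻; ∈-upTo⁻)
  open import Data.Product using (Σ; _×_; _,_; proj₁; proj₂)
  open import Data.Sum using (inj₁; inj₂)
  open import Data.Empty using (⊥-elim)
  open import Relation.Binary.PropositionalEquality
  open RationalSums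
  open PeriodicFunctions
  open Poincaré using (Mean0; vol; vol-pos; 2ℚ)
  open SpectralGap
  open Matrices
  open SetGrowth
  open Saturation
  open Counting
  open CoprimePairs using (range²; length-range²)
  open Residues using (Point; residue-unique)

  T-Nn : ∀ n → Nn (T n)
  T-Nn zero = ≤-refl
  T-Nn (suc n) = T-Nn n ⊞ nonNegative⁻¹ 1ℚ

  T-mono : ∀ {m n} → m ℕ.≤ n → T m ≤ T n
  T-mono {m} {n} h with ℕₚ.m≤n⇒∃[o]m+o≡n h
  ... | k , refl = concl (T-Nn k) (trans (cong (_- T m) (T-+ m k)) (solve 2 (λ a b → a :+ b :- a := b) refl (T m) (T k)))

  T-cancel : ∀ {m n} → T m ≤ T n → m ℕ.≤ n
  T-cancel {m} {n} h with ℕₚ.≤-total m n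
  ... | inj₁ p = p
  ... | inj₂ p with ℕₚ.m≤n⇒m<n∨m≡n p
  ...   | inj₂ refl = ℕₚ.≤-refl
  ...   | inj₁ n<m = ⊥-elim (<-irrefl refl (<-≤-trans (+-monoʳ-< (T n) (positive⁻¹ 1ℚ)) (≤-trans (T-mono n<m) (≤-trans h (≤-reflexive (sym (+-identityʳ (T n))))))))

  P2-T : ∀ k → P2 k ≡ T (2 ℕ.^ k)
  P2-T zero = refl
  P2-T (suc k) = trans (cong (2ℚ *_) (P2-T k)) (sym (T-* 2 (2 ℕ.^ k)))

  sum-T : ∀ n f → sum n (λ i → T (f i)) ≡ T (sumL (upTo n) f)
  sum-T zero f = refl
  sum-T (suc n) f = trans (cong (_+ T (f n)) (sum-T n f)) (trans (sym (T-+ (sumL (upTo n) f) (f n))) (cong T (sym (sumL-upTo n f))))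

  bit : Bool → ℕ
  bit true = 1
  bit false = 0

  count : ℕ → (Point → Bool) → ℕ
  count q β = sumL (range² q) (λ X → bit (β X))

  S₂-T : ∀ q {f : Fn} (g : Point → ℕ) → (∀ i j → f (ℤ.+ i) (ℤ.+ j) ≡ T (g (i , j))) → S₂ q f ≡ T (sumL (range² q) g)
  S₂-T q g h = trans (sum-cong q (λ j → trans (sum-cong q (λ i → h i j)) (sum-T q (λ i → g (i , j))))) (trans (sum-T q (λ j → sumL (upTo q) (λ i → g (i , j))))
    (cong T (trans (sumL-swap (upTo q) (upTo q) (λ j i → g (i , j))) (sym (sumL-product (upTo q) (upTo q) g)))))

  card-T : ∀ q χ → card q χ ≡ T (count q (λ X → χ (ℤ.+ proj₁ X) (ℤ.+ proj₂ X)))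
  card-T q χ = S₂-T q {ιχ q χ} (λ X → bit (χ (ℤ.+ proj₁ X) (ℤ.+ proj₂ X))) (λ i j → ι-T (χ (ℤ.+ i) (ℤ.+ j)))
    where
    ι-T : ∀ b → ι b ≡ T (bit b)
    ι-T true = refl
    ι-T false = refl

  vol-T : ∀ q → vol q ≡ T (q ℕ.* q)
  vol-T q = trans (S₂-T q {λ _ _ → 1ℚ} (λ _ → 1) (λ _ _ → refl)) (cong T (trans (sym (length-sumL (range² q))) (length-range² q)))

  vol-positive : ∀ q → NonZero q → Positive (vol q)
  vol-positive (suc q′) _ = vol-pos q′

  gap-nonzero : ∀ q → NonZero q → ∀ {f} → Periodic q f → Mean0 q f → AlmostInvariant q f → Q q f ≤ 0ℚ
  gap-nonzero (suc q′) _ = gap q′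

  %ℕ-periodic : ∀ q {{_ : NonZero q}} x → (x ℤ.+ ℤ.+ q) %ℕ q ≡ x %ℕ q
  %ℕ-periodic q x = residue-unique q (n%ℕd<d (x ℤ.+ ℤ.+ q) q) (n%ℕd<d x q) (divides (ℤ.+ 1 ℤ.+ x /ℕ q ℤ.- (x ℤ.+ ℤ.+ q) /ℕ q)
      (trans (cong₂ ℤ._-_ (rem (x ℤ.+ ℤ.+ q)) (rem x)) (lem x (ℤ.+ q) ((x ℤ.+ ℤ.+ q) /ℕ q) (x /ℕ q))))
    where
    rem : ∀ n → ℤ.+ (n %ℕ q) ≡ n ℤ.- n /ℕ q ℤ.* ℤ.+ q
    rem n = trans (l (ℤ.+ (n %ℕ q)) (n /ℕ q ℤ.* ℤ.+ q)) (cong (ℤ._- n /ℕ q ℤ.* ℤ.+ q) (sym (a≡a%ℕn+[a/ℕn]*n n q)))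
      where
      l : ∀ r k → r ≡ r ℤ.+ k ℤ.- k
      l = ℤR.solve-∀
    lem : ∀ x q a b → x ℤ.+ q ℤ.- a ℤ.* q ℤ.- (x ℤ.- b ℤ.* q) ≡ (ℤ.+ 1 ℤ.+ b ℤ.- a) ℤ.* q
    lem = ℤR.solve-∀

  steps : ℕ → ℕ → ℕ
  steps k₁ k₂ = k₂ ℕ.* phase ℕ.+ (k₁ ℕ.* phase ℕ.+ 0)

  ints : Point → ℤ × ℤ
  ints (i , j) = ℤ.+ i , ℤ.+ j

  module Amplification (q : ℕ) {{q≢0 : NonZero q}} where

    residues : ℤ × ℤ → Point
    residues (x , y) = x %ℕ q , y %ℕ q

    residues-ints : ∀ {X} → proj₁ X ℕ.< q → proj₂ X ℕ.< q → residues (ints X) ≡ X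
    residues-ints {i , j} hi hj = cong₂ _,_ (m<n⇒m%n≡m hi) (m<n⇒m%n≡m hj)

    count-cong : ∀ {β β′ : Point → Bool} → (∀ i j → i ℕ.< q → j ℕ.< q → β (i , j) ≡ β′ (i , j)) → count q β ℕ.≤ count q β′
    count-cong {β} {β′} h = sumL-mono (range² q) (λ { (i , j) m → let (a , b) = ∈-cartesianProduct⁻ (upTo q) (upTo q) m in ℕₚ.≤-reflexive (cong bit (h i j (∈-upTo⁻ a) (∈-upTo⁻ b))) })

    -- The density statement is cleared of denominators: the complement has at most q² / 2^k₂
    -- points. The path ends at an integer point whose reduction lies in the given set; reducing
    -- only at the end keeps the moves exact over ℤ.
    record Amplified (k₁ k₂ : ℕ) (β : Point → Bool) : Set where
      field
        larger : Point → Bool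
        dense : 2 ℕ.^ k₂ ℕ.* (q ℕ.* q) ℕ.≤ q ℕ.* q ℕ.+ 2 ℕ.^ k₂ ℕ.* count q larger
        path : ∀ X → larger X ≡ true → Σ (ℤ × ℤ) λ p → Move (stretchFactor ℕ.^ steps k₁ k₂) (ints X) p × β (residues p) ≡ true

    -- The Boolean set on residues is extended periodically to ℤ², and `saturate` is read back
    -- through the embedding T of ℕ in ℚ, which reflects inequalities.
    amplify : ∀ k₁ k₂ β → q ℕ.* q ℕ.≤ 2 ℕ.^ k₁ ℕ.* count q β → Amplified k₁ k₂ β
    amplify k₁ k₂ β h = record { larger = λ X → set final (ℤ.+ proj₁ X) (ℤ.+ proj₂ X) ; dense = T-cancel (dense-ℚ (saturate k₁ k₂ start enough)) ; path = λ X e → reach (steps k₁ k₂) start (ℤ.+ proj₁ X) (ℤ.+ proj₂ X) e }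
      where
      open Iterate q {{vol-positive q q≢0}} (gap-nonzero q q≢0)
      χ : Region
      χ x y = β (x %ℕ q , y %ℕ q)
      start : PSet
      start = pset χ (record { pset₁ = λ x y → cong (λ t → β (t , y %ℕ q)) (%ℕ-periodic q x) ; pset₂ = λ x y → cong (λ t → β (x %ℕ q , t)) (%ℕ-periodic q y) })
      final : PSet
      final = iterate (steps k₁ k₂) start
      enough : vol q ≤ P2 k₁ * size start
      enough = subst₂ _≤_ (sym (vol-T q)) (trans (T-* (2 ℕ.^ k₁) _) (sym (cong₂ _*_ (P2-T k₁) (card-T q χ)))) (T-mono (ℕₚ.≤-trans h (ℕₚ.*-monoʳ-≤ (2 ℕ.^ k₁) (count-cong (λ i j hi hj → cong β (sym (residues-ints hi hj)))))))
      n = count q (λ X → set final (ℤ.+ proj₁ X) (ℤ.+ proj₂ X))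
      dense-ℚ : P2 k₂ * (vol q - size final) ≤ vol q → T (2 ℕ.^ k₂ ℕ.* (q ℕ.* q)) ≤ T (q ℕ.* q ℕ.+ 2 ℕ.^ k₂ ℕ.* n)
      dense-ℚ g = subst₂ _≤_ (sym (trans (T-* (2 ℕ.^ k₂) (q ℕ.* q)) (cong₂ _*_ (sym (P2-T k₂)) (sym (vol-T q)))))
        (sym (trans (T-+ (q ℕ.* q) (2 ℕ.^ k₂ ℕ.* n)) (cong₂ _+_ (sym (vol-T q)) (trans (T-* (2 ℕ.^ k₂) n) (cong₂ _*_ (sym (P2-T k₂)) (sym (card-T q (set final))))))))
        (concl (diff g) (solve 3 (λ P v s → v :+ P :* s :- P :* v := v :- P :* (v :- s)) refl (P2 k₂) (vol q) (size final)))

-- From a relation of small density to almost all sources and targets.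

module Slices where

  open import Data.Nat
  open import Data.Nat.Properties
  open import Data.Nat.Solver using (module +-*-Solver)
  open import Data.Integer using (ℤ)
  open import Data.Bool using (Bool; true; false)
  import Data.Bool.Properties as Bool
  open import Data.List using (List; length; filter)
  open import Data.List.Membership.Propositional using (_∈_)
  open import Data.List.Membership.Propositional.Properties using (∈-filter⁻)
  open import Data.List.Relation.Unary.Unique.Propositional using (Unique)
  open import Data.List.Relation.Unary.Unique.Propositional.Properties using (filter⁺)
  open import Data.Product using (Σ; _×_; _,_; proj₁; proj₂)
  open import Relation.Nullary using (Dec; yes; no)
  open import Relation.Binary.PropositionalEquality
  open Counting
  open CoprimePairs using (range²; range²-unique; length-range²)
  open Residues using (Point)
  open SetGrowth using (Move)
  open Saturation using (stretchFactor)
  open Amplify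

  module Slicing (q : ℕ) {{q≢0 : NonZero q}} (s : Point → Point → Bool) (e k₂ : ℕ)
    (plenty : (q * q) * (q * q) ≤ 2 ^ e * sumL (range² q) (λ X → sumL (range² q) (λ Y → bit (s X Y)))) where

    open Amplification q
    open ≤-Reasoning
    open +-*-Solver using (solve; _:=_; _:+_; _:*_; con)

    private
      A = range² q
      Q = q * q
      P = 2 ^ k₂

    length-A : length A ≡ Q
    length-A = length-range² q

    R : ℕ
    R = stretchFactor ^ steps (suc (suc e)) k₂

    instance
      Q≢0 : NonZero (q * q)
      Q≢0 = m*n≢0 q q

    FullColumn? : ∀ Y → Dec (Q ≤ 2 ^ suc e * count q (λ X → s X Y))
    FullColumn? Y = Q ≤? 2 ^ suc e * count q (λ X → s X Y)

    n : ℕ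
    n = length (filter FullColumn? A)

    count≤ : ∀ β → count q β ≤ Q
    count≤ β = ≤-trans (sumL-mono A (λ X _ → bit≤1 (β X))) (≤-reflexive (trans (sym (length-sumL A)) length-A))
      where
      bit≤1 : ∀ b → bit b ≤ 1
      bit≤1 true = ≤-refl
      bit≤1 false = z≤n

    -- Columns below half the average density hold at most half of the relation, and a full column
    -- holds at most Q points.
    full-columns : Q ≤ 2 ^ suc e * n
    full-columns = *-cancelˡ-≤ Q (+-cancelʳ-≤ (Q * Q) (Q * Q) (Q * (E * n)) (begin
      Q * Q + Q * Q ≡⟨ cong (Q * Q +_) (sym (+-identityʳ (Q * Q))) ⟩
      2 * (Q * Q) ≤⟨ *-monoʳ-≤ 2 plenty ⟩
      2 * (2 ^ e * sumL A (λ X → sumL A (λ Y → bit (s X Y)))) ≡⟨ trans (sym (*-assoc 2 (2 ^ e) (sumL A (λ X → sumL A (λ Y → bit (s X Y)))))) (cong (E *_) (sumL-swap A A (λ X Y → bit (s X Y)))) ⟩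
      E * sumL A (λ Y → count q (λ X → s X Y)) ≡⟨ sym (sumL-* A E (λ Y → count q (λ X → s X Y))) ⟩
      sumL A (λ Y → E * count q (λ X → s X Y)) ≤⟨ sumL-mono A (λ Y _ → each Y (FullColumn? Y)) ⟩
      sumL A (λ Y → E * Q * 𝟙 (FullColumn? Y) + Q) ≡⟨ sumL-+ A (λ Y → E * Q * 𝟙 (FullColumn? Y)) (λ _ → Q) ⟩
      sumL A (λ Y → E * Q * 𝟙 (FullColumn? Y)) + sumL A (λ _ → Q) ≡⟨ cong₂ _+_ (trans (sumL-* A (E * Q) (λ Y → 𝟙 (FullColumn? Y))) (cong (E * Q *_) (sym (length-filter FullColumn? A)))) (trans (sumL-const A Q) (cong (_* Q) length-A)) ⟩
      E * Q * n + Q * Q ≡⟨ cong (_+ Q * Q) (solve 3 (λ E Q n → E :* Q :* n := Q :* (E :* n)) refl E Q n) ⟩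
      Q * (E * n) + Q * Q ∎))
      where
      E = 2 ^ suc e
      each : ∀ Y (d : Dec (Q ≤ E * count q (λ X → s X Y))) → E * count q (λ X → s X Y) ≤ E * Q * 𝟙 d + Q
      each Y (yes _) = ≤-trans (*-monoʳ-≤ E (count≤ (λ X → s X Y))) (≤-trans (≤-reflexive (sym (*-identityʳ (E * Q)))) (m≤m+n (E * Q * 1) Q))
      each Y (no h) = ≤-trans (<⇒≤ (≰⇒> h)) (m≤n+m Q (E * Q * 0))

    n≢0 : NonZero n
    n≢0 = ≢-nonZero (λ z → <⇒≱ (>-nonZero⁻¹ Q) (≤-trans full-columns (≤-reflexive (trans (cong (2 ^ suc e *_) z) (*-zeroʳ (2 ^ suc e))))))

    double : ∀ c {x} → x ≤ 2 ^ c * n → ∀ {t} → n ≤ 2 * t → x ≤ 2 ^ suc c * t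
    double c {x} h {t} g = ≤-trans h (≤-trans (*-monoʳ-≤ (2 ^ c) g) (≤-reflexive (solve 2 (λ a t → a :* (con 2 :* t) := con 2 :* a :* t) refl (2 ^ c) t)))

    -- The exponent e + 2 is the one dictated by the rows below; using it for the columns as well
    -- gives both kinds of moves the same bound R.
    columnAmplified : ∀ Y → Q ≤ 2 ^ suc e * count q (λ X → s X Y) → Amplified (suc (suc e)) k₂ (λ X → s X Y)
    columnAmplified Y h = amplify (suc (suc e)) k₂ (λ X → s X Y) (≤-trans h (*-monoˡ-≤ (count q (λ X → s X Y)) (m≤m+n (2 ^ suc e) (2 ^ suc e + 0))))

    column : ∀ Y → Dec (Q ≤ 2 ^ suc e * count q (λ X → s X Y)) → Point → Bool
    column Y (yes h) = Amplified.larger (columnAmplified Y h)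
    column Y (no _) _ = false

    s′ : Point → Point → Bool
    s′ X Y = column Y (FullColumn? Y) X

    column-path : ∀ Y d X → column Y d X ≡ true → Σ (ℤ × ℤ) λ r → Move R (ints X) r × s (residues r) Y ≡ true
    column-path Y (yes h) X t = Amplified.path (columnAmplified Y h) X t

    column-dense : ∀ Y d → P * Q * 𝟙 d ≤ Q * 𝟙 d + P * count q (column Y d)
    column-dense Y (yes h) = subst₂ (λ a b → a ≤ b + P * count q (Amplified.larger (columnAmplified Y h))) (sym (*-identityʳ (P * Q))) (sym (*-identityʳ Q)) (Amplified.dense (columnAmplified Y h))
    column-dense Y (no _) = ≤-trans (≤-reflexive (*-zeroʳ (P * Q))) z≤n

    row≤n : ∀ X → count q (s′ X) ≤ n
    row≤n X = ≤-trans (sumL-mono A (λ Y _ → each Y (FullColumn? Y))) (≤-reflexive (sym (length-filter FullColumn? A)))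
      where
      each : ∀ Y d → bit (column Y d X) ≤ 𝟙 d
      each Y (yes h) = bit≤1 (Amplified.larger (columnAmplified Y h) X)
        where
        bit≤1 : ∀ b → bit b ≤ 1
        bit≤1 true = ≤-refl
        bit≤1 false = z≤n
      each Y (no _) = z≤n

    rows-dense : P * Q * n ≤ Q * n + P * sumL A (λ X → count q (s′ X))
    rows-dense = begin
      P * Q * n ≡⟨ trans (cong (P * Q *_) (length-filter FullColumn? A)) (sym (sumL-* A (P * Q) (λ Y → 𝟙 (FullColumn? Y)))) ⟩
      sumL A (λ Y → P * Q * 𝟙 (FullColumn? Y)) ≤⟨ sumL-mono A (λ Y _ → column-dense Y (FullColumn? Y)) ⟩
      sumL A (λ Y → Q * 𝟙 (FullColumn? Y) + P * count q (λ X → s′ X Y)) ≡⟨ sumL-+ A (λ Y → Q * 𝟙 (FullColumn? Y)) (λ Y → P * count q (λ X → s′ X Y)) ⟩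
      sumL A (λ Y → Q * 𝟙 (FullColumn? Y)) + sumL A (λ Y → P * count q (λ X → s′ X Y)) ≡⟨ cong₂ _+_ (trans (sumL-* A Q (λ Y → 𝟙 (FullColumn? Y))) (cong (Q *_) (sym (length-filter FullColumn? A))))
          (trans (sumL-* A P (λ Y → count q (λ X → s′ X Y))) (cong (P *_) (sumL-swap A A (λ Y X → bit (s′ X Y))))) ⟩
      Q * n + P * sumL A (λ X → count q (s′ X)) ∎

    FullRow? : ∀ X → Dec (n ≤ 2 * count q (s′ X))
    FullRow? X = n ≤? 2 * count q (s′ X)

    good : List Point
    good = filter FullRow? A

    -- The amplified relation misses at most the fraction 1 / P of all points times full columns. A
    -- row outside `good` misses more than half of the n full columns, so there are at most 2Q / P
    -- such rows.
    good-large : P * Q ≤ 2 * Q + P * length good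
    good-large = *-cancelˡ-≤ n {{n≢0}} (+-cancelʳ-≤ (P * Q * n) (n * (P * Q)) (n * (2 * Q + P * length good)) (begin
      n * (P * Q) + P * Q * n ≡⟨ solve 3 (λ n P Q → n :* (P :* Q) :+ P :* Q :* n := con 2 :* (P :* Q :* n)) refl n P Q ⟩
      2 * (P * Q * n) ≤⟨ *-monoʳ-≤ 2 rows-dense ⟩
      2 * (Q * n + P * W) ≡⟨ solve 4 (λ Q n P W → con 2 :* (Q :* n :+ P :* W) := con 2 :* (Q :* n) :+ P :* (con 2 :* W)) refl Q n P W ⟩
      2 * (Q * n) + P * (2 * W) ≤⟨ +-monoʳ-≤ (2 * (Q * n)) (*-monoʳ-≤ P sum-rows) ⟩
      2 * (Q * n) + P * (Q * n + n * g) ≡⟨ solve 4 (λ Q n P g → con 2 :* (Q :* n) :+ P :* (Q :* n :+ n :* g) := n :* (con 2 :* Q :+ P :* g) :+ P :* Q :* n) refl Q n P g ⟩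
      n * (2 * Q + P * g) + P * Q * n ∎))
      where
      W = sumL A (λ X → count q (s′ X))
      g = length good
      each : ∀ X (d : Dec (n ≤ 2 * count q (s′ X))) → 2 * count q (s′ X) ≤ n + n * 𝟙 d
      each X (yes _) = ≤-trans (*-monoʳ-≤ 2 (row≤n X)) (≤-reflexive (solve 1 (λ n → con 2 :* n := n :+ n :* con 1) refl n))
      each X (no h) = ≤-trans (<⇒≤ (≰⇒> h)) (m≤m+n n (n * 0))
      sum-rows : 2 * W ≤ Q * n + n * g
      sum-rows = begin
        2 * W ≡⟨ sym (sumL-* A 2 (λ X → count q (s′ X))) ⟩
        sumL A (λ X → 2 * count q (s′ X)) ≤⟨ sumL-mono A (λ X _ → each X (FullRow? X)) ⟩
        sumL A (λ X → n + n * 𝟙 (FullRow? X)) ≡⟨ sumL-+ A (λ _ → n) (λ X → n * 𝟙 (FullRow? X)) ⟩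
        sumL A (λ _ → n) + sumL A (λ X → n * 𝟙 (FullRow? X)) ≡⟨ cong₂ _+_ (trans (sumL-const A n) (cong (_* n) length-A)) (trans (sumL-* A n (λ X → 𝟙 (FullRow? X))) (cong (n *_) (sym (length-filter FullRow? A)))) ⟩
        Q * n + n * g ∎

    module Row {X} (X∈ : X ∈ good) where

      private
        amplified : Amplified (suc (suc e)) k₂ (s′ X)
        -- A good row holds at least n / 2 targets, where n ≥ Q / 2^(e + 1): density at least 2^(-(e
        -- + 2)).
        amplified = amplify (suc (suc e)) k₂ (s′ X) (double (suc e) full-columns (proj₂ (∈-filter⁻ FullRow? {xs = A} X∈)))

      open Amplified amplified

      targets : List Point
      targets = filter (λ Y → larger Y Bool.≟ true) A

      targets-unique : Unique targets
      targets-unique = filter⁺ (λ Y → larger Y Bool.≟ true) (range²-unique q)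

      target-in : ∀ {Y} → Y ∈ targets → Y ∈ A
      target-in h = proj₁ (∈-filter⁻ (λ Y → larger Y Bool.≟ true) {xs = A} h)

      targets-large : P * Q ≤ Q + P * length targets
      targets-large = subst (λ t → P * Q ≤ Q + P * t) (trans (sumL-cong A (λ Y → eq (larger Y))) (sym (length-filter (λ Y → larger Y Bool.≟ true) A))) dense
        where
        eq : ∀ b → bit b ≡ 𝟙 (b Bool.≟ true)
        eq true = refl
        eq false = refl

      -- The target Y moves to some p in the row of X before amplification; membership there means
      -- that X moves to some r with r and p in the original relation. The order of the two
      -- amplifications is what makes r depend on p.
      target-path : ∀ {Y} → Y ∈ targets → Σ (ℤ × ℤ) λ p → Σ (ℤ × ℤ) λ r → Move R (ints Y) p × Move R (ints X) r × s (residues r) (residues p) ≡ true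
      target-path {Y} h = go (path Y (proj₂ (∈-filter⁻ (λ Y → larger Y Bool.≟ true) {xs = A} h)))
        where
        go : (Σ (ℤ × ℤ) λ p → Move R (ints Y) p × s′ X (residues p) ≡ true) → Σ (ℤ × ℤ) λ p → Σ (ℤ × ℤ) λ r → Move R (ints Y) p × Move R (ints X) r × s (residues r) (residues p) ≡ true
        go (p , mp , e) = let (r , mr , t) = column-path (residues p) (FullColumn? (residues p)) X e in p , r , mp , mr , t

-- Sizes, logarithms and exponents.

module Thresholds where

  open import Data.Nat
  open import Data.Nat.Properties
  open import Data.Nat.Solver using (module +-*-Solver)
  open import Data.Product using (Σ; _×_; _,_)
  open import Data.Sum using (_⊎_; inj₁; inj₂)
  open import Data.Unit using (tt)
  open import Relation.Nullary using (yes; no)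
  open import Relation.Binary.PropositionalEquality
  open Saturation using (phase; stretchFactor)
  open Amplify using (steps)
  open +-*-Solver using (solve; _:=_; _:+_; _:*_; con)

  n≤2^n : ∀ n → n ≤ 2 ^ n
  n≤2^n zero = z≤n
  n≤2^n (suc n) = ≤-trans (+-mono-≤ (m^n>0 2 n) (n≤2^n n)) (≤-reflexive (cong (2 ^ n +_) (sym (+-identityʳ (2 ^ n)))))

  pow2-bracket : ∀ n → Σ ℕ λ ℓ → (suc n ≤ 2 ^ ℓ) × (2 ^ ℓ ≤ 2 * suc n)
  pow2-bracket zero = 0 , ≤-refl , s≤s z≤n
  pow2-bracket (suc n) = go (pow2-bracket n)
    where
    go : (Σ ℕ λ ℓ → (suc n ≤ 2 ^ ℓ) × (2 ^ ℓ ≤ 2 * suc n)) → Σ ℕ λ ℓ → (suc (suc n) ≤ 2 ^ ℓ) × (2 ^ ℓ ≤ 2 * suc (suc n))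
    go (ℓ , lo , hi) with suc (suc n) ≤? 2 ^ ℓ
    ... | yes h = ℓ , h , ≤-trans hi (*-monoʳ-≤ 2 (n≤1+n (suc n)))
    ... | no h = suc ℓ , ≤-trans (s≤s (m≤n+m (suc n) n)) (≤-trans (≤-reflexive (cong (λ t → suc (n + suc t)) (sym (+-identityʳ n)))) (*-monoʳ-≤ 2 lo)) , *-monoʳ-≤ 2 (<⇒≤ (≰⇒> h))

  cube : ℕ → ℕ
  cube m = m * (m * m)

  cube-* : ∀ t m → cube (t * m) ≡ cube t * cube m
  cube-* = solve 2 (λ t m → t :* m :* (t :* m :* (t :* m)) := t :* (t :* t) :* (m :* (m :* m))) refl

  cube-cancel-≤ : ∀ {a b} → cube a ≤ cube b → a ≤ b
  cube-cancel-≤ {a} {b} h = ≮⇒≥ (λ b<a → <⇒≱ (*-mono-< b<a (*-mono-< b<a b<a)) h)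

  cube-bracket : ∀ C → 1 ≤ C → ∀ n → Σ ℕ λ m → (C * cube m ≤ n) × (n < C * cube (suc m))
  cube-bracket C 1≤C zero = 0 , ≤-reflexive (*-zeroʳ C) , *-mono-≤ 1≤C (s≤s z≤n)
  cube-bracket C 1≤C (suc n) = go (cube-bracket C 1≤C n)
    where
    go : (Σ ℕ λ m → (C * cube m ≤ n) × (n < C * cube (suc m))) → Σ ℕ λ m → (C * cube m ≤ suc n) × (suc n < C * cube (suc m))
    go (m , lo , hi) with C * cube (suc m) ≤? suc n
    ... | no h = m , m≤n⇒m≤1+n lo , ≰⇒> h
    ... | yes h = suc m , h , ≤-<-trans hi (*-monoʳ-< C {{>-nonZero 1≤C}} (*-mono-< m< (*-mono-< m< m<)))
      where
      m< : suc m < suc (suc m)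
      m< = ≤-refl

  linear≤exponential : ∀ a b n → a + b * (n + 4 * (a + b)) ≤ 2 ^ (n + 4 * (a + b))
  -- The shift by 4s with s = a + b makes the base case (1 + s)⁴ ≤ 2^(4s), with room for s + 4s².
  linear≤exponential a b zero = begin
    a + b * (4 * s) ≤⟨ +-mono-≤ (m≤m+n a b) (*-monoˡ-≤ (4 * s) (m≤n+m b a)) ⟩
    s + s * (4 * s) ≤⟨ m≤m+n (s + s * (4 * s)) (1 + 3 * s + 2 * (s * s) + 4 * (s * (s * s)) + s * s * (s * s)) ⟩
    s + s * (4 * s) + (1 + 3 * s + 2 * (s * s) + 4 * (s * (s * s)) + s * s * (s * s)) ≡⟨ solve 1 (λ s → s :+ s :* (con 4 :* s) :+ (con 1 :+ con 3 :* s :+ con 2 :* (s :* s) :+ con 4 :* (s :* (s :* s)) :+ s :* s :* (s :* s)) := (con 1 :+ s) :* ((con 1 :+ s) :* ((con 1 :+ s) :* ((con 1 :+ s) :* con 1)))) refl s ⟩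
    suc s ^ 4 ≤⟨ ^-monoˡ-≤ 4 s<2^s ⟩
    (2 ^ s) ^ 4 ≡⟨ trans (^-*-assoc 2 s 4) (cong (2 ^_) (*-comm s 4)) ⟩
    2 ^ (4 * s) ∎
    where
    open ≤-Reasoning
    s = a + b
    n<2^n : ∀ n → n < 2 ^ n
    n<2^n zero = s≤s z≤n
    n<2^n (suc n) = ≤-trans (+-mono-≤ (m^n>0 2 n) (n<2^n n)) (≤-reflexive (cong (2 ^ n +_) (sym (+-identityʳ (2 ^ n)))))
    s<2^s : s < 2 ^ s
    s<2^s = n<2^n s
  linear≤exponential a b (suc n) = begin
    a + b * suc k ≡⟨ solve 3 (λ a b k → a :+ b :* (con 1 :+ k) := a :+ b :* k :+ b) refl a b k ⟩
    a + b * k + b ≤⟨ +-mono-≤ (linear≤exponential a b n) (≤-trans (≤-trans (m≤n+m b a) (≤-trans (m≤n*m (a + b) 4) (m≤n+m (4 * (a + b)) n))) (n≤2^n k)) ⟩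
    2 ^ k + 2 ^ k ≡⟨ cong (2 ^ k +_) (sym (+-identityʳ (2 ^ k))) ⟩
    2 ^ suc k ∎
    where
    open ≤-Reasoning
    k = n + 4 * (a + b)

  logThreshold : ℕ → ℕ → ℕ
  logThreshold a b = a + b * (4 * (2 * a + 2 + 2 * b))

  -- Here μ is about log₂ ℓ. A small μ is covered by the threshold; for a large one, 2 (a + b μ + 1)
  -- ≤ 2^μ ≤ 2 (ℓ + 1) because exponentials outgrow linear functions.
  log-small : ∀ a b ℓ μ → logThreshold a b ≤ ℓ → 2 ^ μ ≤ 2 * suc ℓ → a + b * μ ≤ ℓ
  log-small a b ℓ μ hℓ hμ = go (≤-total μ Λ)
    where
    open ≤-Reasoning
    Λ = 4 * (2 * a + 2 + 2 * b)
    go : (μ ≤ Λ) ⊎ (Λ ≤ μ) → a + b * μ ≤ ℓ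
    go (inj₁ h) = ≤-trans (+-monoʳ-≤ a (*-monoʳ-≤ b h)) hℓ
    go (inj₂ h) = ≤-pred (*-cancelˡ-≤ 2 (begin
      2 * suc (a + b * μ) ≡⟨ solve 3 (λ a b μ → con 2 :* (con 1 :+ (a :+ b :* μ)) := con 2 :* a :+ con 2 :+ con 2 :* b :* μ) refl a b μ ⟩
      2 * a + 2 + 2 * b * μ ≡⟨ cong (λ t → 2 * a + 2 + 2 * b * t) (sym (m∸n+n≡m h)) ⟩
      2 * a + 2 + 2 * b * (μ ∸ Λ + Λ) ≤⟨ linear≤exponential (2 * a + 2) (2 * b) (μ ∸ Λ) ⟩
      2 ^ (μ ∸ Λ + Λ) ≡⟨ cong (2 ^_) (m∸n+n≡m h) ⟩
      2 ^ μ ≤⟨ hμ ⟩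
      2 * suc ℓ ∎))

  -- Cubing both sides removes the cube root of q: the entries contribute q^d, the distortion one
  -- further factor q, and d + 1 ≤ 3n is exactly the condition n / d > 1/3.
  norm-power : ∀ q N t d n → cube N ^ d ≤ q → cube t ≤ q → suc d ≤ 3 * n → .{{_ : NonZero q}} → (N * t) ^ d ≤ q ^ n
  norm-power q N t d n hN ht hd = cube-cancel-≤ (begin
    cube ((N * t) ^ d) ≡⟨ cube-^ (N * t) d ⟩
    cube (N * t) ^ d ≡⟨ cong (_^ d) (cube-* N t) ⟩
    (cube N * cube t) ^ d ≡⟨ ^-* (cube N) (cube t) d ⟩
    cube N ^ d * cube t ^ d ≤⟨ *-mono-≤ hN (^-monoˡ-≤ d ht) ⟩
    q * q ^ d ≤⟨ ^-monoʳ-≤ q hd ⟩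
    q ^ (3 * n) ≡⟨ trans (cong (q ^_) (*-comm 3 n)) (trans (sym (^-*-assoc q n 3)) (solve 1 (λ x → x :* (x :* (x :* con 1)) := x :* (x :* x)) refl (q ^ n))) ⟩
    cube (q ^ n) ∎)
    where
    open ≤-Reasoning
    ^-* : ∀ a b d → (a * b) ^ d ≡ a ^ d * b ^ d
    ^-* a b zero = refl
    ^-* a b (suc d) = trans (cong (a * b *_) (^-* a b d)) (solve 4 (λ a b x y → a :* b :* (x :* y) := a :* x :* (b :* y)) refl a b (a ^ d) (b ^ d))
    cube-^ : ∀ a d → cube (a ^ d) ≡ cube a ^ d
    cube-^ a d = sym (trans (^-* a (a * a) d) (cong (a ^ d *_) (^-* a a d)))

  -- Binary exponent of the reciprocal density from the second moment: 2^κ for the constants and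
  -- three factors L = 2 (ℓ + 1) ≤ 2^(μ + 1).
  lossExponent : ℕ → ℕ → ℕ
  lossExponent κ μ = κ + (suc μ + (suc μ + suc μ))

  -- Coefficients of the exponent in 2 · (9 R²)^(3d) ≤ 2^(base + slope · μ). The number of growth
  -- steps is linear in μ, while R ≤ 2^(`stretchFactor` · steps) and 9 ≤ 2⁴.
  expBase expSlope : ℕ → ℕ → ℕ → ℕ
  expBase κ d k = 3 * (4 + 2 * (stretchFactor * ((2 + k) * phase + (5 + κ) * phase))) * d + 1
  expSlope κ d k = 3 * (2 * (stretchFactor * (3 * phase))) * d

  -- R is a fixed power of log q up to constants, since its exponent is linear in μ, about log log
  -- q. Both sides carry a factor 2 because 2^ℓ is known only up to that factor.
  stretch-small : ∀ κ d k ℓ μ q → logThreshold (expBase κ d k) (expSlope κ d k) ≤ ℓ → 2 ^ μ ≤ 2 * suc ℓ → 2 ^ ℓ ≤ 2 * q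
    → let R = stretchFactor ^ steps (suc (suc (lossExponent κ μ))) (2 + k) in cube (9 * (R * R)) ^ d ≤ q
  stretch-small κ d k ℓ μ q hℓ hμ hq = *-cancelˡ-≤ 2 (begin
    2 * cube (9 * (R * R)) ^ d ≤⟨ *-monoʳ-≤ 2 (^-monoˡ-≤ d (cube-mono N≤)) ⟩
    2 * cube (2 ^ X) ^ d ≡⟨ cong (2 *_) (trans (cong (_^ d) (trans (cong (2 ^ X *_) (sym (^-distribˡ-+-* 2 X X))) (sym (^-distribˡ-+-* 2 X (X + X))))) (^-*-assoc 2 (X + (X + X)) d)) ⟩
    2 ^ suc ((X + (X + X)) * d) ≡⟨ cong (2 ^_) exponent ⟩
    2 ^ (expBase κ d k + expSlope κ d k * μ) ≤⟨ ^-monoʳ-≤ 2 (log-small (expBase κ d k) (expSlope κ d k) ℓ μ hℓ hμ) ⟩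
    2 ^ ℓ ≤⟨ hq ⟩
    2 * q ∎)
    where
    open ≤-Reasoning
    K = steps (suc (suc (lossExponent κ μ))) (2 + k)
    R = stretchFactor ^ K
    X = 4 + (stretchFactor * K + stretchFactor * K)
    cube-mono : ∀ {a b} → a ≤ b → cube a ≤ cube b
    cube-mono h = *-mono-≤ h (*-mono-≤ h h)
    R≤ : R ≤ 2 ^ (stretchFactor * K)
    R≤ = ≤-trans (^-monoˡ-≤ K (n≤2^n stretchFactor)) (≤-reflexive (^-*-assoc 2 stretchFactor K))
    N≤ : 9 * (R * R) ≤ 2 ^ X
    N≤ = ≤-trans (*-mono-≤ (m≤m+n 9 7) (*-mono-≤ R≤ R≤)) (≤-reflexive (trans (cong (16 *_) (sym (^-distribˡ-+-* 2 (stretchFactor * K) (stretchFactor * K)))) (sym (^-distribˡ-+-* 2 4 (stretchFactor * K + stretchFactor * K)))))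
    exponent : suc ((X + (X + X)) * d) ≡ expBase κ d k + expSlope κ d k * μ
    exponent = solve 6 (λ s p κ μ d k →
        let K = (con 2 :+ k) :* p :+ ((con 2 :+ (κ :+ ((con 1 :+ μ) :+ ((con 1 :+ μ) :+ (con 1 :+ μ))))) :* p :+ con 0)
            X = con 4 :+ (s :* K :+ s :* K)
        in con 1 :+ (X :+ (X :+ X)) :* d := con 3 :* (con 4 :+ con 2 :* (s :* ((con 2 :+ k) :* p :+ (con 5 :+ κ) :* p))) :* d :+ con 1 :+ con 3 :* (con 2 :* (s :* (con 3 :* p))) :* d :* μ)
      refl stretchFactor phase κ μ d k

  -- 653 m bounds the entries of the family's matrices; the same constant dominates all other size requirements.
  abstract
    sizeConst : ℕ
    sizeConst = cube 653

    sizeConst≥1 : 1 ≤ sizeConst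
    sizeConst≥1 = ≤ᵇ⇒≤ 1 (cube 653) tt

    cube-653 : ∀ m → cube (653 * m) ≡ sizeConst * cube m
    cube-653 = cube-* 653

    sizeConst-det : 12 * cube 10 < sizeConst
    sizeConst-det = ≤ᵇ⇒≤ (suc (12 * cube 10)) (cube 653) tt

    sizeConst-box : 101 * cube 101 ≤ sizeConst
    sizeConst-box = ≤ᵇ⇒≤ (101 * cube 101) (cube 653) tt

    sizeConst-cop : 9 ≤ sizeConst
    sizeConst-cop = ≤ᵇ⇒≤ 9 (cube 653) tt

    densityConst : ℕ
    densityConst = (8 * sizeConst) * (8 * sizeConst) * 196

    densityConst-eq : densityConst ≡ (8 * sizeConst) * (8 * sizeConst) * 196
    densityConst-eq = refl

    loss₀ : ℕ
    loss₀ = 4 * (3 + 4 * densityConst + 6 * (densityConst * densityConst))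

    loss₀-bound : 4 * (3 + 4 * densityConst + 6 * (densityConst * densityConst)) ≤ 2 ^ loss₀
    loss₀-bound = n≤2^n loss₀

-- The relation of connected points for a large prime.

module LargePrimes where

  open import Data.Nat
  open import Data.Nat.Properties
  open import Data.Nat.DivMod using (m*n/n≡m; /-monoˡ-≤)
  open import Data.Nat.Primality using (Prime)
  open import Data.Nat.Solver using (module +-*-Solver)
  open import Data.Bool using (Bool; true)
  open import Data.List using (List; length)
  open import Data.List.Properties using () renaming (length-filter to length-filter≤)
  open import Data.Product using (Σ; _×_; _,_; proj₁; proj₂)
  open import Relation.Nullary using (Dec; yes; no; does)
  open import Relation.Binary.PropositionalEquality
  open Counting
  open CoprimePairs using (Cop; Cop-large; isCop?; range²; length-range²)
  open Residues using (Point)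
  open Hyperplanes using (box-size)
  open DegenerateTriples using (minorBound)
  open Matrices using (M3; det; VBound; MBound; mb)
  open import Data.Integer using (+_)
  open Family using (Params; matrix; Rows; RowBounds)
  open Collision using (module Collide)
  open Moments using (module SecondMoment)
  open Amplify using (bit)
  open Thresholds
  open +-*-Solver using (solve; _:=_; _:+_; _:*_; con)

  module LargePrime (q : ℕ) (pr : Prime q) (C≤q : sizeConst ≤ q) (ℓ μ : ℕ) (q≤ : q ≤ 2 ^ ℓ) (ℓ≤ : suc ℓ ≤ 2 ^ μ) where

    open ≤-Reasoning

    private
      bracket : Σ ℕ λ m → (sizeConst * cube m ≤ q) × (q < sizeConst * cube (suc m))
      bracket = cube-bracket sizeConst sizeConst≥1 q

    abstract
      m : ℕ
      m = proj₁ bracket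

      m-lower : sizeConst * cube m ≤ q
      m-lower = proj₁ (proj₂ bracket)

      m-upper : q < sizeConst * cube (suc m)
      m-upper = proj₂ (proj₂ bracket)

    m≥1 : 1 ≤ m
    m≥1 = n≢0⇒n>0 (λ e → <⇒≱ (subst (λ t → q < sizeConst * cube (suc t)) e m-upper) (≤-trans (≤-reflexive (*-identityʳ sizeConst)) C≤q))

    private
      instance
        m≢0 : NonZero m
        m≢0 = >-nonZero m≥1

      B = 10 * m
      Y = minorBound B

      instance
        B≢0 : NonZero (10 * m)
        B≢0 = m*n≢0 10 m

    cube≥1 : 1 ≤ cube m
    cube≥1 = *-mono-≤ m≥1 (*-mono-≤ m≥1 m≥1)

    minors-small : Y + Y < q
    minors-small = begin-strict
      Y + Y ≡⟨ solve 1 (λ b → con 3 :* (b :* (b :* b :+ b :* b)) :+ con 3 :* (b :* (b :* b :+ b :* b)) := con 12 :* (b :* (b :* b))) refl B ⟩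
      12 * cube B ≡⟨ trans (cong (12 *_) (cube-* 10 m)) (sym (*-assoc 12 (cube 10) (cube m))) ⟩
      12 * cube 10 * cube m <⟨ *-monoˡ-< (cube m) {{>-nonZero cube≥1}} sizeConst-det ⟩
      sizeConst * cube m ≤⟨ m-lower ⟩
      q ∎

    minors-pow : Y < 2 ^ ℓ
    minors-pow = <-≤-trans (≤-<-trans (m≤m+n Y Y) minors-small) q≤

    open SecondMoment q pr m ℓ m≥1 minors-small minors-pow

    -- The box has side at most 101 m; division by B = 10 m leaves a constant times m³, and
    -- `sizeConst` is large enough to keep this below q.
    z₀≤q : DegenerateTriples.z₀ q pr B ℓ minors-small minors-pow ≤ q
    z₀≤q = ≤-trans (/-monoˡ-≤ B box≤) (≤-reflexive (m*n/n≡m q B))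
      where
      side : ℕ
      side = suc (2 * (5 * B))
      side≤ : side ≤ 101 * m
      side≤ = begin
        1 + 2 * (5 * (10 * m)) ≤⟨ +-monoˡ-≤ (2 * (5 * (10 * m))) m≥1 ⟩
        m + 2 * (5 * (10 * m)) ≡⟨ cong (_+_ m) (trans (sym (*-assoc 2 5 (10 * m))) (sym (*-assoc 10 10 m))) ⟩
        101 * m ∎
      box≤ : box-size (5 * B) ≤ q * B
      box≤ = begin
        side * cube side ≤⟨ *-mono-≤ side≤ (*-mono-≤ side≤ (*-mono-≤ side≤ side≤)) ⟩
        101 * m * cube (101 * m) ≡⟨ cong (101 * m *_) (cube-* 101 m) ⟩
        101 * m * (cube 101 * cube m) ≡⟨ rearrange 101 m (cube 101) (cube m) ⟩
        101 * cube 101 * cube m * m ≤⟨ *-monoˡ-≤ m (≤-trans (*-monoˡ-≤ (cube m) sizeConst-box) m-lower) ⟩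
        q * m ≤⟨ *-monoʳ-≤ q (m≤n*m m 10) ⟩
        q * B ∎
        where
        rearrange : ∀ a m b c → a * m * (b * c) ≡ a * b * c * m
        rearrange = solve 4 (λ a m b c → a :* m :* (b :* c) := a :* b :* c :* m) refl

    cop≤q : length (Cop m) ≤ q
    cop≤q = begin
      length (Cop m) ≤⟨ length-filter≤ (isCop? m) (range² (suc (2 * m))) ⟩
      length (range² (suc (2 * m))) ≡⟨ length-range² (suc (2 * m)) ⟩
      suc (2 * m) * suc (2 * m) ≤⟨ *-mono-≤ side≤ side≤ ⟩
      3 * m * (3 * m) ≡⟨ solve 1 (λ m → con 3 :* m :* (con 3 :* m) := con 9 :* (m :* m)) refl m ⟩
      9 * (m * m) ≤⟨ *-mono-≤ sizeConst-cop (m≤n*m (m * m) m) ⟩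
      sizeConst * cube m ≤⟨ m-lower ⟩
      q ∎
      where
      side≤ : suc (2 * m) ≤ 3 * m
      side≤ = +-monoˡ-≤ (2 * m) m≥1

    -- The family has a positive fraction of m² · m⁴ members; 8 comes from (m + 1)³ ≤ 8 m³ and 196 =
    -- 14² from two uses of `Cop-large`.
    density : q * q ≤ densityConst * length F
    density = begin
      q * q ≤⟨ *-mono-≤ q≤8 q≤8 ⟩
      g * cube m * (g * cube m) ≡⟨ solve 2 (λ g m → g :* (m :* (m :* m)) :* (g :* (m :* (m :* m))) := g :* g :* (m :* m :* (m :* m :* (m :* m)))) refl g m ⟩
      g * g * (m * m * (m * m * (m * m))) ≤⟨ *-monoʳ-≤ (g * g) (*-mono-≤ (Cop-large m) (Cop-large (m * m))) ⟩
      g * g * (14 * length (Cop m) * (14 * length (Cop (m * m)))) ≡⟨ solve 3 (λ g a b → g :* g :* (con 14 :* a :* (con 14 :* b)) := g :* g :* con 196 :* (a :* b)) refl g (length (Cop m)) (length (Cop (m * m))) ⟩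
      g * g * 196 * (length (Cop m) * length (Cop (m * m))) ≡⟨ cong₂ _*_ (sym densityConst-eq) (sym (length-product (Cop m) (Cop (m * m)))) ⟩
      densityConst * length F ∎
      where
      g = 8 * sizeConst
      suc≤ : suc m ≤ 2 * m
      suc≤ = +-mono-≤ m≥1 (≤-reflexive (sym (+-identityʳ m)))
      q≤8 : q ≤ g * cube m
      q≤8 = begin
        q ≤⟨ <⇒≤ m-upper ⟩
        sizeConst * cube (suc m) ≤⟨ *-monoʳ-≤ sizeConst (*-mono-≤ suc≤ (*-mono-≤ suc≤ suc≤)) ⟩
        sizeConst * cube (2 * m) ≡⟨ trans (cong (sizeConst *_) (cube-* 2 m)) (solve 2 (λ c x → c :* (con 8 :* x) := con 8 :* c :* x) refl sizeConst (cube m)) ⟩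
        g * cube m ∎

    family-nonempty : 1 ≤ length F
    family-nonempty = n≢0⇒n>0 (λ e → <⇒≱ (*-mono-≤ q≥1 q≥1) (≤-trans density (≤-reflexive (trans (cong (densityConst *_) e) (*-zeroʳ densityConst)))))
      where
      q≥1 : 1 ≤ q
      q≥1 = ≤-trans sizeConst≥1 C≤q

    hitBy : Point → Point → Bool
    hitBy X Y = does (Reached? (X , Y))

    plenty : (q * q) * (q * q) ≤ 2 ^ lossExponent loss₀ μ * sumL (range² q) (λ X → sumL (range² q) (λ Y → bit (hitBy X Y)))
    plenty = begin
      (q * q) * (q * q) ≤⟨ many-reached densityConst family-nonempty density cop≤q z₀≤q ⟩
      4 * (K * T) * length reached ≤⟨ *-monoˡ-≤ (length reached) (≤-trans (≤-reflexive (sym (*-assoc 4 K T))) (*-mono-≤ loss₀-bound T≤)) ⟩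
      2 ^ loss₀ * 2 ^ (suc μ + (suc μ + suc μ)) * length reached ≡⟨ cong₂ _*_ (sym (^-distribˡ-+-* 2 loss₀ (suc μ + (suc μ + suc μ)))) reached-sum ⟩
      2 ^ lossExponent loss₀ μ * sumL (range² q) (λ X → sumL (range² q) (λ Y → bit (hitBy X Y))) ∎
      where
      open Collide q pr using (pairs)
      K = 3 + 4 * densityConst + 6 * (densityConst * densityConst)
      T = L * (L * L)
      L≤ : L ≤ 2 ^ suc μ
      L≤ = *-monoʳ-≤ 2 ℓ≤
      T≤ : T ≤ 2 ^ (suc μ + (suc μ + suc μ))
      T≤ = ≤-trans (*-mono-≤ L≤ (*-mono-≤ L≤ L≤)) (≤-reflexive (sym (trans (^-distribˡ-+-* 2 (suc μ) (suc μ + suc μ)) (cong (2 ^ suc μ *_) (^-distribˡ-+-* 2 (suc μ) (suc μ))))))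
      𝟙-does : ∀ {P : Set} (d : Dec P) → 𝟙 d ≡ bit (does d)
      𝟙-does (yes _) = refl
      𝟙-does (no _) = refl
      reached-sum : length reached ≡ sumL (range² q) (λ X → sumL (range² q) (λ Y → bit (hitBy X Y)))
      reached-sum = trans (length-filter Reached? pairs) (trans (sumL-cong pairs (λ P → 𝟙-does (Reached? P))) (sumL-product (range² q) (range² q) (λ P → bit (hitBy (proj₁ P) (proj₂ P)))))

    record Connection (X Y : Point) : Set where
      field
        γ : M3
        unit : det γ ≡ + 1
        bound : MBound (653 * m) γ
        connects : Collide.Hit q pr γ X Y

    connection : ∀ X Y → hitBy X Y ≡ true → Connection X Y
    connection X Y h = go (reached-hit (does⇒ (Reached? (X , Y)) h))
      where
      does⇒ : ∀ {P : Set} (d : Dec P) → does d ≡ true → P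
      does⇒ (yes p) _ = p
      go : (Σ Params λ p → Σ _ λ _ → Collide.Hit q pr (matrix p) X Y) → Connection X Y
      go (p , i , k) = record { γ = matrix p ; unit = Rows.unit (Member.rows i) ; connects = k
        ; bound = mb (weaken (RowBounds.u-bound b)) (weaken (RowBounds.v-bound b)) (RowBounds.w-bound b) }
        where
        b = Member.bounds i
        weaken : ∀ {r} → VBound (10 * m) r → VBound (653 * m) r
        weaken (Matrices.vb a b c) = Matrices.vb (≤-trans a 10≤) (≤-trans b 10≤) (≤-trans c 10≤)
          where
          10≤ : 10 * m ≤ 653 * m
          10≤ = *-monoˡ-≤ m (m≤m+n 10 643)

    bound-cube : cube (653 * m) ≤ q
    bound-cube = ≤-trans (≤-reflexive (cube-653 m)) m-lower

-- Translation to the projective plane and to rational error terms.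

module ProjectiveAction where

  open import Defs
  open import Data.Nat as ℕ using (ℕ; zero; suc; _≤_; NonZero)
  import Data.Nat.Properties as ℕₚ
  open import Data.Nat.DivMod using (m%n<n; m<n⇒m%n≡m)
  open import Data.Nat.Primality using (Prime; prime⇒nonZero)
  open import Data.Nat.Solver using (module +-*-Solver)
  open import Data.Integer as ℤ using (ℤ; +_)
  import Data.Integer.Properties as ℤₚ
  open import Data.Integer.DivMod using (_%ℕ_; a≡a%ℕn+[a/ℕn]*n; _/ℕ_)
  open import Data.Integer.Divisibility.Signed using (∣⇒∣ᵤ; ∣ᵤ⇒∣; divides)
  open import Data.Integer.Tactic.RingSolver using (solve-∀)
  open import Data.Rational as ℚ using (ℚ; mkℚ; 0ℚ; 1ℚ; _-_; _*_; _/_; ∣_∣; toℚᵘ; ↥_; ↧ₙ_) renaming (_<_ to _<ℚ_; _≤_ to _≤ℚ_; _+_ to _+ℚ_)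
  import Data.Rational.Properties as ℚₚ
  open import Data.Rational.Unnormalised as ℚᵘ using (mkℚᵘ; *≡*; *≤*)
  import Data.Rational.Unnormalised.Properties as ℚᵘₚ
  import Data.Rational.Solver as ℚS
  open import Data.Fin as Fin using (Fin; fromℕ<) renaming (zero to f0; suc to fs)
  open import Data.Fin.Properties using (toℕ-fromℕ<)
  open import Data.List using (List; []; length; map)
  open import Data.List.Properties using (length-map)
  open import Data.List.Relation.Unary.Unique.Propositional using (Unique)
  open import Data.List.Relation.Unary.Unique.Propositional.Properties using (filter⁺)
  open import Data.List.Relation.Unary.AllPairs using ([])
  open import Data.List.Membership.Propositional using (_∈_)
  open import Data.List.Membership.Propositional.Properties using (∈-map⁻; ∈-filter⁻)
  open import Data.Product using (Σ; ∃; _×_; _,_; proj₁; proj₂)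
  open import Data.Sum using (_⊎_; inj₁; inj₂)
  open import Data.Bool using (true)
  open import Data.Empty using (⊥-elim)
  open import Relation.Nullary using (Dec; yes; no; ¬_)
  open import Relation.Binary.PropositionalEquality
  open RationalSums using (Nn; diff; concl; _⊡_)
  open Matrices
  open Counting using (map-unique)
  open CoprimePairs using (range²; range²-unique)
  open Residues using (Point; pt; Z; lin₁; lin₂; lin₃)
  open SetGrowth using (Move)
  open Saturation using (T; T-+; T-*)
  open Amplify using (T-mono; ints; module Amplification)
  open Collision using (module Collide)
  open Slices using (module Slicing)
  open Thresholds
  open LargePrimes

  entry : V3 → Fin 3 → ℤ
  entry (v3 a _ _) f0 = a
  entry (v3 _ b _) (fs f0) = b
  entry (v3 _ _ c) (fs (fs f0)) = c

  row : M3 → Fin 3 → V3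
  row m f0 = r₁ m
  row m (fs f0) = r₂ m
  row m (fs (fs f0)) = r₃ m

  matrix3 : M3 → Mat3
  matrix3 m i j = entry (row m i) j

  entry-bound : ∀ {B v} → VBound B v → ∀ j → ℤ.∣ entry v j ∣ ≤ B
  entry-bound (vb a _ _) f0 = a
  entry-bound (vb _ b _) (fs f0) = b
  entry-bound (vb _ _ c) (fs (fs f0)) = c

  matrix3-bound : ∀ {B m} → MBound B m → ∀ i j → ℤ.∣ matrix3 m i j ∣ ≤ B
  matrix3-bound (mb a _ _) f0 = entry-bound a
  matrix3-bound (mb _ b _) (fs f0) = entry-bound b
  matrix3-bound (mb _ _ c) (fs (fs f0)) = entry-bound c

  affine : ℤ × ℤ → V3
  affine (b , c) = v3 (+ 1) b c

  module Projective (q : ℕ) (pr : Prime q) where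

    open Collide q pr

    instance
      q≢0 : NonZero q
      q≢0 = prime⇒nonZero pr

    open Amplification q

    infix 4 _≈_
    record _≈_ (a b : V3) : Set where
      constructor congruent
      field
        c₁ : Z q (x a ℤ.- x b)
        c₂ : Z q (y a ℤ.- y b)
        c₃ : Z q (z a ℤ.- z b)

    ·-≈ : ∀ r {a b} → a ≈ b → Z q (r · a ℤ.- r · b)
    ·-≈ r {a} {b} (congruent h₁ h₂ h₃) = lin₃ q (x r) (y r) (z r) h₁ h₂ h₃ (lem (x r) (y r) (z r) (x a) (y a) (z a) (x b) (y b) (z b))
      where
      lem : ∀ r s t a b c d e f → r ℤ.* a ℤ.+ s ℤ.* b ℤ.+ t ℤ.* c ℤ.- (r ℤ.* d ℤ.+ s ℤ.* e ℤ.+ t ℤ.* f) ≡ r ℤ.* (a ℤ.- d) ℤ.+ s ℤ.* (b ℤ.- e) ℤ.+ t ℤ.* (c ℤ.- f)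
      lem = solve-∀

    apply-≈ : ∀ m {a b} → a ≈ b → apply m a ≈ apply m b
    apply-≈ m h = congruent (·-≈ (r₁ m) h) (·-≈ (r₂ m) h) (·-≈ (r₃ m) h)

    Z-add : ∀ {a b c} → Z q (a ℤ.- b) → Z q (b ℤ.- c) → Z q (a ℤ.- c)
    Z-add {a} {b} {c} h k = lin₂ q (+ 1) (+ 1) h k (lem a b c)
      where
      lem : ∀ a b c → a ℤ.- c ≡ + 1 ℤ.* (a ℤ.- b) ℤ.+ + 1 ℤ.* (b ℤ.- c)
      lem = solve-∀

    ≈-trans : ∀ {a b c} → a ≈ b → b ≈ c → a ≈ c
    ≈-trans {a} {b} {c} (congruent h₁ h₂ h₃) (congruent k₁ k₂ k₃) = congruent (Z-add {x a} {x b} {x c} h₁ k₁) (Z-add {y a} {y b} {y c} h₂ k₂) (Z-add {z a} {z b} {z c} h₃ k₃)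

    infixr 7 _⋆_
    _⋆_ : ℤ → V3 → V3
    s ⋆ v3 a b c = v3 (s ℤ.* a) (s ℤ.* b) (s ℤ.* c)

    apply-⋆ : ∀ m s v → apply m (s ⋆ v) ≡ s ⋆ apply m v
    apply-⋆ m s v = V3-≡ (lem s (r₁ m) v) (lem s (r₂ m) v) (lem s (r₃ m) v)
      where
      lem : ∀ s r v → r · (s ⋆ v) ≡ s ℤ.* (r · v)
      lem s (v3 a b c) (v3 d e f) = l s a b c d e f
        where
        l : ∀ s a b c d e f → a ℤ.* (s ℤ.* d) ℤ.+ b ℤ.* (s ℤ.* e) ℤ.+ c ℤ.* (s ℤ.* f) ≡ s ℤ.* (a ℤ.* d ℤ.+ b ℤ.* e ℤ.+ c ℤ.* f)
        l = solve-∀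

    residue-≈ : ∀ p → affine p ≈ pt (residues p)
    residue-≈ (a , b) = congruent (divides (+ 0) refl) (each a) (each b)
      where
      each : ∀ a → Z q (a ℤ.- + (a %ℕ q))
      each a = divides (a /ℕ q) (trans (cong (ℤ._- + (a %ℕ q)) (a≡a%ℕn+[a/ℕn]*n a q)) (lem (+ (a %ℕ q)) ((a /ℕ q) ℤ.* + q)))
        where
        lem : ∀ r k → r ℤ.+ k ℤ.- r ≡ k
        lem = solve-∀

    hit-≈ : ∀ {γ X Y} → Hit γ X Y → apply γ (pt X) ≈ (r₁ γ · pt X) ⋆ pt Y
    hit-≈ {γ} {X} (Collide.hit _ h₁ h₂) = congruent (divides (+ 0) (lem (r₁ γ · pt X))) h₁ h₂
      where
      lem : ∀ s → s ℤ.- s ℤ.* + 1 ≡ + 0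
      lem = solve-∀

    ⋆-≈ : ∀ s {a b} → a ≈ b → (s ⋆ b) ≈ (s ⋆ a)
    ⋆-≈ s {v3 a b c} {v3 d e f} (congruent h₁ h₂ h₃) = congruent (each a d h₁) (each b e h₂) (each c f h₃)
      where
      lem : ∀ s a b → s ℤ.* b ℤ.- s ℤ.* a ≡ (ℤ.- s) ℤ.* (a ℤ.- b)
      lem = solve-∀
      each : ∀ a b → Z q (a ℤ.- b) → Z q (s ℤ.* b ℤ.- s ℤ.* a)
      each a b h = lin₁ q (ℤ.- s) h (lem s a b)

    ≈-respˡ : ∀ {a a′ b} → a ≡ a′ → a ≈ b → a′ ≈ b
    ≈-respˡ refl h = h

    ≈-respʳ : ∀ {a b b′} → b ≡ b′ → a ≈ b → a ≈ b′
    ≈-respʳ refl h = h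

    -- X goes to r by its own move, r to p by a matrix of the family, and p to Y by the inverse of
    -- the move of Y.
    route : ∀ {R X Y p r} → Move R Y p → M3 → Move R X r → M3
    route my γ mx = mul (mul (Move.bwd my) γ) (Move.fwd mx)

    route-det : ∀ {R X Y p r} (my : Move R Y p) γ (mx : Move R X r) → det γ ≡ + 1 → det (route my γ mx) ≡ + 1
    route-det my γ mx e = trans (det-mul (mul (Move.bwd my) γ) (Move.fwd mx)) (cong₂ ℤ._*_ (trans (det-mul (Move.bwd my) γ) (cong₂ ℤ._*_ (Move.det-bwd my) e)) (Move.det-fwd mx))

    route-bound : ∀ {R t X Y p r} (my : Move R Y p) {γ} (mx : Move R X r) → MBound t γ → MBound (9 ℕ.* (R ℕ.* R) ℕ.* t) (route my γ mx)
    route-bound {R} {t} my {γ} mx b = subst (λ n → MBound n (route my γ mx)) (solve 2 (λ R t → con 3 :* (con 3 :* (R :* t) :* R) := con 9 :* (R :* R) :* t) refl R t)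
        (mul-bound {m = mul (Move.bwd my) γ} {Move.fwd mx} (mul-bound {m = Move.bwd my} {γ} (Move.bwd-bound my) b) (Move.fwd-bound mx))
      where open +-*-Solver

    -- The two outer equations are exact and only the middle one is a congruence. Scalars commute
    -- with matrices, so the leading coordinate of the middle step is the final projective factor,
    -- invertible by `Hit`.
    route-≈ : ∀ {R X Y p r} (my : Move R Y p) {γ} (mx : Move R X r) → Hit γ (residues r) (residues p) → apply (route my γ mx) (affine X) ≈ (r₁ γ · pt (residues r)) ⋆ affine Y
    route-≈ {R} {X} {Y} {p} {r} my {γ} mx h = ≈-respˡ (sym start) (≈-respʳ finish (apply-≈ (Move.bwd my) (≈-trans (apply-≈ γ (residue-≈ r)) (≈-trans (hit-≈ h) (⋆-≈ s (residue-≈ p))))))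
      where
      s = r₁ γ · pt (residues r)
      start : apply (route my γ mx) (affine X) ≡ apply (Move.bwd my) (apply γ (affine r))
      start = trans (apply-mul (mul (Move.bwd my) γ) (Move.fwd mx) (affine X)) (trans (cong (apply (mul (Move.bwd my) γ)) (Move.fwd-eq mx)) (apply-mul (Move.bwd my) γ (affine r)))
      finish : apply (Move.bwd my) (s ⋆ affine p) ≡ s ⋆ affine Y
      finish = trans (apply-⋆ (Move.bwd my) s (affine p)) (cong (s ⋆_) (Move.bwd-eq my))

    point : Point → PPoint q
    point (i , j) = pt1 (fromℕ< (m%n<n i q)) (fromℕ< (m%n<n j q))

    rep-point : ∀ {X} → InRange X → ∀ i → rep (point X) i ≡ entry (pt X) i
    rep-point _ f0 = refl
    rep-point {i , j} (hi , _) (fs f0) = cong +_ (trans (toℕ-fromℕ< (m%n<n i q)) (m<n⇒m%n≡m hi))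
    rep-point {i , j} (_ , hj) (fs (fs f0)) = cong +_ (trans (toℕ-fromℕ< (m%n<n j q)) (m<n⇒m%n≡m hj))

    point-injective : ∀ {X Y} → InRange X → InRange Y → point X ≡ point Y → X ≡ Y
    point-injective {X} {Y} hX hY e = cong₂ _,_ (coordinate (fs f0)) (coordinate (fs (fs f0)))
      where
      coordinate : ∀ i → ℤ.∣ entry (pt X) i ∣ ≡ ℤ.∣ entry (pt Y) i ∣
      coordinate i = cong ℤ.∣_∣ (trans (sym (rep-point hX i)) (trans (cong (λ P → rep P i) e) (rep-point hY i)))

    points : List Point → List (PPoint q)
    points = map point

    points-unique : ∀ {Xs} → Unique Xs → (∀ {X} → X ∈ Xs → InRange X) → Unique (points Xs)
    points-unique u h = map-unique u (λ i j → point-injective (h i) (h j))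

    acts : ∀ {M X Y s} (u : det3 (matrix3 M) ≡ + 1) → InRange X → InRange Y → ¬ Z q s → apply M (pt X) ≈ s ⋆ pt Y → Acts q (matrix3 M , u) (point X) (point Y)
    acts {M} {X} {Y} {s} u hX hY n (congruent h₁ h₂ h₃) = s , (λ d → n (subst (Z q) (ℤₚ.+-identityʳ s) (∣ᵤ⇒∣ d))) , coordinate
      where
      mulMV-apply : ∀ i → mulMV (matrix3 M) (rep (point X)) i ≡ row M i · pt X
      mulMV-apply i = trans (cong₂ ℤ._+_ (cong₂ ℤ._+_ (cong (matrix3 M i i0 ℤ.*_) (rep-point hX i0)) (cong (matrix3 M i i1 ℤ.*_) (rep-point hX i1))) (cong (matrix3 M i i2 ℤ.*_) (rep-point hX i2))) refl
      coordinate : ∀ i → mulMV (matrix3 M) (rep (point X)) i ≡[mod q ] (s ℤ.* rep (point Y) i)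
      coordinate i = ∣⇒∣ᵤ (subst (Z q) (sym (cong₂ ℤ._-_ (mulMV-apply i) (cong (s ℤ.*_) (rep-point hY i)))) (each i))
        where
        each : ∀ i → Z q (row M i · pt X ℤ.- s ℤ.* entry (pt Y) i)
        each f0 = h₁
        each (fs f0) = h₂
        each (fs (fs f0)) = h₃

  -- Two losses: 2Q / P exceptional affine points, at most Q / (2K) as P ≥ 4K, and the q + 1 points
  -- at infinity, also at most Q / (2K) as q ≥ 4K. Together they are below the fraction 1 / K.
  loss-count : ∀ q K P len → 4 ℕ.* K ≤ P → 4 ℕ.* K ≤ q → 1 ≤ q → 1 ≤ P → P ℕ.* (q ℕ.* q) ≤ 2 ℕ.* (q ℕ.* q) ℕ.+ P ℕ.* len → K ℕ.* cardP q ≤ K ℕ.* len ℕ.+ cardP q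
  loss-count q K P len hP hq 1≤q 1≤P h = ℕₚ.*-cancelˡ-≤ 2 (begin
    2 ℕ.* (K ℕ.* (Q ℕ.+ q ℕ.+ 1)) ≡⟨ solve 3 (λ K Q q → con 2 :* (K :* (Q :+ q :+ con 1)) := con 2 :* (K :* Q) :+ con 2 :* (K :* (q :+ con 1))) refl K Q q ⟩
    2 ℕ.* (K ℕ.* Q) ℕ.+ 2 ℕ.* (K ℕ.* (q ℕ.+ 1)) ≤⟨ ℕₚ.+-mono-≤ main rest ⟩
    Q ℕ.+ 2 ℕ.* (K ℕ.* len) ℕ.+ Q ≤⟨ ℕₚ.m≤m+n (Q ℕ.+ 2 ℕ.* (K ℕ.* len) ℕ.+ Q) (2 ℕ.* (q ℕ.+ 1)) ⟩
    Q ℕ.+ 2 ℕ.* (K ℕ.* len) ℕ.+ Q ℕ.+ 2 ℕ.* (q ℕ.+ 1) ≡⟨ solve 4 (λ K Q q l → Q :+ con 2 :* (K :* l) :+ Q :+ con 2 :* (q :+ con 1) := con 2 :* (K :* l :+ (Q :+ q :+ con 1))) refl K Q q len ⟩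
    2 ℕ.* (K ℕ.* len ℕ.+ (Q ℕ.+ q ℕ.+ 1)) ∎)
    where
    open ℕₚ.≤-Reasoning
    open +-*-Solver
    Q = q ℕ.* q
    main : 2 ℕ.* (K ℕ.* Q) ≤ Q ℕ.+ 2 ℕ.* (K ℕ.* len)
    main = ℕₚ.*-cancelˡ-≤ P {{ℕ.>-nonZero 1≤P}} (begin
      P ℕ.* (2 ℕ.* (K ℕ.* Q)) ≡⟨ solve 3 (λ P K Q → P :* (con 2 :* (K :* Q)) := con 2 :* K :* (P :* Q)) refl P K Q ⟩
      2 ℕ.* K ℕ.* (P ℕ.* Q) ≤⟨ ℕₚ.*-monoʳ-≤ (2 ℕ.* K) h ⟩
      2 ℕ.* K ℕ.* (2 ℕ.* Q ℕ.+ P ℕ.* len) ≡⟨ solve 4 (λ P K Q l → con 2 :* K :* (con 2 :* Q :+ P :* l) := con 4 :* K :* Q :+ P :* (con 2 :* (K :* l))) refl P K Q len ⟩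
      4 ℕ.* K ℕ.* Q ℕ.+ P ℕ.* (2 ℕ.* (K ℕ.* len)) ≤⟨ ℕₚ.+-monoˡ-≤ (P ℕ.* (2 ℕ.* (K ℕ.* len))) (ℕₚ.*-monoˡ-≤ Q hP) ⟩
      P ℕ.* Q ℕ.+ P ℕ.* (2 ℕ.* (K ℕ.* len)) ≡⟨ sym (ℕₚ.*-distribˡ-+ P Q (2 ℕ.* (K ℕ.* len))) ⟩
      P ℕ.* (Q ℕ.+ 2 ℕ.* (K ℕ.* len)) ∎)
    rest : 2 ℕ.* (K ℕ.* (q ℕ.+ 1)) ≤ Q
    rest = begin
      2 ℕ.* (K ℕ.* (q ℕ.+ 1)) ≤⟨ ℕₚ.*-monoʳ-≤ 2 (ℕₚ.*-monoʳ-≤ K (ℕₚ.+-monoʳ-≤ q 1≤q)) ⟩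
      2 ℕ.* (K ℕ.* (q ℕ.+ q)) ≡⟨ solve 2 (λ K q → con 2 :* (K :* (q :+ q)) := con 4 :* K :* q) refl K q ⟩
      4 ℕ.* K ℕ.* q ≤⟨ ℕₚ.*-monoˡ-≤ q hq ⟩
      Q ∎

  -- The value 1 at 0 makes the bound trivial for the primes below every threshold.
  reciprocal : ℕ → ℚ
  reciprocal zero = 1ℚ
  reciprocal (suc j) = + 1 / suc j

  reciprocal-toℚᵘ : ∀ j → toℚᵘ (reciprocal (suc j)) ℚᵘ.≃ mkℚᵘ (+ 1) j
  reciprocal-toℚᵘ j = ℚₚ.toℚᵘ-fromℚᵘ (mkℚᵘ (+ 1) j)

  T-toℚᵘ : ∀ n → toℚᵘ (T n) ℚᵘ.≃ mkℚᵘ (+ n) 0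
  T-toℚᵘ zero = ℚᵘₚ.≃-refl
  T-toℚᵘ (suc n) = ℚᵘₚ.≃-trans (ℚₚ.toℚᵘ-homo-+ (T n) 1ℚ) (ℚᵘₚ.≃-trans (ℚᵘₚ.+-congˡ (toℚᵘ 1ℚ) (T-toℚᵘ n)) (*≡* (lem (+ n))))
    where
    lem : ∀ n → (n ℤ.* + 1 ℤ.+ + 1 ℤ.* + 1) ℤ.* + 1 ≡ (+ 1 ℤ.+ n) ℤ.* + 1
    lem = solve-∀

  T-ℕtoℚ : ∀ n → T n ≡ ℕtoℚ n
  T-ℕtoℚ n = ℚₚ.toℚᵘ-injective (ℚᵘₚ.≃-trans (T-toℚᵘ n) (ℚᵘₚ.≃-sym (ℚₚ.toℚᵘ-fromℚᵘ (mkℚᵘ (+ n) 0))))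

  T-reciprocal : ∀ j → T (suc j) * reciprocal (suc j) ≡ 1ℚ
  T-reciprocal j = ℚₚ.toℚᵘ-injective (ℚᵘₚ.≃-trans (ℚₚ.toℚᵘ-homo-* (T (suc j)) (reciprocal (suc j))) (ℚᵘₚ.≃-trans (ℚᵘₚ.*-cong (T-toℚᵘ (suc j)) (reciprocal-toℚᵘ j)) (*≡* (lem (+ suc j)))))
    where
    lem : ∀ n → n ℤ.* + 1 ℤ.* + 1 ≡ + 1 ℤ.* (+ 1 ℤ.* n)
    lem = solve-∀

  reciprocal-small : ∀ δ → 0ℚ <ℚ δ → ∀ K → ↧ₙ δ ≤ K → ∣ reciprocal K ∣ ≤ℚ δ
  reciprocal-small δ _ zero ()
  reciprocal-small δ δ>0 (suc j) h = subst (_≤ℚ δ) (sym (ℚₚ.0≤p⇒∣p∣≡p (ℚₚ.toℚᵘ-cancel-≤ (ℚᵘₚ.≤-respʳ-≃ (ℚᵘₚ.≃-sym (reciprocal-toℚᵘ j)) (*≤* (ℤ.+≤+ ℕ.z≤n))))))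
      (ℚₚ.toℚᵘ-cancel-≤ (ℚᵘₚ.≤-respˡ-≃ (ℚᵘₚ.≃-sym (reciprocal-toℚᵘ j)) (bound δ δ>0 h)))
    where
    bound : ∀ δ → 0ℚ <ℚ δ → ↧ₙ δ ≤ suc j → mkℚᵘ (+ 1) j ℚᵘ.≤ toℚᵘ δ
    bound (mkℚ (+ suc n) d _) _ h = *≤* (subst₂ ℤ._≤_ (ℤₚ.pos-* 1 (suc d)) (ℤₚ.pos-* (suc n) (suc j)) (ℤ.+≤+ (ℕₚ.*-mono-≤ (ℕ.s≤s (ℕ.z≤n {n})) h)))
    bound (mkℚ (+ zero) d _) (ℚ.*<* (ℤ.+<+ ())) _
    bound (mkℚ ℤ.-[1+ n ] d _) (ℚ.*<* ()) _

  density-bound : ∀ j c len → suc j ℕ.* c ≤ suc j ℕ.* len ℕ.+ c → (1ℚ - reciprocal (suc j)) * ℕtoℚ c ≤ℚ ℕtoℚ len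
  density-bound j c len h = subst₂ (λ a b → (1ℚ - reciprocal (suc j)) * a ≤ℚ b) (T-ℕtoℚ c) (T-ℕtoℚ len)
    (concl (subst Nn (cong₂ (λ a b → ρ * (a - b)) (trans (T-+ (suc j ℕ.* len) c) (cong (_+ℚ T c) (T-* (suc j) len))) (T-* (suc j) c)) (ρ≥0 ⊡ diff (T-mono h)))
      (trans (cong (λ t → T len - (t - ρ) * T c) (sym (T-reciprocal j))) (trans (cong (λ t → t - (T (suc j) * ρ - ρ) * T c) (trans (sym (ℚₚ.*-identityˡ (T len))) (cong (_* T len) (sym (T-reciprocal j)))))
        (solve 4 (λ κ ρ l c → κ :* ρ :* l :- (κ :* ρ :- ρ) :* c := ρ :* (κ :* l :+ c :- κ :* c)) refl (T (suc j)) ρ (T len) (T c)))))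
    where
    open ℚS.+-*-Solver
    ρ = reciprocal (suc j)
    ρ≥0 : Nn ρ
    ρ≥0 = ℚₚ.toℚᵘ-cancel-≤ (ℚᵘₚ.≤-respʳ-≃ (ℚᵘₚ.≃-sym (reciprocal-toℚᵘ j)) (*≤* (ℤ.+≤+ ℕ.z≤n)))

  -- The largest k up to a limit whose threshold is at most q, and 0 if there is none. It
  -- diagonalises: a threshold for each error 1 / k becomes one error function tending to zero.
  best : (ℕ → ℕ) → ℕ → ℕ → ℕ
  best Th zero q = 0
  best Th (suc n) q = choose (Th (suc n) ℕₚ.≤? q)
    where
    choose : Dec (Th (suc n) ≤ q) → ℕ
    choose (yes _) = suc n
    choose (no _) = best Th n q

  best-reached : ∀ Th n q {j} → best Th n q ≡ suc j → Th (suc j) ≤ q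
  best-reached Th (suc n) q e with Th (suc n) ℕₚ.≤? q
  best-reached Th (suc n) q refl | yes h = h
  ... | no _ = best-reached Th n q e

  best-large : ∀ Th n q {k} → k ≤ n → Th k ≤ q → k ≤ best Th n q
  best-large Th zero q h _ = h
  best-large Th (suc n) q {k} h t with Th (suc n) ℕₚ.≤? q
  ... | yes _ = h
  ... | no nt = go (ℕₚ.m≤n⇒m<n∨m≡n h)
    where
    go : (k ℕ.< suc n) ⊎ (k ≡ suc n) → k ≤ best Th n q
    go (inj₁ l) = best-large Th n q (ℕₚ.≤-pred l) t
    go (inj₂ refl) = ⊥-elim (nt t)

  -- The summands ensure, in this order, that the bracket for m starts at m ≥ 1, that the growth
  -- factor is absorbed by the exponent, and that the points at infinity are negligible.
  threshold : ℕ → ℕ → ℕ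
  threshold d k = sizeConst ℕ.+ 2 ℕ.^ logThreshold (expBase loss₀ d k) (expSlope loss₀ d k) ℕ.+ 4 ℕ.* k

  -- Numerator n and denominator d of a rational above 1/3 satisfy d < 3n; this unit of slack pays
  -- for the polylogarithmic distortion.
  third+ε : ∀ ε → 0ℚ <ℚ ε → suc (↧ₙ ((+ 1 / 3) +ℚ ε)) ≤ 3 ℕ.* ℤ.∣ ↥ ((+ 1 / 3) +ℚ ε) ∣
  third+ε ε h = go ((+ 1 / 3) +ℚ ε) (subst (_<ℚ (+ 1 / 3) +ℚ ε) (ℚₚ.+-identityʳ (+ 1 / 3)) (ℚₚ.+-monoʳ-< (+ 1 / 3) h))
    where
    go : ∀ r → (+ 1 / 3) <ℚ r → suc (↧ₙ r) ≤ 3 ℕ.* ℤ.∣ ↥ r ∣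
    go (mkℚ (+ n) d _) (ℚ.*<* l) = subst₂ ℕ._<_ (ℕₚ.*-identityˡ (suc d)) (ℕₚ.*-comm n 3) (ℤₚ.drop‿+<+ (subst₂ ℤ._<_ (sym (ℤₚ.pos-* 1 (suc d))) (sym (ℤₚ.pos-* n 3)) l))
    go (mkℚ ℤ.-[1+ n ] d _) (ℚ.*<* ())

  module Main (q : ℕ) (pr : Prime q) (d num k : ℕ) (hd : suc d ≤ 3 ℕ.* num) (hq : threshold d k ≤ q) where

    open Projective q pr
    open Collide q pr using (Hit; InRange; in-range)

    C≤q : sizeConst ≤ q
    C≤q = ℕₚ.≤-trans (ℕₚ.≤-trans (ℕₚ.m≤m+n sizeConst (2 ℕ.^ ℓ₀)) (ℕₚ.m≤m+n (sizeConst ℕ.+ 2 ℕ.^ ℓ₀) (4 ℕ.* k))) hq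
      where ℓ₀ = logThreshold (expBase loss₀ d k) (expSlope loss₀ d k)

    pow≤q : 2 ℕ.^ logThreshold (expBase loss₀ d k) (expSlope loss₀ d k) ≤ q
    pow≤q = ℕₚ.≤-trans (ℕₚ.≤-trans (ℕₚ.m≤n+m (2 ℕ.^ ℓ₀) sizeConst) (ℕₚ.m≤m+n (sizeConst ℕ.+ 2 ℕ.^ ℓ₀) (4 ℕ.* k))) hq
      where ℓ₀ = logThreshold (expBase loss₀ d k) (expSlope loss₀ d k)

    4k≤q : 4 ℕ.* k ≤ q
    4k≤q = ℕₚ.≤-trans (ℕₚ.m≤n+m (4 ℕ.* k) (sizeConst ℕ.+ 2 ℕ.^ logThreshold (expBase loss₀ d k) (expSlope loss₀ d k))) hq

    q≥1 : 1 ≤ q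
    q≥1 = ℕ.>-nonZero⁻¹ q

    q-bracket : Σ ℕ λ ℓ → (q ≤ 2 ℕ.^ ℓ) × (2 ℕ.^ ℓ ≤ 2 ℕ.* q)
    q-bracket = subst (λ n → Σ ℕ λ ℓ → (n ≤ 2 ℕ.^ ℓ) × (2 ℕ.^ ℓ ≤ 2 ℕ.* n)) (ℕₚ.suc-pred q) (pow2-bracket (ℕ.pred q))

    abstract
      ℓ : ℕ
      ℓ = proj₁ q-bracket
      q≤2^ℓ : q ≤ 2 ℕ.^ ℓ
      q≤2^ℓ = proj₁ (proj₂ q-bracket)
      2^ℓ≤2q : 2 ℕ.^ ℓ ≤ 2 ℕ.* q
      2^ℓ≤2q = proj₂ (proj₂ q-bracket)
      μ : ℕ
      μ = proj₁ (pow2-bracket ℓ)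
      ℓ≤2^μ : suc ℓ ≤ 2 ℕ.^ μ
      ℓ≤2^μ = proj₁ (proj₂ (pow2-bracket ℓ))
      2^μ≤2ℓ : 2 ℕ.^ μ ≤ 2 ℕ.* suc ℓ
      2^μ≤2ℓ = proj₂ (proj₂ (pow2-bracket ℓ))

    ℓ-large : logThreshold (expBase loss₀ d k) (expSlope loss₀ d k) ≤ ℓ
    ℓ-large = ℕₚ.≮⇒≥ (λ l → ℕₚ.<⇒≱ (ℕₚ.^-monoʳ-< 2 (ℕ.s≤s (ℕ.s≤s ℕ.z≤n)) l) (ℕₚ.≤-trans pow≤q q≤2^ℓ))

    open LargePrime q pr C≤q ℓ μ q≤2^ℓ ℓ≤2^μ
    open Slicing q hitBy (lossExponent loss₀ μ) (2 ℕ.+ k) plenty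
    open Amplification q using (residues)

    4k≤P : 4 ℕ.* k ≤ 2 ℕ.^ (2 ℕ.+ k)
    4k≤P = ℕₚ.≤-trans (ℕₚ.*-monoʳ-≤ 4 (n≤2^n k)) (ℕₚ.≤-reflexive (sym (ℕₚ.^-distribˡ-+-* 2 2 k)))

    P≥1 : 1 ≤ 2 ℕ.^ (2 ℕ.+ k)
    P≥1 = ℕₚ.m^n>0 2 (2 ℕ.+ k)

    good-range : ∀ {X} → X ∈ good → InRange X
    good-range h = in-range (proj₁ (∈-filter⁻ FullRow? {xs = range² q} h))

    Y : List (PPoint q)
    Y = points good

    Y-unique : Unique Y
    Y-unique = points-unique (filter⁺ FullRow? (range²-unique q)) good-range

    Y-large : k ℕ.* cardP q ≤ k ℕ.* length Y ℕ.+ cardP q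
    Y-large = subst (λ n → k ℕ.* cardP q ≤ k ℕ.* n ℕ.+ cardP q) (sym (length-map point good)) (loss-count q k (2 ℕ.^ (2 ℕ.+ k)) (length good) 4k≤P 4k≤q q≥1 P≥1 good-large)

    Connected : ℚ → PPoint q → PPoint q → Set
    Connected r X Y = Σ SL3Z λ γ → NormBound γ q r × Acts q γ X Y

    module _ (r : ℚ) (r-num : ℤ.∣ ↥ r ∣ ≡ num) (r-den : ↧ₙ r ≡ d) where

      connect : ∀ {X Y p s} → InRange X → InRange Y → Move R (ints Y) p → Move R (ints X) s → Connection (residues s) (residues p) → Connected r (point X) (point Y)
      connect {X} {Y} hX hY my mx c = (matrix3 M , unit-M) , norm , acts {M} {X} {Y} unit-M hX hY (Collide.Hit.h₀ connects) (route-≈ my mx connects)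
        where
        open Connection c
        M = route my γ mx
        unit-M : det3 (matrix3 M) ≡ + 1
        unit-M = route-det my γ mx unit
        norm : NormBound (matrix3 M , unit-M) q r
        norm i j = subst₂ (λ e n → ℤ.∣ matrix3 M i j ∣ ℕ.^ e ≤ q ℕ.^ n) (sym r-den) (sym r-num)
          (ℕₚ.≤-trans (ℕₚ.^-monoˡ-≤ d (matrix3-bound (route-bound my mx bound) i j))
            (norm-power q (9 ℕ.* (R ℕ.* R)) (653 ℕ.* m) d num (stretch-small loss₀ d k ℓ μ q ℓ-large 2^μ≤2ℓ 2^ℓ≤2q) bound-cube hd))

      module _ {X} (X∈ : X ∈ good) where

        open Row X∈

        targets-range : ∀ {W} → W ∈ targets → InRange W
        targets-range h = in-range (target-in h)

        Zx : List (PPoint q)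
        Zx = points targets

        Zx-unique : Unique Zx
        Zx-unique = points-unique targets-unique targets-range

        Zx-large : k ℕ.* cardP q ≤ k ℕ.* length Zx ℕ.+ cardP q
        Zx-large = subst (λ n → k ℕ.* cardP q ≤ k ℕ.* n ℕ.+ cardP q) (sym (length-map point targets)) (loss-count q k (2 ℕ.^ (2 ℕ.+ k)) (length targets) 4k≤P 4k≤q q≥1 P≥1
          (ℕₚ.≤-trans targets-large (ℕₚ.+-monoˡ-≤ (2 ℕ.^ (2 ℕ.+ k) ℕ.* length targets) (ℕₚ.m≤n*m (q ℕ.* q) 2))))

        connected : ∀ {W} → W ∈ Zx → Connected r (point X) W
        connected h = go (∈-map⁻ point h)
          where
          go : ∀ {W} → (∃ λ V → V ∈ targets × W ≡ point V) → Connected r (point X) W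
          go (V , V∈ , refl) = go′ (target-path V∈)
            where
            go′ : (Σ (ℤ × ℤ) λ p → Σ (ℤ × ℤ) λ s → Move R (ints V) p × Move R (ints X) s × hitBy (residues s) (residues p) ≡ true) → Connected r (point X) (point V)
            go′ (p , s , mp , ms , e) = connect {X} {V} {p} {s} (good-range X∈) (targets-range V∈) mp ms (connection (residues s) (residues p) e)

-- Choice of the error function and assembly.

open import Defs
open import Data.Nat using (ℕ; _≤_)
open import Data.Nat.Primality using (Prime)
open import Data.Integer using (+_)
open import Data.Rational using (ℚ; 0ℚ; 1ℚ; _-_; _*_; _/_; ∣_∣) renaming (_<_ to _<ℚ_; _≤_ to _≤ℚ_; _+_ to _+ℚ_)
open import Data.List using (List; length)
open import Data.List.Relation.Unary.Unique.Propositional using (Unique)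
open import Data.List.Membership.Propositional using (_∈_)
open import Data.Product using (Σ; ∃; _×_)

open import Data.Nat using (zero; suc)
import Data.Nat as ℕ
import Data.Nat.Properties as ℕₚ
import Data.Integer as ℤ
open import Data.Rational using (↥_; ↧ₙ_)
import Data.Rational.Properties as ℚₚ
open import Data.List using ([])
open import Data.List.Membership.Propositional.Properties using (∈-map⁻)
open import Data.List.Relation.Unary.AllPairs using ([])
open import Data.Product using (_,_)
open import Relation.Binary.PropositionalEquality using (_≡_; refl)
open ProjectiveAction using (module Projective; module Main; reciprocal; reciprocal-small; density-bound; best; best-reached; best-large; threshold; third+ε)

theorem1p3 : (ε : ℚ) → 0ℚ <ℚ ε →
    Σ (ℕ → ℚ) λ f →
    ((δ : ℚ) → 0ℚ <ℚ δ → ∃ λ (Q : ℕ) → (q : ℕ) → Prime q → Q ≤ q → ∣ f q ∣ ≤ℚ δ) ×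
    ((q : ℕ) → Prime q →
    Σ (List (PPoint q)) λ Y → Unique Y ×
    ((1ℚ - f q) * ℕtoℚ (cardP q) ≤ℚ ℕtoℚ (length Y)) ×
    ((x : PPoint q) → x ∈ Y →
    Σ (List (PPoint q)) λ Zx → Unique Zx ×
    ((1ℚ - f q) * ℕtoℚ (cardP q) ≤ℚ ℕtoℚ (length Zx)) ×
    ((y : PPoint q) → y ∈ Zx →
    Σ SL3Z λ γ → NormBound γ q ((+ 1 / 3) +ℚ ε) × Acts q γ x y)))
theorem1p3 ε ε>0 = (λ q → reciprocal (best Th q q)) , limit , (λ q pr → build q pr (best Th q q) refl)
  where
  r : ℚ
  r = (+ 1 / 3) +ℚ ε
  d num : ℕ
  d = ↧ₙ r
  num = ℤ.∣ ↥ r ∣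
  Th : ℕ → ℕ
  Th = threshold d
  limit : (δ : ℚ) → 0ℚ <ℚ δ → ∃ λ (Q : ℕ) → (q : ℕ) → Prime q → Q ≤ q → ∣ reciprocal (best Th q q) ∣ ≤ℚ δ
  -- With k the denominator of δ one has 1 / k ≤ δ. The choice k is available once q exceeds both k,
  -- the search limit, and the threshold of k.
  limit δ δ>0 = ↧ₙ δ ℕ.+ Th (↧ₙ δ) , λ q _ h → reciprocal-small δ δ>0 (best Th q q) (best-large Th q q (ℕₚ.≤-trans (ℕₚ.m≤m+n (↧ₙ δ) (Th (↧ₙ δ))) h) (ℕₚ.≤-trans (ℕₚ.m≤n+m (Th (↧ₙ δ)) (↧ₙ δ)) h))
  Large : (q : ℕ) → ℚ → Set
  Large q φ = Σ (List (PPoint q)) λ Y → Unique Y × ((1ℚ - φ) * ℕtoℚ (cardP q) ≤ℚ ℕtoℚ (length Y)) ×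
    ((x : PPoint q) → x ∈ Y → Σ (List (PPoint q)) λ Zx → Unique Zx × ((1ℚ - φ) * ℕtoℚ (cardP q) ≤ℚ ℕtoℚ (length Zx)) ×
      ((y : PPoint q) → y ∈ Zx → Σ SL3Z λ γ → NormBound γ q r × Acts q γ x y))
  build : ∀ q → Prime q → ∀ K → best Th q q ≡ K → Large q (reciprocal K)
  -- Below every threshold the error is 1, and the empty set is large enough.
  build q _ zero _ = [] , [] , ℚₚ.≤-reflexive (ℚₚ.*-zeroˡ (ℕtoℚ (cardP q))) , (λ _ ())
  build q pr (suc j) e = Y , Y-unique , density-bound j (cardP q) (length Y) Y-large , (λ x h → from (∈-map⁻ point h))
    where
    open Projective q pr using (point)
    open Main q pr d num (suc j) (third+ε ε ε>0) (best-reached Th q q e)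
    from : ∀ {x} → (∃ λ X → X ∈ _ × x ≡ point X) → Σ (List (PPoint q)) λ Zx → Unique Zx × ((1ℚ - reciprocal (suc j)) * ℕtoℚ (cardP q) ≤ℚ ℕtoℚ (length Zx)) ×
      ((y : PPoint q) → y ∈ Zx → Σ SL3Z λ γ → NormBound γ q r × Acts q γ x y)
    from (X , X∈ , refl) = Zx r refl refl X∈ , Zx-unique r refl refl X∈ , density-bound j (cardP q) (length (Zx r refl refl X∈)) (Zx-large r refl refl X∈) , (λ y h → connected r refl refl X∈ h)
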